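{- There exist constants $C>0$ and $N_0$ such that for every integer $N\ge N_0$ and every integer $0\le u<N$, there exist $\ell\le C\log_2 N$ and $a_1,\ldots,a_\ell\in\{1,2\}$ such that the rational number $[a_1,1,a_2,1,\ldots,a_\ell,1]$, computed over $\mathbb{Q}$ and written as $p/q$ with $q$ coprime to $N$, satisfies $p\,q^{ -1}\equiv u \pmod N$; that is, $u\equiv [a_1,1,\ldots,a_\ell,1]\pmod N$.
   Context: For integers $b_1,\ldots,b_m\ge 1$ ($m\ge 0$), the continued fraction $[b_1,\ldots,b_m]$ is defined as $\cfrac{1}{b_1+\cfrac{1}{\ddots+\frac{1}{b_m}}}$. The paper specifies that the continued fraction is first evaluated as a rational number and only then reduced modulo $N$. -}

module Defs where

open import Data.Nat using (ℕ; zero; suc)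
open import Data.List using (List; []; _∷_)
open import Data.Vec using (Vec; []; _∷_)
open import Data.Rational using (ℚ; 0ℚ; _+_; 1/_; ≢-nonZero)
open import Data.Rational.Properties using (_≟_)
open import Data.Integer using (+_)
import Data.Rational as ℚ
open import Relation.Nullary using (yes; no)

-- Total reciprocal on ℚ (1/0 := 0).  Only ever applied to nonzero
-- arguments below, since all partial quotients are ≥ 1.
recip : ℚ → ℚ
recip x with x ≟ 0ℚ
... | yes _ = 0ℚ
... | no x≢0 = 1/_ x {{≢-nonZero x≢0}}

cf : List ℕ → ℚ
cf []       = 0ℚ
cf (b ∷ bs) = recip (ℚ.fromℚᵘ (Data.Rational.Unnormalised.mkℚᵘ (+ b) 0) + cf bs)
  where import Data.Rational.Unnormalised

withOnes : ∀ {ℓ} → Vec ℕ ℓ → List ℕ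
withOnes []       = []
withOnes (a ∷ as) = a ∷ 1 ∷ withOnes as

{-# OPTIONS --safe #-}
module Submission where

-- The words M_{a₁} ⋯ M_{a_ℓ} with a_i ∈ {1, 2}, where M_a = [[1, 1], [a, a + 1]], act on P¹(ℤ/N), and [a₁, 1, …, a_ℓ, 1] is the
-- image of 0 = (0 : 1). It is enough that the averaging operator T f = f ∘ M₁ + f ∘ M₂ contracts the functions of mean zero
-- on P¹(ℤ/N) by a factor independent of N: then every point is reached after O(log N) steps.
--
-- The contraction follows from a spectral gap ‖f‖² ≤ K (‖f ∘ L − f‖² + ‖f ∘ U − f‖²) for the elementary matrices L and U,
-- because M₂ M₁⁻¹ = L and U is a word in L and M₁ L M₁⁻¹. For the gap, f is split over the prime divisors of N into new forms of
-- levels dividing N. A new form f satisfies a Hilbert–Schmidt identity: the sum over all 2 × 2 matrices h mod N of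
-- ⟨f ∘ h , f⟩² is N² φ(N) ‖f‖⁴. So a large correlation of f with its translates by a ball of SL₂(ℤ) would force, after taking
-- powers, many words of length n to be scalar modulo N (Sarnak–Xue). The number of such words is bounded by counting matrices
-- of bounded size with a ≡ d, b ≡ c ≡ 0 mod N, each being hit by few words. Everything is done in ℤ with unnormalised sums.

open import Defs
import Algebra.Structures as AS
open import Data.Empty using (⊥; ⊥-elim)
open import Data.Integer.Base using (ℤ; +_; -[1+_]; _+_; _*_; -_; _-_; _≤_; _<_; _^_; 0ℤ; 1ℤ; +≤+; +<+)
  renaming (∣_∣ to abs; NonZero to ℤNonZero)
open import Data.Integer.Divisibility using () renaming (_∣_ to _∣ℤ_)
import Data.Integer.DivMod as ℤD
open import Data.Integer.DivMod using (_/ℕ_; _%ℕ_; n%ℕd<d; a≡a%ℕn+[a/ℕn]*n)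
open import Data.Integer.Divisibility.Signed using (_∣_; divides; _∣?_)
import Data.Integer.Divisibility.Signed as Div
import Data.Integer.Properties as ℤₚ
open import Data.Integer.Tactic.RingSolver using (solve-∀)
open import Data.List.Base using (List; []; _∷_; _++_; map; concatMap; cartesianProduct; applyUpTo; length)
open import Data.List.Membership.Propositional using (_∈_; find; lose)
open import Data.List.Membership.Propositional.Properties
  using (∈-applyUpTo⁻; ∈-applyUpTo⁺; ∈-cartesianProduct⁺; ∈-cartesianProduct⁻; ∈-concatMap⁻; ∈-concatMap⁺; ∈-map⁻; ∈-map⁺; ∈-++⁺ˡ; ∈-++⁺ʳ; ∈-++⁻)
open import Data.List.Properties using (applyUpTo-∷ʳ; length-++; length-map; length-applyUpTo)
import Data.List.Relation.Unary.All as Allᴸ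
open import Data.List.Relation.Unary.Any using (here; there; any?)
open import Data.Nat.Base as ℕ using (ℕ; zero; suc)
open import Data.Nat.Coprimality using (Coprime; coprime?; coprime-Bézout; coprime-divisor; coprime-/gcd; gcd≡1⇒coprime) renaming (sym to coprime-sym)
import Data.Nat.Divisibility as ℕD
open import Data.Nat.DivMod using (_/_; m/n*n≤m; m*n/n≡m; m/n*n≡m; /-mono-≤; /-monoˡ-≤; m≡m%n+[m/n]*n; m%n<n)
open import Data.Nat.GCD using (gcd; gcd[m,n]∣m; gcd[m,n]∣n; gcd[m,n]≢0; gcd-GCD; module Bézout)
open import Data.Nat.Induction using (<-rec)
open import Data.Nat.ListAction using (product)
open import Data.Nat.Logarithm using (⌈log₂_⌉; ⌈log₂⌉-mono-≤; ⌈log₂2^n⌉≡n)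
open import Data.Nat.Primality
  using (Prime; prime?; euclidsLemma; _Rough_; 2-rough; ∤⇒rough-suc; rough∧∣⇒rough; rough∧∣⇒prime; rough⇒≤; prime⇒nonZero; prime⇒nonTrivial; prime⇒irreducible)
open import Data.Nat.Primality.Factorisation using (factorise)
import Data.Nat.Properties as ℕₚ
open import Data.Nat.Tactic.RingSolver using () renaming (solve-∀ to solveℕ-∀)
open import Data.Product.Base using (Σ; _×_; _,_; proj₁; proj₂; ∃)
open import Data.Rational.Base as ℚ using (ℚ; mkℚ; toℚᵘ; fromℚᵘ; ↥_; ↧ₙ_)
import Data.Rational.Properties as ℚₚ
open import Data.Rational.Unnormalised.Base using (mkℚᵘ; *≡*) renaming (_≃_ to _≃ᵘ_)
import Data.Rational.Unnormalised.Properties as ℚᵘₚ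
open import Data.Sum.Base using (_⊎_; inj₁; inj₂; [_,_]′)
open import Data.Vec.Base using (Vec; []; _∷_)
open import Data.Vec.Relation.Unary.All using (All; []; _∷_)
open import Function.Base using (_∘_; id; case_of_)
open import Relation.Binary.PropositionalEquality
  using (_≡_; _≢_; refl; sym; trans; cong; cong₂; subst; subst₂; module ≡-Reasoning)
open import Relation.Nullary.Decidable.Core using (Dec; yes; no; _×-dec_; _⊎-dec_; ¬?; map′)
open import Relation.Nullary.Negation.Core using (¬_)

-- Finite sums

-- The argument works because there is a window for the size R of the entries of a word. A ball of
-- radius ρ has about ρ² elements, while the number of words that equal a given matrix grows, up to
-- a logarithm, only by a factor ρ per letter. So n letters gain about ρⁿ, which is roughly R. This
-- gain has to beat the factor N² that the Hilbert-Schmidt identity costs, and the count of scalar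
-- words stays essentially diagonal as long as R is well below N³. An R between N² and N³ leaves
-- room on both sides for logarithms and divisor bounds. The radius ρ must not depend on N: only
-- then is every element of the ball a word in L and U of bounded length, so that its correlations
-- bound those of L and U. For composite N the number of primes to be removed is unbounded, so the
-- splitting may lose no constant. It is therefore an exact Pythagorean identity, with the same
-- coefficients for the norm and for the energy. T is not self-adjoint, and one step of it only
-- detects L. The contraction is therefore proved for T².

module Sums {R : Set} {_⊕_ _⊗_ : R → R → R} {𝟘 𝟙 : R}
            (isCSR : AS.IsCommutativeSemiring {A = R} _≡_ _⊕_ _⊗_ 𝟘 𝟙)
            (_≼_ : R → R → Set) (≼-refl : ∀ {x} → x ≼ x)
            (⊕-mono : ∀ {x y u v} → x ≼ y → u ≼ v → (x ⊕ u) ≼ (y ⊕ v)) where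

  open AS.IsCommutativeSemiring isCSR
    using (+-assoc; +-comm; *-comm; +-identityˡ; +-identityʳ; distribˡ; distribʳ; zeroˡ; zeroʳ)

  private variable
    A B : Set

  ∑ : List A → (A → R) → R
  ∑ []       f = 𝟘
  ∑ (x ∷ xs) f = f x ⊕ ∑ xs f

  ∑-cong∈ : (xs : List A) {f g : A → R} → (∀ x → x ∈ xs → f x ≡ g x) → ∑ xs f ≡ ∑ xs g
  ∑-cong∈ []       e = refl
  ∑-cong∈ (x ∷ xs) e = cong₂ _⊕_ (e x (here refl)) (∑-cong∈ xs (λ y m → e y (there m)))

  ∑-cong : (xs : List A) {f g : A → R} → (∀ x → f x ≡ g x) → ∑ xs f ≡ ∑ xs g
  ∑-cong xs e = ∑-cong∈ xs (λ x _ → e x)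

  ∑-mono∈ : (xs : List A) {f g : A → R} → (∀ x → x ∈ xs → f x ≼ g x) → ∑ xs f ≼ ∑ xs g
  ∑-mono∈ []       e = ≼-refl
  ∑-mono∈ (x ∷ xs) e = ⊕-mono (e x (here refl)) (∑-mono∈ xs (λ y m → e y (there m)))

  ∑-mono : (xs : List A) {f g : A → R} → (∀ x → f x ≼ g x) → ∑ xs f ≼ ∑ xs g
  ∑-mono xs e = ∑-mono∈ xs (λ x _ → e x)

  ∑-zero : (xs : List A) → ∑ xs (λ _ → 𝟘) ≡ 𝟘
  ∑-zero []       = refl
  ∑-zero (x ∷ xs) = trans (+-identityˡ _) (∑-zero xs)

  ∑-zero∈ : (xs : List A) {f : A → R} → (∀ x → x ∈ xs → f x ≡ 𝟘) → ∑ xs f ≡ 𝟘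
  ∑-zero∈ xs e = trans (∑-cong∈ xs e) (∑-zero xs)

  ⊕-interchange : ∀ a b c d → ((a ⊕ b) ⊕ (c ⊕ d)) ≡ ((a ⊕ c) ⊕ (b ⊕ d))
  ⊕-interchange a b c d = begin
    (a ⊕ b) ⊕ (c ⊕ d)  ≡⟨ +-assoc a b _ ⟩
    a ⊕ (b ⊕ (c ⊕ d))  ≡⟨ cong (a ⊕_) (sym (+-assoc b c d)) ⟩
    a ⊕ ((b ⊕ c) ⊕ d)  ≡⟨ cong (λ z → a ⊕ (z ⊕ d)) (+-comm b c) ⟩
    a ⊕ ((c ⊕ b) ⊕ d)  ≡⟨ cong (a ⊕_) (+-assoc c b d) ⟩
    a ⊕ (c ⊕ (b ⊕ d))  ≡⟨ sym (+-assoc a c _) ⟩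
    (a ⊕ c) ⊕ (b ⊕ d)  ∎
    where open ≡-Reasoning

  ∑-⊕ : (xs : List A) (f g : A → R) → ∑ xs (λ x → f x ⊕ g x) ≡ (∑ xs f ⊕ ∑ xs g)
  ∑-⊕ []       f g = sym (+-identityˡ 𝟘)
  ∑-⊕ (x ∷ xs) f g = trans (cong ((f x ⊕ g x) ⊕_) (∑-⊕ xs f g)) (⊕-interchange _ _ _ _)

  ∑-*ˡ : (xs : List A) (c : R) (f : A → R) → ∑ xs (λ x → c ⊗ f x) ≡ (c ⊗ ∑ xs f)
  ∑-*ˡ []       c f = sym (zeroʳ c)
  ∑-*ˡ (x ∷ xs) c f = trans (cong ((c ⊗ f x) ⊕_) (∑-*ˡ xs c f)) (sym (distribˡ c _ _))

  ∑-*ʳ : (xs : List A) (c : R) (f : A → R) → ∑ xs (λ x → f x ⊗ c) ≡ (∑ xs f ⊗ c)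
  ∑-*ʳ []       c f = sym (zeroˡ c)
  ∑-*ʳ (x ∷ xs) c f = trans (cong ((f x ⊗ c) ⊕_) (∑-*ʳ xs c f)) (sym (distribʳ c _ _))

  ∑-swap : (xs : List A) (ys : List B) (f : A → B → R) →
           ∑ xs (λ x → ∑ ys (f x)) ≡ ∑ ys (λ y → ∑ xs (λ x → f x y))
  ∑-swap []       ys f = sym (∑-zero ys)
  ∑-swap (x ∷ xs) ys f = trans (cong (∑ ys (f x) ⊕_) (∑-swap xs ys f))
                               (sym (∑-⊕ ys (f x) (λ y → ∑ xs (λ x → f x y))))

  ∑-prod : (xs : List A) (ys : List B) (f : A → R) (g : B → R) →
           (∑ xs f ⊗ ∑ ys g) ≡ ∑ xs (λ x → ∑ ys (λ y → f x ⊗ g y))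
  ∑-prod xs ys f g = trans (sym (∑-*ʳ xs (∑ ys g) f)) (∑-cong xs (λ x → sym (∑-*ˡ ys (f x) g)))

  ∑-++ : (xs ys : List A) (f : A → R) → ∑ (xs ++ ys) f ≡ (∑ xs f ⊕ ∑ ys f)
  ∑-++ []       ys f = sym (+-identityˡ _)
  ∑-++ (x ∷ xs) ys f = trans (cong (f x ⊕_) (∑-++ xs ys f)) (sym (+-assoc _ _ _))

  ∑-map : (h : A → B) (xs : List A) (f : B → R) → ∑ (map h xs) f ≡ ∑ xs (f ∘ h)
  ∑-map h []       f = refl
  ∑-map h (x ∷ xs) f = cong (f (h x) ⊕_) (∑-map h xs f)

  ∑-concatMap : (h : A → List B) (xs : List A) (f : B → R) →
                ∑ (concatMap h xs) f ≡ ∑ xs (λ x → ∑ (h x) f)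
  ∑-concatMap h []       f = refl
  ∑-concatMap h (x ∷ xs) f = trans (∑-++ (h x) _ f) (cong (∑ (h x) f ⊕_) (∑-concatMap h xs f))

  ∑-cartesian : (xs : List A) (ys : List B) (f : A × B → R) →
                ∑ (cartesianProduct xs ys) f ≡ ∑ xs (λ x → ∑ ys (λ y → f (x , y)))
  ∑-cartesian []       ys f = refl
  ∑-cartesian (x ∷ xs) ys f =
    trans (∑-++ (map (x ,_) ys) _ f) (cong₂ _⊕_ (∑-map (x ,_) ys f) (∑-cartesian xs ys f))

  ∑-applyUpTo-∘ : (h : A → B) (g : ℕ → A) (n : ℕ) (f : B → R) →
                  ∑ (applyUpTo (h ∘ g) n) f ≡ ∑ (applyUpTo g n) (f ∘ h)
  ∑-applyUpTo-∘ h g zero    f = refl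
  ∑-applyUpTo-∘ h g (suc n) f = cong (f (h (g 0)) ⊕_) (∑-applyUpTo-∘ h (g ∘ suc) n f)

  ∑-last : (g : ℕ → A) (n : ℕ) (f : A → R) →
           ∑ (applyUpTo g (suc n)) f ≡ (∑ (applyUpTo g n) f ⊕ f (g n))
  ∑-last g n f = trans (cong (λ l → ∑ l f) (sym (applyUpTo-∷ʳ g n)))
                       (trans (∑-++ (applyUpTo g n) _ f) (cong (∑ (applyUpTo g n) f ⊕_) (+-identityʳ _)))

  ∑-upTo-cong : (g : ℕ → A) (n : ℕ) {f f′ : A → R} → (∀ i → i ℕ.< n → f (g i) ≡ f′ (g i)) →
                ∑ (applyUpTo g n) f ≡ ∑ (applyUpTo g n) f′
  ∑-upTo-cong g n {f} {f′} e = ∑-cong∈ (applyUpTo g n) λ x m → lem (∈-applyUpTo⁻ g m)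
    where
    lem : ∀ {x} → ∃ (λ i → i ℕ.< n × x ≡ g i) → f x ≡ f′ x
    lem (i , i<n , refl) = e i i<n

  ∑-upTo-split : (g : ℕ → A) (m n : ℕ) (f : A → R) →
                 ∑ (applyUpTo g (m ℕ.+ n)) f ≡ (∑ (applyUpTo g m) f ⊕ ∑ (applyUpTo (λ i → g (m ℕ.+ i)) n) f)
  ∑-upTo-split g zero    n f = sym (+-identityˡ _)
  ∑-upTo-split g (suc m) n f = trans (cong (f (g 0) ⊕_) (∑-upTo-split (g ∘ suc) m n f)) (sym (+-assoc (f (g 0)) _ _))

  ∑-blocks : ∀ N Q (F : ℕ → R) → ∑ (applyUpTo id (Q ℕ.* N)) F ≡ ∑ (applyUpTo id Q) (λ k → ∑ (applyUpTo id N) (λ t → F (k ℕ.* N ℕ.+ t)))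
  ∑-blocks N zero    F = refl
  ∑-blocks N (suc Q) F = begin
    ∑ (applyUpTo id (N ℕ.+ Q ℕ.* N)) F
      ≡⟨ ∑-upTo-split id N (Q ℕ.* N) F ⟩
    ∑ (applyUpTo id N) F ⊕ ∑ (applyUpTo (N ℕ.+_) (Q ℕ.* N)) F
      ≡⟨ cong (∑ (applyUpTo id N) F ⊕_) (∑-applyUpTo-∘ (N ℕ.+_) id (Q ℕ.* N) F) ⟩
    ∑ (applyUpTo id N) F ⊕ ∑ (applyUpTo id (Q ℕ.* N)) (λ i → F (N ℕ.+ i))
      ≡⟨ cong (∑ (applyUpTo id N) F ⊕_) (trans (∑-blocks N Q (λ i → F (N ℕ.+ i)))
           (trans (∑-cong (applyUpTo id Q) (λ k → ∑-cong (applyUpTo id N) (λ t → cong F (sym (ℕₚ.+-assoc N (k ℕ.* N) t)))))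
             (sym (∑-applyUpTo-∘ suc id Q _)))) ⟩
    ∑ (applyUpTo id (suc Q)) (λ k → ∑ (applyUpTo id N) (λ t → F (k ℕ.* N ℕ.+ t))) ∎
    where open ≡-Reasoning

-- Functions on residues take both signs and are summed in ℤ; counts are summed in ℕ.
module ∑ℤ = Sums ℤₚ.+-*-isCommutativeSemiring _≤_ ℤₚ.≤-refl ℤₚ.+-mono-≤
module ∑ℕ = Sums ℕₚ.+-*-isCommutativeSemiring ℕ._≤_ ℕₚ.≤-refl ℕₚ.+-mono-≤
open ∑ℤ public

-- Order arithmetic in ℤ, Cauchy-Schwarz and indicators

+-congˡ : ∀ a {b c} → b ≡ c → a + b ≡ a + c
+-congˡ a refl = refl

*-congˡ : ∀ a {b c} → b ≡ c → a * b ≡ a * c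
*-congˡ a refl = refl

*-congʳ : ∀ a {b c} → b ≡ c → b * a ≡ c * a
*-congʳ a refl = refl

0≤² : ∀ x → 0ℤ ≤ x * x
0≤² (+ n)     = subst (0ℤ ≤_) (ℤₚ.pos-* n n) (+≤+ ℕ.z≤n)
0≤² (-[1+ n ]) = +≤+ ℕ.z≤n

0≤* : ∀ {a b} → 0ℤ ≤ a → 0ℤ ≤ b → 0ℤ ≤ a * b
0≤* {+ m} {+ n} _ _ = subst (0ℤ ≤_) (ℤₚ.pos-* m n) (+≤+ ℕ.z≤n)

0≤+ : ∀ {a b} → 0ℤ ≤ a → 0ℤ ≤ b → 0ℤ ≤ a + b
0≤+ = ℤₚ.+-mono-≤

≤-by : ∀ {a b} d → 0ℤ ≤ d → a + d ≡ b → a ≤ b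
≤-by {a} d 0≤d refl = subst (_≤ a + d) (ℤₚ.+-identityʳ a) (ℤₚ.+-monoʳ-≤ a 0≤d)

0≤- : ∀ {a b} → a ≤ b → 0ℤ ≤ b - a
0≤- = ℤₚ.i≤j⇒0≤j-i

*-monoˡ : ∀ {a b} c → 0ℤ ≤ c → a ≤ b → c * a ≤ c * b
*-monoˡ {a} {b} c 0≤c a≤b = ≤-by (c * (b - a)) (0≤* 0≤c (0≤- a≤b)) (lem a b c)
  where
  lem : ∀ a b c → c * a + c * (b - a) ≡ c * b
  lem = solve-∀

*-monoʳ : ∀ {a b} c → 0ℤ ≤ c → a ≤ b → a * c ≤ b * c
*-monoʳ {a} {b} c 0≤c a≤b = subst₂ _≤_ (ℤₚ.*-comm c a) (ℤₚ.*-comm c b) (*-monoˡ c 0≤c a≤b)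

∑-nonneg : {A : Set} (xs : List A) {f : A → ℤ} → (∀ x → 0ℤ ≤ f x) → 0ℤ ≤ ∑ xs f
∑-nonneg xs {f} p = subst (_≤ ∑ xs f) (∑-zero xs) (∑-mono xs p)

∑-- : {A : Set} (xs : List A) (f g : A → ℤ) → ∑ xs (λ x → f x - g x) ≡ ∑ xs f - ∑ xs g
∑-- xs f g = trans (∑-⊕ xs f (λ x → - g x)) (+-congˡ (∑ xs f) (neg xs))
  where
  neg : ∀ xs → ∑ xs (λ x → - g x) ≡ - ∑ xs g
  neg []       = refl
  neg (x ∷ xs) = trans (+-congˡ (- g x) (neg xs)) (sym (ℤₚ.neg-distrib-+ (g x) (∑ xs g)))

∑-term≤ : {A : Set} {xs : List A} {f : A → ℤ} → (∀ x → 0ℤ ≤ f x) → ∀ {y} → y ∈ xs → f y ≤ ∑ xs f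
∑-term≤ {xs = x ∷ xs} {f} p (here refl) = ≤-by (∑ xs f) (∑-nonneg xs p) refl
∑-term≤ {xs = x ∷ xs} {f} p {y} (there m) =
  ≤-by (f x + (∑ xs f - f y)) (0≤+ (p x) (0≤- (∑-term≤ p m))) (lem (f y) (f x) (∑ xs f))
  where
  lem : ∀ a b c → a + (b + (c - a)) ≡ b + c
  lem = solve-∀

-- Lagrange's identity gives the inequality without division.
cauchy-schwarz : {A : Set} (xs : List A) (f g : A → ℤ) →
  ∑ xs (λ x → f x * g x) * ∑ xs (λ x → f x * g x) ≤ ∑ xs (λ x → f x * f x) * ∑ xs (λ x → g x * g x)
cauchy-schwarz xs f g =
  ℤₚ.*-cancelˡ-≤-pos _ _ (+ 2) (≤-by D (∑-nonneg xs (λ x → ∑-nonneg xs (λ y → 0≤² (f x * g y - f y * g x)))) eq)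
  where
  open ≡-Reasoning
  S = ∑ xs (λ x → f x * g x)
  P = ∑ xs (λ x → f x * f x)
  Q = ∑ xs (λ x → g x * g x)
  D = ∑ xs (λ x → ∑ xs (λ y → (f x * g y - f y * g x) * (f x * g y - f y * g x)))
  expand : ∀ a b c d → (a * b - c * d) * (a * b - c * d) ≡ (a * a) * (b * b) + (d * d) * (c * c) - (+ 2 * (a * d)) * (c * b)
  expand = solve-∀
  swapPQ : ∀ s p q → + 2 * (s * s) + (p * q + q * p - + 2 * s * s) ≡ + 2 * (p * q)
  swapPQ = solve-∀
  Deq : D ≡ P * Q + Q * P - + 2 * S * S
  Deq = begin
    D ≡⟨ ∑-cong xs (λ x → trans (∑-cong xs (λ y → expand (f x) (g y) (f y) (g x)))
           (trans (∑-- xs _ _) (cong₂ _-_ (trans (∑-⊕ xs _ _) (cong₂ _+_ (∑-*ˡ xs (f x * f x) _) (∑-*ˡ xs (g x * g x) _)))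
              (∑-*ˡ xs (+ 2 * (f x * g x)) _)))) ⟩
    ∑ xs (λ x → (f x * f x) * Q + (g x * g x) * P - + 2 * (f x * g x) * S)
      ≡⟨ trans (∑-- xs _ _) (cong₂ _-_ (trans (∑-⊕ xs _ _) (cong₂ _+_ (∑-*ʳ xs Q _) (∑-*ʳ xs P _)))
           (trans (∑-*ʳ xs S _) (cong (_* S) (∑-*ˡ xs (+ 2) _)))) ⟩
    P * Q + Q * P - + 2 * S * S ∎
  eq : + 2 * (S * S) + D ≡ + 2 * (P * Q)
  eq = trans (+-congˡ (+ 2 * (S * S)) Deq) (swapPQ S P Q)

ind : {P : Set} → Dec P → ℤ
ind (yes _) = 1ℤ
ind (no  _) = 0ℤ

ind-yes : {P : Set} (d : Dec P) → P → ind d ≡ 1ℤ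
ind-yes (yes _) p = refl
ind-yes (no ¬p) p = ⊥-elim (¬p p)

ind-no : {P : Set} (d : Dec P) → ¬ P → ind d ≡ 0ℤ
ind-no (yes p) ¬p = ⊥-elim (¬p p)
ind-no (no _)  ¬p = refl

ind-⇔ : {P Q : Set} (d : Dec P) (e : Dec Q) → (P → Q) → (Q → P) → ind d ≡ ind e
ind-⇔ (yes p) e f g = sym (ind-yes e (f p))
ind-⇔ (no ¬p) e f g = sym (ind-no e (¬p ∘ g))

ind-≥0 : {P : Set} (d : Dec P) → 0ℤ ≤ ind d
ind-≥0 (yes _) = +≤+ ℕ.z≤n
ind-≥0 (no _)  = +≤+ ℕ.z≤n

ind-cong : {P : Set} (d : Dec P) {a b : ℤ} → (P → a ≡ b) → ind d * a ≡ ind d * b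
ind-cong (yes p) e = cong (1ℤ *_) (e p)
ind-cong (no _)  e = refl

ind-zero : {P : Set} (d : Dec P) {a : ℤ} → (P → a ≡ 0ℤ) → ind d * a ≡ 0ℤ
ind-zero (yes p) e = trans (ℤₚ.*-identityˡ _) (e p)
ind-zero (no _)  e = refl

ind-mono : {P : Set} (d : Dec P) {a b : ℤ} → (P → a ≤ b) → ind d * a ≤ ind d * b
ind-mono (yes p) e = subst₂ _≤_ (sym (ℤₚ.*-identityˡ _)) (sym (ℤₚ.*-identityˡ _)) (e p)
ind-mono (no _)  e = ℤₚ.≤-refl

-- A linear substitution mixes the two coordinates, so only the conjunction of the two congruences
-- can be transported, not each of them separately.
ind²-⇔ : {P Q R S : Set} (p : Dec P) (q : Dec Q) (r : Dec R) (s : Dec S) →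
         (P → Q → R × S) → (R → S → P × Q) → ind p * ind q ≡ ind r * ind s
ind²-⇔ (yes p) (yes q) r s f g =
  sym (cong₂ _*_ (ind-yes r (proj₁ (f p q))) (ind-yes s (proj₂ (f p q))))
ind²-⇔ (yes p) (no ¬q) (yes r) s f g = sym (trans (ℤₚ.*-identityˡ _) (ind-no s (λ s → ¬q (proj₂ (g r s)))))
ind²-⇔ (yes p) (no ¬q) (no _)  s f g = refl
ind²-⇔ (no ¬p) q (yes r) s f g = sym (trans (ℤₚ.*-identityˡ _) (ind-no s (λ s → ¬p (proj₁ (g r s)))))
ind²-⇔ (no ¬p) q (no _)  s f g = refl

-- Residues modulo N and the action of integer matrices

V : Set
V = ℤ × ℤ

∣-via : ∀ {k x y} → k ∣ x → x ≡ y → k ∣ y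
∣-via p refl = p

∣0 : ∀ {k} → k ∣ 0ℤ
∣0 = divides 0ℤ refl

infix 4 _≡_[_]
_≡_[_] : ℤ → ℤ → ℕ → Set
x ≡ y [ N ] = + N ∣ x - y

≡-mod-refl : ∀ {N} x → x ≡ x [ N ]
≡-mod-refl x = ∣-via ∣0 (sym (ℤₚ.+-inverseʳ x))

≡-mod-sym : ∀ {N} x y → x ≡ y [ N ] → y ≡ x [ N ]
≡-mod-sym x y p = ∣-via (Div.∣m⇒∣-m p) (lem x y)
  where
  lem : ∀ x y → - (x - y) ≡ y - x
  lem = solve-∀

≡-mod-trans : ∀ {N} x y z → x ≡ y [ N ] → y ≡ z [ N ] → x ≡ z [ N ]
≡-mod-trans x y z p q = ∣-via (Div.∣m∣n⇒∣m+n p q) (lem x y z)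
  where
  lem : ∀ x y z → (x - y) + (y - z) ≡ x - z
  lem = solve-∀

res : ℕ → List ℤ
res N = applyUpTo +_ N

Per : ℕ → (ℤ → ℤ) → Set
Per N F = ∀ x y → x ≡ y [ N ] → F x ≡ F y

-- A shift by 1 trades the term F 0 for F N, and these agree by periodicity. A negative shift is
-- undone by a positive one.
∑-shift : ∀ N (F : ℤ → ℤ) → Per N F → ∀ z → ∑ (res N) (λ y → F (z + y)) ≡ ∑ (res N) F
∑-shift N F per = go
  where
  shift₁ : ∀ F → Per N F → ∑ (res N) (λ y → F (1ℤ + y)) ≡ ∑ (res N) F
  shift₁ F per = ℤ-cancel (F 0ℤ) _ _ (begin
    F 0ℤ + ∑ (res N) (λ y → F (1ℤ + y))  ≡⟨ +-congˡ (F 0ℤ) (sym (∑-applyUpTo-∘ (λ y → 1ℤ + y) +_ N F)) ⟩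
    ∑ (applyUpTo +_ (suc N)) F            ≡⟨ ∑-last +_ N F ⟩
    ∑ (res N) F + F (+ N)                 ≡⟨ ℤₚ.+-comm (∑ (res N) F) (F (+ N)) ⟩
    F (+ N) + ∑ (res N) F                 ≡⟨ cong (_+ ∑ (res N) F) (per (+ N) 0ℤ (divides 1ℤ (lem (+ N)))) ⟩
    F 0ℤ + ∑ (res N) F                    ∎)
    where
    open ≡-Reasoning
    lem : ∀ x → x - 0ℤ ≡ 1ℤ * x
    lem = solve-∀
    ℤ-cancel : ∀ a b c → a + b ≡ a + c → b ≡ c
    ℤ-cancel a b c e = trans (l a b) (trans (cong (λ x → x - a) e) (sym (l a c)))
      where
      l : ∀ a b → b ≡ (a + b) - a
      l = solve-∀
  shift-per : ∀ z F → Per N F → Per N (λ y → F (z + y))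
  shift-per z F per x y p = per (z + x) (z + y) (∣-via p (lem z x y))
    where
    lem : ∀ z x y → x - y ≡ (z + x) - (z + y)
    lem = solve-∀
  shiftₙ : ∀ n F → Per N F → ∑ (res N) (λ y → F (+ n + y)) ≡ ∑ (res N) F
  shiftₙ zero F per = ∑-cong (res N) (λ y → cong F (ℤₚ.+-identityˡ y))
  shiftₙ (suc n) F per =
    trans (∑-cong (res N) (λ y → cong F (lem (+ n) y)))
          (trans (shift₁ (λ y → F (+ n + y)) (shift-per (+ n) F per)) (shiftₙ n F per))
    where
    lem : ∀ n y → (1ℤ + n) + y ≡ n + (1ℤ + y)
    lem = solve-∀
  go : ∀ z → ∑ (res N) (λ y → F (z + y)) ≡ ∑ (res N) F
  go (+ n) = shiftₙ n F per
  go (-[1+ n ]) = trans (sym (shiftₙ (suc n) (λ y → F (-[1+ n ] + y)) (shift-per -[1+ n ] F per)))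
                        (∑-cong (res N) (λ y → cong F (lem (+ (suc n)) y)))
    where
    lem : ∀ m y → - m + (m + y) ≡ y
    lem = solve-∀

δ : ℕ → ℤ → ℤ
δ N x = ind (+ N ∣? x)

small-∣⇒≡0 : ∀ {N i} → i ℕ.< N → + N ∣ + i → i ≡ 0
small-∣⇒≡0 {N} {zero}  i<N d = refl
small-∣⇒≡0 {N} {suc i} i<N d = ⊥-elim (ℕₚ.<⇒≱ i<N (ℕD.∣⇒≤ (Div.∣⇒∣ᵤ d)))

∑-δ₀ : ∀ N .{{_ : ℕ.NonZero N}} (F : ℤ → ℤ) → ∑ (res N) (λ y → δ N y * F y) ≡ F 0ℤ
∑-δ₀ (suc n) F = begin
  δ (suc n) 0ℤ * F 0ℤ + ∑ (applyUpTo (+_ ∘ suc) n) (λ y → δ (suc n) y * F y)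
    ≡⟨ cong₂ (λ a b → a * F 0ℤ + b) (ind-yes (+ suc n ∣? 0ℤ) ∣0)
         (trans (∑-upTo-cong (+_ ∘ suc) n (λ i i<n → ind-zero (+ suc n ∣? + suc i)
              (λ d → ⊥-elim (case small-∣⇒≡0 (ℕ.s≤s i<n) d of λ ()))))
            (∑-zero (applyUpTo (+_ ∘ suc) n))) ⟩
  1ℤ * F 0ℤ + 0ℤ ≡⟨ lem (F 0ℤ) ⟩
  F 0ℤ ∎
  where
  open ≡-Reasoning
  lem : ∀ x → 1ℤ * x + 0ℤ ≡ x
  lem = solve-∀

∑-δ : ∀ N .{{_ : ℕ.NonZero N}} (F : ℤ → ℤ) → Per N F → ∀ z →
      ∑ (res N) (λ y → δ N (y - z) * F y) ≡ F z
∑-δ N F per z = begin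
  ∑ (res N) (λ y → δ N (y - z) * F y)              ≡⟨ sym (∑-shift N (λ y → δ N (y - z) * F y) perG z) ⟩
  ∑ (res N) (λ y → δ N ((z + y) - z) * F (z + y))  ≡⟨ ∑-cong (res N) (λ y → cong (λ w → δ N w * F (z + y)) (lem z y)) ⟩
  ∑ (res N) (λ y → δ N y * F (z + y))              ≡⟨ ∑-δ₀ N (λ y → F (z + y)) ⟩
  F (z + 0ℤ)                                       ≡⟨ cong F (ℤₚ.+-identityʳ z) ⟩
  F z ∎
  where
  open ≡-Reasoning
  lem : ∀ z y → (z + y) - z ≡ y
  lem = solve-∀
  perG : Per N (λ y → δ N (y - z) * F y)
  perG x y p = cong₂ _*_
    (ind-⇔ (+ N ∣? (x - z)) (+ N ∣? (y - z)) (≡-mod-trans y x z (≡-mod-sym x y p)) (≡-mod-trans x y z p))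
    (per x y p)

∑-δ1 : ∀ N .{{_ : ℕ.NonZero N}} z → ∑ (res N) (λ y → δ N (y - z)) ≡ 1ℤ
∑-δ1 N z = trans (∑-cong (res N) (λ y → sym (ℤₚ.*-identityʳ (δ N (y - z))))) (∑-δ N (λ _ → 1ℤ) (λ _ _ _ → refl) z)

Per² : ℕ → (V → ℤ) → Set
Per² N F = ∀ x y x′ y′ → x ≡ x′ [ N ] → y ≡ y′ [ N ] → F (x , y) ≡ F (x′ , y′)

res² : ℕ → List V
res² N = cartesianProduct (res N) (res N)

δ² : ℕ → V → V → ℤ
δ² N (p , q) (x , y) = δ N (p - x) * δ N (q - y)

∑²-nested : ∀ N (F : V → ℤ) → ∑ (res² N) F ≡ ∑ (res N) (λ x → ∑ (res N) (λ y → F (x , y)))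
∑²-nested N F = ∑-cartesian (res N) (res N) F

∑-δ² : ∀ N .{{_ : ℕ.NonZero N}} (F : V → ℤ) → Per² N F → ∀ u →
       ∑ (res² N) (λ p → δ² N p u * F p) ≡ F u
∑-δ² N F per (x , y) = begin
  ∑ (res² N) (λ p → δ² N p (x , y) * F p) ≡⟨ ∑²-nested N _ ⟩
  ∑ (res N) (λ p → ∑ (res N) (λ q → (δ N (p - x) * δ N (q - y)) * F (p , q)))
    ≡⟨ ∑-cong (res N) (λ p → trans (∑-cong (res N) (λ q → ℤₚ.*-assoc (δ N (p - x)) (δ N (q - y)) (F (p , q))))
         (trans (∑-*ˡ (res N) (δ N (p - x)) _) (*-congˡ (δ N (p - x))
           (∑-δ N (λ q → F (p , q)) (λ a b → per p a p b (≡-mod-refl p)) y)))) ⟩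
  ∑ (res N) (λ p → δ N (p - x) * F (p , y))
    ≡⟨ ∑-δ N (λ p → F (p , y)) (λ a b e → per a y b y e (≡-mod-refl y)) x ⟩
  F (x , y) ∎
  where open ≡-Reasoning

∑-δ²1 : ∀ N .{{_ : ℕ.NonZero N}} u → ∑ (res² N) (λ p → δ² N p u) ≡ 1ℤ
∑-δ²1 N u = trans (∑-cong (res² N) (λ p → sym (ℤₚ.*-identityʳ (δ² N p u)))) (∑-δ² N (λ _ → 1ℤ) (λ _ _ _ _ _ _ → refl) u)

record Mat : Set where
  constructor mat
  field a b c d : ℤ

infixr 7 _▹_
_▹_ : Mat → V → V
mat a b c d ▹ (x , y) = (a * x + b * y , c * x + d * y)

det : Mat → ℤ
det (mat a b c d) = a * d - b * c

adj : Mat → Mat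
adj (mat a b c d) = mat d (- b) (- c) a

infixl 7 _·_
_·_ : Mat → Mat → Mat
mat a b c d · mat a′ b′ c′ d′ = mat (a * a′ + b * c′) (a * b′ + b * d′) (c * a′ + d * c′) (c * b′ + d * d′)

·-▹ : ∀ g h v → (g · h) ▹ v ≡ g ▹ h ▹ v
·-▹ (mat a b c d) (mat a′ b′ c′ d′) (x , y) = cong₂ _,_ (lem a b a′ b′ c′ d′ x y) (lem c d a′ b′ c′ d′ x y)
  where
  lem : ∀ a b a′ b′ c′ d′ x y →
        (a * a′ + b * c′) * x + (a * b′ + b * d′) * y ≡ a * (a′ * x + b′ * y) + b * (c′ * x + d′ * y)
  lem = solve-∀

-- Change of variables without permuting a list: F (g ▹ v) is written as a sum of `δ²` over p, the
-- sums are swapped, and the sum over v is then 1 because p ≡ g v exactly when v ≡ adj g p.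
∑-reindex : ∀ N .{{_ : ℕ.NonZero N}} (F : V → ℤ) → Per² N F → ∀ g → det g ≡ 1ℤ [ N ] →
            ∑ (res² N) (λ v → F (g ▹ v)) ≡ ∑ (res² N) F
∑-reindex N F per g@(mat a b c d) dt = begin
  ∑ (res² N) (λ v → F (g ▹ v))
    ≡⟨ ∑-cong (res² N) (λ v → sym (∑-δ² N F per (g ▹ v))) ⟩
  ∑ (res² N) (λ v → ∑ (res² N) (λ p → δ² N p (g ▹ v) * F p))
    ≡⟨ ∑-swap (res² N) (res² N) _ ⟩
  ∑ (res² N) (λ p → ∑ (res² N) (λ v → δ² N p (g ▹ v) * F p))
    ≡⟨ ∑-cong (res² N) (λ p → trans (∑-*ʳ (res² N) (F p) _) (trans (*-congʳ (F p)
         (trans (∑-cong (res² N) (λ v → flip p v)) (∑-δ²1 N (adj g ▹ p)))) (ℤₚ.*-identityˡ (F p)))) ⟩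
  ∑ (res² N) F ∎
  where
  open ≡-Reasoning
  e₁ : ∀ a b c d p q x y → d * (p - (a * x + b * y)) - b * (q - (c * x + d * y)) + (a * d - b * c - 1ℤ) * x
       ≡ - (x - (d * p + - b * q))
  e₁ = solve-∀
  e₂ : ∀ a b c d p q x y → a * (q - (c * x + d * y)) - c * (p - (a * x + b * y)) + (a * d - b * c - 1ℤ) * y
       ≡ - (y - (- c * p + a * q))
  e₂ = solve-∀
  e₃ : ∀ a b c d p q x y → (- (a * d - b * c - 1ℤ)) * p - a * (x - (d * p + - b * q)) - b * (y - (- c * p + a * q))
       ≡ p - (a * x + b * y)
  e₃ = solve-∀
  e₄ : ∀ a b c d p q x y → (- (a * d - b * c - 1ℤ)) * q - c * (x - (d * p + - b * q)) - d * (y - (- c * p + a * q))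
       ≡ q - (c * x + d * y)
  e₄ = solve-∀
  neg-∣ : ∀ {x} → + N ∣ - x → + N ∣ x
  neg-∣ {x} p = ∣-via (Div.∣m⇒∣-m p) (ℤₚ.neg-involutive x)
  comb : ∀ {x y z} k l m → + N ∣ x → + N ∣ y → + N ∣ z → + N ∣ (k * x - l * y) + z * m
  comb k l m p q r = Div.∣m∣n⇒∣m+n (Div.∣m∣n⇒∣m-n (Div.∣n⇒∣m*n k p) (Div.∣n⇒∣m*n l q)) (Div.∣m⇒∣m*n m r)
  comb′ : ∀ {x y z} k l m → + N ∣ x → + N ∣ y → + N ∣ z → + N ∣ (- z * m - k * x) - l * y
  comb′ k l m p q r = Div.∣m∣n⇒∣m-n (Div.∣m∣n⇒∣m-n (Div.∣m⇒∣m*n m (Div.∣m⇒∣-m r)) (Div.∣n⇒∣m*n k p)) (Div.∣n⇒∣m*n l q)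
  flip : ∀ p v → δ² N p (g ▹ v) ≡ δ² N v (adj g ▹ p)
  flip (p , q) (x , y) = ind²-⇔ (+ N ∣? _) (+ N ∣? _) (+ N ∣? _) (+ N ∣? _)
    (λ s t → neg-∣ (∣-via (comb d b x s t dt) (e₁ a b c d p q x y)) ,
             neg-∣ (∣-via (comb a c y t s dt) (e₂ a b c d p q x y)))
    (λ s t → ∣-via (comb′ a b p s t dt) (e₃ a b c d p q x y) ,
             ∣-via (comb′ c d q s t dt) (e₄ a b c d p q x y))

-- New forms and the Hilbert–Schmidt identity

Unit : ℕ → ℤ → Set
Unit N t = Σ ℤ λ s → t * s ≡ 1ℤ [ N ]

-- Primitivity modulo N in Bézout form: v is the first column of a matrix of determinant 1.
Prim : ℕ → V → Set
Prim N (x , y) = Σ V λ (z , w) → x * w - z * y ≡ 1ℤ [ N ]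

infixr 7 _⊛_
_⊛_ : ℤ → V → V
t ⊛ (x , y) = (t * x , t * y)

infixl 6 _⊞_
_⊞_ : V → V → V
(x , y) ⊞ (z , w) = (x + z , y + w)

-- Functions on the projective line over ℤ/N, lifted to homogeneous coordinates.
record InV (N : ℕ) (f : V → ℤ) : Set where
  field
    per : Per² N f
    scl : ∀ t → Unit N t → ∀ v → f (t ⊛ v) ≡ f v
    sup : ∀ v → f v ≡ 0ℤ ⊎ Prim N v

-- For g = gcd(β, N) the points u + β q run over the fibre of u under reduction modulo g, each g²
-- times. So this is orthogonality to everything pulled back from a proper divisor of N. The form
-- with β is the one in which `K-sum` meets it.
New : ℕ → (V → ℤ) → Set
New N f = ∀ β → ¬ (+ N ∣ β) → ∀ u → ∑ (res² N) (λ q → f (u ⊞ β ⊛ q)) ≡ 0ℤ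

⟨_,_⟩[_] : (V → ℤ) → (V → ℤ) → ℕ → ℤ
⟨ f , g ⟩[ N ] = ∑ (res² N) (λ v → f v * g v)

-- The number of inverses of t among the residues, hence 1 for a unit and 0 otherwise. Its total `φ`
-- is Euler's totient.
units : ℕ → ℤ → ℤ
units N t = ∑ (res N) (λ s → δ N (t * s - 1ℤ))

φ : ℕ → ℤ
φ N = ∑ (res N) (units N)

rows : V → V → Mat
rows (a , b) (c , d) = mat a b c d

∑-const : {A : Set} (g : ℕ → A) (n : ℕ) (c : ℤ) → ∑ (applyUpTo g n) (λ _ → c) ≡ + n * c
∑-const g zero    c = refl
∑-const g (suc n) c = trans (+-congˡ c (∑-const (g ∘ suc) n c)) (lem (+ n) c)
  where
  lem : ∀ n c → c + n * c ≡ (1ℤ + n) * c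
  lem = solve-∀

∑²-const : ∀ N c → ∑ (res² N) (λ _ → c) ≡ + N * + N * c
∑²-const N c = trans (∑²-nested N _) (trans (∑-cong (res N) (λ _ → ∑-const +_ N c))
                 (trans (∑-const +_ N (+ N * c)) (sym (ℤₚ.*-assoc (+ N) (+ N) c))))

≡-mod-+ : ∀ {N} x y x′ y′ → x ≡ x′ [ N ] → y ≡ y′ [ N ] → x + y ≡ x′ + y′ [ N ]
≡-mod-+ x y x′ y′ p q = ∣-via (Div.∣m∣n⇒∣m+n p q) (lem x y x′ y′)
  where
  lem : ∀ x y x′ y′ → (x - x′) + (y - y′) ≡ (x + y) - (x′ + y′)
  lem = solve-∀

≡-mod-*ˡ : ∀ {N} k x x′ → x ≡ x′ [ N ] → k * x ≡ k * x′ [ N ]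
≡-mod-*ˡ k x x′ p = ∣-via (Div.∣n⇒∣m*n k p) (lem k x x′)
  where
  lem : ∀ k x x′ → k * (x - x′) ≡ k * x - k * x′
  lem = solve-∀

≡-mod-* : ∀ {N} x y x′ y′ → x ≡ x′ [ N ] → y ≡ y′ [ N ] → x * y ≡ x′ * y′ [ N ]
≡-mod-* x y x′ y′ p q = ∣-via (Div.∣m∣n⇒∣m+n (Div.∣m⇒∣m*n y p) (Div.∣n⇒∣m*n x′ q)) (lem x y x′ y′)
  where
  lem : ∀ x y x′ y′ → (x - x′) * y + x′ * (y - y′) ≡ x * y - x′ * y′
  lem = solve-∀

Per²-▹ : ∀ {N F} → Per² N F → ∀ g → Per² N (λ v → F (g ▹ v))
Per²-▹ per (mat a b c d) x y x′ y′ p q =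
  per _ _ _ _ (≡-mod-+ (a * x) (b * y) (a * x′) (b * y′) (≡-mod-*ˡ a x x′ p) (≡-mod-*ˡ b y y′ q))
              (≡-mod-+ (c * x) (d * y) (c * x′) (d * y′) (≡-mod-*ˡ c x x′ p) (≡-mod-*ˡ d y y′ q))

Per²-⊞ : ∀ {N F} → Per² N F → ∀ u β → Per² N (λ v → F (u ⊞ β ⊛ v))
Per²-⊞ per (a , b) β x y x′ y′ p q =
  per _ _ _ _ (≡-mod-+ a (β * x) a (β * x′) (≡-mod-refl a) (≡-mod-*ˡ β x x′ p))
              (≡-mod-+ b (β * y) b (β * y′) (≡-mod-refl b) (≡-mod-*ˡ β y y′ q))

module HS (N : ℕ) .{{_ : ℕ.NonZero N}} (f : V → ℤ) (inV : InV N f) (new : New N f) where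
  open InV inV
  open ≡-Reasoning

  ‖f‖² : ℤ
  ‖f‖² = ⟨ f , f ⟩[ N ]

  units-scl : ∀ α u → units N α * f u ≡ units N α * f (α ⊛ u)
  units-scl α u = begin
    units N α * f u                                 ≡⟨ sym (∑-*ʳ (res N) (f u) _) ⟩
    ∑ (res N) (λ s → δ N (α * s - 1ℤ) * f u)        ≡⟨ ∑-cong (res N) (λ s → ind-cong (+ N ∣? (α * s - 1ℤ)) (λ p → sym (scl α (s , p) u))) ⟩
    ∑ (res N) (λ s → δ N (α * s - 1ℤ) * f (α ⊛ u))  ≡⟨ ∑-*ʳ (res N) (f (α ⊛ u)) _ ⟩
    units N α * f (α ⊛ u) ∎

  units-1 : ∀ α → Unit N α → units N α ≡ 1ℤ
  units-1 α (s₀ , p) = trans (∑-cong (res N) (λ s → ind-⇔ (+ N ∣? _) (+ N ∣? _)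
      (λ q → ∣-via (Div.∣m∣n⇒∣m-n (Div.∣n⇒∣m*n s₀ q) (Div.∣n⇒∣m*n s p)) (l₁ α s s₀))
      (λ q → ∣-via (Div.∣m∣n⇒∣m+n (Div.∣n⇒∣m*n α q) p) (l₂ α s s₀))))
    (∑-δ1 N s₀)
    where
    l₁ : ∀ α s s₀ → s₀ * (α * s - 1ℤ) - s * (α * s₀ - 1ℤ) ≡ s - s₀
    l₁ = solve-∀
    l₂ : ∀ α s s₀ → α * (s - s₀) + (α * s₀ - 1ℤ) ≡ α * s - 1ℤ
    l₂ = solve-∀

  dot : V → V → ℤ
  dot (a , b) (x , y) = a * x + b * y

  -- All matrices modulo N are summed, not only those of determinant 1. The images of two basis
  -- vectors then vary independently, which makes the sum computable.
  K : V → V → ℤ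
  K u v = ∑ (res² N) (λ r → ∑ (res² N) (λ s → f (rows r s ▹ u) * f (rows r s ▹ v)))

  -- The coordinates of a vector in the basis (u , z) turn the sum over matrices into a sum over their values on the basis.
  K-basis : ∀ x y z w → x * w - z * y ≡ 1ℤ [ N ] → ∀ α β →
            K (x , y) (mat x z y w ▹ (α , β)) ≡
            ∑ (res² N) (λ p → f p * ∑ (res² N) (λ q → f (α ⊛ p ⊞ β ⊛ q)))
  K-basis x y z w e α β = begin
    K (x , y) (mat x z y w ▹ (α , β))
      ≡⟨ ∑-cong (res² N) (λ r → ∑-cong (res² N) (λ s → cong₂ (λ a b → f a * f b) (hu r s) (hv r s))) ⟩
    ∑ (res² N) (λ r → ∑ (res² N) (λ s → G (mᵗ ▹ r) (mᵗ ▹ s)))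
      ≡⟨ ∑-cong (res² N) (λ r → ∑-reindex N (G (mᵗ ▹ r)) (G-per₂ (mᵗ ▹ r)) mᵗ e′) ⟩
    ∑ (res² N) (λ r → ∑ (res² N) (λ s → G (mᵗ ▹ r) s))
      ≡⟨ ∑-reindex N (λ r → ∑ (res² N) (G r)) (λ a b a′ b′ p q → ∑-cong (res² N) (λ s → G-per₁ s a b a′ b′ p q)) mᵗ e′ ⟩
    ∑ (res² N) (λ r → ∑ (res² N) (λ s → G r s))
      ≡⟨ trans (∑²-nested N _) (∑-cong (res N) (λ a → ∑-cong (res N) (λ b → ∑²-nested N _))) ⟩
    ∑ (res N) (λ a → ∑ (res N) (λ b → ∑ (res N) (λ c → ∑ (res N) (λ d → G (a , b) (c , d)))))
      ≡⟨ ∑-cong (res N) (λ a → ∑-swap (res N) (res N) _) ⟩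
    ∑ (res N) (λ a → ∑ (res N) (λ c → ∑ (res N) (λ b → ∑ (res N) (λ d → G (a , b) (c , d)))))
      ≡⟨ ∑-cong (res N) (λ a → ∑-cong (res N) (λ c →
           trans (∑-cong (res N) (λ b → ∑-*ˡ (res N) (f (a , c)) _)) (trans (∑-*ˡ (res N) (f (a , c)) _)
             (*-congˡ (f (a , c)) (sym (∑²-nested N _)))))) ⟩
    ∑ (res N) (λ a → ∑ (res N) (λ c → f (a , c) * ∑ (res² N) (λ q → f (α ⊛ (a , c) ⊞ β ⊛ q))))
      ≡⟨ sym (∑²-nested N _) ⟩
    ∑ (res² N) (λ p → f p * ∑ (res² N) (λ q → f (α ⊛ p ⊞ β ⊛ q))) ∎
    where
    mᵗ = mat x y z w
    e′ : det mᵗ ≡ 1ℤ [ N ]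
    e′ = ∣-via e (cong (λ t → x * w - t - 1ℤ) (ℤₚ.*-comm z y))
    G : V → V → ℤ
    G (a , b) (c , d) = f (a , c) * f (α ⊛ (a , c) ⊞ β ⊛ (b , d))
    l₁ : ∀ a b x y → a * x + b * y ≡ x * a + y * b
    l₁ = solve-∀
    l₂ : ∀ a b x y z w α β → a * (x * α + z * β) + b * (y * α + w * β) ≡ α * (x * a + y * b) + β * (z * a + w * b)
    l₂ = solve-∀
    hu : ∀ r s → rows r s ▹ (x , y) ≡ (proj₁ (mᵗ ▹ r) , proj₁ (mᵗ ▹ s))
    hu (a , b) (c , d) = cong₂ _,_ (l₁ a b x y) (l₁ c d x y)
    hv : ∀ r s → rows r s ▹ mat x z y w ▹ (α , β) ≡
         α ⊛ (proj₁ (mᵗ ▹ r) , proj₁ (mᵗ ▹ s)) ⊞ β ⊛ (proj₂ (mᵗ ▹ r) , proj₂ (mᵗ ▹ s))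
    hv (a , b) (c , d) = cong₂ _,_ (l₂ a b x y z w α β) (l₂ c d x y z w α β)
    lin : ∀ a b a′ b′ → a ≡ a′ [ N ] → b ≡ b′ [ N ] → α * a + β * b ≡ α * a′ + β * b′ [ N ]
    lin a b a′ b′ p q = ≡-mod-+ (α * a) (β * b) (α * a′) (β * b′) (≡-mod-*ˡ α a a′ p) (≡-mod-*ˡ β b b′ q)
    G-per₂ : ∀ r → Per² N (G r)
    G-per₂ (a , b) c d c′ d′ p q = cong₂ _*_ (per a c a c′ (≡-mod-refl a) p)
      (per _ _ _ _ (≡-mod-refl (α * a + β * b)) (lin c d c′ d′ p q))
    G-per₁ : ∀ s → Per² N (λ r → G r s)
    G-per₁ (c , d) a b a′ b′ p q = cong₂ _*_ (per a c a′ c p (≡-mod-refl c))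
      (per _ _ _ _ (lin a b a′ b′ p q) (≡-mod-refl (α * c + β * d)))

  K-per : ∀ u → Per² N (K u)
  K-per u x y x′ y′ p q = ∑-cong (res² N) (λ r → ∑-cong (res² N) (λ s →
    *-congˡ (f (rows r s ▹ u)) (Per²-▹ per (rows r s) x y x′ y′ p q)))

  Q : ℤ → ℤ
  Q α = ∑ (res² N) (λ p → f p * f (α ⊛ p))

  -- In a basis (u , z) every v is α u + β z. If N does not divide β, the inner sum of `K-basis`
  -- runs over a whole fibre and vanishes for a new form, so only the multiples of u survive. For
  -- these the image q of z is free and contributes N².
  K-sum : ∀ u → Prim N u → ∑ (res² N) (λ v → f v * K u v) ≡
          ∑ (res N) (λ α → f (α ⊛ u) * (+ N * + N * Q α))
  K-sum (x , y) ((z , w) , e) = begin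
    ∑ (res² N) (λ v → f v * K (x , y) v)
      ≡⟨ sym (∑-reindex N (λ v → f v * K (x , y) v) (λ a b a′ b′ p q → cong₂ _*_ (per a b a′ b′ p q) (K-per (x , y) a b a′ b′ p q)) m e) ⟩
    ∑ (res² N) (λ v → f (m ▹ v) * K (x , y) (m ▹ v))
      ≡⟨ ∑²-nested N _ ⟩
    ∑ (res N) (λ α → ∑ (res N) (λ β → f (m ▹ (α , β)) * K (x , y) (m ▹ (α , β))))
      ≡⟨ ∑-cong (res N) (λ α → ∑-cong (res N) (λ β → kill α β)) ⟩
    ∑ (res N) (λ α → ∑ (res N) (λ β → δ N β * (f (m ▹ (α , β)) * K (x , y) (m ▹ (α , β)))))
      ≡⟨ ∑-cong (res N) (λ α → ∑-δ₀ N _) ⟩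
    ∑ (res N) (λ α → f (m ▹ (α , 0ℤ)) * K (x , y) (m ▹ (α , 0ℤ)))
      ≡⟨ ∑-cong (res N) (λ α → cong₂ _*_ (cong f (cong₂ _,_ (l₀ x z α) (l₀ y w α))) (K₀ α)) ⟩
    ∑ (res N) (λ α → f (α ⊛ (x , y)) * (+ N * + N * Q α)) ∎
    where
    m = mat x z y w
    l₀ : ∀ x z α → x * α + z * 0ℤ ≡ α * x
    l₀ = solve-∀
    l₁ : ∀ a b → a + 0ℤ * b ≡ a
    l₁ = solve-∀
    l₂ : ∀ a b n → a * (n * b) ≡ n * (a * b)
    l₂ = solve-∀
    K₀ : ∀ α → K (x , y) (m ▹ (α , 0ℤ)) ≡ + N * + N * Q α
    K₀ α = begin
      K (x , y) (m ▹ (α , 0ℤ)) ≡⟨ K-basis x y z w e α 0ℤ ⟩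
      ∑ (res² N) (λ p → f p * ∑ (res² N) (λ q → f (α ⊛ p ⊞ 0ℤ ⊛ q)))
        ≡⟨ ∑-cong (res² N) (λ p → *-congˡ (f p) (trans (∑-cong (res² N) (λ q → cong f (cong₂ _,_ (l₁ _ (proj₁ q)) (l₁ _ (proj₂ q)))))
             (∑²-const N (f (α ⊛ p))))) ⟩
      ∑ (res² N) (λ p → f p * (+ N * + N * f (α ⊛ p)))
        ≡⟨ trans (∑-cong (res² N) (λ p → l₂ (f p) (f (α ⊛ p)) (+ N * + N))) (∑-*ˡ (res² N) (+ N * + N) _) ⟩
      + N * + N * Q α ∎
    kill : ∀ α β → f (m ▹ (α , β)) * K (x , y) (m ▹ (α , β)) ≡ δ N β * (f (m ▹ (α , β)) * K (x , y) (m ▹ (α , β)))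
    kill α β with + N ∣? β
    ... | yes _ = sym (ℤₚ.*-identityˡ _)
    ... | no ¬p = trans (*-congˡ (f (m ▹ (α , β))) (trans (K-basis x y z w e α β)
            (∑-zero∈ (res² N) (λ p _ → trans (*-congˡ (f p) (new β ¬p (α ⊛ p))) (ℤₚ.*-zeroʳ (f p)))))) (ℤₚ.*-zeroʳ (f (m ▹ (α , β))))

  unit-of : ∀ α u → Prim N (α ⊛ u) → Unit N α
  unit-of α (x , y) ((z , w) , e) = (x * w - z * y) , ∣-via e (lem α x y z w)
    where
    lem : ∀ α x y z w → (α * x) * w - z * (α * y) - 1ℤ ≡ α * (x * w - z * y) - 1ℤ
    lem = solve-∀

  -- If f does not vanish at α u, then α u is primitive and α is a unit; scale invariance gives f (α
  -- u) = f u and Q α = ‖f‖².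
  f-units : ∀ α u → f u * (f (α ⊛ u) * (+ N * + N * Q α)) ≡ f u * f u * (units N α * (+ N * + N * ‖f‖²))
  f-units α u with sup (α ⊛ u)
  ... | inj₁ z = trans (cong (λ t → f u * (t * (+ N * + N * Q α))) z)
                   (trans (l₁ (f u) (+ N * + N * Q α)) (sym (trans (l₂ (f u) (units N α) (+ N * + N * ‖f‖²))
                   (trans (cong (λ t → f u * (+ N * + N * ‖f‖²) * t) (trans (units-scl α u) (trans (*-congˡ (units N α) z) (ℤₚ.*-zeroʳ (units N α))))) (ℤₚ.*-zeroʳ (f u * (+ N * + N * ‖f‖²)))))))
    where
    l₁ : ∀ a b → a * (0ℤ * b) ≡ 0ℤ
    l₁ = solve-∀
    l₂ : ∀ a b c → a * a * (b * c) ≡ a * c * (b * a)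
    l₂ = solve-∀
  ... | inj₂ pr = trans (cong₂ (λ s t → f u * (s * (+ N * + N * t))) (scl α un u) (∑-cong (res² N) (λ p → *-congˡ (f p) (scl α un p))))
                    (trans (l (f u) (+ N * + N * ‖f‖²)) (cong (λ t → f u * f u * (t * (+ N * + N * ‖f‖²))) (sym (units-1 α un))))
    where
    un = unit-of α u pr
    l : ∀ a b → a * (a * b) ≡ a * a * (1ℤ * b)
    l = solve-∀

  K-total : ∀ u → f u * ∑ (res² N) (λ v → f v * K u v) ≡ f u * f u * (φ N * (+ N * + N * ‖f‖²))
  K-total u with sup u
  ... | inj₁ z = trans (cong (λ t → t * ∑ (res² N) (λ v → f v * K u v)) z) (sym (cong (λ t → t * t * (φ N * (+ N * + N * ‖f‖²))) z))
  ... | inj₂ pr = begin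
    f u * ∑ (res² N) (λ v → f v * K u v)
      ≡⟨ *-congˡ (f u) (K-sum u pr) ⟩
    f u * ∑ (res N) (λ α → f (α ⊛ u) * (+ N * + N * Q α))
      ≡⟨ trans (sym (∑-*ˡ (res N) (f u) _)) (∑-cong (res N) (λ α → f-units α u)) ⟩
    ∑ (res N) (λ α → f u * f u * (units N α * (+ N * + N * ‖f‖²)))
      ≡⟨ trans (∑-*ˡ (res N) (f u * f u) _) (*-congˡ (f u * f u) (∑-*ʳ (res N) (+ N * + N * ‖f‖²) (units N))) ⟩
    f u * f u * (φ N * (+ N * + N * ‖f‖²)) ∎

  H : V → V → ℤ
  H r s = ⟨ (λ v → f (rows r s ▹ v)) , f ⟩[ N ]

  -- The square is expanded into a sum over u and v, and the matrices are summed first, which leaves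
  -- f u · f v · K u v. The factor φ(N) counts the unit multiples of u, the factor N² the free image
  -- of the second basis vector.
  hilbert-schmidt : ∑ (res² N) (λ r → ∑ (res² N) (λ s → H r s * H r s)) ≡ φ N * (+ N * + N) * (‖f‖² * ‖f‖²)
  hilbert-schmidt = begin
    ∑ X (λ r → ∑ X (λ s → H r s * H r s))
      ≡⟨ ∑-cong X (λ r → trans (∑-cong X (λ s → ∑-prod X X _ _)) (∑-swap X X _)) ⟩
    ∑ X (λ r → ∑ X (λ u → ∑ X (λ s → ∑ X (λ v → T r s u v))))
      ≡⟨ ∑-swap X X _ ⟩
    ∑ X (λ u → ∑ X (λ r → ∑ X (λ s → ∑ X (λ v → T r s u v))))
      ≡⟨ ∑-cong X (λ u → trans (∑-cong X (λ r → ∑-swap X X _)) (∑-swap X X _)) ⟩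
    ∑ X (λ u → ∑ X (λ v → ∑ X (λ r → ∑ X (λ s → T r s u v))))
      ≡⟨ ∑-cong X (λ u → trans (∑-cong X (λ v → trans (∑-cong X (λ r → trans (∑-cong X (λ s → l₁ (f (rows r s ▹ u)) (f u) (f (rows r s ▹ v)) (f v))) (∑-*ˡ X (f u * f v) _)))
           (trans (∑-*ˡ X (f u * f v) _) (ℤₚ.*-assoc (f u) (f v) (K u v))))) (∑-*ˡ X (f u) _)) ⟩
    ∑ X (λ u → f u * ∑ X (λ v → f v * K u v))
      ≡⟨ ∑-cong X K-total ⟩
    ∑ X (λ u → f u * f u * (φ N * (+ N * + N * ‖f‖²)))
      ≡⟨ ∑-*ʳ X (φ N * (+ N * + N * ‖f‖²)) _ ⟩
    ‖f‖² * (φ N * (+ N * + N * ‖f‖²))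
      ≡⟨ l₂ ‖f‖² (φ N) (+ N * + N) ⟩
    φ N * (+ N * + N) * (‖f‖² * ‖f‖²) ∎
    where
    X = res² N
    T : V → V → V → V → ℤ
    T r s u v = (f (rows r s ▹ u) * f u) * (f (rows r s ▹ v) * f v)
    l₁ : ∀ a b c d → (a * b) * (c * d) ≡ (b * d) * (a * c)
    l₁ = solve-∀
    l₂ : ∀ a b c → a * (b * (c * a)) ≡ b * c * (a * a)
    l₂ = solve-∀

-- Correlations of a new form along words

ind-≤ : {P Q : Set} (p : Dec P) (q : Dec Q) → (P → Q) → ind p ≤ ind q
ind-≤ (yes p) q f = ℤₚ.≤-reflexive (sym (ind-yes q (f p)))
ind-≤ (no ¬p) q f = ind-≥0 q

ind-* : {P Q : Set} (p : Dec P) (q : Dec Q) → ind p * ind q ≡ ind (p ×-dec q)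
ind-* (yes p) (yes q) = refl
ind-* (yes p) (no ¬q) = refl
ind-* (no ¬p) q       = refl

I : Mat
I = mat 1ℤ 0ℤ 0ℤ 1ℤ

mat-≡ : ∀ {a b c d a′ b′ c′ d′} → a ≡ a′ → b ≡ b′ → c ≡ c′ → d ≡ d′ → mat a b c d ≡ mat a′ b′ c′ d′
mat-≡ refl refl refl refl = refl

·-identityˡ : ∀ g → I · g ≡ g
·-identityˡ (mat a b c d) = mat-≡ (l₁ a c) (l₁ b d) (l₂ a c) (l₂ b d)
  where
  l₁ : ∀ a c → 1ℤ * a + 0ℤ * c ≡ a
  l₁ = solve-∀
  l₂ : ∀ a c → 0ℤ * a + 1ℤ * c ≡ c
  l₂ = solve-∀

·-identityʳ : ∀ g → g · I ≡ g
·-identityʳ (mat a b c d) = mat-≡ (l₁ a b) (l₂ a b) (l₁ c d) (l₂ c d)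
  where
  l₁ : ∀ a b → a * 1ℤ + b * 0ℤ ≡ a
  l₁ = solve-∀
  l₂ : ∀ a b → a * 0ℤ + b * 1ℤ ≡ b
  l₂ = solve-∀

·-assoc : ∀ g h k → (g · h) · k ≡ g · (h · k)
·-assoc (mat a b c d) (mat a′ b′ c′ d′) (mat p q r s) =
  mat-≡ (l a b a′ b′ c′ d′ p r) (l a b a′ b′ c′ d′ q s) (l c d a′ b′ c′ d′ p r) (l c d a′ b′ c′ d′ q s)
  where
  l : ∀ a b a′ b′ c′ d′ p r → (a * a′ + b * c′) * p + (a * b′ + b * d′) * r ≡ a * (a′ * p + b′ * r) + b * (c′ * p + d′ * r)
  l = solve-∀

adj-· : ∀ g h → adj (g · h) ≡ adj h · adj g
adj-· (mat a b c d) (mat a′ b′ c′ d′) =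
  mat-≡ (l₁ c d b′ d′) (l₂ a b b′ d′) (l₃ a′ c′ c d) (l₄ a b a′ c′)
  where
  l₁ : ∀ c d b′ d′ → c * b′ + d * d′ ≡ d′ * d + - b′ * - c
  l₁ = solve-∀
  l₂ : ∀ a b b′ d′ → - (a * b′ + b * d′) ≡ d′ * - b + - b′ * a
  l₂ = solve-∀
  l₃ : ∀ a′ c′ c d → - (c * a′ + d * c′) ≡ - c′ * d + a′ * - c
  l₃ = solve-∀
  l₄ : ∀ a b a′ c′ → a * a′ + b * c′ ≡ - c′ * - b + a′ * a
  l₄ = solve-∀

det-· : ∀ g h → det (g · h) ≡ det g * det h
det-· (mat a b c d) (mat a′ b′ c′ d′) = l a b c d a′ b′ c′ d′
  where
  l : ∀ a b c d a′ b′ c′ d′ → (a * a′ + b * c′) * (c * b′ + d * d′) - (a * b′ + b * d′) * (c * a′ + d * c′)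
      ≡ (a * d - b * c) * (a′ * d′ - b′ * c′)
  l = solve-∀

det-adj : ∀ g → det (adj g) ≡ det g
det-adj (mat a b c d) = l a b c d
  where
  l : ∀ a b c d → d * a - (- b) * (- c) ≡ a * d - b * c
  l = solve-∀

adj-inverse : ∀ g → det g ≡ 1ℤ → ∀ v → g ▹ adj g ▹ v ≡ v
adj-inverse g@(mat a b c d) e v@(x , y) = cong₂ _,_
  (trans (l₁ a b c d x y) (trans (*-congʳ x e) (ℤₚ.*-identityˡ x)))
  (trans (l₂ a b c d x y) (trans (*-congʳ y e) (ℤₚ.*-identityˡ y)))
  where
  l₁ : ∀ a b c d x y → a * (d * x + - b * y) + b * (- c * x + a * y) ≡ (a * d - b * c) * x
  l₁ = solve-∀
  l₂ : ∀ a b c d x y → c * (d * x + - b * y) + d * (- c * x + a * y) ≡ (a * d - b * c) * y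
  l₂ = solve-∀

adj-inverseˡ : ∀ g → det g ≡ 1ℤ → ∀ v → adj g ▹ g ▹ v ≡ v
adj-inverseˡ g e v = subst (λ h → adj g ▹ h ▹ v ≡ v) (adj-adj g) (adj-inverse (adj g) (trans (det-adj g) e) v)
  where
  adj-adj : ∀ g → adj (adj g) ≡ g
  adj-adj (mat a b c d) = mat-≡ refl (ℤₚ.neg-involutive b) (ℤₚ.neg-involutive c) refl

I▹ : ∀ v → I ▹ v ≡ v
I▹ (x , y) = cong₂ _,_ (l₁ x y) (l₂ x y)
  where
  l₁ : ∀ x y → 1ℤ * x + 0ℤ * y ≡ x
  l₁ = solve-∀
  l₂ : ∀ x y → 0ℤ * x + 1ℤ * y ≡ y
  l₂ = solve-∀

det-mod : ∀ {N} g → det g ≡ 1ℤ → det g ≡ 1ℤ [ N ]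
det-mod {N} g e = subst (λ z → z ≡ 1ℤ [ N ]) (sym e) (≡-mod-refl {N} 1ℤ)

row₁ row₂ : Mat → V
row₁ (mat a b c d) = (a , b)
row₂ (mat a b c d) = (c , d)

Scalar : ℕ → Mat → Set
Scalar N (mat a b c d) = + N ∣ b × + N ∣ c × + N ∣ a - d

scalar? : ∀ N g → Dec (Scalar N g)
scalar? N (mat a b c d) = (+ N ∣? b) ×-dec ((+ N ∣? c) ×-dec (+ N ∣? (a - d)))

χ : ℕ → Mat → ℤ
χ N g = ind (scalar? N g)

*-cancel-pos : ∀ a b c → 0ℤ < c → c * a ≤ c * b → a ≤ b
*-cancel-pos a b (+ suc n) _ p = ℤₚ.*-cancelˡ-≤-pos a b (+ suc n) p
*-cancel-pos a b (+ zero) (+<+ ()) p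

0≤-≢⇒pos : ∀ {a} → 0ℤ ≤ a → a ≢ 0ℤ → 0ℤ < a
0≤-≢⇒pos p n = ℤₚ.≤∧≢⇒< p (n ∘ sym)

pos*pos : ∀ {a b} → 0ℤ < a → 0ℤ < b → 0ℤ < a * b
pos*pos {+ suc m} {+ suc n} _ _ = +<+ (ℕ.s≤s ℕ.z≤n)
pos*pos {+ zero} (+<+ ()) _
pos*pos {+ suc m} {+ zero} _ (+<+ ())

φ-pos : ∀ N .{{_ : ℕ.NonZero N}} → 0ℤ < φ N
φ-pos N = ℤₚ.<-≤-trans (+<+ (ℕ.s≤s ℕ.z≤n)) (subst (_≤ φ N) eq (∑-mono (res N) bound))
  where
  units≥0 : ∀ t → 0ℤ ≤ units N t
  units≥0 t = ∑-nonneg (res N) (λ s → ind-≥0 (+ N ∣? (t * s - 1ℤ)))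
  bound : ∀ t → δ N (t - 1ℤ) * units N t ≤ units N t
  bound t with + N ∣? (t - 1ℤ)
  ... | yes _ = ℤₚ.≤-reflexive (ℤₚ.*-identityˡ _)
  ... | no  _ = units≥0 t
  per : Per N (units N)
  per x y p = ∑-cong (res N) (λ s → ind-⇔ (+ N ∣? (x * s - 1ℤ)) (+ N ∣? (y * s - 1ℤ)) (tr x y p s) (tr y x (≡-mod-sym x y p) s))
    where
    tr : ∀ x y → x ≡ y [ N ] → ∀ s → + N ∣ x * s - 1ℤ → + N ∣ y * s - 1ℤ
    tr x y p s = ≡-mod-trans (y * s) (x * s) 1ℤ (≡-mod-* y s x s (≡-mod-sym x y p) (≡-mod-refl s))
  eq : ∑ (res N) (λ t → δ N (t - 1ℤ) * units N t) ≡ 1ℤ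
  eq = trans (∑-δ N (units N) per 1ℤ)
         (trans (∑-cong (res N) (λ s → cong (λ w → δ N (w - 1ℤ)) (ℤₚ.*-identityˡ s))) (∑-δ1 N 1ℤ))

-- `D-inv` says that the letters are closed under inversion, with multiplicities, so that the
-- averaging operator over D is self-adjoint. Words are listed with multiplicity as well.
module Words (D : List Mat) (D-det : ∀ {g} → g ∈ D → det g ≡ 1ℤ)
             (D-inv : ∀ (F : Mat → ℤ) → ∑ D (λ g → F (adj g)) ≡ ∑ D F) where
  open ℤₚ.≤-Reasoning

  pow : ℕ → List Mat
  pow zero    = I ∷ []
  pow (suc n) = concatMap (λ g → map (g ·_) (pow n)) D

  ∑-pow-suc : ∀ n (F : Mat → ℤ) → ∑ (pow (suc n)) F ≡ ∑ D (λ g → ∑ (pow n) (λ w → F (g · w)))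
  ∑-pow-suc n F = trans (∑-concatMap _ D F) (∑-cong D (λ g → ∑-map (g ·_) (pow n) F))

  ∑-pow-+ : ∀ m n (F : Mat → ℤ) → ∑ (pow (m ℕ.+ n)) F ≡ ∑ (pow m) (λ w → ∑ (pow n) (λ z → F (w · z)))
  ∑-pow-+ zero    n F = trans (∑-cong (pow n) (λ z → cong F (sym (·-identityˡ z)))) (sym (ℤₚ.+-identityʳ _))
  ∑-pow-+ (suc m) n F = begin-equality
    ∑ (pow (suc m ℕ.+ n)) F
      ≡⟨ ∑-pow-suc (m ℕ.+ n) F ⟩
    ∑ D (λ g → ∑ (pow (m ℕ.+ n)) (λ w → F (g · w)))
      ≡⟨ ∑-cong D (λ g → trans (∑-pow-+ m n (λ w → F (g · w))) (∑-cong (pow m) (λ w → ∑-cong (pow n) (λ z → cong F (sym (·-assoc g w z)))))) ⟩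
    ∑ D (λ g → ∑ (pow m) (λ w → ∑ (pow n) (λ z → F (g · w · z))))
      ≡⟨ sym (∑-pow-suc m _) ⟩
    ∑ (pow (suc m)) (λ w → ∑ (pow n) (λ z → F (w · z))) ∎

  ∑-pow-1 : ∀ (F : Mat → ℤ) → ∑ (pow 1) F ≡ ∑ D F
  ∑-pow-1 F = trans (∑-pow-suc 0 F) (∑-cong D (λ g → trans (ℤₚ.+-identityʳ _) (cong F (·-identityʳ g))))

  ∑-pow-sucʳ : ∀ n (F : Mat → ℤ) → ∑ (pow (suc n)) F ≡ ∑ (pow n) (λ w → ∑ D (λ g → F (w · g)))
  ∑-pow-sucʳ n F = trans (cong (λ k → ∑ (pow k) F) (sym (ℕₚ.+-comm n 1)))
    (trans (∑-pow-+ n 1 F) (∑-cong (pow n) (λ w → ∑-pow-1 (λ z → F (w · z)))))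

  ∑-pow-adj : ∀ n (F : Mat → ℤ) → ∑ (pow n) (λ w → F (adj w)) ≡ ∑ (pow n) F
  ∑-pow-adj zero    F = refl
  ∑-pow-adj (suc n) F = begin-equality
    ∑ (pow (suc n)) (λ w → F (adj w))
      ≡⟨ ∑-pow-suc n _ ⟩
    ∑ D (λ g → ∑ (pow n) (λ w → F (adj (g · w))))
      ≡⟨ ∑-cong D (λ g → trans (∑-cong (pow n) (λ w → cong F (adj-· g w))) (∑-pow-adj n (λ w → F (w · adj g)))) ⟩
    ∑ D (λ g → ∑ (pow n) (λ w → F (w · adj g)))
      ≡⟨ D-inv (λ g → ∑ (pow n) (λ w → F (w · g))) ⟩
    ∑ D (λ g → ∑ (pow n) (λ w → F (w · g)))
      ≡⟨ ∑-swap D (pow n) _ ⟩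
    ∑ (pow n) (λ w → ∑ D (λ g → F (w · g)))
      ≡⟨ sym (∑-pow-sucʳ n F) ⟩
    ∑ (pow (suc n)) F ∎

  ∈-pow : (P : ℕ → Mat → Set) → P 0 I → (∀ n g w → g ∈ D → P n w → P (suc n) (g · w)) →
          ∀ n {w} → w ∈ pow n → P n w
  ∈-pow P p₀ step zero    (here refl) = p₀
  ∈-pow P p₀ step (suc n) m = lem (find (∈-concatMap⁻ (λ g → map (g ·_) (pow n)) {xs = D} m))
    where
    lem : ∀ {w} → Σ Mat (λ g → g ∈ D × w ∈ map (g ·_) (pow n)) → P (suc n) w
    lem (g , g∈ , w∈) with ∈-map⁻ (g ·_) w∈
    ... | (z , z∈ , refl) = step n g z g∈ (∈-pow P p₀ step n z∈)

  pow-det : ∀ n {w} → w ∈ pow n → det w ≡ 1ℤ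
  pow-det = ∈-pow (λ _ w → det w ≡ 1ℤ) refl (λ n g w g∈ e → trans (det-· g w) (cong₂ _*_ (D-det g∈) e))

  module Moments (N : ℕ) .{{_ : ℕ.NonZero N}} (f : V → ℤ) (inV : InV N f) where
    open InV inV

    A : ℕ → ℤ
    A n = ∑ (pow n) (λ z → ⟨ (λ v → f (z ▹ v)) , f ⟩[ N ])

    P : ℕ → V → ℤ
    P n v = ∑ (pow n) (λ w → f (w ▹ v))

    move : ∀ w w′ → det w′ ≡ 1ℤ →
           ⟨ (λ v → f (w ▹ v)) , (λ v → f (w′ ▹ v)) ⟩[ N ] ≡ ⟨ (λ v → f ((w · adj w′) ▹ v)) , f ⟩[ N ]
    move w w′ e = begin-equality
      ∑ (res² N) (λ v → f (w ▹ v) * f (w′ ▹ v))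
        ≡⟨ sym (∑-reindex N _ (λ a b a′ b′ p q → cong₂ _*_ (Per²-▹ per w a b a′ b′ p q) (Per²-▹ per w′ a b a′ b′ p q))
             (adj w′) (det-mod (adj w′) (trans (det-adj w′) e))) ⟩
      ∑ (res² N) (λ v → f (w ▹ adj w′ ▹ v) * f (w′ ▹ adj w′ ▹ v))
        ≡⟨ ∑-cong (res² N) (λ v → cong₂ (λ a b → f a * f b) (sym (·-▹ w (adj w′) v)) (adj-inverse w′ e v)) ⟩
      ∑ (res² N) (λ v → f ((w · adj w′) ▹ v) * f v) ∎

    -- Moving w′ to the other side of the inner product turns it into its inverse, and words of
    -- length n are closed under inversion. Thus the A n are the moments of a self-adjoint operator,
    -- and `A-cauchy` is their log-convexity.
    gram : ∀ m n → ⟨ P m , P n ⟩[ N ] ≡ A (m ℕ.+ n)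
    gram m n = begin-equality
      ∑ X (λ v → P m v * P n v)
        ≡⟨ ∑-cong X (λ v → ∑-prod (pow m) (pow n) _ _) ⟩
      ∑ X (λ v → ∑ (pow m) (λ w → ∑ (pow n) (λ w′ → f (w ▹ v) * f (w′ ▹ v))))
        ≡⟨ trans (∑-swap X (pow m) _) (∑-cong (pow m) (λ w → ∑-swap X (pow n) _)) ⟩
      ∑ (pow m) (λ w → ∑ (pow n) (λ w′ → ∑ X (λ v → f (w ▹ v) * f (w′ ▹ v))))
        ≡⟨ ∑-cong (pow m) (λ w → ∑-cong∈ (pow n) (λ w′ w′∈ → move w w′ (pow-det n w′∈))) ⟩
      ∑ (pow m) (λ w → ∑ (pow n) (λ w′ → G (w · adj w′)))
        ≡⟨ ∑-cong (pow m) (λ w → ∑-pow-adj n (λ z → G (w · z))) ⟩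
      ∑ (pow m) (λ w → ∑ (pow n) (λ w′ → G (w · w′)))
        ≡⟨ sym (∑-pow-+ m n G) ⟩
      A (m ℕ.+ n) ∎
      where
      X = res² N
      G : Mat → ℤ
      G z = ⟨ (λ v → f (z ▹ v)) , f ⟩[ N ]

    A-cauchy : ∀ m n → A (m ℕ.+ n) * A (m ℕ.+ n) ≤ A (m ℕ.+ m) * A (n ℕ.+ n)
    A-cauchy m n = subst₂ _≤_ (cong₂ _*_ (gram m n) (gram m n)) (cong₂ _*_ (gram m m) (gram n n))
      (cauchy-schwarz (res² N) (P m) (P n))

    A-even≥0 : ∀ n → 0ℤ ≤ A (n ℕ.+ n)
    A-even≥0 n = subst (0ℤ ≤_) (gram n n) (∑-nonneg (res² N) (λ v → 0≤² (P n v)))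

    ‖f‖² : ℤ
    ‖f‖² = ⟨ f , f ⟩[ N ]

    A₀ : A 0 ≡ ‖f‖²
    A₀ = trans (ℤₚ.+-identityʳ _) (∑-cong (res² N) (λ v → cong (λ u → f u * f v) (I▹ v)))

    module Spread (new : New N f) (m : ℕ) where
      H = HS.H N f inV new
      hilbert-schmidt = HS.hilbert-schmidt N f inV new

      X : List V
      X = res² N

      M : List Mat
      M = pow m

      T : List V
      T = res² N

      -- A unit is summed as a pair of mutually inverse residues, so that the inverse is at hand
      -- without a choice.
      e : V → ℤ
      e (t , s) = δ N (t * s - 1ℤ)

      d : V → Mat → V → V → ℤ
      d (t , _) w r s = δ² N r (t ⊛ row₁ w) * δ² N s (t ⊛ row₂ w)

      -- The number of ways to write the matrix with rows r and s as a unit scalar times a word of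
      -- length m.
      c : V → V → ℤ
      c r s = ∑ T (λ τ → ∑ M (λ w → e τ * d τ w r s))

      φ-T : ∑ T e ≡ φ N
      φ-T = ∑²-nested N e

      H-per₁ : ∀ s → Per² N (λ r → H r s)
      H-per₁ (c , d) a b a′ b′ p q = ∑-cong X (λ (x , y) → *-congʳ (f (x , y))
        (per _ _ _ _ (≡-mod-+ (a * x) (b * y) (a′ * x) (b′ * y) (≡-mod-* a x a′ x p (≡-mod-refl x)) (≡-mod-* b y b′ y q (≡-mod-refl y)))
             (≡-mod-refl (c * x + d * y))))

      H-per₂ : ∀ r → Per² N (H r)
      H-per₂ (c , d) a b a′ b′ p q = ∑-cong X (λ (x , y) → *-congʳ (f (x , y))
        (per _ _ _ _ (≡-mod-refl (c * x + d * y))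
          (≡-mod-+ (a * x) (b * y) (a′ * x) (b′ * y) (≡-mod-* a x a′ x p (≡-mod-refl x)) (≡-mod-* b y b′ y q (≡-mod-refl y)))))

      H-scl : ∀ t s w → + N ∣ t * s - 1ℤ → ⟨ (λ v → f (w ▹ v)) , f ⟩[ N ] ≡ H (t ⊛ row₁ w) (t ⊛ row₂ w)
      H-scl t s (mat a b c d) p = ∑-cong X (λ (x , y) → *-congʳ (f (x , y))
        (trans (sym (scl t (s , p) _)) (cong f (cong₂ _,_ (l t a b x y) (l t c d x y)))))
        where
        l : ∀ t a b x y → t * (a * x + b * y) ≡ (t * a) * x + (t * b) * y
        l = solve-∀

      H-expand : ∀ τ w → H (proj₁ τ ⊛ row₁ w) (proj₁ τ ⊛ row₂ w) ≡ ∑ X (λ r → ∑ X (λ s → d τ w r s * H r s))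
      H-expand (t , _) w = sym (begin-equality
        ∑ X (λ r → ∑ X (λ s → δ² N r (t ⊛ row₁ w) * δ² N s (t ⊛ row₂ w) * H r s))
          ≡⟨ ∑-cong X (λ r → trans (∑-cong X (λ s → ℤₚ.*-assoc (δ² N r (t ⊛ row₁ w)) (δ² N s (t ⊛ row₂ w)) (H r s)))
               (trans (∑-*ˡ X (δ² N r (t ⊛ row₁ w)) _) (*-congˡ (δ² N r (t ⊛ row₁ w)) (∑-δ² N (H r) (H-per₂ r) (t ⊛ row₂ w))))) ⟩
        ∑ X (λ r → δ² N r (t ⊛ row₁ w) * H r (t ⊛ row₂ w))
          ≡⟨ ∑-δ² N (λ r → H r (t ⊛ row₂ w)) (H-per₁ (t ⊛ row₂ w)) (t ⊛ row₁ w) ⟩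
        H (t ⊛ row₁ w) (t ⊛ row₂ w) ∎)

      -- H is unchanged when its matrix is multiplied by a unit, so A m may be averaged over all
      -- unit scalars. Compared with Cauchy-Schwarz on A m itself, this saves a factor φ(N) in
      -- `spread`, at the price of counting scalar words instead of words congruent to the identity.
      φA : φ N * A m ≡ ∑ X (λ r → ∑ X (λ s → c r s * H r s))
      φA = begin-equality
        φ N * A m ≡⟨ cong (_* A m) (sym φ-T) ⟩
        ∑ T e * A m ≡⟨ ∑-prod T M e _ ⟩
        ∑ T (λ τ → ∑ M (λ w → e τ * ⟨ (λ v → f (w ▹ v)) , f ⟩[ N ]))
          ≡⟨ ∑-cong T (λ (t , s) → ∑-cong M (λ w → ind-cong (+ N ∣? (t * s - 1ℤ)) (λ p → trans (H-scl t s w p) (H-expand (t , s) w)))) ⟩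
        ∑ T (λ τ → ∑ M (λ w → e τ * ∑ X (λ r → ∑ X (λ s → d τ w r s * H r s))))
          ≡⟨ ∑-cong T (λ τ → ∑-cong M (λ w → trans (sym (∑-*ˡ X (e τ) _)) (∑-cong X (λ r → trans (sym (∑-*ˡ X (e τ) _))
               (∑-cong X (λ s → sym (ℤₚ.*-assoc (e τ) (d τ w r s) (H r s)))))))) ⟩
        ∑ T (λ τ → ∑ M (λ w → ∑ X (λ r → ∑ X (λ s → e τ * d τ w r s * H r s))))
          ≡⟨ ∑-cong T (λ τ → trans (∑-swap M X _) (∑-cong X (λ r → ∑-swap M X _))) ⟩
        ∑ T (λ τ → ∑ X (λ r → ∑ X (λ s → ∑ M (λ w → e τ * d τ w r s * H r s))))
          ≡⟨ trans (∑-swap T X _) (∑-cong X (λ r → ∑-swap T X _)) ⟩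
        ∑ X (λ r → ∑ X (λ s → ∑ T (λ τ → ∑ M (λ w → e τ * d τ w r s * H r s))))
          ≡⟨ ∑-cong X (λ r → ∑-cong X (λ s → trans (∑-cong T (λ τ → ∑-*ʳ M (H r s) _)) (∑-*ʳ T (H r s) _))) ⟩
        ∑ X (λ r → ∑ X (λ s → c r s * H r s)) ∎

      Z : ℤ
      Z = ∑ (pow (m ℕ.+ m)) (χ N)

      dd : V → Mat → V → Mat → ℤ
      dd (t , _) w (t′ , _) w′ = δ² N (t ⊛ row₁ w) (t′ ⊛ row₁ w′) * δ² N (t ⊛ row₂ w) (t′ ⊛ row₂ w′)

      δ²-pair : ∀ u v → ∑ X (λ p → δ² N p u * δ² N p v) ≡ δ² N u v
      δ²-pair u (x , y) = ∑-δ² N (λ p → δ² N p (x , y)) (λ a b a′ b′ p q → cong₂ _*_ (sh a a′ x p) (sh b b′ y q)) u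
        where
        sh : ∀ a a′ x → a ≡ a′ [ N ] → δ N (a - x) ≡ δ N (a′ - x)
        sh a a′ x p = ind-⇔ (+ N ∣? (a - x)) (+ N ∣? (a′ - x)) (≡-mod-trans a′ a x (≡-mod-sym a a′ p)) (≡-mod-trans a a′ x p)

      d-pair : ∀ τ w τ′ w′ → ∑ X (λ r → ∑ X (λ s → d τ w r s * d τ′ w′ r s)) ≡ dd τ w τ′ w′
      d-pair (t , _) w (t′ , _) w′ = begin-equality
        ∑ X (λ r → ∑ X (λ s → (a₁ r * a₂ s) * (b₁ r * b₂ s)))
          ≡⟨ ∑-cong X (λ r → ∑-cong X (λ s → l (a₁ r) (a₂ s) (b₁ r) (b₂ s))) ⟩
        ∑ X (λ r → ∑ X (λ s → (a₁ r * b₁ r) * (a₂ s * b₂ s)))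
          ≡⟨ sym (∑-prod X X _ _) ⟩
        ∑ X (λ r → a₁ r * b₁ r) * ∑ X (λ s → a₂ s * b₂ s)
          ≡⟨ cong₂ _*_ (δ²-pair (t ⊛ row₁ w) (t′ ⊛ row₁ w′)) (δ²-pair (t ⊛ row₂ w) (t′ ⊛ row₂ w′)) ⟩
        dd (t , 0ℤ) w (t′ , 0ℤ) w′ ∎
        where
        a₁ = λ r → δ² N r (t ⊛ row₁ w)
        a₂ = λ s → δ² N s (t ⊛ row₂ w)
        b₁ = λ r → δ² N r (t′ ⊛ row₁ w′)
        b₂ = λ s → δ² N s (t′ ⊛ row₂ w′)
        l : ∀ a b c d → (a * b) * (c * d) ≡ (a * c) * (b * d)
        l = solve-∀

      corner : Mat → ℤ
      corner (mat a b c d) = a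

      -- If tw ≡ t′w′ then w w′⁻¹ is the scalar t′/t, so t′ is determined by t, w and w′; likewise its inverse s′.
      collide : ∀ τ w τ′ w′ → det w ≡ 1ℤ → det w′ ≡ 1ℤ →
                e τ * (e τ′ * dd τ w τ′ w′) ≤ e τ * (χ N (w · adj w′) * δ² N τ′ (corner (w · adj w′) ⊛ τ))
      collide (t , s) w@(mat a b c d) (t′ , s′) w′@(mat a′ b′ c′ d′) ew ew′ =
        ind-mono (+ N ∣? (t * s - 1ℤ)) λ ts →
          subst₂ _≤_ (sym (trans (*-congˡ (δ N (t′ * s′ - 1ℤ)) (trans (cong₂ _*_ (ind-* p₁ p₂) (ind-* p₃ p₄)) (ind-* (p₁ ×-dec p₂) (p₃ ×-dec p₄)))) (ind-* p₀ _)))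
                     (sym (trans (*-congˡ (χ N (w · adj w′)) (ind-* q₁ q₂)) (ind-* (scalar? N (w · adj w′)) _)))
            (ind-≤ (p₀ ×-dec ((p₁ ×-dec p₂) ×-dec (p₃ ×-dec p₄))) (scalar? N (w · adj w′) ×-dec (q₁ ×-dec q₂))
              (λ (h₀ , ((h₁ , h₂) , (h₃ , h₄))) → concl ts h₀ h₁ h₂ h₃ h₄))
        where
        α = a * d′ + b * (- c′)
        β = a * (- b′) + b * a′
        γ = c * d′ + d * (- c′)
        ε = c * (- b′) + d * a′
        p₀ = + N ∣? (t′ * s′ - 1ℤ)
        p₁ = + N ∣? (t * a - t′ * a′)
        p₂ = + N ∣? (t * b - t′ * b′)
        p₃ = + N ∣? (t * c - t′ * c′)
        p₄ = + N ∣? (t * d - t′ * d′)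
        q₁ = + N ∣? (t′ - α * t)
        q₂ = + N ∣? (s′ - α * s)
        ∣+ : ∀ {x y} → + N ∣ x → + N ∣ y → + N ∣ x + y
        ∣+ = Div.∣m∣n⇒∣m+n
        ∣* : ∀ k {x} → + N ∣ x → + N ∣ k * x
        ∣* = Div.∣n⇒∣m*n
        i₁ : ∀ s d′ c′ t a b a′ b′ t′ → s * (a′ * (t * b - t′ * b′) + - b′ * (t * a - t′ * a′)) + - (a * (- b′) + b * a′) * (t * s - 1ℤ) ≡ a * (- b′) + b * a′
        i₁ = solve-∀
        i₂ : ∀ s t c d c′ d′ t′ → s * (d′ * (t * c - t′ * c′) + - c′ * (t * d - t′ * d′)) + - (c * d′ + d * (- c′)) * (t * s - 1ℤ) ≡ c * d′ + d * (- c′)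
        i₂ = solve-∀
        i₃ : ∀ t a b c d a′ b′ c′ d′ t′ → (d′ * (t * a - t′ * a′) + - c′ * (t * b - t′ * b′)) + - (a′ * (t * d - t′ * d′) + - b′ * (t * c - t′ * c′))
             ≡ t * ((a * d′ + b * (- c′)) - (c * (- b′) + d * a′))
        i₃ = solve-∀
        i₃′ : ∀ s t x → s * (t * x) + - x * (t * s - 1ℤ) ≡ x
        i₃′ = solve-∀
        i₄ : ∀ t a b a′ b′ c′ d′ t′ → - (d′ * (t * a - t′ * a′) + - c′ * (t * b - t′ * b′)) + - (t′ * (a′ * d′ - b′ * c′ - 1ℤ)) ≡ t′ - (a * d′ + b * (- c′)) * t
        i₄ = solve-∀
        i₅ : ∀ α β γ ε t s t′ s′ →
             (s * α) * (t′ * s′ - 1ℤ) + (- (s * α * s′) * (t′ - α * t) + (- (α * α * s′) * (t * s - 1ℤ) + (- s′ * (α * ε - β * γ - 1ℤ) + (- (s′ * γ) * β + - (s′ * α) * (α - ε)))))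
             ≡ s′ - α * s
        i₅ = solve-∀
        detαε : α * ε - β * γ ≡ 1ℤ
        detαε = trans (det-· w (adj w′)) (trans (cong₂ _*_ ew (trans (det-adj w′) ew′)) refl)
        zero∣ : ∀ {x} → x ≡ 1ℤ → + N ∣ x - 1ℤ
        zero∣ refl = ∣0
        neg : ∀ {x} → + N ∣ x → + N ∣ - x
        neg = Div.∣m⇒∣-m
        concl : + N ∣ t * s - 1ℤ → + N ∣ t′ * s′ - 1ℤ → + N ∣ t * a - t′ * a′ → + N ∣ t * b - t′ * b′ →
                + N ∣ t * c - t′ * c′ → + N ∣ t * d - t′ * d′ →
                (+ N ∣ β × + N ∣ γ × + N ∣ α - ε) × (+ N ∣ t′ - α * t × + N ∣ s′ - α * s)
        concl h h₀ h₁ h₂ h₃ h₄ = (Hβ , Hγ , Hε) , (Ht , Hs)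
          where
          Hβ : + N ∣ β
          Hβ = ∣-via (∣+ (∣* s (∣+ (∣* a′ h₂) (∣* (- b′) h₁))) (∣* (- β) h)) (i₁ s d′ c′ t a b a′ b′ t′)
          Hγ : + N ∣ γ
          Hγ = ∣-via (∣+ (∣* s (∣+ (∣* d′ h₃) (∣* (- c′) h₄))) (∣* (- γ) h)) (i₂ s t c d c′ d′ t′)
          Hε : + N ∣ α - ε
          Hε = ∣-via (∣+ (∣* s (∣-via (∣+ (∣+ (∣* d′ h₁) (∣* (- c′) h₂)) (neg (∣+ (∣* a′ h₄) (∣* (- b′) h₃)))) (i₃ t a b c d a′ b′ c′ d′ t′)))
                 (∣* (- (α - ε)) h)) (i₃′ s t (α - ε))
          Ht : + N ∣ t′ - α * t
          Ht = ∣-via (∣+ (neg (∣+ (∣* d′ h₁) (∣* (- c′) h₂))) (neg (∣* t′ (zero∣ ew′)))) (i₄ t a b a′ b′ c′ d′ t′)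
          Hs : + N ∣ s′ - α * s
          Hs = ∣-via (∣+ (∣* (s * α) h₀) (∣+ (∣* (- (s * α * s′)) Ht) (∣+ (∣* (- (α * α * s′)) h)
                 (∣+ (∣* (- s′) (zero∣ detαε)) (∣+ (∣* (- (s′ * γ)) Hβ) (∣* (- (s′ * α)) Hε)))))) (i₅ α β γ ε t s t′ s′)

      c²-bound : ∑ X (λ r → ∑ X (λ s → c r s * c r s)) ≤ φ N * Z
      c²-bound = ℤₚ.≤-trans (ℤₚ.≤-reflexive eq₁) (ℤₚ.≤-trans bound (ℤₚ.≤-reflexive eq₂))
        where
        eq₁ : ∑ X (λ r → ∑ X (λ s → c r s * c r s)) ≡
              ∑ T (λ τ → ∑ M (λ w → ∑ T (λ τ′ → ∑ M (λ w′ → e τ * (e τ′ * dd τ w τ′ w′)))))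
        eq₁ = begin-equality
          ∑ X (λ r → ∑ X (λ s → c r s * c r s))
            ≡⟨ ∑-cong X (λ r → ∑-cong X (λ s → trans (∑-prod T T _ _) (∑-cong T (λ τ → trans (∑-cong T (λ τ′ → ∑-prod M M _ _)) (∑-swap T M _))))) ⟩
          ∑ X (λ r → ∑ X (λ s → ∑ T (λ τ → ∑ M (λ w → ∑ T (λ τ′ → ∑ M (λ w′ → (e τ * d τ w r s) * (e τ′ * d τ′ w′ r s)))))))
            ≡⟨ trans (∑-cong X (λ r → ∑-swap X T _)) (∑-swap X T _) ⟩
          ∑ T (λ τ → ∑ X (λ r → ∑ X (λ s → ∑ M (λ w → ∑ T (λ τ′ → ∑ M (λ w′ → (e τ * d τ w r s) * (e τ′ * d τ′ w′ r s)))))))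
            ≡⟨ ∑-cong T (λ τ → trans (∑-cong X (λ r → ∑-swap X M _)) (∑-swap X M _)) ⟩
          ∑ T (λ τ → ∑ M (λ w → ∑ X (λ r → ∑ X (λ s → ∑ T (λ τ′ → ∑ M (λ w′ → (e τ * d τ w r s) * (e τ′ * d τ′ w′ r s)))))))
            ≡⟨ ∑-cong T (λ τ → ∑-cong M (λ w → trans (∑-cong X (λ r → ∑-swap X T _)) (∑-swap X T _))) ⟩
          ∑ T (λ τ → ∑ M (λ w → ∑ T (λ τ′ → ∑ X (λ r → ∑ X (λ s → ∑ M (λ w′ → (e τ * d τ w r s) * (e τ′ * d τ′ w′ r s)))))))
            ≡⟨ ∑-cong T (λ τ → ∑-cong M (λ w → ∑-cong T (λ τ′ → trans (∑-cong X (λ r → ∑-swap X M _)) (∑-swap X M _)))) ⟩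
          ∑ T (λ τ → ∑ M (λ w → ∑ T (λ τ′ → ∑ M (λ w′ → ∑ X (λ r → ∑ X (λ s → (e τ * d τ w r s) * (e τ′ * d τ′ w′ r s)))))))
            ≡⟨ ∑-cong T (λ τ → ∑-cong M (λ w → ∑-cong T (λ τ′ → ∑-cong M (λ w′ → inner τ w τ′ w′)))) ⟩
          ∑ T (λ τ → ∑ M (λ w → ∑ T (λ τ′ → ∑ M (λ w′ → e τ * (e τ′ * dd τ w τ′ w′))))) ∎
          where
          l : ∀ a b c d → (a * b) * (c * d) ≡ (a * c) * (b * d)
          l = solve-∀
          inner : ∀ τ w τ′ w′ → ∑ X (λ r → ∑ X (λ s → (e τ * d τ w r s) * (e τ′ * d τ′ w′ r s))) ≡ e τ * (e τ′ * dd τ w τ′ w′)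
          inner τ w τ′ w′ = trans (∑-cong X (λ r → trans (∑-cong X (λ s → l (e τ) (d τ w r s) (e τ′) (d τ′ w′ r s))) (∑-*ˡ X (e τ * e τ′) _)))
            (trans (∑-*ˡ X (e τ * e τ′) _) (trans (*-congˡ (e τ * e τ′) (d-pair τ w τ′ w′)) (ℤₚ.*-assoc (e τ) (e τ′) (dd τ w τ′ w′))))
        bound : ∑ T (λ τ → ∑ M (λ w → ∑ T (λ τ′ → ∑ M (λ w′ → e τ * (e τ′ * dd τ w τ′ w′))))) ≤
                ∑ T (λ τ → ∑ M (λ w → ∑ T (λ τ′ → ∑ M (λ w′ → e τ * (χ N (w · adj w′) * δ² N τ′ (corner (w · adj w′) ⊛ τ))))))
        bound = ∑-mono T (λ τ → ∑-mono∈ M (λ w w∈ → ∑-mono T (λ τ′ → ∑-mono∈ M (λ w′ w′∈ → collide τ w τ′ w′ (pow-det m w∈) (pow-det m w′∈)))))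
        eq₂ : ∑ T (λ τ → ∑ M (λ w → ∑ T (λ τ′ → ∑ M (λ w′ → e τ * (χ N (w · adj w′) * δ² N τ′ (corner (w · adj w′) ⊛ τ))))))
              ≡ φ N * Z
        eq₂ = begin-equality
          _ ≡⟨ ∑-cong T (λ τ → trans (∑-cong M (λ w → trans (∑-swap T M _) (trans (∑-cong M (λ w′ → pull τ w w′)) (∑-*ˡ M (e τ) _)))) (∑-*ˡ M (e τ) _)) ⟩
          ∑ T (λ τ → e τ * ∑ M (λ w → ∑ M (λ w′ → χ N (w · adj w′))))
            ≡⟨ ∑-*ʳ T _ e ⟩
          ∑ T e * ∑ M (λ w → ∑ M (λ w′ → χ N (w · adj w′)))
            ≡⟨ cong₂ _*_ φ-T (trans (∑-cong M (λ w → ∑-pow-adj m (λ z → χ N (w · z)))) (sym (∑-pow-+ m m (χ N)))) ⟩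
          φ N * Z ∎
          where
          pull : ∀ τ w w′ → ∑ T (λ τ′ → e τ * (χ N (w · adj w′) * δ² N τ′ (corner (w · adj w′) ⊛ τ))) ≡ e τ * χ N (w · adj w′)
          pull τ w w′ = trans (∑-*ˡ T (e τ) _) (*-congˡ (e τ) (trans (∑-*ˡ T (χ N (w · adj w′)) _)
            (trans (*-congˡ (χ N (w · adj w′)) (∑-δ²1 N (corner (w · adj w′) ⊛ τ))) (ℤₚ.*-identityʳ _))))

      -- Cauchy-Schwarz between c and H. The number of collisions and the Hilbert-Schmidt norm each
      -- carry one factor φ(N), which together cancel the square on the left and leave N².
      spread : A m * A m ≤ (+ N * + N) * ∑ (pow (m ℕ.+ m)) (χ N) * (A 0 * A 0)
      spread = *-cancel-pos _ _ (φ N * φ N) (pos*pos (φ-pos N) (φ-pos N)) (begin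
        φ N * φ N * (A m * A m)      ≡⟨ l₁ (φ N) (A m) ⟩
        (φ N * A m) * (φ N * A m)    ≡⟨ cong₂ _*_ φA′ φA′ ⟩
        ∑ XX (λ p → c′ p * H′ p) * ∑ XX (λ p → c′ p * H′ p)
                                     ≤⟨ cauchy-schwarz XX c′ H′ ⟩
        ∑ XX (λ p → c′ p * c′ p) * ∑ XX (λ p → H′ p * H′ p)
                                     ≡⟨ cong₂ _*_ (∑-cartesian X X _) (trans (∑-cartesian X X _) hilbert-schmidt) ⟩
        ∑ X (λ r → ∑ X (λ s → c r s * c r s)) * HS
                                     ≤⟨ *-monoʳ HS HS≥0 c²-bound ⟩
        φ N * Z * HS                 ≡⟨ trans (cong (λ t → φ N * Z * (φ N * (+ N * + N) * (t * t))) (sym A₀)) (l₂ (φ N) Z (+ N * + N) (A 0)) ⟩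
        φ N * φ N * ((+ N * + N) * Z * (A 0 * A 0)) ∎)
        where
        XX = cartesianProduct X X
        HS = φ N * (+ N * + N) * (‖f‖² * ‖f‖²)
        c′ H′ : V × V → ℤ
        c′ (r , s) = c r s
        H′ (r , s) = H r s
        φA′ : φ N * A m ≡ ∑ XX (λ p → c′ p * H′ p)
        φA′ = trans φA (sym (∑-cartesian X X _))
        HS≥0 : 0ℤ ≤ HS
        HS≥0 = 0≤* (0≤* (ℤₚ.<⇒≤ (φ-pos N)) (0≤² (+ N))) (0≤² ‖f‖²)
        l₁ : ∀ a b → a * a * (b * b) ≡ (a * b) * (a * b)
        l₁ = solve-∀
        l₂ : ∀ a z n b → a * z * (a * n * (b * b)) ≡ a * a * (n * z * (b * b))
        l₂ = solve-∀

    q : ℤ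
    q = ∑ D (λ _ → 1ℤ)

    q≥0 : 0ℤ ≤ q
    q≥0 = ∑-nonneg D (λ _ → +≤+ ℕ.z≤n)

    a : ℕ → ℤ
    a i = A (i ℕ.+ i)

    A₀≥0 : 0ℤ ≤ A 0
    A₀≥0 = A-even≥0 0

    module _ (large : q * A 0 < + 2 * A 1) where
      A₁>0 : 0ℤ < A 1
      A₁>0 = ℤₚ.*-cancelˡ-<-nonNeg (+ 2) (ℤₚ.≤-<-trans (0≤* q≥0 A₀≥0) large)

      prod-pos : ∀ {x y} → 0ℤ ≤ x → 0ℤ ≤ y → ∀ {z} → 0ℤ < z → z * z ≤ x * y → 0ℤ < x × 0ℤ < y
      prod-pos {x} {y} x≥0 y≥0 {z} z>0 le =
        0≤-≢⇒pos x≥0 (λ e → ℤₚ.<-irrefl (sym (cong (_* y) e)) (ℤₚ.<-≤-trans (pos*pos z>0 z>0) le)) ,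
        0≤-≢⇒pos y≥0 (λ e → ℤₚ.<-irrefl (sym (trans (*-congˡ x e) (ℤₚ.*-zeroʳ x))) (ℤₚ.<-≤-trans (pos*pos z>0 z>0) le))

      A₀-a₁ : 0ℤ < A 0 × 0ℤ < a 1
      A₀-a₁ = prod-pos A₀≥0 (A-even≥0 1) A₁>0 (A-cauchy 0 1)

      log-convex : ∀ i → a (suc i) * a (suc i) ≤ a i * a (suc (suc i))
      log-convex i = subst (λ k → A k * A k ≤ a i * a (suc (suc i))) (lem i) (A-cauchy i (suc (suc i)))
        where
        lem : ∀ i → i ℕ.+ suc (suc i) ≡ suc i ℕ.+ suc i
        lem i = ℕₚ.+-suc i (suc i)

      -- By log-convexity the ratios a (i + 1) / a i do not decrease, and the first is at least (A 1
      -- / A 0)², which exceeds (q / 2)² by `large`. Positivity is carried along because each ratio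
      -- is compared by cancelling a (i + 1).
      step : ∀ i → (q * q * a i ≤ + 4 * a (suc i)) × (0ℤ < a i) × (0ℤ < a (suc i))
      step zero = *-cancel-pos _ _ (A 0) (proj₁ A₀-a₁) (begin
          A 0 * (q * q * A 0)      ≡⟨ l₁ (A 0) q ⟩
          (q * A 0) * (q * A 0)    ≤⟨ ℤₚ.≤-trans (*-monoˡ (q * A 0) (0≤* q≥0 A₀≥0) (ℤₚ.<⇒≤ large)) (*-monoʳ (+ 2 * A 1) (0≤* {+ 2} (+≤+ ℕ.z≤n) (ℤₚ.<⇒≤ A₁>0)) (ℤₚ.<⇒≤ large)) ⟩
          (+ 2 * A 1) * (+ 2 * A 1) ≡⟨ l₂ (A 1) ⟩
          + 4 * (A 1 * A 1)        ≤⟨ *-monoˡ (+ 4) (+≤+ ℕ.z≤n) (A-cauchy 0 1) ⟩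
          + 4 * (A 0 * a 1)        ≡⟨ l₃ (A 0) (a 1) ⟩
          A 0 * (+ 4 * a 1) ∎) , A₀-a₁
        where
        l₁ : ∀ a q → a * (q * q * a) ≡ (q * a) * (q * a)
        l₁ = solve-∀
        l₂ : ∀ a → (+ 2 * a) * (+ 2 * a) ≡ + 4 * (a * a)
        l₂ = solve-∀
        l₃ : ∀ a b → + 4 * (a * b) ≡ a * (+ 4 * b)
        l₃ = solve-∀
      step (suc i) with step i
      ... | (le , p , p′) = *-cancel-pos _ _ (a (suc i)) p′ (begin
          a (suc i) * (q * q * a (suc i))       ≡⟨ l₁ (a (suc i)) q ⟩
          q * q * (a (suc i) * a (suc i))       ≤⟨ *-monoˡ (q * q) (0≤² q) (log-convex i) ⟩
          q * q * (a i * a (suc (suc i)))       ≡⟨ sym (ℤₚ.*-assoc (q * q) (a i) (a (suc (suc i)))) ⟩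
          q * q * a i * a (suc (suc i))         ≤⟨ *-monoʳ (a (suc (suc i))) (A-even≥0 (suc (suc i))) le ⟩
          + 4 * a (suc i) * a (suc (suc i))     ≡⟨ l₂ (a (suc i)) (a (suc (suc i))) ⟩
          a (suc i) * (+ 4 * a (suc (suc i))) ∎) ,
          p′ , proj₂ (prod-pos (A-even≥0 i) (A-even≥0 (suc (suc i))) p′ (log-convex i))
        where
        l₁ : ∀ a q → a * (q * q * a) ≡ q * q * (a * a)
        l₁ = solve-∀
        l₂ : ∀ a b → + 4 * a * b ≡ a * (+ 4 * b)
        l₂ = solve-∀

      ^≥0 : ∀ x → 0ℤ ≤ x → ∀ i → 0ℤ ≤ x ^ i
      ^≥0 x p zero    = +≤+ ℕ.z≤n
      ^≥0 x p (suc i) = 0≤* p (^≥0 x p i)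

      iterate : ∀ i → (q * q) ^ i * A 0 ≤ (+ 4) ^ i * a i
      iterate zero    = ℤₚ.≤-refl
      iterate (suc i) = begin
        (q * q) * (q * q) ^ i * A 0          ≡⟨ ℤₚ.*-assoc (q * q) ((q * q) ^ i) (A 0) ⟩
        (q * q) * ((q * q) ^ i * A 0)        ≤⟨ *-monoˡ (q * q) (0≤² q) (iterate i) ⟩
        (q * q) * ((+ 4) ^ i * a i)          ≡⟨ l₁ (q * q) ((+ 4) ^ i) (a i) ⟩
        (+ 4) ^ i * (q * q * a i)            ≤⟨ *-monoˡ ((+ 4) ^ i) (^≥0 (+ 4) (+≤+ ℕ.z≤n) i) (proj₁ (step i)) ⟩
        (+ 4) ^ i * (+ 4 * a (suc i))        ≡⟨ l₂ ((+ 4) ^ i) (a (suc i)) ⟩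
        + 4 * (+ 4) ^ i * a (suc i) ∎
        where
        l₁ : ∀ a b c → a * (b * c) ≡ b * (a * c)
        l₁ = solve-∀
        l₂ : ∀ a b → a * (+ 4 * b) ≡ + 4 * a * b
        l₂ = solve-∀

      -- The lower bound (q / 2) to the power 2i for the moment A (2i) meets the upper bound of
      -- `spread`, whose collisions are words of twice that length, 4i.
      contra : New N f → ∀ i → (q * q) ^ i * (q * q) ^ i ≤
               ((+ 4) ^ i * (+ 4) ^ i) * ((+ N * + N) * ∑ (pow ((i ℕ.+ i) ℕ.+ (i ℕ.+ i))) (χ N))
      contra new i = *-cancel-pos _ _ (A 0 * A 0) (pos*pos (proj₁ A₀-a₁) (proj₁ A₀-a₁)) (begin
        (A 0 * A 0) * (Q * Q)                  ≡⟨ l₁ (A 0) Q ⟩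
        (Q * A 0) * (Q * A 0)                  ≤⟨ ℤₚ.≤-trans (*-monoˡ (Q * A 0) QA≥0 (iterate i)) (*-monoʳ (F * a i) Fa≥0 (iterate i)) ⟩
        (F * a i) * (F * a i)                  ≡⟨ l₂ F (a i) ⟩
        F * F * (a i * a i)                    ≤⟨ *-monoˡ (F * F) (0≤² F) (Spread.spread new (i ℕ.+ i)) ⟩
        F * F * ((+ N * + N) * Z * (A 0 * A 0)) ≡⟨ l₃ (F * F) ((+ N * + N) * Z) (A 0 * A 0) ⟩
        (A 0 * A 0) * (F * F * ((+ N * + N) * Z)) ∎)
        where
        Q = (q * q) ^ i
        F = (+ 4) ^ i
        Z = ∑ (pow ((i ℕ.+ i) ℕ.+ (i ℕ.+ i))) (χ N)
        QA≥0 : 0ℤ ≤ Q * A 0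
        QA≥0 = 0≤* (^≥0 (q * q) (0≤² q) i) A₀≥0
        Fa≥0 : 0ℤ ≤ F * a i
        Fa≥0 = ℤₚ.≤-trans QA≥0 (iterate i)
        l₁ : ∀ a q → (a * a) * (q * q) ≡ (q * a) * (q * a)
        l₁ = solve-∀
        l₂ : ∀ a b → (a * b) * (a * b) ≡ a * a * (b * b)
        l₂ = solve-∀
        l₃ : ∀ a b c → a * (b * c) ≡ c * (a * b)
        l₃ = solve-∀

    new-bound : New N f → ∀ i →
      ((+ 4) ^ i * (+ 4) ^ i) * ((+ N * + N) * ∑ (pow ((i ℕ.+ i) ℕ.+ (i ℕ.+ i))) (χ N)) < (q * q) ^ i * (q * q) ^ i →
      + 2 * A 1 ≤ q * A 0
    new-bound new i h = ℤₚ.≮⇒≥ (λ large → ℤₚ.<⇒≱ h (contra large new i))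

-- The ball in SL₂(ℤ)

open ∑ℕ public using () renaming
  (∑ to ∑ⁿ; ∑-cong to ∑ⁿ-cong; ∑-cong∈ to ∑ⁿ-cong∈; ∑-mono to ∑ⁿ-mono; ∑-mono∈ to ∑ⁿ-mono∈; ∑-zero to ∑ⁿ-zero;
   ∑-zero∈ to ∑ⁿ-zero∈; ∑-⊕ to ∑ⁿ-+; ∑-*ˡ to ∑ⁿ-*ˡ; ∑-*ʳ to ∑ⁿ-*ʳ; ∑-swap to ∑ⁿ-swap; ∑-++ to ∑ⁿ-++;
   ∑-map to ∑ⁿ-map; ∑-concatMap to ∑ⁿ-concatMap; ∑-cartesian to ∑ⁿ-cartesian; ∑-applyUpTo-∘ to ∑ⁿ-applyUpTo-∘;
   ∑-last to ∑ⁿ-last; ∑-upTo-cong to ∑ⁿ-upTo-cong; ∑-upTo-split to ∑ⁿ-upTo-split; ∑-blocks to ∑ⁿ-blocks)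

indⁿ : {P : Set} → Dec P → ℕ
indⁿ (yes _) = 1
indⁿ (no  _) = 0

indⁿ-yes : {P : Set} (d : Dec P) → P → indⁿ d ≡ 1
indⁿ-yes (yes _) p = refl
indⁿ-yes (no ¬p) p = ⊥-elim (¬p p)

indⁿ-no : {P : Set} (d : Dec P) → ¬ P → indⁿ d ≡ 0
indⁿ-no (yes p) ¬p = ⊥-elim (¬p p)
indⁿ-no (no _)  ¬p = refl

indⁿ≤1 : {P : Set} (d : Dec P) → indⁿ d ℕ.≤ 1
indⁿ≤1 (yes _) = ℕₚ.≤-refl
indⁿ≤1 (no _)  = ℕ.z≤n

indⁿ-⇔ : {P Q : Set} (d : Dec P) (e : Dec Q) → (P → Q) → (Q → P) → indⁿ d ≡ indⁿ e
indⁿ-⇔ (yes p) e f g = sym (indⁿ-yes e (f p))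
indⁿ-⇔ (no ¬p) e f g = sym (indⁿ-no e (¬p ∘ g))

indⁿ-≤ : {P Q : Set} (p : Dec P) (q : Dec Q) → (P → Q) → indⁿ p ℕ.≤ indⁿ q
indⁿ-≤ (yes p) q f = ℕₚ.≤-reflexive (sym (indⁿ-yes q (f p)))
indⁿ-≤ (no ¬p) q f = ℕ.z≤n

indⁿ-mono : {P : Set} (d : Dec P) {a b : ℕ} → (P → a ℕ.≤ b) → indⁿ d ℕ.* a ℕ.≤ indⁿ d ℕ.* b
indⁿ-mono (yes p) e = ℕₚ.*-monoʳ-≤ 1 (e p)
indⁿ-mono (no _)  e = ℕ.z≤n

indⁿ-*≤ : {P : Set} (d : Dec P) (a : ℕ) → indⁿ d ℕ.* a ℕ.≤ a
indⁿ-*≤ (yes p) a = ℕₚ.≤-reflexive (ℕₚ.*-identityˡ a)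
indⁿ-*≤ (no _)  a = ℕ.z≤n

≤-indⁿ : {P : Set} (d : Dec P) {a b : ℕ} → (P → a ℕ.≤ b) → (¬ P → a ≡ 0) → a ℕ.≤ indⁿ d ℕ.* b
≤-indⁿ (yes p) {b = b} f g = ℕₚ.≤-trans (f p) (ℕₚ.≤-reflexive (sym (ℕₚ.*-identityˡ b)))
≤-indⁿ (no ¬p) f g = ℕₚ.≤-reflexive (g ¬p)

indⁿ-* : {P Q : Set} (p : Dec P) (q : Dec Q) → indⁿ p ℕ.* indⁿ q ≡ indⁿ (p ×-dec q)
indⁿ-* (yes p) (yes q) = refl
indⁿ-* (yes p) (no ¬q) = refl
indⁿ-* (no ¬p) q       = refl

∑ⁿ-term≤ : {A : Set} {xs : List A} (f : A → ℕ) → ∀ {y} → y ∈ xs → f y ℕ.≤ ∑ⁿ xs f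
∑ⁿ-term≤ f (here refl) = ℕₚ.m≤m+n _ _
∑ⁿ-term≤ {xs = x ∷ xs} f (there m) = ℕₚ.≤-trans (∑ⁿ-term≤ f m) (ℕₚ.m≤n+m _ (f x))

∑ⁿ-const : {A : Set} (xs : List A) (c : ℕ) → ∑ⁿ xs (λ _ → c) ≡ length xs ℕ.* c
∑ⁿ-const []       c = refl
∑ⁿ-const (x ∷ xs) c = cong (c ℕ.+_) (∑ⁿ-const xs c)

∑-pos : {A : Set} (xs : List A) (f : A → ℕ) → ∑ xs (λ x → + f x) ≡ + ∑ⁿ xs f
∑-pos []       f = refl
∑-pos (x ∷ xs) f = +-congˡ (+ f x) (∑-pos xs f)

-- Lists stand for sets here but may repeat entries, so the multiplicity m enters the bound.
cover : {A B : Set} {P : A → Set} (P? : ∀ x → Dec (P x)) (_≟_ : (x y : A) → Dec (x ≡ y)) (xs : List A) (ys : List B) (h : B → A) (m : ℕ) →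
        (∀ z → ∑ⁿ xs (λ x → indⁿ (x ≟ z)) ℕ.≤ m) →
        (∀ x → x ∈ xs → P x → Σ B λ y → y ∈ ys × x ≡ h y) →
        ∑ⁿ xs (λ x → indⁿ (P? x)) ℕ.≤ length ys ℕ.* m
cover P? _≟_ xs ys h m mult cov = begin
  ∑ⁿ xs (λ x → indⁿ (P? x))
    ≤⟨ ∑ⁿ-mono∈ xs (λ x x∈ → bound x x∈) ⟩
  ∑ⁿ xs (λ x → ∑ⁿ ys (λ y → indⁿ (x ≟ h y)))
    ≡⟨ ∑ⁿ-swap xs ys _ ⟩
  ∑ⁿ ys (λ y → ∑ⁿ xs (λ x → indⁿ (x ≟ h y)))
    ≤⟨ ∑ⁿ-mono ys (λ y → mult (h y)) ⟩
  ∑ⁿ ys (λ _ → m)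
    ≡⟨ ∑ⁿ-const ys m ⟩
  length ys ℕ.* m ∎
  where
  open ℕₚ.≤-Reasoning
  bound : ∀ x → x ∈ xs → indⁿ (P? x) ℕ.≤ ∑ⁿ ys (λ y → indⁿ (x ≟ h y))
  bound x x∈ with P? x
  ... | no _  = ℕ.z≤n
  ... | yes p with cov x x∈ p
  ...   | (y , y∈ , e) = ℕₚ.≤-trans (ℕₚ.≤-reflexive (sym (indⁿ-yes (x ≟ h y) e))) (∑ⁿ-term≤ (λ y → indⁿ (x ≟ h y)) y∈)

-- Each solution is compared with one fixed solution, if there is any.
cover-by-one : {A B : Set} {P : A → Set} (P? : ∀ x → Dec (P x)) (_≟_ : (x y : A) → Dec (x ≡ y)) (xs : List A) (ys : List B) (h : A → B → A) (m : ℕ) →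
        (∀ z → ∑ⁿ xs (λ x → indⁿ (x ≟ z)) ℕ.≤ m) →
        (∀ z x → z ∈ xs → x ∈ xs → P z → P x → Σ B λ y → y ∈ ys × x ≡ h z y) →
        ∑ⁿ xs (λ x → indⁿ (P? x)) ℕ.≤ length ys ℕ.* m
cover-by-one {A = A} {P = P} P? _≟_ xs ys h m mult cov with any? P? xs
... | yes a = let (z , z∈ , pz) = find a in cover P? _≟_ xs ys (h z) m mult (λ x x∈ px → cov z x z∈ x∈ pz px)
... | no ¬a = ℕₚ.≤-trans (ℕₚ.≤-reflexive (∑ⁿ-zero∈ xs (λ x x∈ → indⁿ-no (P? x) (λ px → ¬a (lose x∈ px))))) ℕ.z≤n

mult-applyUpTo : ∀ {g : ℕ → ℤ} → (∀ {i j} → g i ≡ g j → i ≡ j) → ∀ n z → ∑ⁿ (applyUpTo g n) (λ x → indⁿ (x ℤₚ.≟ z)) ℕ.≤ 1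
mult-applyUpTo inj zero z = ℕ.z≤n
mult-applyUpTo {g} inj (suc n) z with g 0 ℤₚ.≟ z
... | yes refl = ℕₚ.≤-reflexive (cong suc (∑ⁿ-zero∈ (applyUpTo (g ∘ suc) n) lem))
  where
  lem : ∀ x → x ∈ applyUpTo (g ∘ suc) n → indⁿ (x ℤₚ.≟ g 0) ≡ 0
  lem x x∈ with ∈-applyUpTo⁻ (g ∘ suc) x∈
  ... | (i , _ , refl) = indⁿ-no (g (suc i) ℤₚ.≟ g 0) (λ e → case inj e of λ ())
... | no _ = mult-applyUpTo (λ e → ℕₚ.suc-injective (inj e)) n z

abstract
  -- 0 belongs to both halves, so that negation simply exchanges them. The price is a multiplicity
  -- of 2 per entry in all counts below.
  rng : ℕ → List ℤ
  rng ρ = applyUpTo +_ (suc ρ) ++ applyUpTo (λ i → - + i) (suc ρ)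

  ∑-rng : ∀ ρ (F : ℤ → ℤ) → ∑ (rng ρ) F ≡ ∑ (applyUpTo id (suc ρ)) (λ i → F (+ i)) + ∑ (applyUpTo id (suc ρ)) (λ i → F (- + i))
  ∑-rng ρ F = trans (∑-++ (applyUpTo +_ (suc ρ)) _ F)
    (cong₂ _+_ (∑-applyUpTo-∘ +_ id (suc ρ) F) (∑-applyUpTo-∘ (λ i → - + i) id (suc ρ) F))

  ∑ⁿ-rng : ∀ ρ (F : ℤ → ℕ) → ∑ⁿ (rng ρ) F ≡ ∑ⁿ (applyUpTo id (suc ρ)) (λ i → F (+ i)) ℕ.+ ∑ⁿ (applyUpTo id (suc ρ)) (λ i → F (- + i))
  ∑ⁿ-rng ρ F = trans (∑ⁿ-++ (applyUpTo +_ (suc ρ)) _ F)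
    (cong₂ ℕ._+_ (∑ⁿ-applyUpTo-∘ +_ id (suc ρ) F) (∑ⁿ-applyUpTo-∘ (λ i → - + i) id (suc ρ) F))

  ∈-rng⁺ : ∀ {ρ} x → abs x ℕ.≤ ρ → x ∈ rng ρ
  ∈-rng⁺ (+ n) p = ∈-++⁺ˡ (∈-applyUpTo⁺ +_ (ℕ.s≤s p))
  ∈-rng⁺ {ρ} -[1+ n ] p = ∈-++⁺ʳ (applyUpTo +_ (suc ρ)) (∈-applyUpTo⁺ (λ i → - + i) {suc n} (ℕ.s≤s p))

  ∈-rng⁻ : ∀ {ρ x} → x ∈ rng ρ → abs x ℕ.≤ ρ
  ∈-rng⁻ {ρ} {x} m with ∈-++⁻ (applyUpTo +_ (suc ρ)) m
  ... | inj₁ m′ with ∈-applyUpTo⁻ +_ m′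
  ...   | (i , i< , refl) = ℕ.s≤s⁻¹ i<
  ∈-rng⁻ {ρ} {x} m | inj₂ m′ with ∈-applyUpTo⁻ (λ i → - + i) m′
  ... | (i , i< , refl) = ℕₚ.≤-trans (ℕₚ.≤-reflexive (ℤₚ.∣-i∣≡∣i∣ (+ i))) (ℕ.s≤s⁻¹ i<)

  length-rng : ∀ ρ → length (rng ρ) ≡ 2 ℕ.* suc ρ
  length-rng ρ = trans (length-++ (applyUpTo +_ (suc ρ))) (trans (cong₂ ℕ._+_ (length-applyUpTo +_ (suc ρ)) (length-applyUpTo (λ i → - + i) (suc ρ))) (cong (suc ρ ℕ.+_) (sym (ℕₚ.+-identityʳ (suc ρ)))))

  mult-rng : ∀ ρ z → ∑ⁿ (rng ρ) (λ x → indⁿ (x ℤₚ.≟ z)) ℕ.≤ 2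
  mult-rng ρ z = ℕₚ.≤-trans (ℕₚ.≤-reflexive (∑ⁿ-++ (applyUpTo +_ (suc ρ)) _ _))
    (ℕₚ.+-mono-≤ (mult-applyUpTo ℤₚ.+-injective (suc ρ) z)
                 (mult-applyUpTo (λ e → ℤₚ.+-injective (ℤₚ.neg-injective e)) (suc ρ) z))

∑-rng-neg : ∀ ρ (F : ℤ → ℤ) → ∑ (rng ρ) (λ x → F (- x)) ≡ ∑ (rng ρ) F
∑-rng-neg ρ F = trans (∑-rng ρ (λ x → F (- x)))
  (trans (ℤₚ.+-comm X Y) (trans (cong (λ y → y + X) (∑-cong (applyUpTo id (suc ρ)) (λ i → cong F (ℤₚ.neg-involutive (+ i))))) (sym (∑-rng ρ F))))
  where
  X = ∑ (applyUpTo id (suc ρ)) (λ i → F (- + i))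
  Y = ∑ (applyUpTo id (suc ρ)) (λ i → F (- - + i))

_≟V_ : (u v : V) → Dec (u ≡ v)
_≟V_ = ≡-dec ℤₚ._≟_ ℤₚ._≟_
  where open import Data.Product.Properties using (≡-dec)

rng² : ℕ → List V
rng² ρ = cartesianProduct (rng ρ) (rng ρ)

mult-rng² : ∀ ρ z → ∑ⁿ (rng² ρ) (λ v → indⁿ (v ≟V z)) ℕ.≤ 4
mult-rng² ρ z@(p , q) = begin
  ∑ⁿ (rng² ρ) (λ v → indⁿ (v ≟V z))
    ≡⟨ ∑ⁿ-cartesian (rng ρ) (rng ρ) _ ⟩
  ∑ⁿ (rng ρ) (λ x → ∑ⁿ (rng ρ) (λ y → indⁿ ((x , y) ≟V z)))
    ≤⟨ ∑ⁿ-mono (rng ρ) (λ x → ℕₚ.≤-trans (∑ⁿ-mono (rng ρ) (λ y → ℕₚ.≤-trans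
         (indⁿ-≤ ((x , y) ≟V z) ((x ℤₚ.≟ p) ×-dec (y ℤₚ.≟ q)) λ { refl → refl , refl })
         (ℕₚ.≤-reflexive (sym (indⁿ-* (x ℤₚ.≟ p) (y ℤₚ.≟ q))))))
         (ℕₚ.≤-trans (ℕₚ.≤-reflexive (∑ⁿ-*ˡ (rng ρ) (indⁿ (x ℤₚ.≟ p)) _)) (ℕₚ.*-monoʳ-≤ (indⁿ (x ℤₚ.≟ p)) (mult-rng ρ q)))) ⟩
  ∑ⁿ (rng ρ) (λ x → indⁿ (x ℤₚ.≟ p) ℕ.* 2)
    ≡⟨ ∑ⁿ-*ʳ (rng ρ) 2 _ ⟩
  ∑ⁿ (rng ρ) (λ x → indⁿ (x ℤₚ.≟ p)) ℕ.* 2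
    ≤⟨ ℕₚ.*-monoˡ-≤ 2 (mult-rng ρ p) ⟩
  4 ∎
  where open ℕₚ.≤-Reasoning

∈-rng²⁺ : ∀ {ρ} v → abs (proj₁ v) ℕ.≤ ρ → abs (proj₂ v) ℕ.≤ ρ → v ∈ rng² ρ
∈-rng²⁺ (x , y) p q = ∈-cartesianProduct⁺ (∈-rng⁺ x p) (∈-rng⁺ y q)

∈-rng²⁻ : ∀ {ρ} v → v ∈ rng² ρ → abs (proj₁ v) ℕ.≤ ρ × abs (proj₂ v) ℕ.≤ ρ
∈-rng²⁻ {ρ} (x , y) m = let (p , q) = ∈-cartesianProduct⁻ (rng ρ) (rng ρ) m in ∈-rng⁻ p , ∈-rng⁻ q

-- The set of matrices of determinant 1 with entries bounded by ρ, each with multiplicity at most 16 since rng lists 0 twice.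
one? : ∀ g → Dec (det g ≡ 1ℤ)
one? g = det g ℤₚ.≟ 1ℤ

sel : Mat → List Mat
sel g with one? g
... | yes _ = g ∷ []
... | no  _ = []

Ball : ℕ → List Mat
Ball ρ = concatMap (λ r → concatMap (λ s → sel (rows r s)) (rng² ρ)) (rng² ρ)

∑-sel : ∀ g (F : Mat → ℤ) → ∑ (sel g) F ≡ ind (one? g) * F g
∑-sel g F with one? g
... | yes _ = trans (ℤₚ.+-identityʳ (F g)) (sym (ℤₚ.*-identityˡ (F g)))
... | no  _ = refl

∑ⁿ-sel : ∀ g (F : Mat → ℕ) → ∑ⁿ (sel g) F ≡ indⁿ (one? g) ℕ.* F g
∑ⁿ-sel g F with one? g
... | yes _ = refl
... | no  _ = refl

∑-Ball : ∀ ρ (F : Mat → ℤ) → ∑ (Ball ρ) F ≡ ∑ (rng² ρ) (λ r → ∑ (rng² ρ) (λ s → ind (one? (rows r s)) * F (rows r s)))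
∑-Ball ρ F = trans (∑-concatMap _ (rng² ρ) F) (∑-cong (rng² ρ) (λ r → trans (∑-concatMap _ (rng² ρ) F) (∑-cong (rng² ρ) (λ s → ∑-sel (rows r s) F))))

∑ⁿ-Ball : ∀ ρ (F : Mat → ℕ) → ∑ⁿ (Ball ρ) F ≡ ∑ⁿ (rng² ρ) (λ r → ∑ⁿ (rng² ρ) (λ s → indⁿ (one? (rows r s)) ℕ.* F (rows r s)))
∑ⁿ-Ball ρ F = trans (∑ⁿ-concatMap _ (rng² ρ) F) (∑ⁿ-cong (rng² ρ) (λ r → trans (∑ⁿ-concatMap _ (rng² ρ) F) (∑ⁿ-cong (rng² ρ) (λ s → ∑ⁿ-sel (rows r s) F))))

∈-Ball⁻ : ∀ {ρ g} → g ∈ Ball ρ → Σ V λ r → Σ V λ s → r ∈ rng² ρ × s ∈ rng² ρ × g ≡ rows r s × det g ≡ 1ℤ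
∈-Ball⁻ {ρ} {g} m with find (∈-concatMap⁻ (λ r → concatMap (λ s → sel (rows r s)) (rng² ρ)) {xs = rng² ρ} m)
... | (r , r∈ , m′) with find (∈-concatMap⁻ (λ s → sel (rows r s)) {xs = rng² ρ} m′)
...   | (s , s∈ , m″) = r , s , r∈ , s∈ , lem (rows r s) m″
  where
  lem : ∀ h → g ∈ sel h → g ≡ h × det g ≡ 1ℤ
  lem h m with one? h
  lem h (here refl) | yes e = refl , e

∈-Ball⁺ : ∀ {ρ} r s → r ∈ rng² ρ → s ∈ rng² ρ → det (rows r s) ≡ 1ℤ → rows r s ∈ Ball ρ
∈-Ball⁺ {ρ} r s r∈ s∈ e = ∈-concatMap⁺ (λ r → concatMap (λ s → sel (rows r s)) (rng² ρ))
  (lose r∈ (∈-concatMap⁺ (λ s → sel (rows r s)) (lose s∈ (lem (rows r s) e))))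
  where
  lem : ∀ h → det h ≡ 1ℤ → h ∈ sel h
  lem h e with one? h
  ... | yes _ = here refl
  ... | no ¬e = ⊥-elim (¬e e)

Ball-det : ∀ {ρ g} → g ∈ Ball ρ → det g ≡ 1ℤ
Ball-det m = let (_ , _ , _ , _ , _ , e) = ∈-Ball⁻ m in e

-- The adjugate swaps a and d and negates b and c, all of which preserve the range of the entries.
-- This supplies the symmetry `D-inv` for words in the ball.
Ball-adj : ∀ ρ (F : Mat → ℤ) → ∑ (Ball ρ) (λ g → F (adj g)) ≡ ∑ (Ball ρ) F
Ball-adj ρ F = begin
  ∑ (Ball ρ) (λ g → F (adj g))
    ≡⟨ trans (∑-Ball ρ (λ g → F (adj g))) (nest (λ r s → ind (one? (rows r s)) * F (adj (rows r s)))) ⟩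
  ∑ R (λ a → ∑ R (λ b → ∑ R (λ c → ∑ R (λ d → ind (one? (mat a b c d)) * F (mat d (- b) (- c) a)))))
    ≡⟨ ∑-cong R (λ a → ∑-cong R (λ b → ∑-cong R (λ c → ∑-cong R (λ d → *-congʳ (F (mat d (- b) (- c) a)) (flip a b c d))))) ⟩
  ∑ R (λ a → ∑ R (λ b → ∑ R (λ c → ∑ R (λ d → H d (- b) (- c) a))))
    ≡⟨ ∑-cong R (λ a → trans (∑-cong R (λ b → ∑-rng-neg ρ (λ c → ∑ R (λ d → H d (- b) c a)))) (∑-rng-neg ρ (λ b → ∑ R (λ c → ∑ R (λ d → H d b c a))))) ⟩
  ∑ R (λ a → ∑ R (λ b → ∑ R (λ c → ∑ R (λ d → H d b c a))))
    ≡⟨ ∑-cong R (λ a → trans (∑-cong R (λ b → ∑-swap R R _)) (∑-swap R R _)) ⟩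
  ∑ R (λ a → ∑ R (λ d → ∑ R (λ b → ∑ R (λ c → H d b c a))))
    ≡⟨ ∑-swap R R _ ⟩
  ∑ R (λ d → ∑ R (λ a → ∑ R (λ b → ∑ R (λ c → H d b c a))))
    ≡⟨ ∑-cong R (λ d → trans (∑-swap R R _) (∑-cong R (λ b → ∑-swap R R _))) ⟩
  ∑ R (λ d → ∑ R (λ b → ∑ R (λ c → ∑ R (λ a → H d b c a))))
    ≡⟨ sym (trans (∑-Ball ρ F) (nest (λ r s → ind (one? (rows r s)) * F (rows r s)))) ⟩
  ∑ (Ball ρ) F ∎
  where
  open ≡-Reasoning
  R = rng ρ
  H : ℤ → ℤ → ℤ → ℤ → ℤ
  H a b c d = ind (one? (mat a b c d)) * F (mat a b c d)
  nest : ∀ (G : V → V → ℤ) → ∑ (rng² ρ) (λ r → ∑ (rng² ρ) (G r)) ≡ ∑ R (λ a → ∑ R (λ b → ∑ R (λ c → ∑ R (λ d → G (a , b) (c , d)))))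
  nest G = trans (∑-cartesian R R _) (∑-cong R (λ a → ∑-cong R (λ b → ∑-cartesian R R _)))
  flip : ∀ a b c d → ind (one? (mat a b c d)) ≡ ind (one? (mat d (- b) (- c) a))
  flip a b c d = ind-⇔ (one? (mat a b c d)) (one? (mat d (- b) (- c) a)) (trans (det-adj (mat a b c d))) (trans (sym (det-adj (mat a b c d))))

-- Words hitting a given matrix

nrm : V → ℕ
nrm (x , y) = abs x ℕ.+ abs y

dot : V → V → ℤ
dot (a , b) (x , y) = a * x + b * y

cross : V → V → ℤ
cross (a , b) (c , d) = a * d - b * c

_⊟_ : V → V → V
(x , y) ⊟ (z , w) = (x - z , y - w)

abs-lin≤ : ∀ a b c d → abs (a * b - c * d) ℕ.≤ abs a ℕ.* abs b ℕ.+ abs c ℕ.* abs d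
abs-lin≤ a b c d = ℕₚ.≤-trans (ℤₚ.∣i-j∣≤∣i∣+∣j∣ (a * b) (c * d)) (ℕₚ.≤-reflexive (cong₂ ℕ._+_ (ℤₚ.abs-* a b) (ℤₚ.abs-* c d)))

-- The Cramer identity cross r s · v = (s × (r·v)) − (r × (s·v)), with norms taken.
cramer-≤ : ∀ r s v → abs (cross r s) ℕ.* nrm v ℕ.≤ nrm s ℕ.* abs (dot r v) ℕ.+ nrm r ℕ.* abs (dot s v)
cramer-≤ r@(x , y) s@(z , w) v@(p , q) = begin
  abs j ℕ.* (abs p ℕ.+ abs q)
    ≡⟨ trans (ℕₚ.*-distribˡ-+ (abs j) (abs p) (abs q)) (sym (cong₂ ℕ._+_ (ℤₚ.abs-* j p) (ℤₚ.abs-* j q))) ⟩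
  abs (j * p) ℕ.+ abs (j * q)
    ≡⟨ cong₂ (λ a b → abs a ℕ.+ abs b) (e₁ x y z w p q) (e₂ x y z w p q) ⟩
  abs (w * dr - y * ds) ℕ.+ abs (x * ds - z * dr)
    ≤⟨ ℕₚ.+-mono-≤ (abs-lin≤ w dr y ds) (abs-lin≤ x ds z dr) ⟩
  (abs w ℕ.* abs dr ℕ.+ abs y ℕ.* abs ds) ℕ.+ (abs x ℕ.* abs ds ℕ.+ abs z ℕ.* abs dr)
    ≡⟨ e₃ (abs w) (abs dr) (abs y) (abs ds) (abs x) (abs z) ⟩
  nrm s ℕ.* abs dr ℕ.+ nrm r ℕ.* abs ds ∎
  where
  open ℕₚ.≤-Reasoning
  j = cross r s
  dr = dot r v
  ds = dot s v
  e₁ : ∀ x y z w p q → (x * w - y * z) * p ≡ w * (x * p + y * q) - y * (z * p + w * q)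
  e₁ = solve-∀
  e₂ : ∀ x y z w p q → (x * w - y * z) * q ≡ x * (z * p + w * q) - z * (x * p + y * q)
  e₂ = solve-∀
  e₃ : ∀ w d y s x z → (w ℕ.* d ℕ.+ y ℕ.* s) ℕ.+ (x ℕ.* s ℕ.+ z ℕ.* d) ≡ (z ℕ.+ w) ℕ.* d ℕ.+ (x ℕ.+ y) ℕ.* s
  e₃ = solveℕ-∀

-- The quotient F / G is minimised, with quotients compared by cross-multiplication.
argmin : {A : Set} (F G : A → ℕ) (x : A) (xs : List A) → (∀ y → y ∈ x ∷ xs → 0 ℕ.< G y) →
         Σ A λ z → z ∈ x ∷ xs × (∀ y → y ∈ x ∷ xs → F z ℕ.* G y ℕ.≤ F y ℕ.* G z)
argmin F G x [] pos = x , here refl , λ { y (here refl) → ℕₚ.≤-refl }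
argmin {A} F G x (y ∷ ys) pos with argmin F G y ys (λ z m → pos z (there m))
... | (z , z∈ , min) with ℕₚ.≤-total (F x ℕ.* G z) (F z ℕ.* G x)
...   | inj₂ le = z , there z∈ , λ { w (here refl) → le ; w (there m) → min w m }
...   | inj₁ le = x , here refl , λ { w (here refl) → ℕₚ.≤-refl ; w (there m) → tr w m }
  where
  tr : ∀ w → w ∈ y ∷ ys → F x ℕ.* G w ℕ.≤ F w ℕ.* G x
  tr w m = ℕₚ.*-cancelʳ-≤ (F x ℕ.* G w) (F w ℕ.* G x) (G z) {{ℕ.>-nonZero (pos z (there z∈))}} (begin
    F x ℕ.* G w ℕ.* G z  ≡⟨ l (F x) (G w) (G z) ⟩
    F x ℕ.* G z ℕ.* G w  ≤⟨ ℕₚ.*-monoˡ-≤ (G w) le ⟩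
    F z ℕ.* G x ℕ.* G w  ≡⟨ l (F z) (G x) (G w) ⟩
    F z ℕ.* G w ℕ.* G x  ≤⟨ ℕₚ.*-monoˡ-≤ (G x) (min w m) ⟩
    F w ℕ.* G z ℕ.* G x  ≡⟨ l (F w) (G z) (G x) ⟩
    F w ℕ.* G x ℕ.* G z ∎)
    where
    open ℕₚ.≤-Reasoning
    l : ∀ a b c → a ℕ.* b ℕ.* c ≡ a ℕ.* c ℕ.* b
    l = solveℕ-∀

argmin∈ : {A : Set} (F G : A → ℕ) (xs : List A) → ∀ {x} → x ∈ xs → (∀ y → y ∈ xs → 0 ℕ.< G y) →
          Σ A λ z → z ∈ xs × (∀ y → y ∈ xs → F z ℕ.* G y ℕ.≤ F y ℕ.* G z)
argmin∈ F G (x ∷ xs) _ pos = argmin F G x xs pos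

-- The value E at n = 0 is deliberate: a quantity x with n x ≤ E is bounded by E / n when n is
-- positive, and where n vanishes the sums below still have the bound x ≤ E from another source.
hdiv : ℕ → ℕ → ℕ
hdiv E zero    = E
hdiv E (suc n) = E / suc n

hdiv-intro : ∀ E n x → n ℕ.* x ℕ.≤ E → (n ≡ 0 → x ℕ.≤ E) → x ℕ.≤ hdiv E n
hdiv-intro E zero    x p z = z refl
hdiv-intro E (suc n) x p z = ℕₚ.≤-trans (ℕₚ.≤-reflexive (sym (m*n/n≡m x (suc n))))
  (/-monoˡ-≤ (suc n) (ℕₚ.≤-trans (ℕₚ.≤-reflexive (ℕₚ.*-comm x (suc n))) p))

hdiv-elim : ∀ E n → n ℕ.* hdiv E n ℕ.≤ E
hdiv-elim E zero    = ℕ.z≤n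
hdiv-elim E (suc n) = ℕₚ.≤-trans (ℕₚ.≤-reflexive (ℕₚ.*-comm (suc n) (E / suc n))) (m/n*n≤m E (suc n))

hdiv-mono : ∀ {E E′} n → E ℕ.≤ E′ → hdiv E n ℕ.≤ hdiv E′ n
hdiv-mono zero    p = p
hdiv-mono (suc n) p = /-mono-≤ p ℕₚ.≤-refl

hdiv-* : ∀ E n c → hdiv E n ℕ.* c ℕ.≤ hdiv (E ℕ.* c) n
hdiv-* E n c = hdiv-intro (E ℕ.* c) n (hdiv E n ℕ.* c)
  (ℕₚ.≤-trans (ℕₚ.≤-reflexive (sym (ℕₚ.*-assoc n (hdiv E n) c))) (ℕₚ.*-monoˡ-≤ c (hdiv-elim E n)))
  (λ { refl → ℕₚ.≤-refl })

-- Doubling the range from m = 2^L adds m terms of size at most E / m, hence another E. The initial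
-- E is the term at 0.
harmonic : ∀ E L → ∑ⁿ (applyUpTo id (2 ℕ.^ L)) (hdiv E) ℕ.≤ suc L ℕ.* E
harmonic E zero    = ℕₚ.≤-refl
harmonic E (suc L) = begin
  ∑ⁿ (applyUpTo id (m ℕ.+ (m ℕ.+ 0))) (hdiv E)
    ≡⟨ cong (λ k → ∑ⁿ (applyUpTo id (m ℕ.+ k)) (hdiv E)) (ℕₚ.+-identityʳ m) ⟩
  ∑ⁿ (applyUpTo id (m ℕ.+ m)) (hdiv E)
    ≡⟨ ∑ⁿ-upTo-split id m m (hdiv E) ⟩
  ∑ⁿ (applyUpTo id m) (hdiv E) ℕ.+ ∑ⁿ (applyUpTo (m ℕ.+_) m) (hdiv E)
    ≤⟨ ℕₚ.+-mono-≤ (harmonic E L) (ℕₚ.≤-trans (∑ⁿ-mono∈ (applyUpTo (m ℕ.+_) m) {g = λ _ → hdiv E m} small)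
         (ℕₚ.≤-reflexive (trans (∑ⁿ-const (applyUpTo (m ℕ.+_) m) (hdiv E m)) (cong (ℕ._* hdiv E m) (length-applyUpTo (m ℕ.+_) m))))) ⟩
  suc L ℕ.* E ℕ.+ m ℕ.* hdiv E m
    ≤⟨ ℕₚ.+-monoʳ-≤ (suc L ℕ.* E) (hdiv-elim E m) ⟩
  suc L ℕ.* E ℕ.+ E ≡⟨ ℕₚ.+-comm (suc L ℕ.* E) E ⟩
  suc (suc L) ℕ.* E ∎
  where
  open ℕₚ.≤-Reasoning
  m = 2 ℕ.^ L
  hm : ∀ k n → 0 ℕ.< k → hdiv E (k ℕ.+ n) ℕ.≤ hdiv E k
  hm (suc k) n _ = /-mono-≤ (ℕₚ.≤-refl {E}) (ℕₚ.m≤m+n (suc k) n)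
  small : ∀ x → x ∈ applyUpTo (m ℕ.+_) m → hdiv E x ℕ.≤ hdiv E m
  small x x∈ with ∈-applyUpTo⁻ (m ℕ.+_) x∈
  ... | (i , _ , refl) = hm m i (ℕₚ.m^n>0 2 L)

∑-rng-abs : ∀ J (F : ℕ → ℕ) → ∑ⁿ (rng J) (λ j → F (abs j)) ≡ 2 ℕ.* ∑ⁿ (applyUpTo id (suc J)) F
∑-rng-abs J F = trans (∑ⁿ-rng J (λ j → F (abs j)))
  (trans (cong (X ℕ.+_) (∑ⁿ-cong (applyUpTo id (suc J)) (λ i → cong F (ℤₚ.∣-i∣≡∣i∣ (+ i))))) (cong (X ℕ.+_) (sym (ℕₚ.+-identityʳ X))))
  where X = ∑ⁿ (applyUpTo id (suc J)) F

nrm-⊟ : ∀ u v → nrm (u ⊟ v) ℕ.≤ nrm u ℕ.+ nrm v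
nrm-⊟ (x , y) (z , w) = ℕₚ.≤-trans (ℕₚ.+-mono-≤ (ℤₚ.∣i-j∣≤∣i∣+∣j∣ x z) (ℤₚ.∣i-j∣≤∣i∣+∣j∣ y w))
  (ℕₚ.≤-reflexive (l (abs x) (abs z) (abs y) (abs w)))
  where
  l : ∀ a b c d → (a ℕ.+ b) ℕ.+ (c ℕ.+ d) ≡ (a ℕ.+ c) ℕ.+ (b ℕ.+ d)
  l = solveℕ-∀

nrm-⊛ : ∀ t v → nrm (t ⊛ v) ≡ abs t ℕ.* nrm v
nrm-⊛ t (x , y) = trans (cong₂ ℕ._+_ (ℤₚ.abs-* t x) (ℤₚ.abs-* t y)) (sym (ℕₚ.*-distribˡ-+ (abs t) (abs x) (abs y)))

-- As (e , f) is a basis, a difference having zero cross product with e is a multiple of e, and the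
-- multiplier is its cross product with f.
line-point : ∀ e f u u′ → cross e f ≡ 1ℤ → cross e u′ ≡ cross e u → u′ ≡ u ⊞ cross (u′ ⊟ u) f ⊛ e
line-point (a , b) (c , d) (x , y) (x′ , y′) ef eu = cong₂ _,_
  (trans (l₁ a b c d x y x′ y′) (fin (x + τ * a) c (x′ - x)))
  (trans (l₂ a b c d x y x′ y′) (fin (y + τ * b) d (y′ - y)))
  where
  Δ = (a * y′ - b * x′) - (a * y - b * x)
  τ = (x′ - x) * d - (y′ - y) * c
  l₁ : ∀ a b c d x y x′ y′ → x′ ≡ (x + ((x′ - x) * d - (y′ - y) * c) * a)
       + (((a * y′ - b * x′) - (a * y - b * x)) * c + (1ℤ - (a * d - b * c)) * (x′ - x))
  l₁ = solve-∀
  l₂ : ∀ a b c d x y x′ y′ → y′ ≡ (y + ((x′ - x) * d - (y′ - y) * c) * b)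
       + (((a * y′ - b * x′) - (a * y - b * x)) * d + (1ℤ - (a * d - b * c)) * (y′ - y))
  l₂ = solve-∀
  zz : ∀ u c z → u + (0ℤ * c + (1ℤ - 1ℤ) * z) ≡ u
  zz = solve-∀
  e₀ = a * d - b * c
  fin : ∀ u c z → u + (Δ * c + (1ℤ - e₀) * z) ≡ u
  fin u c z = trans (cong₂ (λ s t → u + (s * c + (1ℤ - t) * z)) (ℤₚ.i≡j⇒i-j≡0 eu) ef) (zz u c z)

diff-small : ∀ {B} u u′ t e → u′ ≡ u ⊞ t ⊛ e → nrm u′ ℕ.+ nrm u ℕ.≤ B → nrm e ℕ.* abs t ℕ.≤ B
diff-small u u′ t e refl le = ℕₚ.≤-trans (ℕₚ.≤-reflexive (trans (ℕₚ.*-comm (nrm e) (abs t)) (trans (sym (nrm-⊛ t e)) (cong nrm (sym (l u t e))))))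
  (ℕₚ.≤-trans (nrm-⊟ (u ⊞ t ⊛ e) u) le)
  where
  l : ∀ u t e → (u ⊞ t ⊛ e) ⊟ u ≡ t ⊛ e
  l (x , y) t (a , b) = cong₂ _,_ (l′ x (t * a)) (l′ y (t * b))
    where
    l′ : ∀ x y → (x + y) - x ≡ y
    l′ = solve-∀

small-coef : ∀ e t → 0 ℕ.< nrm e → nrm e ℕ.* abs t ℕ.≤ nrm e ℕ.+ nrm e → abs t ℕ.≤ 2
small-coef e t pos le = ℕₚ.*-cancelˡ-≤ (nrm e) {{ℕ.>-nonZero pos}} (ℕₚ.≤-trans le (ℕₚ.≤-reflexive (l (nrm e))))
  where
  l : ∀ n → n ℕ.+ n ≡ n ℕ.* 2
  l = solveℕ-∀

-- The aim is that the sum of |v| / |g v| over the ball is at most κ, which is ρ up to a logarithm.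
-- Let r₀ be the row with the smallest |r · v| / |r|. Cramer's identity then bounds |s · v| from
-- below by |r₀ × s| |v| / (2 |r₀|) for every row s, so the sum becomes a harmonic sum over the
-- values of r₀ × s. J bounds these values, and J + 1 is a power of 2 to suit `harmonic`.
module Star (ρ : ℕ) (1≤ρ : 1 ℕ.≤ ρ) (L J : ℕ) (J≡ : suc J ≡ 2 ℕ.^ L) (2ρ²≤J : 2 ℕ.* (ρ ℕ.* ρ) ℕ.≤ J) where
  open ℕₚ.≤-Reasoning

  R : List V
  R = rng² ρ

  I∈ : I ∈ Ball ρ
  I∈ = ∈-Ball⁺ (1ℤ , 0ℤ) (0ℤ , 1ℤ) (∈-rng²⁺ (1ℤ , 0ℤ) 1≤ρ ℕ.z≤n) (∈-rng²⁺ (0ℤ , 1ℤ) ℕ.z≤n 1≤ρ) refl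

  Row : V → Set
  Row r = (Σ V λ z → cross r z ≡ 1ℤ) × (nrm r ℕ.≤ 2 ℕ.* ρ)

  nrm≤ : ∀ {r} → r ∈ R → nrm r ℕ.≤ 2 ℕ.* ρ
  nrm≤ {r} m = let (p , q) = ∈-rng²⁻ r m in ℕₚ.≤-trans (ℕₚ.+-mono-≤ p q) (ℕₚ.≤-reflexive (cong (ρ ℕ.+_) (sym (ℕₚ.+-identityʳ ρ))))

  nrm-pos : ∀ r z → cross r z ≡ 1ℤ → 0 ℕ.< nrm r
  nrm-pos (+ zero , + zero) (z , w) e = ⊥-elim (case trans (sym e) (l z w) of λ ())
    where
    l : ∀ z w → 0ℤ * w - 0ℤ * z ≡ 0ℤ
    l = solve-∀
  nrm-pos (+ suc _ , _) z e = ℕ.s≤s ℕ.z≤n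
  nrm-pos (-[1+ _ ] , _) z e = ℕ.s≤s ℕ.z≤n
  nrm-pos (+ zero , + suc _) z e = ℕ.s≤s ℕ.z≤n
  nrm-pos (+ zero , -[1+ _ ]) z e = ℕ.s≤s ℕ.z≤n

  row₁-Row : ∀ {r s} → r ∈ R → cross r s ≡ 1ℤ → Row r
  row₁-Row {r} {s} m e = (s , e) , nrm≤ m

  row₂-Row : ∀ {r s} → s ∈ R → cross r s ≡ 1ℤ → Row s
  row₂-Row {a , b} {c , d} m e = ((- a , - b) , trans (l a b c d) e) , nrm≤ m
    where
    l : ∀ a b c d → c * (- b) - d * (- a) ≡ a * d - b * c
    l = solve-∀

  rowList : List V
  rowList = map row₁ (Ball ρ) ++ map row₂ (Ball ρ)

  ∈-rowList⁻ : ∀ {r} → r ∈ rowList → Σ V λ u → Σ V λ w → u ∈ R × w ∈ R × cross u w ≡ 1ℤ × (r ≡ u ⊎ r ≡ w)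
  ∈-rowList⁻ {r} m = [ first ∘ ∈-map⁻ row₁ , second ∘ ∈-map⁻ row₂ ]′ (∈-++⁻ (map row₁ (Ball ρ)) m)
    where
    first : (Σ Mat λ g → g ∈ Ball ρ × r ≡ row₁ g) → Σ V λ u → Σ V λ w → u ∈ R × w ∈ R × cross u w ≡ 1ℤ × (r ≡ u ⊎ r ≡ w)
    first (g , g∈ , er) = let (u , w , u∈ , w∈ , eg , e) = ∈-Ball⁻ g∈ in u , w , u∈ , w∈ , trans (sym (cong det eg)) e , inj₁ (trans er (cong row₁ eg))
    second : (Σ Mat λ g → g ∈ Ball ρ × r ≡ row₂ g) → Σ V λ u → Σ V λ w → u ∈ R × w ∈ R × cross u w ≡ 1ℤ × (r ≡ u ⊎ r ≡ w)
    second (g , g∈ , er) = let (u , w , u∈ , w∈ , eg , e) = ∈-Ball⁻ g∈ in u , w , u∈ , w∈ , trans (sym (cong det eg)) e , inj₂ (trans er (cong row₂ eg))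

  rowList-Row : ∀ r → r ∈ rowList → Row r
  rowList-Row r m = let (u , w , u∈ , w∈ , e , c) = ∈-rowList⁻ m in
    [ (λ er → subst Row (sym er) (row₁-Row {u} {w} u∈ e)) , (λ er → subst Row (sym er) (row₂-Row {u} {w} w∈ e)) ]′ c

  nrm-rowList : ∀ r → r ∈ rowList → 0 ℕ.< nrm r
  nrm-rowList r m = let ((z , e) , _) = rowList-Row r m in nrm-pos r z e

  best : (v : V) → Σ V λ r₀ → r₀ ∈ rowList × (∀ s → s ∈ rowList → abs (dot r₀ v) ℕ.* nrm s ℕ.≤ abs (dot s v) ℕ.* nrm r₀)
  best v = argmin∈ (λ r → abs (dot r v)) nrm rowList (∈-++⁺ˡ {ys = map row₂ (Ball ρ)} (∈-map⁺ row₁ I∈)) nrm-rowList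

  -- The points counted lie on a line with spacing r₀ and have norm at most 2ρ, so the multipliers
  -- are at most T = 4ρ / |r₀|. `rng T` has 2 (T + 1) entries and each point multiplicity 4; 8 (4ρ +
  -- 2ρ) gives 48ρ.
  line-count : ∀ r₀ → Row r₀ → ∀ j → ∑ⁿ R (λ s → indⁿ (cross r₀ s ℤₚ.≟ j)) ℕ.* nrm r₀ ℕ.≤ 48 ℕ.* ρ
  line-count r₀ ((z₀ , e₀) , r₀≤) j = begin
    ∑ⁿ R (λ s → indⁿ (cross r₀ s ℤₚ.≟ j)) ℕ.* n
      ≤⟨ ℕₚ.*-monoˡ-≤ n (cover-by-one (λ s → cross r₀ s ℤₚ.≟ j) _≟V_ R (rng T) (λ u t → u ⊞ t ⊛ r₀) 4 (mult-rng² ρ) cov) ⟩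
    length (rng T) ℕ.* 4 ℕ.* n
      ≡⟨ trans (cong (λ k → k ℕ.* 4 ℕ.* n) (length-rng T)) (l₁ T n) ⟩
    8 ℕ.* (n ℕ.* T ℕ.+ n)
      ≤⟨ ℕₚ.*-monoʳ-≤ 8 (ℕₚ.+-mono-≤ (hdiv-elim (4 ℕ.* ρ) n) r₀≤) ⟩
    8 ℕ.* (4 ℕ.* ρ ℕ.+ 2 ℕ.* ρ) ≡⟨ l₂ ρ ⟩
    48 ℕ.* ρ ∎
    where
    n = nrm r₀
    T = hdiv (4 ℕ.* ρ) n
    l₁ : ∀ T n → 2 ℕ.* suc T ℕ.* 4 ℕ.* n ≡ 8 ℕ.* (n ℕ.* T ℕ.+ n)
    l₁ = solveℕ-∀
    l₂ : ∀ ρ → 8 ℕ.* (4 ℕ.* ρ ℕ.+ 2 ℕ.* ρ) ≡ 48 ℕ.* ρ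
    l₂ = solveℕ-∀
    l₃ : ∀ ρ → 2 ℕ.* ρ ℕ.+ 2 ℕ.* ρ ≡ 4 ℕ.* ρ
    l₃ = solveℕ-∀
    cov : ∀ u u′ → u ∈ R → u′ ∈ R → cross r₀ u ≡ j → cross r₀ u′ ≡ j → Σ ℤ λ t → t ∈ rng T × u′ ≡ u ⊞ t ⊛ r₀
    cov u u′ u∈ u′∈ eu eu′ = t , ∈-rng⁺ t (hdiv-intro (4 ℕ.* ρ) n (abs t) small (λ n0 → ⊥-elim (ℕₚ.<-irrefl (sym n0) (nrm-pos r₀ z₀ e₀)))) , pt
      where
      t = cross (u′ ⊟ u) z₀
      pt = line-point r₀ z₀ u u′ e₀ (trans eu′ (sym eu))
      small : n ℕ.* abs t ℕ.≤ 4 ℕ.* ρ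
      small = diff-small u u′ t r₀ pt (ℕₚ.≤-trans (ℕₚ.+-mono-≤ (nrm≤ u′∈) (nrm≤ u∈)) (ℕₚ.≤-reflexive (l₃ ρ)))

  -- Two such rows differ by a multiple t of s, and as both are no longer than s, |t| ≤ 2. The 6
  -- entries of `rng 2` times the multiplicity 4 give 24.
  row-count : ∀ s → ∑ⁿ R (λ r → indⁿ (one? (rows r s) ×-dec (nrm r ℕₚ.≤? nrm s))) ℕ.≤ 24
  row-count s = ℕₚ.≤-trans (cover-by-one _ _≟V_ R (rng 2) (λ u t → u ⊞ t ⊛ s) 4 (mult-rng² ρ) cov)
                  (ℕₚ.≤-reflexive (cong (ℕ._* 4) (length-rng 2)))
    where
    neg : V → V
    neg (x , y) = (- x , - y)
    cov : ∀ u u′ → u ∈ R → u′ ∈ R → cross u s ≡ 1ℤ × nrm u ℕ.≤ nrm s → cross u′ s ≡ 1ℤ × nrm u′ ℕ.≤ nrm s →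
          Σ ℤ λ t → t ∈ rng 2 × u′ ≡ u ⊞ t ⊛ s
    cov u u′ u∈ u′∈ (eu , nu) (eu′ , nu′) = t , ∈-rng⁺ t (small-coef s t (nrm-pos s (neg u) su) (diff-small u u′ t s pt (ℕₚ.+-mono-≤ nu′ nu))) , pt
      where
      su : cross s (neg u) ≡ 1ℤ
      su = trans (l s u) eu
        where
        l : ∀ s u → cross s (neg u) ≡ cross u s
        l (a , b) (c , d) = l′ a b c d
          where
          l′ : ∀ a b c d → a * (- d) - b * (- c) ≡ c * b - d * a
          l′ = solve-∀
      flip : ∀ u → cross s u ≡ - cross u s
      flip (c , d) = l (proj₁ s) (proj₂ s) c d
        where
        l : ∀ a b c d → a * d - b * c ≡ - (c * b - d * a)
        l = solve-∀
      t = cross (u′ ⊟ u) (neg u)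
      pt : u′ ≡ u ⊞ t ⊛ s
      pt = line-point s (neg u) u u′ su (trans (flip u′) (trans (cong -_ (trans eu′ (sym eu))) (sym (flip u))))

  row-count′ : ∀ r → ∑ⁿ R (λ s → indⁿ (one? (rows r s) ×-dec (nrm s ℕₚ.≤? nrm r))) ℕ.≤ 24
  row-count′ r = ℕₚ.≤-trans (cover-by-one _ _≟V_ R (rng 2) (λ u t → u ⊞ t ⊛ r) 4 (mult-rng² ρ) cov)
                  (ℕₚ.≤-reflexive (cong (ℕ._* 4) (length-rng 2)))
    where
    cov : ∀ u u′ → u ∈ R → u′ ∈ R → cross r u ≡ 1ℤ × nrm u ℕ.≤ nrm r → cross r u′ ≡ 1ℤ × nrm u′ ℕ.≤ nrm r →
          Σ ℤ λ t → t ∈ rng 2 × u′ ≡ u ⊞ t ⊛ r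
    cov u u′ u∈ u′∈ (eu , nu) (eu′ , nu′) = t , ∈-rng⁺ t (small-coef r t (nrm-pos r u eu) (diff-small u u′ t r pt (ℕₚ.+-mono-≤ nu′ nu))) , pt
      where
      t = cross (u′ ⊟ u) u
      pt = line-point r u u u′ eu (trans eu′ (sym eu))

  -- 9216 = 2 · 24 · 2 · 96: either row may be the longer one, the other has 24 choices, the cross
  -- product has two signs, and 96 = 2 · 48 comes from `row-bound` and `line-count`.
  κ : ℕ
  κ = 9216 ℕ.* (ρ ℕ.* suc L)

  module _ (K : ℕ) (W : Mat → ℕ) (v : V) (hyp : ∀ g → g ∈ Ball ρ → W g ℕ.* nrm (g ▹ v) ℕ.≤ K) where
    r₀ : V
    r₀ = proj₁ (best v)

    r₀-Row : Row r₀
    r₀-Row = rowList-Row r₀ (proj₁ (proj₂ (best v)))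

    r₀-min : ∀ s → s ∈ rowList → abs (dot r₀ v) ℕ.* nrm s ℕ.≤ abs (dot s v) ℕ.* nrm r₀
    r₀-min = proj₂ (proj₂ (best v))

    M : ℕ
    M = 2 ℕ.* nrm r₀ ℕ.* K

    m : ℕ
    m = nrm v

    μ : V → ℕ
    μ s = hdiv M (abs (cross r₀ s))

    -- In Cramer's identity for r₀ and s, minimality of r₀ replaces |s| |r₀ · v| by |r₀| |s · v|, so
    -- both terms have the same bound. Then |s · v| ≤ |g v| and the hypothesis on W apply.
    row-bound : ∀ g s → s ∈ rowList → abs (dot s v) ℕ.≤ nrm (g ▹ v) → g ∈ Ball ρ → abs (cross r₀ s) ℕ.* (m ℕ.* W g) ℕ.≤ M
    row-bound g s s∈ le g∈ = begin
      abs (cross r₀ s) ℕ.* (m ℕ.* W g)   ≡⟨ sym (ℕₚ.*-assoc (abs (cross r₀ s)) m (W g)) ⟩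
      abs (cross r₀ s) ℕ.* m ℕ.* W g     ≤⟨ ℕₚ.*-monoˡ-≤ (W g) (cramer-≤ r₀ s v) ⟩
      (nrm s ℕ.* abs (dot r₀ v) ℕ.+ nrm r₀ ℕ.* abs (dot s v)) ℕ.* W g
        ≤⟨ ℕₚ.*-monoˡ-≤ (W g) (ℕₚ.+-monoˡ-≤ _ (ℕₚ.≤-trans (ℕₚ.≤-reflexive (ℕₚ.*-comm (nrm s) _)) (r₀-min s s∈))) ⟩
      (abs (dot s v) ℕ.* nrm r₀ ℕ.+ nrm r₀ ℕ.* abs (dot s v)) ℕ.* W g
        ≡⟨ l (abs (dot s v)) (nrm r₀) (W g) ⟩
      2 ℕ.* nrm r₀ ℕ.* (W g ℕ.* abs (dot s v))
        ≤⟨ ℕₚ.*-monoʳ-≤ (2 ℕ.* nrm r₀) (ℕₚ.≤-trans (ℕₚ.*-monoʳ-≤ (W g) le) (hyp g g∈)) ⟩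
      M ∎
      where
      l : ∀ a b c → (a ℕ.* b ℕ.+ b ℕ.* a) ℕ.* c ≡ 2 ℕ.* b ℕ.* (c ℕ.* a)
      l = solveℕ-∀

    -- The two rows of g form a basis, so r₀ cannot have vanishing cross product with both.
    independent : ∀ r s → cross r s ≡ 1ℤ → cross r₀ r ≡ 0ℤ → cross r₀ s ≡ 0ℤ → ⊥
    independent r@(a , b) s@(c , d) e er es = ℕₚ.<-irrefl refl (subst (λ u → 0 ℕ.< nrm u) zero₀ (nrm-pos r₀ (proj₁ (proj₁ r₀-Row)) (proj₂ (proj₁ r₀-Row))))
      where
      x = proj₁ r₀
      y = proj₂ r₀
      l₁ : ∀ a b c d x y → (a * d - b * c) * x ≡ (x * d - y * c) * a - (x * b - y * a) * c
      l₁ = solve-∀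
      l₂ : ∀ a b c d x y → (a * d - b * c) * y ≡ (x * d - y * c) * b - (x * b - y * a) * d
      l₂ = solve-∀
      z : ∀ a c → 0ℤ * a - 0ℤ * c ≡ 0ℤ
      z = solve-∀
      zero₀ : r₀ ≡ (0ℤ , 0ℤ)
      zero₀ = cong₂ _,_
        (trans (sym (ℤₚ.*-identityˡ x)) (trans (*-congʳ x (sym e)) (trans (l₁ a b c d x y) (trans (cong₂ (λ p q → p * a - q * c) es er) (z a c)))))
        (trans (sym (ℤₚ.*-identityˡ y)) (trans (*-congʳ y (sym e)) (trans (l₂ a b c d x y) (trans (cong₂ (λ p q → p * b - q * d) es er) (z b d)))))

    -- If r₀ has zero cross product with one row, it has a nonzero one with the other, and
    -- `row-bound` for that row already gives the bound M, which is the value of `hdiv` at 0.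
    μ-bound : ∀ r s → r ∈ R → s ∈ R → cross r s ≡ 1ℤ → m ℕ.* W (rows r s) ℕ.≤ μ s × m ℕ.* W (rows r s) ℕ.≤ μ r
    μ-bound r s r∈ s∈ e = hdiv-intro M (abs (cross r₀ s)) x bs (λ z → from-other (abs (cross r₀ r)) refl br (λ z′ → independent r s e (ℤₚ.∣i∣≡0⇒i≡0 z′) (ℤₚ.∣i∣≡0⇒i≡0 z))) ,
                          hdiv-intro M (abs (cross r₀ r)) x br (λ z → from-other (abs (cross r₀ s)) refl bs (λ z′ → independent r s e (ℤₚ.∣i∣≡0⇒i≡0 z) (ℤₚ.∣i∣≡0⇒i≡0 z′)))
      where
      g = rows r s
      x = m ℕ.* W g
      g∈ : g ∈ Ball ρ
      g∈ = ∈-Ball⁺ r s r∈ s∈ e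
      bs : abs (cross r₀ s) ℕ.* x ℕ.≤ M
      bs = row-bound g s (∈-++⁺ʳ (map row₁ (Ball ρ)) (∈-map⁺ row₂ g∈)) (ℕₚ.m≤n+m _ (abs (dot r v))) g∈
      br : abs (cross r₀ r) ℕ.* x ℕ.≤ M
      br = row-bound g r (∈-++⁺ˡ (∈-map⁺ row₁ g∈)) (ℕₚ.m≤m+n _ (abs (dot s v))) g∈
      from-other : ∀ n → n ≡ n → n ℕ.* x ℕ.≤ M → (n ≡ 0 → ⊥) → x ℕ.≤ M
      from-other zero    _ _ f = ⊥-elim (f refl)
      from-other (suc n) _ p _ = ℕₚ.≤-trans (ℕₚ.m≤m+n x (n ℕ.* x)) p

    E : ℕ
    E = 96 ℕ.* ρ ℕ.* K

    -- The rows s are sorted by j = r₀ × s. The factor |r₀| in M cancels the spacing in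
    -- `line-count`, so the bound no longer depends on r₀.
    μ-sum : ∑ⁿ R μ ℕ.≤ 2 ℕ.* (suc L ℕ.* E)
    μ-sum = begin
      ∑ⁿ R μ
        ≤⟨ ∑ⁿ-mono∈ R (λ s s∈ → ℕₚ.≤-trans (ℕₚ.≤-reflexive (sym (trans (cong (ℕ._* μ s) (indⁿ-yes (cross r₀ s ℤₚ.≟ cross r₀ s) refl)) (ℕₚ.*-identityˡ (μ s)))))
             (∑ⁿ-term≤ (λ j → indⁿ (cross r₀ s ℤₚ.≟ j) ℕ.* hdiv M (abs j)) (∈-rng⁺ (cross r₀ s) (cross≤ s s∈)))) ⟩
      ∑ⁿ R (λ s → ∑ⁿ (rng J) (λ j → indⁿ (cross r₀ s ℤₚ.≟ j) ℕ.* hdiv M (abs j)))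
        ≡⟨ trans (∑ⁿ-swap R (rng J) _) (∑ⁿ-cong (rng J) (λ j → ∑ⁿ-*ʳ R (hdiv M (abs j)) _)) ⟩
      ∑ⁿ (rng J) (λ j → ∑ⁿ R (λ s → indⁿ (cross r₀ s ℤₚ.≟ j)) ℕ.* hdiv M (abs j))
        ≤⟨ ∑ⁿ-mono (rng J) bnd ⟩
      ∑ⁿ (rng J) (λ j → hdiv E (abs j))
        ≡⟨ ∑-rng-abs J (hdiv E) ⟩
      2 ℕ.* ∑ⁿ (applyUpTo id (suc J)) (hdiv E)
        ≤⟨ ℕₚ.*-monoʳ-≤ 2 (ℕₚ.≤-trans (ℕₚ.≤-reflexive (cong (λ k → ∑ⁿ (applyUpTo id k) (hdiv E)) J≡)) (harmonic E L)) ⟩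
      2 ℕ.* (suc L ℕ.* E) ∎
      where
      ent : ∀ r → r ∈ rowList → abs (proj₁ r) ℕ.≤ ρ × abs (proj₂ r) ℕ.≤ ρ
      ent r m = let (u , w , u∈ , w∈ , _ , c) = ∈-rowList⁻ m in ∈-rng²⁻ r ([ (λ er → subst (_∈ R) (sym er) u∈) , (λ er → subst (_∈ R) (sym er) w∈) ]′ c)
      cross≤ : ∀ s → s ∈ R → abs (cross r₀ s) ℕ.≤ J
      cross≤ s s∈ = let (p , q) = ent r₀ (proj₁ (proj₂ (best v))); (p′ , q′) = ∈-rng²⁻ s s∈ in
        ℕₚ.≤-trans (abs-lin≤ (proj₁ r₀) (proj₂ s) (proj₂ r₀) (proj₁ s))
          (ℕₚ.≤-trans (ℕₚ.+-mono-≤ (ℕₚ.*-mono-≤ p q′) (ℕₚ.*-mono-≤ q p′))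
            (ℕₚ.≤-trans (ℕₚ.≤-reflexive (cong (ρ ℕ.* ρ ℕ.+_) (sym (ℕₚ.+-identityʳ _)))) 2ρ²≤J))
      bnd : ∀ j → ∑ⁿ R (λ s → indⁿ (cross r₀ s ℤₚ.≟ j)) ℕ.* hdiv M (abs j) ℕ.≤ hdiv E (abs j)
      bnd j = begin
        c ℕ.* hdiv M (abs j)    ≡⟨ ℕₚ.*-comm c _ ⟩
        hdiv M (abs j) ℕ.* c    ≤⟨ hdiv-* M (abs j) c ⟩
        hdiv (M ℕ.* c) (abs j)  ≤⟨ hdiv-mono (abs j) (ℕₚ.≤-trans (ℕₚ.≤-reflexive (l (nrm r₀) K c))
                                     (ℕₚ.≤-trans (ℕₚ.*-monoˡ-≤ (2 ℕ.* K) (line-count r₀ r₀-Row j)) (ℕₚ.≤-reflexive (l′ ρ K)))) ⟩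
        hdiv E (abs j) ∎
        where
        c = ∑ⁿ R (λ s → indⁿ (cross r₀ s ℤₚ.≟ j))
        l : ∀ n k c → 2 ℕ.* n ℕ.* k ℕ.* c ≡ c ℕ.* n ℕ.* (2 ℕ.* k)
        l = solveℕ-∀
        l′ : ∀ ρ k → 48 ℕ.* ρ ℕ.* (2 ℕ.* k) ≡ 96 ℕ.* ρ ℕ.* k
        l′ = solveℕ-∀

    -- W g plays the role of K / |g v|. Each matrix is charged to its longer row, since then
    -- `row-count` and `row-count′` leave few choices for the other one. In effect 1 / |v| is almost
    -- an eigenfunction of the ball average, with an eigenvalue of about the square root of the
    -- number of matrices.
    star : nrm v ℕ.* ∑ⁿ (Ball ρ) W ℕ.≤ κ ℕ.* K
    star = begin
      m ℕ.* ∑ⁿ (Ball ρ) W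
        ≡⟨ sym (∑ⁿ-*ˡ (Ball ρ) m W) ⟩
      ∑ⁿ (Ball ρ) (λ g → m ℕ.* W g)
        ≡⟨ ∑ⁿ-Ball ρ _ ⟩
      ∑ⁿ R (λ r → ∑ⁿ R (λ s → indⁿ (one? (rows r s)) ℕ.* (m ℕ.* W (rows r s))))
        ≤⟨ ∑ⁿ-mono∈ R (λ r r∈ → ∑ⁿ-mono∈ R (λ s s∈ → split r s r∈ s∈)) ⟩
      ∑ⁿ R (λ r → ∑ⁿ R (λ s → p r s ℕ.* μ s ℕ.+ p′ r s ℕ.* μ r))
        ≡⟨ trans (∑ⁿ-cong R (λ r → ∑ⁿ-+ R _ _)) (∑ⁿ-+ R _ _) ⟩
      ∑ⁿ R (λ r → ∑ⁿ R (λ s → p r s ℕ.* μ s)) ℕ.+ ∑ⁿ R (λ r → ∑ⁿ R (λ s → p′ r s ℕ.* μ r))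
        ≡⟨ cong₂ ℕ._+_ (trans (∑ⁿ-swap R R _) (∑ⁿ-cong R (λ s → ∑ⁿ-*ʳ R (μ s) _))) (∑ⁿ-cong R (λ r → ∑ⁿ-*ʳ R (μ r) _)) ⟩
      ∑ⁿ R (λ s → ∑ⁿ R (λ r → p r s) ℕ.* μ s) ℕ.+ ∑ⁿ R (λ r → ∑ⁿ R (p′ r) ℕ.* μ r)
        ≤⟨ ℕₚ.+-mono-≤ (∑ⁿ-mono R (λ s → ℕₚ.*-monoˡ-≤ (μ s) (row-count s))) (∑ⁿ-mono R (λ r → ℕₚ.*-monoˡ-≤ (μ r) (row-count′ r))) ⟩
      ∑ⁿ R (λ s → 24 ℕ.* μ s) ℕ.+ ∑ⁿ R (λ s → 24 ℕ.* μ s)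
        ≡⟨ cong (λ z → z ℕ.+ z) (∑ⁿ-*ˡ R 24 μ) ⟩
      24 ℕ.* ∑ⁿ R μ ℕ.+ 24 ℕ.* ∑ⁿ R μ
        ≤⟨ ℕₚ.+-mono-≤ (ℕₚ.*-monoʳ-≤ 24 μ-sum) (ℕₚ.*-monoʳ-≤ 24 μ-sum) ⟩
      24 ℕ.* (2 ℕ.* (suc L ℕ.* E)) ℕ.+ 24 ℕ.* (2 ℕ.* (suc L ℕ.* E))
        ≡⟨ l (suc L) ρ K ⟩
      κ ℕ.* K ∎
      where
      p p′ : V → V → ℕ
      p r s = indⁿ (one? (rows r s) ×-dec (nrm r ℕₚ.≤? nrm s))
      p′ r s = indⁿ (one? (rows r s) ×-dec (nrm s ℕₚ.≤? nrm r))
      l : ∀ L ρ K → 24 ℕ.* (2 ℕ.* (L ℕ.* (96 ℕ.* ρ ℕ.* K))) ℕ.+ 24 ℕ.* (2 ℕ.* (L ℕ.* (96 ℕ.* ρ ℕ.* K))) ≡ 9216 ℕ.* (ρ ℕ.* L) ℕ.* K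
      l = solveℕ-∀
      split : ∀ r s → r ∈ R → s ∈ R → indⁿ (one? (rows r s)) ℕ.* (m ℕ.* W (rows r s)) ℕ.≤ p r s ℕ.* μ s ℕ.+ p′ r s ℕ.* μ r
      split r s r∈ s∈ = cases (one? (rows r s)) (nrm r ℕₚ.≤? nrm s) (nrm s ℕₚ.≤? nrm r) (ℕₚ.≤-total (nrm r) (nrm s)) (μ-bound r s r∈ s∈)
        where
        cases : ∀ {P A B : Set} {x y z : ℕ} (d : Dec P) (a : Dec A) (b : Dec B) → A ⊎ B → (P → x ℕ.≤ y × x ℕ.≤ z) →
                indⁿ d ℕ.* x ℕ.≤ indⁿ (d ×-dec a) ℕ.* y ℕ.+ indⁿ (d ×-dec b) ℕ.* z
        cases (no _) a b t h = ℕ.z≤n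
        cases {y = y} (yes p) a b (inj₁ α) h = ℕₚ.≤-trans (ℕₚ.*-monoʳ-≤ 1 (proj₁ (h p)))
          (ℕₚ.≤-trans (ℕₚ.≤-reflexive (cong (ℕ._* y) (sym (indⁿ-yes (yes p ×-dec a) (p , α))))) (ℕₚ.m≤m+n _ _))
        cases {z = z} (yes p) a b (inj₂ β) h = ℕₚ.≤-trans (ℕₚ.*-monoʳ-≤ 1 (proj₂ (h p)))
          (ℕₚ.≤-trans (ℕₚ.≤-reflexive (cong (ℕ._* z) (sym (indⁿ-yes (yes p ×-dec b) (p , β))))) (ℕₚ.m≤n+m _ _))

-- Divisors

Complete : ℕ → List (ℕ × ℕ) → Set
Complete n fs = ∀ e f → e ℕ.* f ≡ n → (e , f) ∈ fs

-- The divisor bound, the number of divisors being O(n^(1/k)), without roots; the list may be longer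
-- than necessary.
FewFactors : ℕ → ℕ → ℕ → Set
FewFactors k C n = Σ (List (ℕ × ℕ)) λ fs → Complete n fs × length fs ℕ.^ k ℕ.≤ C ℕ.* n

*-^ : ∀ a b k → (a ℕ.* b) ℕ.^ k ≡ a ℕ.^ k ℕ.* b ℕ.^ k
*-^ a b zero    = refl
*-^ a b (suc k) = trans (cong (a ℕ.* b ℕ.*_) (*-^ a b k)) (l a b (a ℕ.^ k) (b ℕ.^ k))
  where
  l : ∀ a b c d → a ℕ.* b ℕ.* (c ℕ.* d) ≡ a ℕ.* c ℕ.* (b ℕ.* d)
  l = solveℕ-∀

n<2^n : ∀ n → n ℕ.< 2 ℕ.^ n
n<2^n zero    = ℕ.s≤s ℕ.z≤n
n<2^n (suc n) = ℕₚ.≤-trans (ℕ.s≤s (n<2^n n)) (ℕₚ.≤-trans (ℕₚ.+-monoˡ-≤ (2 ℕ.^ n) (ℕₚ.m^n>0 2 n)) (ℕₚ.≤-reflexive (cong (2 ℕ.^ n ℕ.+_) (sym (ℕₚ.+-identityʳ _)))))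

-- Writing a = qk + r gives a + 1 ≤ k(q + 1) ≤ k·2^q.
suc-^≤ : ∀ k .{{_ : ℕ.NonZero k}} a → suc a ℕ.^ k ℕ.≤ k ℕ.^ k ℕ.* 2 ℕ.^ a
suc-^≤ k a = begin
  suc a ℕ.^ k                ≤⟨ ℕₚ.^-monoˡ-≤ k (ℕₚ.≤-trans a≤ (ℕₚ.*-monoʳ-≤ k (n<2^n q))) ⟩
  (k ℕ.* 2 ℕ.^ q) ℕ.^ k      ≡⟨ trans (*-^ k (2 ℕ.^ q) k) (cong (k ℕ.^ k ℕ.*_) (ℕₚ.^-*-assoc 2 q k)) ⟩
  k ℕ.^ k ℕ.* 2 ℕ.^ (q ℕ.* k) ≤⟨ ℕₚ.*-monoʳ-≤ (k ℕ.^ k) (ℕₚ.^-monoʳ-≤ 2 (ℕₚ.≤-trans (ℕₚ.m≤n+m (q ℕ.* k) (a ℕ.% k)) (ℕₚ.≤-reflexive (sym (m≡m%n+[m/n]*n a k))))) ⟩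
  k ℕ.^ k ℕ.* 2 ℕ.^ a ∎
  where
  open ℕₚ.≤-Reasoning
  q = a ℕ./ k
  a≤ : suc a ℕ.≤ k ℕ.* suc q
  a≤ = ℕₚ.≤-trans (ℕₚ.≤-reflexive (cong suc (m≡m%n+[m/n]*n a k)))
         (ℕₚ.≤-trans (ℕₚ.+-monoˡ-≤ (q ℕ.* k) (m%n<n a k)) (ℕₚ.≤-reflexive (trans (cong (k ℕ.+_) (ℕₚ.*-comm q k)) (sym (ℕₚ.*-suc k q)))))

split-prime : ∀ {p} → Prime p → ∀ {m e f} → e ℕ.* f ≡ p ℕ.* m →
              (Σ ℕ λ e′ → e ≡ p ℕ.* e′ × e′ ℕ.* f ≡ m) ⊎ (Σ ℕ λ f′ → f ≡ p ℕ.* f′ × e ℕ.* f′ ≡ m)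
split-prime {p} pp {m} {e} {f} eq with euclidsLemma e f pp (ℕD.divides m (trans eq (ℕₚ.*-comm p m)))
... | inj₁ (ℕD.divides e′ refl) = inj₁ (e′ , ℕₚ.*-comm e′ p , ℕₚ.*-cancelˡ-≡ (e′ ℕ.* f) m p {{prime⇒nonZero pp}} (trans (l p e′ f) eq))
  where
  l : ∀ p e f → p ℕ.* (e ℕ.* f) ≡ e ℕ.* p ℕ.* f
  l = solveℕ-∀
... | inj₂ (ℕD.divides f′ refl) = inj₂ (f′ , ℕₚ.*-comm f′ p , ℕₚ.*-cancelˡ-≡ (e ℕ.* f′) m p {{prime⇒nonZero pp}} (trans (l p e f′) eq))
  where
  l : ∀ p e f → p ℕ.* (e ℕ.* f) ≡ e ℕ.* (f ℕ.* p)
  l = solveℕ-∀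

split-prime-power : ∀ {p} → Prime p → ∀ a {m e f} → e ℕ.* f ≡ p ℕ.^ a ℕ.* m →
  Σ ℕ λ s → s ℕ.≤ a × Σ (ℕ × ℕ) λ (e′ , f′) → e′ ℕ.* f′ ≡ m × e ≡ p ℕ.^ s ℕ.* e′ × f ≡ p ℕ.^ (a ℕ.∸ s) ℕ.* f′
split-prime-power pp zero {m} {e} {f} eq = 0 , ℕ.z≤n , (e , f) , trans eq (ℕₚ.*-identityˡ m) , sym (ℕₚ.*-identityˡ e) , sym (ℕₚ.*-identityˡ f)
split-prime-power {p} pp (suc a) {m} {e} {f} eq with split-prime pp {p ℕ.^ a ℕ.* m} {e} {f} (trans eq (ℕₚ.*-assoc p (p ℕ.^ a) m))
... | inj₁ (e₁ , refl , eq′) with split-prime-power pp a {m} {e₁} {f} eq′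
...   | (s , s≤ , (e′ , f′) , em , refl , fe) = suc s , ℕ.s≤s s≤ , (e′ , f′) , em , sym (ℕₚ.*-assoc p (p ℕ.^ s) e′) , fe
split-prime-power {p} pp (suc a) {m} {e} {f} eq | inj₂ (f₁ , refl , eq′) with split-prime-power pp a {m} {e} {f₁} eq′
... | (s , s≤ , (e′ , f′) , em , ee , refl) = s , ℕₚ.m≤n⇒m≤1+n s≤ , (e′ , f′) , em , ee ,
      trans (sym (ℕₚ.*-assoc p (p ℕ.^ (a ℕ.∸ s)) f′)) (cong (ℕ._* f′) (cong (p ℕ.^_) (sym (ℕₚ.+-∸-assoc 1 s≤))))

-- Each prime factor p at most doubles the number of factorisations, and its contribution 2^k is
-- paid for by p itself when p ≥ 2^k.
few-rough : ∀ k n → 0 ℕ.< n → (2 ℕ.^ k) Rough n → FewFactors k 1 n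
few-rough k = <-rec _ go
  where
  open ℕₚ.≤-Reasoning
  go : ∀ n → (∀ {m} → m ℕ.< n → 0 ℕ.< m → (2 ℕ.^ k) Rough m → FewFactors k 1 m) → 0 ℕ.< n → (2 ℕ.^ k) Rough n → FewFactors k 1 n
  go n rec pos rough with factorise n {{ℕ.>-nonZero pos}}
  ... | record { factors = [] ; isFactorisation = refl } =
    (1 , 1) ∷ [] , (λ e f eq → here (cong₂ _,_ (ℕₚ.m*n≡1⇒m≡1 e f eq) (ℕₚ.m*n≡1⇒n≡1 e f eq))) , ℕₚ.≤-reflexive (ℕₚ.^-zeroˡ k)
  ... | record { factors = p ∷ ps ; isFactorisation = refl ; factorsPrime = pp Allᴸ.∷ _ } =
    map (λ (e , f) → (p ℕ.* e , f)) fs ++ map (λ (e , f) → (e , p ℕ.* f)) fs , complete′ , bound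
    where
    m = product ps
    instance
      _ = prime⇒nonZero pp
      _ = prime⇒nonTrivial pp
    m>0 : 0 ℕ.< m
    m>0 = ℕₚ.n≢0⇒n>0 (λ z → ℕₚ.<-irrefl (sym (trans (cong (p ℕ.*_) z) (ℕₚ.*-zeroʳ p))) pos)
    sub : FewFactors k 1 m
    sub = rec (subst (m ℕ.<_) (ℕₚ.*-comm m p) (ℕₚ.m<m*n m p {{ℕ.>-nonZero m>0}} (ℕ.nonTrivial⇒n>1 p))) m>0 (rough∧∣⇒rough rough (ℕD.divides p refl))
    fs = proj₁ sub
    complete′ : Complete (p ℕ.* m) _
    complete′ e f eq with split-prime pp {m} {e} {f} eq
    ... | inj₁ (e′ , refl , eq′) = ∈-++⁺ˡ (∈-map⁺ (λ (e , f) → (p ℕ.* e , f)) (proj₁ (proj₂ sub) e′ f eq′))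
    ... | inj₂ (f′ , refl , eq′) = ∈-++⁺ʳ (map (λ (e , f) → (p ℕ.* e , f)) fs) (∈-map⁺ (λ (e , f) → (e , p ℕ.* f)) (proj₁ (proj₂ sub) e f′ eq′))
    bound : _ ℕ.≤ 1 ℕ.* (p ℕ.* m)
    bound = begin
      length (map (λ (e , f) → (p ℕ.* e , f)) fs ++ map (λ (e , f) → (e , p ℕ.* f)) fs) ℕ.^ k
        ≡⟨ cong (ℕ._^ k) (trans (length-++ (map (λ (e , f) → (p ℕ.* e , f)) fs)) (trans (cong₂ ℕ._+_ (length-map _ fs) (length-map _ fs)) (cong (length fs ℕ.+_) (sym (ℕₚ.+-identityʳ _))))) ⟩
      (2 ℕ.* length fs) ℕ.^ k ≡⟨ *-^ 2 (length fs) k ⟩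
      2 ℕ.^ k ℕ.* length fs ℕ.^ k ≤⟨ ℕₚ.*-mono-≤ (rough⇒≤ (rough∧∣⇒rough rough (ℕD.divides m (ℕₚ.*-comm p m)))) (proj₂ (proj₂ sub)) ⟩
      p ℕ.* (1 ℕ.* m) ≡⟨ trans (cong (p ℕ.*_) (ℕₚ.*-identityˡ m)) (sym (ℕₚ.*-identityˡ (p ℕ.* m))) ⟩
      1 ℕ.* (p ℕ.* m) ∎

strip : ∀ p → 1 ℕ.< p → ∀ n → 0 ℕ.< n → Σ ℕ λ a → Σ ℕ λ m → n ≡ p ℕ.^ a ℕ.* m × ¬ p ℕD.∣ m × 0 ℕ.< m
strip p 1<p = <-rec _ go
  where
  go : ∀ n → (∀ {m} → m ℕ.< n → 0 ℕ.< m → Σ ℕ λ a → Σ ℕ λ m′ → m ≡ p ℕ.^ a ℕ.* m′ × ¬ p ℕD.∣ m′ × 0 ℕ.< m′) → 0 ℕ.< n → Σ ℕ λ a → Σ ℕ λ m → n ≡ p ℕ.^ a ℕ.* m × ¬ p ℕD.∣ m × 0 ℕ.< m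
  go n rec pos with p ℕD.∣? n
  ... | no ¬d = 0 , n , sym (ℕₚ.*-identityˡ n) , ¬d , pos
  ... | yes (ℕD.divides q refl) =
    let q>0 = ℕₚ.n≢0⇒n>0 (λ { refl → ℕₚ.<-irrefl refl pos })
        (a , m , e , nd , m>0) = rec (ℕₚ.m<m*n q p {{ℕ.>-nonZero q>0}} 1<p) q>0
    in suc a , m , trans (ℕₚ.*-comm q p) (trans (cong (p ℕ.*_) e) (sym (ℕₚ.*-assoc p (p ℕ.^ a) m))) , nd , m>0

-- The full power i^a is removed at once: it multiplies the count by a + 1, and (a + 1)^k ≤ k^k 2^a
-- ≤ k^k i^a. When i divides an i-rough number it is automatically prime.
few-step : ∀ k .{{_ : ℕ.NonZero k}} i C → 1 ℕ.< i → (∀ n → 0 ℕ.< n → suc i Rough n → FewFactors k C n) →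
           ∀ n → 0 ℕ.< n → i Rough n → FewFactors k (k ℕ.^ k ℕ.* C) n
few-step k i C 1<i hyp n n>0 rough with i ℕD.∣? n
... | no ¬d = let (fs , c , b) = hyp n n>0 (∤⇒rough-suc ¬d rough) in fs , c ,
  ℕₚ.≤-trans b (ℕₚ.*-monoˡ-≤ n (ℕₚ.m≤n*m C (k ℕ.^ k) {{ℕₚ.m^n≢0 k k}}))
... | yes i∣n with strip i 1<i n n>0
...   | (a , m , refl , i∤m , m>0) = concatMap lift (applyUpTo id (suc a)) , complete′ , bound
  where
  open ℕₚ.≤-Reasoning
  instance _ = ℕ.n>1⇒nonTrivial 1<i
  pp : Prime i
  pp = rough∧∣⇒prime rough i∣n
  sub = hyp m m>0 (∤⇒rough-suc i∤m (rough∧∣⇒rough rough (ℕD.divides (i ℕ.^ a) refl)))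
  fs = proj₁ sub
  lift : ℕ → List (ℕ × ℕ)
  lift s = map (λ (e , f) → (i ℕ.^ s ℕ.* e , i ℕ.^ (a ℕ.∸ s) ℕ.* f)) fs
  complete′ : Complete (i ℕ.^ a ℕ.* m) (concatMap lift (applyUpTo id (suc a)))
  complete′ e f eq with split-prime-power pp a {m} {e} {f} eq
  ... | (s , s≤ , (e′ , f′) , eq′ , refl , refl) =
    ∈-concatMap⁺ lift (lose (∈-applyUpTo⁺ id (ℕ.s≤s s≤)) (∈-map⁺ _ (proj₁ (proj₂ sub) e′ f′ eq′)))
  len : ∀ xs → length (concatMap lift xs) ≡ length xs ℕ.* length fs
  len []       = refl
  len (x ∷ xs) = trans (length-++ (lift x)) (cong₂ ℕ._+_ (length-map _ fs) (len xs))
  bound : length (concatMap lift (applyUpTo id (suc a))) ℕ.^ k ℕ.≤ k ℕ.^ k ℕ.* C ℕ.* (i ℕ.^ a ℕ.* m)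
  bound = begin
    length (concatMap lift (applyUpTo id (suc a))) ℕ.^ k
      ≡⟨ trans (cong (ℕ._^ k) (trans (len (applyUpTo id (suc a))) (cong (ℕ._* length fs) (length-applyUpTo id (suc a))))) (*-^ (suc a) (length fs) k) ⟩
    suc a ℕ.^ k ℕ.* length fs ℕ.^ k
      ≤⟨ ℕₚ.*-mono-≤ (ℕₚ.≤-trans (suc-^≤ k a) (ℕₚ.*-monoʳ-≤ (k ℕ.^ k) (ℕₚ.^-monoˡ-≤ a 1<i))) (proj₂ (proj₂ sub)) ⟩
    k ℕ.^ k ℕ.* i ℕ.^ a ℕ.* (C ℕ.* m) ≡⟨ l (k ℕ.^ k) (i ℕ.^ a) C m ⟩
    k ℕ.^ k ℕ.* C ℕ.* (i ℕ.^ a ℕ.* m) ∎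
    where
    l : ∀ a b c d → a ℕ.* b ℕ.* (c ℕ.* d) ≡ a ℕ.* c ℕ.* (b ℕ.* d)
    l = solveℕ-∀

few-from : ∀ k .{{_ : ℕ.NonZero k}} c i → 1 ℕ.< i → i ℕ.+ c ≡ 2 ℕ.^ k → ∀ n → 0 ℕ.< n → i Rough n → FewFactors k ((k ℕ.^ k) ℕ.^ c) n
few-from k zero    i 1<i e n n>0 r = few-rough k n n>0 (subst (_Rough n) (trans (sym (ℕₚ.+-identityʳ i)) e) r)
few-from k (suc c) i 1<i e = few-step k i ((k ℕ.^ k) ℕ.^ c) 1<i (few-from k c (suc i) (ℕₚ.m≤n⇒m≤1+n 1<i) (trans (sym (ℕₚ.+-suc i c)) e))

-- The exponent 2^k - 2 counts the numbers from 2 to 2^k - 1, each charged a factor k^k whether it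
-- is prime or not; from 2^k on, `few-rough` costs nothing.
few-factors : ∀ k .{{_ : ℕ.NonZero k}} → Σ ℕ λ C → ∀ n → 0 ℕ.< n → FewFactors k C n
few-factors k = (k ℕ.^ k) ℕ.^ (2 ℕ.^ k ℕ.∸ 2) , λ n n>0 →
  few-from k (2 ℕ.^ k ℕ.∸ 2) 2 (ℕ.s≤s (ℕ.s≤s ℕ.z≤n)) (ℕₚ.m+[n∸m]≡n (ℕₚ.^-monoʳ-≤ 2 (ℕ.>-nonZero⁻¹ k))) n n>0 2-rough

-- How many words equal a given matrix

_≟M_ : (g h : Mat) → Dec (g ≡ h)
mat a b c d ≟M mat a′ b′ c′ d′ with a ℤₚ.≟ a′ | b ℤₚ.≟ b′ | c ℤₚ.≟ c′ | d ℤₚ.≟ d′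
... | yes refl | yes refl | yes refl | yes refl = yes refl
... | no ¬e | _ | _ | _ = no λ { refl → ¬e refl }
... | _ | no ¬e | _ | _ = no λ { refl → ¬e refl }
... | _ | _ | no ¬e | _ = no λ { refl → ¬e refl }
... | _ | _ | _ | no ¬e = no λ { refl → ¬e refl }

Ball-adjⁿ : ∀ ρ (F : Mat → ℕ) → ∑ⁿ (Ball ρ) (λ g → F (adj g)) ≡ ∑ⁿ (Ball ρ) F
Ball-adjⁿ ρ F = ℤₚ.+-injective (trans (sym (∑-pos (Ball ρ) _)) (trans (Ball-adj ρ (λ g → + F g)) (∑-pos (Ball ρ) F)))

adj-cancelˡ : ∀ g w → det g ≡ 1ℤ → adj g · (g · w) ≡ w
adj-cancelˡ (mat a b c d) (mat p q r s) e = mat-≡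
  (fin p (l₁ a b c d p r)) (fin q (l₁ a b c d q s)) (fin r (l₂ a b c d p r)) (fin s (l₂ a b c d q s))
  where
  l₁ : ∀ a b c d p r → d * (a * p + b * r) + (- b) * (c * p + d * r) ≡ (a * d - b * c) * p
  l₁ = solve-∀
  l₂ : ∀ a b c d p r → (- c) * (a * p + b * r) + a * (c * p + d * r) ≡ (a * d - b * c) * r
  l₂ = solve-∀
  fin : ∀ p {x} → x ≡ (a * d - b * c) * p → x ≡ p
  fin p h = trans h (trans (*-congʳ p e) (ℤₚ.*-identityˡ p))

adj-cancelʳ : ∀ g w → det g ≡ 1ℤ → g · (adj g · w) ≡ w
adj-cancelʳ (mat a b c d) (mat p q r s) e = mat-≡
  (fin p (l₁ a b c d p r)) (fin q (l₁ a b c d q s)) (fin r (l₂ a b c d p r)) (fin s (l₂ a b c d q s))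
  where
  l₁ : ∀ a b c d p r → a * (d * p + (- b) * r) + b * ((- c) * p + a * r) ≡ (a * d - b * c) * p
  l₁ = solve-∀
  l₂ : ∀ a b c d p r → c * (d * p + (- b) * r) + d * ((- c) * p + a * r) ≡ (a * d - b * c) * r
  l₂ = solve-∀
  fin : ∀ p {x} → x ≡ (a * d - b * c) * p → x ≡ p
  fin p h = trans h (trans (*-congʳ p e) (ℤₚ.*-identityˡ p))

Bounded : ℕ → Mat → Set
Bounded X (mat a b c d) = (abs a ℕ.≤ X × abs b ℕ.≤ X) × (abs c ℕ.≤ X × abs d ℕ.≤ X)

module WordCount (ρ : ℕ) (1≤ρ : 1 ℕ.≤ ρ) (L J : ℕ) (J≡ : suc J ≡ 2 ℕ.^ L) (2ρ²≤J : 2 ℕ.* (ρ ℕ.* ρ) ℕ.≤ J) where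
  κ = Star.κ ρ 1≤ρ L J J≡ 2ρ²≤J
  star = Star.star ρ 1≤ρ L J J≡ 2ρ²≤J
  pow = Words.pow (Ball ρ) Ball-det (Ball-adj ρ)
  ∈-pow = Words.∈-pow (Ball ρ) Ball-det (Ball-adj ρ)
  open ℕₚ.≤-Reasoning

  W : ℕ → Mat → ℕ
  W n γ = ∑ⁿ (pow n) (λ w → indⁿ (w ≟M γ))

  W-suc : ∀ n γ → W (suc n) γ ≡ ∑ⁿ (Ball ρ) (λ g → W n (g · γ))
  W-suc n γ = begin-equality
    ∑ⁿ (pow (suc n)) (eq γ)                              ≡⟨ ∑ⁿ-concatMap (λ g → map (g ·_) (pow n)) (Ball ρ) (eq γ) ⟩
    ∑ⁿ (Ball ρ) (λ g → ∑ⁿ (map (g ·_) (pow n)) (eq γ))   ≡⟨ ∑ⁿ-cong∈ (Ball ρ) (λ g g∈ → trans (∑ⁿ-map (g ·_) (pow n) (eq γ)) (∑ⁿ-cong (pow n) (λ w → shift g w (Ball-det g∈)))) ⟩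
    ∑ⁿ (Ball ρ) (λ g → W n (adj g · γ))                  ≡⟨ Ball-adjⁿ ρ (λ g → W n (g · γ)) ⟩
    ∑ⁿ (Ball ρ) (λ g → W n (g · γ)) ∎
    where
    eq : Mat → Mat → ℕ
    eq γ w = indⁿ (w ≟M γ)
    shift : ∀ g w → det g ≡ 1ℤ → eq γ (g · w) ≡ eq (adj g · γ) w
    shift g w e = indⁿ-⇔ ((g · w) ≟M γ) (w ≟M (adj g · γ))
      (λ h → trans (sym (adj-cancelˡ g w e)) (cong (adj g ·_) h)) (λ h → trans (cong (g ·_) h) (adj-cancelʳ g γ e))

  -- Induction on the word: `star` is applied at the vector γ v, with the counts of words equal to g
  -- γ as weights. With v a basis vector the bound is κⁿ divided by the size of a column of γ, so
  -- large matrices are hit rarely. This takes the place of freeness of the generators.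
  W-bound : ∀ n γ v → W n γ ℕ.* nrm (γ ▹ v) ℕ.≤ κ ℕ.^ n ℕ.* nrm v
  W-bound zero γ v with I ≟M γ
  ... | no _     = ℕ.z≤n
  ... | yes refl = ℕₚ.≤-reflexive (cong (λ u → 1 ℕ.* nrm u) (I▹ v))
  W-bound (suc n) γ v = begin
    W (suc n) γ ℕ.* nrm (γ ▹ v)                          ≡⟨ ℕₚ.*-comm (W (suc n) γ) _ ⟩
    nrm (γ ▹ v) ℕ.* W (suc n) γ                          ≡⟨ cong (nrm (γ ▹ v) ℕ.*_) (W-suc n γ) ⟩
    nrm (γ ▹ v) ℕ.* ∑ⁿ (Ball ρ) (λ g → W n (g · γ))
      ≤⟨ star (κ ℕ.^ n ℕ.* nrm v) (λ g → W n (g · γ)) (γ ▹ v)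
           (λ g _ → ℕₚ.≤-trans (ℕₚ.≤-reflexive (cong (λ u → W n (g · γ) ℕ.* nrm u) (sym (·-▹ g γ v)))) (W-bound n (g · γ) v)) ⟩
    κ ℕ.* (κ ℕ.^ n ℕ.* nrm v)                            ≡⟨ sym (ℕₚ.*-assoc κ (κ ℕ.^ n) (nrm v)) ⟩
    κ ℕ.^ suc n ℕ.* nrm v ∎

  pow-bounded : ∀ n {w} → w ∈ pow n → Bounded ((2 ℕ.* ρ) ℕ.^ n) w
  pow-bounded = ∈-pow (λ n w → Bounded ((2 ℕ.* ρ) ℕ.^ n) w) ((ℕₚ.≤-refl , ℕ.z≤n) , (ℕ.z≤n , ℕₚ.≤-refl)) step
    where
    ent : ∀ {X} a b p r → abs a ℕ.≤ ρ → abs b ℕ.≤ ρ → abs p ℕ.≤ X → abs r ℕ.≤ X → abs (a * p + b * r) ℕ.≤ 2 ℕ.* ρ ℕ.* X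
    ent {X} a b p r ha hb hp hr = ℕₚ.≤-trans (ℤₚ.∣i+j∣≤∣i∣+∣j∣ (a * p) (b * r))
      (ℕₚ.≤-trans (ℕₚ.≤-reflexive (cong₂ ℕ._+_ (ℤₚ.abs-* a p) (ℤₚ.abs-* b r)))
        (ℕₚ.≤-trans (ℕₚ.+-mono-≤ (ℕₚ.*-mono-≤ ha hp) (ℕₚ.*-mono-≤ hb hr)) (ℕₚ.≤-reflexive (l ρ X))))
      where
      l : ∀ a b → a ℕ.* b ℕ.+ a ℕ.* b ≡ 2 ℕ.* a ℕ.* b
      l = solveℕ-∀
    step : ∀ n g w → g ∈ Ball ρ → Bounded ((2 ℕ.* ρ) ℕ.^ n) w → Bounded ((2 ℕ.* ρ) ℕ.^ suc n) (g · w)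
    step n g (mat p q r s) g∈ ((hp , hq) , (hr , hs)) with ∈-Ball⁻ g∈
    ... | ((a , b) , (c , d) , r∈ , s∈ , refl , _) =
      let (ha , hb) = ∈-rng²⁻ (a , b) r∈; (hc , hd) = ∈-rng²⁻ (c , d) s∈ in
      (ent a b p r ha hb hp hr , ent a b q s ha hb hq hs) , (ent c d p r hc hd hp hr , ent c d q s hc hd hq hs)

  W-col₁ : ∀ n a b c d → W n (mat a b c d) ℕ.* (abs a ℕ.+ abs c) ℕ.≤ κ ℕ.^ n
  W-col₁ n a b c d = subst₂ ℕ._≤_ (cong₂ (λ x y → W n (mat a b c d) ℕ.* (abs x ℕ.+ abs y)) (l a b) (l c d)) (ℕₚ.*-identityʳ (κ ℕ.^ n)) (W-bound n (mat a b c d) (1ℤ , 0ℤ))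
    where
    l : ∀ a b → a * 1ℤ + b * 0ℤ ≡ a
    l = solve-∀

  W-col₂ : ∀ n a b c d → W n (mat a b c d) ℕ.* (abs b ℕ.+ abs d) ℕ.≤ κ ℕ.^ n
  W-col₂ n a b c d = subst₂ ℕ._≤_ (cong₂ (λ x y → W n (mat a b c d) ℕ.* (abs x ℕ.+ abs y)) (l a b) (l c d)) (ℕₚ.*-identityʳ (κ ℕ.^ n)) (W-bound n (mat a b c d) (0ℤ , 1ℤ))
    where
    l : ∀ a b → a * 0ℤ + b * 1ℤ ≡ b
    l = solve-∀

-- Square roots of 1 modulo N: t gives the factorisation N = e f with e ∣ t − 1 and f ∣ t + 1, which determines t up to N/2.
module Roots (N : ℕ) (2≤N : 2 ℕ.≤ N) (fs : List (ℕ × ℕ)) (complete : Complete N fs) where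
  open ℕₚ.≤-Reasoning

  private instance
    N≢0 : ℕ.NonZero N
    N≢0 = ℕ.>-nonZero (ℕₚ.≤-trans (ℕ.s≤s ℕ.z≤n) 2≤N)

  root? : ∀ i → Dec (+ N ∣ + i * + i - 1ℤ)
  root? i = + N ∣? (+ i * + i - 1ℤ)

  factor-of : ∀ x y → N ℕD.∣ x ℕ.* y → Σ ℕ λ e → Σ ℕ λ f → e ℕ.* f ≡ N × e ℕD.∣ x × f ℕD.∣ y
  factor-of x y N∣ = g , N / g , trans (ℕₚ.*-comm g (N / g)) (m/n*n≡m g∣N) , gcd[m,n]∣m x N , coprime-divisor (coprime-sym (coprime-/gcd x N)) f∣
    where
    g = gcd x N
    instance
      g≢0 : ℕ.NonZero g
      g≢0 = ℕ.≢-nonZero (gcd[m,n]≢0 x N (inj₂ (ℕ.≢-nonZero⁻¹ N)))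
    g∣N = gcd[m,n]∣n x N
    g∣x = gcd[m,n]∣m x N
    f∣ : (N / g) ℕD.∣ (x / g) ℕ.* y
    f∣ = ℕD.*-cancelˡ-∣ g (subst₂ ℕD._∣_ (trans (sym (m/n*n≡m g∣N)) (ℕₚ.*-comm (N / g) g))
      (trans (cong (ℕ._* y) (trans (sym (m/n*n≡m g∣x)) (ℕₚ.*-comm (x / g) g))) (ℕₚ.*-assoc g (x / g) y)) N∣)

  P? : ∀ e f i → Dec (+ e ∣ + i - 1ℤ × + f ∣ + i + 1ℤ)
  P? e f i = (+ e ∣? (+ i - 1ℤ)) ×-dec (+ f ∣? (+ i + 1ℤ))

  -- A common divisor of e and f divides (t + 1) - (t - 1) = 2, so two solutions agree modulo N up
  -- to a factor 2. Their difference is 0 or ± N/2, hence three candidates.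
  pair-count : ∀ e f → e ℕ.* f ≡ N → ∑ⁿ (applyUpTo id N) (λ i → indⁿ (P? e f i)) ℕ.≤ 3
  pair-count e f ef = cover-by-one (P? e f) ℕₚ._≟_ (applyUpTo id N) (0ℤ ∷ + (N / 2) ∷ - + (N / 2) ∷ []) (λ z y → abs (+ z + y)) 1 mult cov
    where
    mult : ∀ z → ∑ⁿ (applyUpTo id N) (λ x → indⁿ (x ℕₚ.≟ z)) ℕ.≤ 1
    mult z = ℕₚ.≤-trans (ℕₚ.≤-reflexive (trans (∑ⁿ-cong (applyUpTo id N) (λ x → indⁿ-⇔ (x ℕₚ.≟ z) (+ x ℤₚ.≟ + z) (cong (λ n → + n)) ℤₚ.+-injective))
               (sym (∑ⁿ-applyUpTo-∘ +_ id N (λ x → indⁿ (x ℤₚ.≟ + z)))))) (mult-applyUpTo ℤₚ.+-injective N (+ z))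
    cov : ∀ z x → z ∈ applyUpTo id N → x ∈ applyUpTo id N → (+ e ∣ + z - 1ℤ × + f ∣ + z + 1ℤ) → (+ e ∣ + x - 1ℤ × + f ∣ + x + 1ℤ) →
          Σ ℤ λ y → y ∈ (0ℤ ∷ + (N / 2) ∷ - + (N / 2) ∷ []) × x ≡ abs (+ z + y)
    cov z x z∈ x∈ (ez , fz) (ex , fx) with ∈-applyUpTo⁻ id z∈ | ∈-applyUpTo⁻ id x∈
    ... | (_ , z<N , refl) | (_ , x<N , refl) = answer
      where
      Δ = + x - + z
      eΔ : + e ∣ Δ
      eΔ = ∣-via (Div.∣m∣n⇒∣m-n ex ez) (l (+ x) (+ z))
        where
        l : ∀ x z → (x - 1ℤ) - (z - 1ℤ) ≡ x - z
        l = solve-∀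
      fΔ : + f ∣ Δ
      fΔ = ∣-via (Div.∣m∣n⇒∣m-n fx fz) (l (+ x) (+ z))
        where
        l : ∀ x z → (x + 1ℤ) - (z + 1ℤ) ≡ x - z
        l = solve-∀
      prod : ∀ {u v} → + e ∣ u → + f ∣ v → + N ∣ u * v
      prod (divides p refl) (divides q refl) = divides (p * q) (trans (l p q (+ e) (+ f)) (*-congˡ (p * q) (trans (sym (ℤₚ.pos-* e f)) (cong (λ n → + n) ef))))
        where
        l : ∀ p q e f → p * e * (q * f) ≡ p * q * (e * f)
        l = solve-∀
      N2Δ : + N ∣ + 2 * Δ
      N2Δ = ∣-via (Div.∣m∣n⇒∣m-n (prod eΔ fz) (prod ez fΔ)) (l (+ z) Δ)
        where
        l : ∀ z d → d * (z + 1ℤ) - (z - 1ℤ) * d ≡ + 2 * d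
        l = solve-∀
      half : ∀ {a b} → a ℕ.< N → b ℕ.≤ a → N ℕD.∣ 2 ℕ.* (a ℕ.∸ b) → a ≡ b ⊎ a ℕ.∸ b ≡ N / 2
      half {a} {b} a<N b≤a (ℕD.divides zero eq) = inj₁ (ℕₚ.≤-antisym (ℕₚ.m∸n≡0⇒m≤n (ℕₚ.m*n≡0⇒m≡0 (a ℕ.∸ b) 2 (trans (ℕₚ.*-comm (a ℕ.∸ b) 2) eq))) b≤a)
      half {a} {b} a<N b≤a (ℕD.divides 1 eq) = inj₂ (trans (sym (m*n/n≡m (a ℕ.∸ b) 2)) (cong (_/ 2) (trans (ℕₚ.*-comm (a ℕ.∸ b) 2) (trans eq (ℕₚ.*-identityˡ N)))))
      half {a} {b} a<N b≤a (ℕD.divides (suc (suc k)) eq) = ⊥-elim (ℕₚ.<⇒≱ (ℕₚ.*-monoʳ-< 2 (ℕₚ.≤-<-trans (ℕₚ.m∸n≤m a b) a<N))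
        (ℕₚ.≤-trans (ℕₚ.+-monoʳ-≤ N (ℕₚ.+-monoʳ-≤ N ℕ.z≤n)) (ℕₚ.≤-reflexive (sym eq))))
      h = N / 2
      Goal = Σ ℤ λ y → y ∈ (0ℤ ∷ + h ∷ - + h ∷ []) × x ≡ abs (+ z + y)
      up : z ℕ.≤ x → x ≡ z ⊎ x ℕ.∸ z ≡ h → Goal
      up z≤x (inj₁ refl) = 0ℤ , here refl , sym (cong abs (ℤₚ.+-identityʳ (+ z)))
      up z≤x (inj₂ e) = + h , there (here refl) , trans (sym (ℕₚ.m+[n∸m]≡n z≤x)) (cong (z ℕ.+_) e)
      down : x ℕ.≤ z → z ≡ x ⊎ z ℕ.∸ x ≡ h → Goal
      down x≤z (inj₁ refl) = 0ℤ , here refl , sym (cong abs (ℤₚ.+-identityʳ (+ z)))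
      down x≤z (inj₂ e) = - + h , there (there (here refl)) ,
        trans (sym (ℕₚ.m∸[m∸n]≡n x≤z)) (trans (cong (z ℕ.∸_) e) (sym (cong abs (trans (ℤₚ.m-n≡m⊖n z h) (ℤₚ.⊖-≥ (subst (ℕ._≤ z) e (ℕₚ.m∸n≤m z x)))))))
      N2Δᵤ : N ℕD.∣ 2 ℕ.* abs Δ
      N2Δᵤ = subst (N ℕD.∣_) (ℤₚ.abs-* (+ 2) Δ) (Div.∣⇒∣ᵤ N2Δ)
      answer : Goal
      answer = [ (λ z≤x → up z≤x (half x<N z≤x (subst (λ d → N ℕD.∣ 2 ℕ.* d) (cong abs (trans (ℤₚ.m-n≡m⊖n x z) (ℤₚ.⊖-≥ z≤x))) N2Δᵤ)))
               , (λ x≤z → down x≤z (half z<N x≤z (subst (λ d → N ℕD.∣ 2 ℕ.* d) (trans (ℤₚ.∣i-j∣≡∣j-i∣ (+ x) (+ z)) (cong abs (trans (ℤₚ.m-n≡m⊖n z x) (ℤₚ.⊖-≥ x≤z)))) N2Δᵤ)))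
               ]′ (ℕₚ.≤-total z x)

  root-count : ∑ⁿ (applyUpTo id N) (λ i → indⁿ (root? i)) ℕ.≤ 3 ℕ.* length fs
  root-count = begin
    ∑ⁿ (applyUpTo id N) (λ i → indⁿ (root? i))
      ≤⟨ ∑ⁿ-mono (applyUpTo id N) pt ⟩
    ∑ⁿ (applyUpTo id N) (λ i → ∑ⁿ fs (λ (e , f) → indⁿ (e ℕ.* f ℕₚ.≟ N) ℕ.* indⁿ (P? e f i)))
      ≡⟨ trans (∑ⁿ-swap (applyUpTo id N) fs _) (∑ⁿ-cong fs (λ (e , f) → ∑ⁿ-*ˡ (applyUpTo id N) (indⁿ (e ℕ.* f ℕₚ.≟ N)) _)) ⟩
    ∑ⁿ fs (λ (e , f) → indⁿ (e ℕ.* f ℕₚ.≟ N) ℕ.* ∑ⁿ (applyUpTo id N) (λ i → indⁿ (P? e f i)))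
      ≤⟨ ∑ⁿ-mono fs (λ (e , f) → ℕₚ.≤-trans (indⁿ-mono (e ℕ.* f ℕₚ.≟ N) (pair-count e f)) (indⁿ-*≤ (e ℕ.* f ℕₚ.≟ N) 3)) ⟩
    ∑ⁿ fs (λ _ → 3)
      ≡⟨ trans (∑ⁿ-const fs 3) (ℕₚ.*-comm (length fs) 3) ⟩
    3 ℕ.* length fs ∎
    where
    pt : ∀ i → indⁿ (root? i) ℕ.≤ ∑ⁿ fs (λ (e , f) → indⁿ (e ℕ.* f ℕₚ.≟ N) ℕ.* indⁿ (P? e f i))
    pt i = ℕₚ.≤-trans (≤-indⁿ (root? i) {b = X} (λ d → ℕₚ.≤-trans (indⁿ≤1 (root? i)) (1≤X (factor-of (abs (+ i - 1ℤ)) (abs (+ i + 1ℤ))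
        (subst (N ℕD.∣_) (trans (cong abs (l (+ i))) (ℤₚ.abs-* (+ i - 1ℤ) (+ i + 1ℤ))) (Div.∣⇒∣ᵤ d))))) (indⁿ-no (root? i))) (indⁿ-*≤ (root? i) X)
      where
      X = ∑ⁿ fs (λ (e , f) → indⁿ (e ℕ.* f ℕₚ.≟ N) ℕ.* indⁿ (P? e f i))
      l : ∀ i → i * i - 1ℤ ≡ (i - 1ℤ) * (i + 1ℤ)
      l = solve-∀
      1≤X : (Σ ℕ λ e → Σ ℕ λ f → e ℕ.* f ≡ N × e ℕD.∣ abs (+ i - 1ℤ) × f ℕD.∣ abs (+ i + 1ℤ)) → 1 ℕ.≤ X
      1≤X (e , f , ef , e∣ , f∣) = ℕₚ.≤-trans (ℕₚ.≤-reflexive (sym (cong₂ ℕ._*_ (indⁿ-yes (e ℕ.* f ℕₚ.≟ N) ef) (indⁿ-yes (P? e f i) (Div.∣ᵤ⇒∣ e∣ , Div.∣ᵤ⇒∣ f∣)))))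
        (∑ⁿ-term≤ (λ (e , f) → indⁿ (e ℕ.* f ℕₚ.≟ N) ℕ.* indⁿ (P? e f i)) (complete e f ef))

-- Words that are scalar modulo N

square-abs : ∀ a → + abs a * + abs a ≡ a * a
square-abs (+ n)      = refl
square-abs (-[1+ n ]) = refl

∈-upTo⇒< : ∀ {n i} → i ∈ applyUpTo id n → i ℕ.< n
∈-upTo⇒< m with ∈-applyUpTo⁻ id m
... | (_ , lt , refl) = lt

-- With off-diagonal entries N b and N c the determinant condition reads a d - 1 = N² b c. Together
-- with a ≡ d this gives a² ≡ 1 modulo N, so a has few residues; a determines d modulo N²; and for b
-- c ≠ 0 the divisor bound λ′ controls the pairs (b , c). Each matrix is weighted by the words that
-- hit it, at most K over the size of a column.
module Count (ρ : ℕ) (1≤ρ : 1 ℕ.≤ ρ) (L J : ℕ) (J≡ : suc J ≡ 2 ℕ.^ L) (2ρ²≤J : 2 ℕ.* (ρ ℕ.* ρ) ℕ.≤ J)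
             (N : ℕ) (2≤N : 2 ℕ.≤ N) (n ℓ λ′ B : ℕ)
             (few : ∀ m → 0 ℕ.< m → m ℕ.≤ B → Σ (List (ℕ × ℕ)) λ fs → Complete m fs × length fs ℕ.≤ λ′)
             (R²≤B : (2 ℕ.* ρ) ℕ.^ n ℕ.* (2 ℕ.* ρ) ℕ.^ n ℕ.≤ B) (N≤B : N ℕ.≤ B)
             (R<2^ℓ : suc ((2 ℕ.* ρ) ℕ.^ n) ℕ.≤ 2 ℕ.^ ℓ) where
  κ = Star.κ ρ 1≤ρ L J J≡ 2ρ²≤J
  pow = Words.pow (Ball ρ) Ball-det (Ball-adj ρ)
  pow-det = Words.pow-det (Ball ρ) Ball-det (Ball-adj ρ)
  W = WordCount.W ρ 1≤ρ L J J≡ 2ρ²≤J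
  W-col₁ = WordCount.W-col₁ ρ 1≤ρ L J J≡ 2ρ²≤J
  W-col₂ = WordCount.W-col₂ ρ 1≤ρ L J J≡ 2ρ²≤J
  pow-bounded = WordCount.pow-bounded ρ 1≤ρ L J J≡ 2ρ²≤J
  open ℕₚ.≤-Reasoning

  private instance
    N≢0 : ℕ.NonZero N
    N≢0 = ℕ.>-nonZero (ℕₚ.≤-trans (ℕ.s≤s ℕ.z≤n) 2≤N)

  R K : ℕ
  R = (2 ℕ.* ρ) ℕ.^ n
  K = κ ℕ.^ n

  E′ U Q : ℕ
  E′ = hdiv K N
  U = hdiv (2 ℕ.* K) (N ℕ.* N)
  Q = suc (R / N)

  1≤R : 1 ℕ.≤ R
  1≤R = ℕₚ.m^n>0 (2 ℕ.* ρ) {{ℕ.>-nonZero (ℕₚ.≤-trans 1≤ρ (ℕₚ.m≤n*m ρ 2))}} n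

  X : List V
  X = rng² R

  asm : V → V → Mat
  asm (a , d) (b , c) = mat a (+ N * b) (+ N * c) d

  Good : V → V → Set
  Good (a , d) (b , c) = det (asm (a , d) (b , c)) ≡ 1ℤ × + N ∣ a - d

  good? : ∀ p q → Dec (Good p q)
  good? (a , d) (b , c) = one? (asm (a , d) (b , c)) ×-dec (+ N ∣? (a - d))

  T : V → V → ℕ
  T p q = indⁿ (good? p q) ℕ.* W n (asm p q)

  Z : ℕ
  Z = ∑ⁿ (pow n) (λ w → indⁿ (scalar? N w))

  quot-bound : ∀ x q → x ≡ q * + N → abs x ℕ.≤ R → abs q ℕ.≤ R
  quot-bound x q e p = ℕₚ.≤-trans (ℕₚ.≤-trans (ℕₚ.m≤m*n (abs q) N) (ℕₚ.≤-reflexive (sym (trans (cong abs e) (ℤₚ.abs-* q (+ N)))))) p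

  Z≤T : Z ℕ.≤ ∑ⁿ X (λ p → ∑ⁿ X (T p))
  Z≤T = begin
    ∑ⁿ (pow n) (λ w → indⁿ (scalar? N w))
      ≤⟨ ∑ⁿ-mono∈ (pow n) pt ⟩
    ∑ⁿ (pow n) (λ w → ∑ⁿ X (λ p → ∑ⁿ X (λ q → indⁿ (good? p q) ℕ.* indⁿ (w ≟M asm p q))))
      ≡⟨ trans (∑ⁿ-swap (pow n) X _) (∑ⁿ-cong X (λ p → trans (∑ⁿ-swap (pow n) X _) (∑ⁿ-cong X (λ q → ∑ⁿ-*ˡ (pow n) (indⁿ (good? p q)) _)))) ⟩
    ∑ⁿ X (λ p → ∑ⁿ X (T p)) ∎
    where
    pt : ∀ w → w ∈ pow n → indⁿ (scalar? N w) ℕ.≤ ∑ⁿ X (λ p → ∑ⁿ X (λ q → indⁿ (good? p q) ℕ.* indⁿ (w ≟M asm p q)))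
    pt w@(mat a b c d) w∈ = ℕₚ.≤-trans (≤-indⁿ (scalar? N w) {b = S} yes-case (indⁿ-no (scalar? N w))) (indⁿ-*≤ (scalar? N w) S)
      where
      S = ∑ⁿ X (λ p → ∑ⁿ X (λ q → indⁿ (good? p q) ℕ.* indⁿ (w ≟M asm p q)))
      yes-case : Scalar N w → indⁿ (scalar? N w) ℕ.≤ S
      yes-case sc@(divides b′ eb , divides c′ ec , da) = begin
        indⁿ (scalar? N w) ≡⟨ indⁿ-yes (scalar? N w) sc ⟩
        1 ≡⟨ sym (cong₂ ℕ._*_ (indⁿ-yes (good? p q) (subst (λ g → det g ≡ 1ℤ) w≡ (pow-det n w∈) , da)) (indⁿ-yes (w ≟M asm p q) w≡)) ⟩
        indⁿ (good? p q) ℕ.* indⁿ (w ≟M asm p q)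
          ≤⟨ ∑ⁿ-term≤ (λ q → indⁿ (good? p q) ℕ.* indⁿ (w ≟M asm p q)) (∈-rng²⁺ q (quot-bound b b′ eb hb) (quot-bound c c′ ec hc)) ⟩
        ∑ⁿ X (λ q → indⁿ (good? p q) ℕ.* indⁿ (w ≟M asm p q))
          ≤⟨ ∑ⁿ-term≤ (λ p → ∑ⁿ X (λ q → indⁿ (good? p q) ℕ.* indⁿ (w ≟M asm p q))) (∈-rng²⁺ p ha hd) ⟩
        S ∎
        where
        p = (a , d)
        q = (b′ , c′)
        bd = pow-bounded n w∈
        ha = proj₁ (proj₁ bd)
        hb = proj₂ (proj₁ bd)
        hc = proj₁ (proj₂ bd)
        hd = proj₂ (proj₂ bd)
        w≡ : w ≡ asm p q
        w≡ = mat-≡ refl (trans eb (ℤₚ.*-comm b′ (+ N))) (trans ec (ℤₚ.*-comm c′ (+ N))) refl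

  -- Unipotent contributions: bc = 0 forces a = d = ±1.
  Sgn : V → Set
  Sgn p = p ≡ (1ℤ , 1ℤ) ⊎ p ≡ (-[1+ 0 ] , -[1+ 0 ])

  sgn? : ∀ p → Dec (Sgn p)
  sgn? p = (p ≟V (1ℤ , 1ℤ)) ⊎-dec (p ≟V (-[1+ 0 ] , -[1+ 0 ]))

  P₁ P₂ : V → V → ℕ
  P₁ p (b , c) = indⁿ (sgn? p) ℕ.* (indⁿ (b ℤₚ.≟ 0ℤ) ℕ.* hdiv K (N ℕ.* abs c))
  P₂ p (b , c) = indⁿ (sgn? p) ℕ.* (indⁿ (c ℤₚ.≟ 0ℤ) ℕ.* hdiv K (N ℕ.* abs b))

  -- The remaining ones, by symmetry with |d| ≤ |a|.
  Big : ℤ → ℤ → Set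
  Big a d = (+ N * + N ∣ a * d - 1ℤ × + N ∣ a - d) × (¬ (a * d ≡ 1ℤ) × abs d ℕ.≤ abs a)

  big? : ∀ a d → Dec (Big a d)
  big? a d = ((+ N * + N ∣? (a * d - 1ℤ)) ×-dec (+ N ∣? (a - d))) ×-dec (¬? (a * d ℤₚ.≟ 1ℤ) ×-dec (abs d ℕₚ.≤? abs a))

  Hyp : ℤ → ℤ → V → Set
  Hyp a d (b , c) = + N * + N * (b * c) ≡ a * d - 1ℤ

  hyp? : ∀ a d q → Dec (Hyp a d q)
  hyp? a d (b , c) = (+ N * + N * (b * c)) ℤₚ.≟ (a * d - 1ℤ)

  P₃ : ℤ → ℤ → V → ℕ
  P₃ a d q = indⁿ (big? a d) ℕ.* hdiv K (abs a) ℕ.* indⁿ (hyp? a d q)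

  W-col₁-≤ : ∀ a b c d x → x ℕ.≤ abs a ℕ.+ abs c → (x ≡ 0 → 1 ℕ.≤ abs a ℕ.+ abs c) → W n (mat a b c d) ℕ.≤ hdiv K x
  W-col₁-≤ a b c d x le z = hdiv-intro K x w (ℕₚ.≤-trans (ℕₚ.*-monoˡ-≤ w le) (ℕₚ.≤-trans (ℕₚ.≤-reflexive (ℕₚ.*-comm _ w)) (W-col₁ n a b c d)))
    (λ e → ℕₚ.≤-trans (ℕₚ.m≤m*n w _ {{ℕ.>-nonZero (z e)}}) (W-col₁ n a b c d))
    where w = W n (mat a b c d)

  W-col₂-≤ : ∀ a b c d x → x ℕ.≤ abs b ℕ.+ abs d → (x ≡ 0 → 1 ℕ.≤ abs b ℕ.+ abs d) → W n (mat a b c d) ℕ.≤ hdiv K x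
  W-col₂-≤ a b c d x le z = hdiv-intro K x w (ℕₚ.≤-trans (ℕₚ.*-monoˡ-≤ w le) (ℕₚ.≤-trans (ℕₚ.≤-reflexive (ℕₚ.*-comm _ w)) (W-col₂ n a b c d)))
    (λ e → ℕₚ.≤-trans (ℕₚ.m≤m*n w _ {{ℕ.>-nonZero (z e)}}) (W-col₂ n a b c d))
    where w = W n (mat a b c d)

  det-asm : ∀ a d b c → det (asm (a , d) (b , c)) ≡ 1ℤ → Hyp a d (b , c)
  det-asm a d b c e = trans (l a d b c (+ N)) (cong (λ t → a * d - t) e)
    where
    l : ∀ a d b c n → n * n * (b * c) ≡ a * d - (a * d - n * b * (n * c))
    l = solve-∀

  unit-pair : ∀ a d → a * d ≡ 1ℤ → Sgn (a , d)
  unit-pair a d e = go a d (ℕₚ.m*n≡1⇒m≡1 (abs a) (abs d) e′) (ℕₚ.m*n≡1⇒n≡1 (abs a) (abs d) e′) e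
    where
    e′ : abs a ℕ.* abs d ≡ 1
    e′ = trans (sym (ℤₚ.abs-* a d)) (cong abs e)
    go : ∀ a d → abs a ≡ 1 → abs d ≡ 1 → a * d ≡ 1ℤ → Sgn (a , d)
    go (+ 1) (+ 1) refl refl _ = inj₁ refl
    go (+ 1) (-[1+ 0 ]) refl refl ()
    go (-[1+ 0 ]) (+ 1) refl refl ()
    go (-[1+ 0 ]) (-[1+ 0 ]) refl refl _ = inj₂ refl

  sgn-abs : ∀ {a d} → Sgn (a , d) → abs a ≡ 1 × abs d ≡ 1
  sgn-abs (inj₁ refl) = refl , refl
  sgn-abs (inj₂ refl) = refl , refl

  T≤ : ∀ p q → T p q ℕ.≤ (P₁ p q ℕ.+ P₂ p q) ℕ.+ (P₃ (proj₁ p) (proj₂ p) q ℕ.+ P₃ (proj₂ p) (proj₁ p) q)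
  T≤ p@(a , d) q@(b , c) = ℕₚ.≤-trans (≤-indⁿ (good? p q) {b = S} (λ g → ℕₚ.≤-trans (indⁿ-*≤ (good? p q) _) (case₀ g))
      (λ ng → cong (ℕ._* W n (asm p q)) (indⁿ-no (good? p q) ng))) (indⁿ-*≤ (good? p q) S)
    where
    S = (P₁ p q ℕ.+ P₂ p q) ℕ.+ (P₃ a d q ℕ.+ P₃ d a q)
    w = W n (asm p q)
    ind1 : {P : Set} (x : Dec P) → P → ∀ {y} → y ≡ indⁿ x ℕ.* y
    ind1 x px {y} = sym (trans (cong (ℕ._* y) (indⁿ-yes x px)) (ℕₚ.*-identityˡ y))
    case₀ : Good p q → w ℕ.≤ S
    case₀ (e , da) = bc (b ℤₚ.≟ 0ℤ) (c ℤₚ.≟ 0ℤ)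
      where
      hy : Hyp a d q
      hy = det-asm a d b c e
      ad1 : b * c ≡ 0ℤ → a * d ≡ 1ℤ
      ad1 z = ℤₚ.i-j≡0⇒i≡j (a * d) 1ℤ (trans (sym hy) (trans (*-congˡ (+ N * + N) z) (ℤₚ.*-zeroʳ (+ N * + N))))
      bc : Dec (b ≡ 0ℤ) → Dec (c ≡ 0ℤ) → w ℕ.≤ S
      bc (yes z) _ = begin
        w ≤⟨ W-col₁-≤ a (+ N * b) (+ N * c) d (N ℕ.* abs c) (ℕₚ.≤-trans (ℕₚ.≤-reflexive (sym (ℤₚ.abs-* (+ N) c))) (ℕₚ.m≤n+m _ (abs a)))
               (λ _ → ℕₚ.≤-trans (ℕₚ.≤-reflexive (sym (proj₁ (sgn-abs sg)))) (ℕₚ.m≤m+n _ _)) ⟩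
        hdiv K (N ℕ.* abs c) ≡⟨ trans (ind1 (b ℤₚ.≟ 0ℤ) z) (ind1 (sgn? p) sg) ⟩
        P₁ p q ≤⟨ ℕₚ.m≤m+n _ _ ⟩
        P₁ p q ℕ.+ P₂ p q ≤⟨ ℕₚ.m≤m+n _ _ ⟩
        S ∎
        where
        sg : Sgn p
        sg = unit-pair a d (ad1 (cong (_* c) z))
      bc (no _) (yes z) = begin
        w ≤⟨ W-col₂-≤ a (+ N * b) (+ N * c) d (N ℕ.* abs b) (ℕₚ.≤-trans (ℕₚ.≤-reflexive (sym (ℤₚ.abs-* (+ N) b))) (ℕₚ.m≤m+n _ (abs d)))
               (λ _ → ℕₚ.≤-trans (ℕₚ.≤-reflexive (sym (proj₂ (sgn-abs sg)))) (ℕₚ.m≤n+m _ _)) ⟩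
        hdiv K (N ℕ.* abs b) ≡⟨ trans (ind1 (c ℤₚ.≟ 0ℤ) z) (ind1 (sgn? p) sg) ⟩
        P₂ p q ≤⟨ ℕₚ.m≤n+m _ (P₁ p q) ⟩
        P₁ p q ℕ.+ P₂ p q ≤⟨ ℕₚ.m≤m+n _ _ ⟩
        S ∎
        where
        sg : Sgn p
        sg = unit-pair a d (ad1 (trans (*-congˡ b z) (ℤₚ.*-zeroʳ b)))
      bc (no b≢0) (no c≢0) = [ left , right ]′ (ℕₚ.≤-total (abs d) (abs a))
        where
        N≢0ℤ : + N ≢ 0ℤ
        N≢0ℤ z = ℕ.≢-nonZero⁻¹ N (ℤₚ.+-injective z)
        zero-prod : ∀ x y → x ≢ 0ℤ → y ≢ 0ℤ → x * y ≢ 0ℤ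
        zero-prod x y nx ny z = [ nx , ny ]′ (ℤₚ.i*j≡0⇒i≡0∨j≡0 x z)
        nad : ¬ (a * d ≡ 1ℤ)
        nad e′ = zero-prod (+ N * + N) (b * c) (zero-prod (+ N) (+ N) N≢0ℤ N≢0ℤ) (zero-prod b c b≢0 c≢0)
                   (trans hy (ℤₚ.i≡j⇒i-j≡0 e′))
        pos : ∀ x y → 1 ℕ.≤ abs (+ N * y) → 1 ℕ.≤ x ℕ.+ abs (+ N * y)
        pos x y p = ℕₚ.≤-trans p (ℕₚ.m≤n+m _ x)
        Npos : ∀ y → y ≢ 0ℤ → 1 ℕ.≤ abs (+ N * y)
        Npos y ny = ℕₚ.n≢0⇒n>0 (λ z → zero-prod (+ N) y N≢0ℤ ny (ℤₚ.∣i∣≡0⇒i≡0 z))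
        N²∣ : + N * + N ∣ a * d - 1ℤ
        N²∣ = divides (b * c) (trans (sym hy) (ℤₚ.*-comm (+ N * + N) (b * c)))
        left : abs d ℕ.≤ abs a → w ℕ.≤ S
        left le = begin
          w ≤⟨ W-col₁-≤ a (+ N * b) (+ N * c) d (abs a) (ℕₚ.m≤m+n _ _) (λ _ → pos (abs a) c (Npos c c≢0)) ⟩
          hdiv K (abs a) ≡⟨ trans (ind1 (big? a d) ((N²∣ , da) , (nad , le))) (trans (sym (ℕₚ.*-identityʳ _)) (cong (indⁿ (big? a d) ℕ.* hdiv K (abs a) ℕ.*_) (sym (indⁿ-yes (hyp? a d q) hy)))) ⟩
          P₃ a d q ≤⟨ ℕₚ.≤-trans (ℕₚ.m≤m+n _ (P₃ d a q)) (ℕₚ.m≤n+m _ (P₁ p q ℕ.+ P₂ p q)) ⟩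
          S ∎
        comm1 : ∀ {x} → x ≡ a * d - 1ℤ → x ≡ d * a - 1ℤ
        comm1 h = trans h (cong (λ t → t - 1ℤ) (ℤₚ.*-comm a d))
        right : abs a ℕ.≤ abs d → w ℕ.≤ S
        right le = begin
          w ≤⟨ W-col₂-≤ a (+ N * b) (+ N * c) d (abs d) (ℕₚ.m≤n+m _ _) (λ _ → ℕₚ.≤-trans (Npos b b≢0) (ℕₚ.m≤m+n _ _)) ⟩
          hdiv K (abs d) ≡⟨ trans (ind1 (big? d a) ((∣-via N²∣ (comm1 refl) , ≡-mod-sym a d da) , ((λ e′ → nad (trans (ℤₚ.*-comm a d) e′)) , le)))
                              (trans (sym (ℕₚ.*-identityʳ _)) (cong (indⁿ (big? d a) ℕ.* hdiv K (abs d) ℕ.*_) (sym (indⁿ-yes (hyp? d a q) (comm1 hy))))) ⟩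
          P₃ d a q ≤⟨ ℕₚ.≤-trans (ℕₚ.m≤n+m _ (P₃ a d q)) (ℕₚ.m≤n+m _ (P₁ p q ℕ.+ P₂ p q)) ⟩
          S ∎

  E′-K : N ℕ.* E′ ℕ.≤ K
  E′-K = hdiv-elim K N

  suc-sum : ∀ (F : ℕ → ℕ) m → ∑ⁿ (applyUpTo suc m) F ℕ.≤ ∑ⁿ (applyUpTo id (suc m)) F
  suc-sum F m = ℕₚ.m≤n+m _ (F 0)

  harmonic-R : ∀ E → ∑ⁿ (applyUpTo id (suc R)) (hdiv E) ℕ.≤ suc ℓ ℕ.* E
  harmonic-R E = ℕₚ.≤-trans (upTo-mono R<2^ℓ (hdiv E)) (harmonic E ℓ)
    where
    upTo-mono : ∀ {m m′} → m ℕ.≤ m′ → ∀ F → ∑ⁿ (applyUpTo id m) F ℕ.≤ ∑ⁿ (applyUpTo id m′) F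
    upTo-mono {m} {m′} le F = subst (λ k → ∑ⁿ (applyUpTo id m) F ℕ.≤ ∑ⁿ (applyUpTo id k) F) (ℕₚ.m+[n∸m]≡n le)
      (ℕₚ.≤-trans (ℕₚ.m≤m+n _ _) (ℕₚ.≤-reflexive (sym (∑ⁿ-upTo-split id m (m′ ℕ.∸ m) F))))

  hdiv-N : ∀ i → hdiv K (N ℕ.* suc i) ℕ.≤ hdiv E′ (suc i)
  hdiv-N i = hdiv-intro E′ (suc i) h (hdiv-intro K N (suc i ℕ.* h) (ℕₚ.≤-trans (ℕₚ.≤-reflexive (sym (ℕₚ.*-assoc N (suc i) h))) (hdiv-elim K (N ℕ.* suc i)))
    (λ z → ⊥-elim (ℕ.≢-nonZero⁻¹ N z))) (λ ())
    where h = hdiv K (N ℕ.* suc i)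

  unipotent-sum : ∑ⁿ (rng R) (λ c → hdiv K (N ℕ.* abs c)) ℕ.≤ 2 ℕ.* (K ℕ.+ suc ℓ ℕ.* E′)
  unipotent-sum = ℕₚ.≤-trans (ℕₚ.≤-reflexive (∑-rng-abs R (λ i → hdiv K (N ℕ.* i)))) (ℕₚ.*-monoʳ-≤ 2
    (ℕₚ.+-mono-≤ (ℕₚ.≤-reflexive (cong (hdiv K) (ℕₚ.*-zeroʳ N)))
      (ℕₚ.≤-trans (ℕₚ.≤-reflexive (∑ⁿ-applyUpTo-∘ suc id R (λ i → hdiv K (N ℕ.* i)))) (ℕₚ.≤-trans (∑ⁿ-mono (applyUpTo id R) hdiv-N)
        (ℕₚ.≤-trans (ℕₚ.≤-reflexive (sym (∑ⁿ-applyUpTo-∘ suc id R (hdiv E′)))) (ℕₚ.≤-trans (suc-sum (hdiv E′) R) (harmonic-R E′)))))))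

  sgn-count : ∑ⁿ X (λ p → indⁿ (sgn? p)) ℕ.≤ 8
  sgn-count = cover sgn? _≟V_ X ((1ℤ , 1ℤ) ∷ (-[1+ 0 ] , -[1+ 0 ]) ∷ []) id 4 (mult-rng² R)
    (λ { p _ (inj₁ e) → (1ℤ , 1ℤ) , here refl , e ; p _ (inj₂ e) → (-[1+ 0 ] , -[1+ 0 ]) , there (here refl) , e })

  S₁≤ : ∑ⁿ X (λ p → ∑ⁿ X (P₁ p)) ℕ.≤ 32 ℕ.* (K ℕ.+ suc ℓ ℕ.* E′)
  S₁≤ = begin
    ∑ⁿ X (λ p → ∑ⁿ X (P₁ p))
      ≡⟨ trans (∑ⁿ-cong X (λ p → ∑ⁿ-*ˡ X (indⁿ (sgn? p)) _)) (∑ⁿ-*ʳ X _ _) ⟩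
    ∑ⁿ X (λ p → indⁿ (sgn? p)) ℕ.* ∑ⁿ X (λ (b , c) → indⁿ (b ℤₚ.≟ 0ℤ) ℕ.* hdiv K (N ℕ.* abs c))
      ≡⟨ cong (∑ⁿ X (λ p → indⁿ (sgn? p)) ℕ.*_) (trans (∑ⁿ-cartesian (rng R) (rng R) _)
           (trans (∑ⁿ-cong (rng R) (λ b → ∑ⁿ-*ˡ (rng R) (indⁿ (b ℤₚ.≟ 0ℤ)) _)) (∑ⁿ-*ʳ (rng R) _ _))) ⟩
    ∑ⁿ X (λ p → indⁿ (sgn? p)) ℕ.* (∑ⁿ (rng R) (λ b → indⁿ (b ℤₚ.≟ 0ℤ)) ℕ.* ∑ⁿ (rng R) (λ c → hdiv K (N ℕ.* abs c)))
      ≤⟨ ℕₚ.*-mono-≤ sgn-count (ℕₚ.*-mono-≤ (mult-rng R 0ℤ) unipotent-sum) ⟩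
    8 ℕ.* (2 ℕ.* (2 ℕ.* (K ℕ.+ suc ℓ ℕ.* E′)))
      ≡⟨ l (K ℕ.+ suc ℓ ℕ.* E′) ⟩
    32 ℕ.* (K ℕ.+ suc ℓ ℕ.* E′) ∎
    where
    l : ∀ x → 8 ℕ.* (2 ℕ.* (2 ℕ.* x)) ≡ 32 ℕ.* x
    l = solveℕ-∀

  S₂≡S₁ : ∑ⁿ X (λ p → ∑ⁿ X (P₂ p)) ≡ ∑ⁿ X (λ p → ∑ⁿ X (P₁ p))
  S₂≡S₁ = ∑ⁿ-cong X (λ p → trans (∑ⁿ-cartesian (rng R) (rng R) _) (trans (∑ⁿ-swap (rng R) (rng R) _) (sym (∑ⁿ-cartesian (rng R) (rng R) _))))

  signs : List ℤ
  signs = 1ℤ ∷ -[1+ 0 ] ∷ []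

  signed : ∀ x → Σ ℤ λ σ → σ ∈ signs × x ≡ σ * + abs x
  signed (+ m)      = 1ℤ , here refl , sym (ℤₚ.*-identityˡ (+ m))
  signed (-[1+ m ]) = -[1+ 0 ] , there (here refl) , sym (ℤₚ.-1*i≡-i (+ suc m))

  -- The product b c is the nonzero m = (a d - 1) / N², and |m| ≤ B because 2 |m| ≤ |m| N² ≤ R² + 1.
  -- The factor 16 is 4 choices of signs times the multiplicity 4 of pairs.
  few-hyp : ∀ a d → a ∈ rng R → d ∈ rng R → Big a d → ∑ⁿ X (λ q → indⁿ (hyp? a d q)) ℕ.≤ 16 ℕ.* λ′
  few-hyp a d a∈ d∈ ((divides m em , _) , (nad , _)) with few (abs m) m>0 m≤
    where
    m>0 : 0 ℕ.< abs m
    m>0 = ℕₚ.n≢0⇒n>0 (λ z → nad (ℤₚ.i-j≡0⇒i≡j (a * d) 1ℤ (trans em (cong (_* (+ N * + N)) (ℤₚ.∣i∣≡0⇒i≡0 {m} z)))))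
    big : abs m ℕ.* (N ℕ.* N) ℕ.≤ R ℕ.* R ℕ.+ 1
    big = ℕₚ.≤-trans (ℕₚ.≤-reflexive (trans (cong (abs m ℕ.*_) (sym (ℤₚ.abs-* (+ N) (+ N)))) (trans (sym (ℤₚ.abs-* m (+ N * + N))) (cong abs (sym em)))))
      (ℕₚ.≤-trans (ℤₚ.∣i-j∣≤∣i∣+∣j∣ (a * d) 1ℤ) (ℕₚ.+-monoˡ-≤ 1 (ℕₚ.≤-trans (ℕₚ.≤-reflexive (ℤₚ.abs-* a d)) (ℕₚ.*-mono-≤ (∈-rng⁻ a∈) (∈-rng⁻ d∈)))))
    m≤ : abs m ℕ.≤ B
    m≤ = ℕₚ.≤-trans (ℕₚ.*-cancelʳ-≤ (abs m) (R ℕ.* R) 2 (begin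
      abs m ℕ.* 2           ≤⟨ ℕₚ.*-monoʳ-≤ (abs m) (ℕₚ.≤-trans 2≤N (ℕₚ.m≤m*n N N)) ⟩
      abs m ℕ.* (N ℕ.* N)   ≤⟨ big ⟩
      R ℕ.* R ℕ.+ 1         ≤⟨ ℕₚ.+-monoʳ-≤ (R ℕ.* R) (ℕₚ.*-mono-≤ 1≤R 1≤R) ⟩
      R ℕ.* R ℕ.+ R ℕ.* R   ≡⟨ l (R ℕ.* R) ⟩
      R ℕ.* R ℕ.* 2 ∎)) R²≤B
      where
      l : ∀ x → x ℕ.+ x ≡ x ℕ.* 2
      l = solveℕ-∀
  ... | (fs , comp , len≤) = ℕₚ.≤-trans (cover (hyp? a d) _≟V_ X ys h 4 (mult-rng² R) cov)
        (ℕₚ.≤-trans (ℕₚ.≤-reflexive (cong (ℕ._* 4) len)) (ℕₚ.≤-trans (ℕₚ.≤-reflexive (l (length fs))) (ℕₚ.*-monoʳ-≤ 16 len≤)))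
    where
    ss : List (ℤ × ℤ)
    ss = cartesianProduct signs signs
    ys : List ((ℤ × ℤ) × (ℕ × ℕ))
    ys = cartesianProduct ss fs
    h : (ℤ × ℤ) × (ℕ × ℕ) → V
    h ((σ , τ) , (e , f)) = (σ * + e , τ * + f)
    len-cart : ∀ {A B : Set} (xs : List A) (zs : List B) → length (cartesianProduct xs zs) ≡ length xs ℕ.* length zs
    len-cart []       zs = refl
    len-cart (x ∷ xs) zs = trans (length-++ (map (x ,_) zs)) (cong₂ ℕ._+_ (length-map (x ,_) zs) (len-cart xs zs))
    len : length ys ≡ 4 ℕ.* length fs
    len = len-cart ss fs
    l : ∀ x → 4 ℕ.* x ℕ.* 4 ≡ 16 ℕ.* x
    l = solveℕ-∀
    cov : ∀ q → q ∈ X → Hyp a d q → Σ ((ℤ × ℤ) × (ℕ × ℕ)) λ y → y ∈ ys × q ≡ h y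
    cov (b , c) _ hy with signed b | signed c
    ... | (σ , σ∈ , eb) | (τ , τ∈ , ec) = ((σ , τ) , (abs b , abs c)) ,
          ∈-cartesianProduct⁺ (∈-cartesianProduct⁺ σ∈ τ∈) (comp (abs b) (abs c) (trans (sym (ℤₚ.abs-* b c)) (cong abs bc≡m))) , cong₂ _,_ eb ec
      where
      bc≡m : b * c ≡ m
      bc≡m = ℤₚ.*-cancelˡ-≡ (+ N * + N) (b * c) m {{ℤₚ.i*j≢0 (+ N) (+ N)}} (trans hy (trans em (ℤₚ.*-comm m (+ N * + N))))

  Base : ℕ → Set
  Base i = + N ∣ + i * + i - 1ℤ × N ℕ.≤ i

  base? : ∀ i → Dec (Base i)
  base? i = (+ N ∣? (+ i * + i - 1ℤ)) ×-dec (N ℕₚ.≤? i)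

  -- N² divides the nonzero number a d - 1 and |d| ≤ |a|, so N² ≤ a² + 1 and hence N ≤ |a|. This
  -- excludes the block |a| < N, where the weight K / |a| would be too large.
  Big⇒Base : ∀ a d → Big a d → Base (abs a)
  Big⇒Base a d ((n²@(divides m em) , nd) , (nad , le)) =
    ∣-via (Div.∣m∣n⇒∣m+n (Div.∣-trans (divides (+ N) refl) n²) (Div.∣n⇒∣m*n a nd)) (trans (l a d) (cong (λ t → t - 1ℤ) (sym (square-abs a)))) ,
    ℕₚ.≮⇒≥ contra
    where
    l : ∀ a d → (a * d - 1ℤ) + a * (a - d) ≡ a * a - 1ℤ
    l = solve-∀
    contra : abs a ℕ.< N → ⊥
    contra lt = ℕₚ.<⇒≱ small big
      where
      m≥1 : 1 ℕ.≤ abs m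
      m≥1 = ℕₚ.n≢0⇒n>0 (λ z → nad (ℤₚ.i-j≡0⇒i≡j (a * d) 1ℤ (trans em (cong (_* (+ N * + N)) (ℤₚ.∣i∣≡0⇒i≡0 {m} z)))))
      big : N ℕ.* N ℕ.≤ abs a ℕ.* abs a ℕ.+ 1
      big = begin
        N ℕ.* N                ≤⟨ ℕₚ.m≤n*m (N ℕ.* N) (abs m) {{ℕ.>-nonZero m≥1}} ⟩
        abs m ℕ.* (N ℕ.* N)    ≡⟨ trans (cong (abs m ℕ.*_) (sym (ℤₚ.abs-* (+ N) (+ N)))) (trans (sym (ℤₚ.abs-* m (+ N * + N))) (cong abs (sym em))) ⟩
        abs (a * d - 1ℤ)       ≤⟨ ℤₚ.∣i-j∣≤∣i∣+∣j∣ (a * d) 1ℤ ⟩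
        abs (a * d) ℕ.+ 1      ≤⟨ ℕₚ.+-monoˡ-≤ 1 (ℕₚ.≤-trans (ℕₚ.≤-reflexive (ℤₚ.abs-* a d)) (ℕₚ.*-monoʳ-≤ (abs a) le)) ⟩
        abs a ℕ.* abs a ℕ.+ 1 ∎
      small : abs a ℕ.* abs a ℕ.+ 1 ℕ.< N ℕ.* N
      small = ℕₚ.≤-trans (ℕₚ.≤-trans (ℕₚ.≤-reflexive (l₁ (abs a ℕ.* abs a))) (ℕₚ.+-monoʳ-≤ (abs a ℕ.* abs a) (ℕₚ.≤-trans 2≤2a+1 (ℕₚ.≤-refl))))
                (ℕₚ.≤-trans (ℕₚ.≤-reflexive (l₂ (abs a))) (ℕₚ.*-mono-≤ lt lt))
        where
        l₁ : ∀ x → suc (x ℕ.+ 1) ≡ x ℕ.+ 2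
        l₁ = solveℕ-∀
        l₂ : ∀ x → x ℕ.* x ℕ.+ (1 ℕ.+ (x ℕ.+ x)) ≡ suc x ℕ.* suc x
        l₂ = solveℕ-∀
        a≥1 : 1 ℕ.≤ abs a
        a≥1 = ℕₚ.n≢0⇒n>0 (λ z → N∤1 (subst (λ t → N ℕ.* N ℕ.≤ t ℕ.* t ℕ.+ 1) z big))
          where
          N∤1 : N ℕ.* N ℕ.≤ 1 → ⊥
          N∤1 h = ℕₚ.<⇒≱ (ℕ.s≤s (ℕ.s≤s ℕ.z≤n)) (ℕₚ.≤-trans (ℕₚ.*-mono-≤ 2≤N 2≤N) h)
        2≤2a+1 : 2 ℕ.≤ 1 ℕ.+ (abs a ℕ.+ abs a)
        2≤2a+1 = ℕ.s≤s (ℕₚ.≤-trans a≥1 (ℕₚ.m≤m+n _ _))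

  -- Modulo N² the number d is the inverse of a, so with |d| ≤ |a| there are about 1 + 2 |a| / N² of
  -- them. Multiplied by the weight K / |a|, the second term becomes 2K / N², which no longer
  -- depends on a.
  d-count : ∀ a → hdiv K (abs a) ℕ.* ∑ⁿ (rng R) (λ d → indⁿ (big? a d)) ℕ.≤ 4 ℕ.* hdiv K (abs a) ℕ.+ 4 ℕ.* U
  d-count a = begin
    h ℕ.* ∑ⁿ (rng R) (λ d → indⁿ (big? a d))
      ≤⟨ ℕₚ.*-monoʳ-≤ h (ℕₚ.≤-trans (cover-by-one (big? a) ℤₚ._≟_ (rng R) (rng Tₐ) (λ z t → z + t * (+ N * + N)) 2 (mult-rng R) cov)
           (ℕₚ.≤-reflexive (cong (ℕ._* 2) (length-rng Tₐ)))) ⟩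
    h ℕ.* (2 ℕ.* suc Tₐ ℕ.* 2)       ≡⟨ l₁ h Tₐ ⟩
    4 ℕ.* h ℕ.+ 4 ℕ.* (h ℕ.* Tₐ)     ≤⟨ ℕₚ.+-monoʳ-≤ (4 ℕ.* h) (ℕₚ.*-monoʳ-≤ 4 hT≤U) ⟩
    4 ℕ.* h ℕ.+ 4 ℕ.* U ∎
    where
    h = hdiv K (abs a)
    Tₐ = hdiv (2 ℕ.* abs a) (N ℕ.* N)
    N²≢0 : N ℕ.* N ≡ 0 → ⊥
    N²≢0 z = ℕ.≢-nonZero⁻¹ N ([ id , id ]′ (ℕₚ.m*n≡0⇒m≡0∨n≡0 N z))
    l₁ : ∀ h t → h ℕ.* (2 ℕ.* suc t ℕ.* 2) ≡ 4 ℕ.* h ℕ.+ 4 ℕ.* (h ℕ.* t)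
    l₁ = solveℕ-∀
    hT≤U : h ℕ.* Tₐ ℕ.≤ U
    hT≤U = hdiv-intro (2 ℕ.* K) (N ℕ.* N) (h ℕ.* Tₐ) (begin
      N ℕ.* N ℕ.* (h ℕ.* Tₐ)    ≡⟨ l₂ (N ℕ.* N) h Tₐ ⟩
      h ℕ.* (N ℕ.* N ℕ.* Tₐ)    ≤⟨ ℕₚ.*-monoʳ-≤ h (hdiv-elim (2 ℕ.* abs a) (N ℕ.* N)) ⟩
      h ℕ.* (2 ℕ.* abs a)       ≡⟨ l₃ h (abs a) ⟩
      2 ℕ.* (abs a ℕ.* h)       ≤⟨ ℕₚ.*-monoʳ-≤ 2 (hdiv-elim K (abs a)) ⟩
      2 ℕ.* K ∎) (λ z → ⊥-elim (N²≢0 z))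
      where
      l₂ : ∀ a b c → a ℕ.* (b ℕ.* c) ≡ b ℕ.* (a ℕ.* c)
      l₂ = solveℕ-∀
      l₃ : ∀ a b → a ℕ.* (2 ℕ.* b) ≡ 2 ℕ.* (b ℕ.* a)
      l₃ = solveℕ-∀
    cov : ∀ z x → z ∈ rng R → x ∈ rng R → Big a z → Big a x → Σ ℤ λ t → t ∈ rng Tₐ × x ≡ z + t * (+ N * + N)
    cov z x _ _ ((nz , _) , (_ , lz)) ((nx , _) , (_ , lx)) = quot dd
      where
      l : ∀ a z x → z * ((a * x - 1ℤ) - (a * z - 1ℤ)) - (a * z - 1ℤ) * (x - z) ≡ x - z
      l = solve-∀
      dd : + N * + N ∣ x - z
      dd = ∣-via (Div.∣m∣n⇒∣m-n (Div.∣n⇒∣m*n z (Div.∣m∣n⇒∣m-n nx nz)) (Div.∣m⇒∣m*n (x - z) nz)) (l a z x)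
      quot : + N * + N ∣ x - z → Σ ℤ λ t → t ∈ rng Tₐ × x ≡ z + t * (+ N * + N)
      quot (divides t et) = t , ∈-rng⁺ t (hdiv-intro (2 ℕ.* abs a) (N ℕ.* N) (abs t) small (λ z → ⊥-elim (N²≢0 z))) , trans (l₄ x z) (+-congˡ z et)
        where
        l₄ : ∀ x z → x ≡ z + (x - z)
        l₄ = solve-∀
        small : N ℕ.* N ℕ.* abs t ℕ.≤ 2 ℕ.* abs a
        small = begin
          N ℕ.* N ℕ.* abs t           ≡⟨ trans (ℕₚ.*-comm (N ℕ.* N) (abs t)) (trans (cong (abs t ℕ.*_) (sym (ℤₚ.abs-* (+ N) (+ N)))) (trans (sym (ℤₚ.abs-* t (+ N * + N))) (cong abs (sym et)))) ⟩
          abs (x - z)                 ≤⟨ ℤₚ.∣i-j∣≤∣i∣+∣j∣ x z ⟩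
          abs x ℕ.+ abs z             ≤⟨ ℕₚ.+-mono-≤ lx lz ⟩
          abs a ℕ.+ abs a             ≡⟨ cong (abs a ℕ.+_) (sym (ℕₚ.+-identityʳ (abs a))) ⟩
          2 ℕ.* abs a ∎

  R<QN : suc R ℕ.≤ Q ℕ.* N
  R<QN = ℕₚ.≤-trans (ℕₚ.≤-reflexive (cong suc (m≡m%n+[m/n]*n R N))) (ℕₚ.+-monoˡ-≤ ((R / N) ℕ.* N) (m%n<n R N))

  -- The range is cut into Q blocks of length N. Each block contains at most 3 λ′ square roots of 1,
  -- and in block k the weight is at most E′ / k, which sums harmonically. The constant is 2 signs ·
  -- 3 · 4.
  a-sum : ∑ⁿ (rng R) (λ a → indⁿ (base? (abs a)) ℕ.* (4 ℕ.* hdiv K (abs a) ℕ.+ 4 ℕ.* U)) ℕ.≤ 24 ℕ.* λ′ ℕ.* (suc ℓ ℕ.* E′ ℕ.+ Q ℕ.* U)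
  a-sum = begin
    ∑ⁿ (rng R) (λ a → F (abs a))
      ≡⟨ ∑-rng-abs R F ⟩
    2 ℕ.* ∑ⁿ (applyUpTo id (suc R)) F
      ≤⟨ ℕₚ.*-monoʳ-≤ 2 (upTo-mono R<QN F) ⟩
    2 ℕ.* ∑ⁿ (applyUpTo id (Q ℕ.* N)) F
      ≡⟨ cong (2 ℕ.*_) (∑ⁿ-blocks N Q F) ⟩
    2 ℕ.* ∑ⁿ (applyUpTo id Q) (λ k → ∑ⁿ (applyUpTo id N) (λ t → F (k ℕ.* N ℕ.+ t)))
      ≤⟨ ℕₚ.*-monoʳ-≤ 2 (∑ⁿ-mono (applyUpTo id Q) (λ k → ℕₚ.≤-trans (∑ⁿ-mono∈ (applyUpTo id N) (λ t t∈ → pt k t t∈)) (ℕₚ.≤-reflexive (∑ⁿ-*ʳ (applyUpTo id N) (G k) _)))) ⟩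
    2 ℕ.* ∑ⁿ (applyUpTo id Q) (λ k → ∑ⁿ (applyUpTo id N) (λ t → indⁿ (root? t)) ℕ.* G k)
      ≡⟨ cong (2 ℕ.*_) (∑ⁿ-*ˡ (applyUpTo id Q) (∑ⁿ (applyUpTo id N) (λ t → indⁿ (root? t))) G) ⟩
    2 ℕ.* (∑ⁿ (applyUpTo id N) (λ t → indⁿ (root? t)) ℕ.* ∑ⁿ (applyUpTo id Q) G)
      ≤⟨ ℕₚ.*-monoʳ-≤ 2 (ℕₚ.*-mono-≤ (ℕₚ.≤-trans root-count (ℕₚ.*-monoʳ-≤ 3 (proj₂ (proj₂ fewN)))) Gsum) ⟩
    2 ℕ.* (3 ℕ.* λ′ ℕ.* (4 ℕ.* (suc ℓ ℕ.* E′) ℕ.+ Q ℕ.* (4 ℕ.* U)))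
      ≡⟨ l λ′ (suc ℓ ℕ.* E′) Q U ⟩
    24 ℕ.* λ′ ℕ.* (suc ℓ ℕ.* E′ ℕ.+ Q ℕ.* U) ∎
    where
    fewN = few N (ℕₚ.≤-trans (ℕ.s≤s ℕ.z≤n) 2≤N) N≤B
    root? = Roots.root? N 2≤N (proj₁ fewN) (proj₁ (proj₂ fewN))
    root-count = Roots.root-count N 2≤N (proj₁ fewN) (proj₁ (proj₂ fewN))
    F : ℕ → ℕ
    F i = indⁿ (base? i) ℕ.* (4 ℕ.* hdiv K i ℕ.+ 4 ℕ.* U)
    G : ℕ → ℕ
    G k = 4 ℕ.* hdiv E′ k ℕ.+ 4 ℕ.* U
    l : ∀ x y q u → 2 ℕ.* (3 ℕ.* x ℕ.* (4 ℕ.* y ℕ.+ q ℕ.* (4 ℕ.* u))) ≡ 24 ℕ.* x ℕ.* (y ℕ.+ q ℕ.* u)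
    l = solveℕ-∀
    upTo-mono : ∀ {m m′} → m ℕ.≤ m′ → ∀ F → ∑ⁿ (applyUpTo id m) F ℕ.≤ ∑ⁿ (applyUpTo id m′) F
    upTo-mono {m} {m′} le F = subst (λ k → ∑ⁿ (applyUpTo id m) F ℕ.≤ ∑ⁿ (applyUpTo id k) F) (ℕₚ.m+[n∸m]≡n le)
      (ℕₚ.≤-trans (ℕₚ.m≤m+n _ _) (ℕₚ.≤-reflexive (sym (∑ⁿ-upTo-split id m (m′ ℕ.∸ m) F))))
    root-shift : ∀ k t → + N ∣ + (k ℕ.* N ℕ.+ t) * + (k ℕ.* N ℕ.+ t) - 1ℤ → + N ∣ + t * + t - 1ℤ
    root-shift k t d = ∣-via (Div.∣m∣n⇒∣m-n d (divides (+ k * (+ k * + N + + 2 * + t)) refl))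
      (trans (cong (λ z → z * z - 1ℤ - + k * (+ k * + N + + 2 * + t) * + N) (trans (ℤₚ.pos-+ (k ℕ.* N) t) (cong (_+ + t) (ℤₚ.pos-* k N)))) (l′ (+ k) (+ N) (+ t)))
      where
      l′ : ∀ k n t → (k * n + t) * (k * n + t) - 1ℤ - k * (k * n + + 2 * t) * n ≡ t * t - 1ℤ
      l′ = solve-∀
    hb : ∀ k t → t ℕ.< N → N ℕ.≤ k ℕ.* N ℕ.+ t → hdiv K (k ℕ.* N ℕ.+ t) ℕ.≤ hdiv E′ k
    hb zero    t t<N le = ⊥-elim (ℕₚ.<⇒≱ t<N le)
    hb (suc k) t t<N le = ℕₚ.≤-trans (hdiv-intro K (N ℕ.* suc k) (hdiv K (suc k ℕ.* N ℕ.+ t))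
        (ℕₚ.≤-trans (ℕₚ.*-monoˡ-≤ (hdiv K (suc k ℕ.* N ℕ.+ t)) (ℕₚ.≤-trans (ℕₚ.≤-reflexive (ℕₚ.*-comm N (suc k))) (ℕₚ.m≤m+n (suc k ℕ.* N) t)))
           (hdiv-elim K (suc k ℕ.* N ℕ.+ t)))
        (λ z → ⊥-elim (ℕ.≢-nonZero⁻¹ (N ℕ.* suc k) {{ℕₚ.m*n≢0 N (suc k)}} z))) (hdiv-N k)
    pt : ∀ k t → t ∈ applyUpTo id N → F (k ℕ.* N ℕ.+ t) ℕ.≤ indⁿ (root? t) ℕ.* G k
    pt k t t∈ = ℕₚ.≤-trans (indⁿ-mono (base? i) {b = G k} (λ (_ , N≤i) → ℕₚ.+-monoˡ-≤ (4 ℕ.* U) (ℕₚ.*-monoʳ-≤ 4 (hb k t (∈-upTo⇒< t∈) N≤i))))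
          (ℕₚ.*-monoˡ-≤ (G k) (indⁿ-≤ (base? i) (root? t) (λ (r , _) → root-shift k t r)))
      where i = k ℕ.* N ℕ.+ t
    Gsum : ∑ⁿ (applyUpTo id Q) G ℕ.≤ 4 ℕ.* (suc ℓ ℕ.* E′) ℕ.+ Q ℕ.* (4 ℕ.* U)
    Gsum = ℕₚ.≤-trans (ℕₚ.≤-reflexive (trans (∑ⁿ-+ (applyUpTo id Q) (λ k → 4 ℕ.* hdiv E′ k) (λ _ → 4 ℕ.* U)) (cong₂ ℕ._+_ (∑ⁿ-*ˡ (applyUpTo id Q) 4 (hdiv E′))
        (trans (∑ⁿ-const (applyUpTo id Q) (4 ℕ.* U)) (cong (ℕ._* (4 ℕ.* U)) (length-applyUpTo id Q))))))
      (ℕₚ.+-monoˡ-≤ (Q ℕ.* (4 ℕ.* U)) (ℕₚ.*-monoʳ-≤ 4 (ℕₚ.≤-trans (upTo-mono (ℕ.s≤s (m/n≤m′ R N)) (hdiv E′)) (harmonic-R E′))))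
      where
      m/n≤m′ : ∀ m n .{{_ : ℕ.NonZero n}} → m / n ℕ.≤ m
      m/n≤m′ m n = ℕₚ.≤-trans (ℕₚ.m≤m*n (m / n) n) (m/n*n≤m m n)

  S₃≤ : ∑ⁿ X (λ (a , d) → ∑ⁿ X (P₃ a d)) ℕ.≤ 384 ℕ.* (λ′ ℕ.* λ′) ℕ.* (suc ℓ ℕ.* E′ ℕ.+ Q ℕ.* U)
  S₃≤ = begin
    ∑ⁿ X (λ (a , d) → ∑ⁿ X (P₃ a d))
      ≤⟨ ∑ⁿ-mono∈ X (λ (a , d) p∈ → inner a d p∈) ⟩
    ∑ⁿ X (λ (a , d) → indⁿ (big? a d) ℕ.* hdiv K (abs a) ℕ.* (16 ℕ.* λ′))
      ≡⟨ trans (∑ⁿ-*ʳ X (16 ℕ.* λ′) _) (cong (ℕ._* (16 ℕ.* λ′)) (trans (∑ⁿ-cartesian (rng R) (rng R) _)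
           (∑ⁿ-cong (rng R) (λ a → trans (∑ⁿ-*ʳ (rng R) (hdiv K (abs a)) _) (ℕₚ.*-comm _ (hdiv K (abs a))))))) ⟩
    ∑ⁿ (rng R) (λ a → hdiv K (abs a) ℕ.* ∑ⁿ (rng R) (λ d → indⁿ (big? a d))) ℕ.* (16 ℕ.* λ′)
      ≤⟨ ℕₚ.*-monoˡ-≤ (16 ℕ.* λ′) (ℕₚ.≤-trans (∑ⁿ-mono (rng R) gate) a-sum) ⟩
    24 ℕ.* λ′ ℕ.* (suc ℓ ℕ.* E′ ℕ.+ Q ℕ.* U) ℕ.* (16 ℕ.* λ′)
      ≡⟨ l λ′ (suc ℓ ℕ.* E′ ℕ.+ Q ℕ.* U) ⟩
    384 ℕ.* (λ′ ℕ.* λ′) ℕ.* (suc ℓ ℕ.* E′ ℕ.+ Q ℕ.* U) ∎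
    where
    l : ∀ x y → 24 ℕ.* x ℕ.* y ℕ.* (16 ℕ.* x) ≡ 384 ℕ.* (x ℕ.* x) ℕ.* y
    l = solveℕ-∀
    inner : ∀ a d → (a , d) ∈ X → ∑ⁿ X (P₃ a d) ℕ.≤ indⁿ (big? a d) ℕ.* hdiv K (abs a) ℕ.* (16 ℕ.* λ′)
    inner a d p∈ = ℕₚ.≤-trans (ℕₚ.≤-reflexive (trans (∑ⁿ-*ˡ X (i ℕ.* h) (λ q → indⁿ (hyp? a d q))) (ℕₚ.*-assoc i h S)))
        (ℕₚ.≤-trans (indⁿ-mono (big? a d) (λ b → ℕₚ.*-monoʳ-≤ h (few-hyp a d (proj₁ ∈s) (proj₂ ∈s) b))) (ℕₚ.≤-reflexive (sym (ℕₚ.*-assoc i h (16 ℕ.* λ′)))))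
      where
      i = indⁿ (big? a d)
      h = hdiv K (abs a)
      S = ∑ⁿ X (λ q → indⁿ (hyp? a d q))
      ∈s = ∈-cartesianProduct⁻ (rng R) (rng R) p∈
    gate : ∀ a → hdiv K (abs a) ℕ.* ∑ⁿ (rng R) (λ d → indⁿ (big? a d)) ℕ.≤ indⁿ (base? (abs a)) ℕ.* (4 ℕ.* hdiv K (abs a) ℕ.+ 4 ℕ.* U)
    gate a = ≤-indⁿ (base? (abs a)) (λ _ → d-count a)
      (λ nb → trans (cong (hdiv K (abs a) ℕ.*_) (∑ⁿ-zero∈ (rng R) (λ d _ → indⁿ-no (big? a d) (λ b → nb (Big⇒Base a d b))))) (ℕₚ.*-zeroʳ (hdiv K (abs a))))

  S₄≡S₃ : ∑ⁿ X (λ (a , d) → ∑ⁿ X (P₃ d a)) ≡ ∑ⁿ X (λ (a , d) → ∑ⁿ X (P₃ a d))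
  S₄≡S₃ = trans (∑ⁿ-cartesian (rng R) (rng R) _) (trans (∑ⁿ-swap (rng R) (rng R) _) (sym (∑ⁿ-cartesian (rng R) (rng R) _)))

  Z≤ : Z ℕ.≤ 64 ℕ.* (K ℕ.+ suc ℓ ℕ.* E′) ℕ.+ 768 ℕ.* (λ′ ℕ.* λ′) ℕ.* (suc ℓ ℕ.* E′ ℕ.+ Q ℕ.* U)
  Z≤ = begin
    Z ≤⟨ Z≤T ⟩
    ∑ⁿ X (λ p → ∑ⁿ X (T p))
      ≤⟨ ∑ⁿ-mono X (λ p → ∑ⁿ-mono X (T≤ p)) ⟩
    ∑ⁿ X (λ p → ∑ⁿ X (λ q → (P₁ p q ℕ.+ P₂ p q) ℕ.+ (P₃ (proj₁ p) (proj₂ p) q ℕ.+ P₃ (proj₂ p) (proj₁ p) q)))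
      ≡⟨ trans (∑ⁿ-cong X (λ p → trans (∑ⁿ-+ X _ _) (cong₂ ℕ._+_ (∑ⁿ-+ X _ _) (∑ⁿ-+ X _ _)))) (trans (∑ⁿ-+ X _ _) (cong₂ ℕ._+_ (∑ⁿ-+ X _ _) (∑ⁿ-+ X _ _))) ⟩
    (S₁ ℕ.+ ∑ⁿ X (λ p → ∑ⁿ X (P₂ p))) ℕ.+ (S₃ ℕ.+ ∑ⁿ X (λ (a , d) → ∑ⁿ X (P₃ d a)))
      ≡⟨ cong₂ (λ x y → (S₁ ℕ.+ x) ℕ.+ (S₃ ℕ.+ y)) S₂≡S₁ S₄≡S₃ ⟩
    (S₁ ℕ.+ S₁) ℕ.+ (S₃ ℕ.+ S₃)
      ≤⟨ ℕₚ.+-mono-≤ (ℕₚ.+-mono-≤ S₁≤ S₁≤) (ℕₚ.+-mono-≤ S₃≤ S₃≤) ⟩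
    _ ≡⟨ l (K ℕ.+ suc ℓ ℕ.* E′) (λ′ ℕ.* λ′) (suc ℓ ℕ.* E′ ℕ.+ Q ℕ.* U) ⟩
    64 ℕ.* (K ℕ.+ suc ℓ ℕ.* E′) ℕ.+ 768 ℕ.* (λ′ ℕ.* λ′) ℕ.* (suc ℓ ℕ.* E′ ℕ.+ Q ℕ.* U) ∎
    where
    S₁ = ∑ⁿ X (λ p → ∑ⁿ X (P₁ p))
    S₃ = ∑ⁿ X (λ (a , d) → ∑ⁿ X (P₃ a d))
    l : ∀ x y z → (32 ℕ.* x ℕ.+ 32 ℕ.* x) ℕ.+ (384 ℕ.* y ℕ.* z ℕ.+ 384 ℕ.* y ℕ.* z) ≡ 64 ℕ.* x ℕ.+ 768 ℕ.* y ℕ.* z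
    l = solveℕ-∀

  -- Denominators are cleared by N³: the term N³ is the diagonal contribution K, and R enters only
  -- as R / N³. It is this last term that limits the length of the words.
  scalar-count : Z ℕ.* (N ℕ.* N ℕ.* N) ℕ.≤
    K ℕ.* (64 ℕ.* (N ℕ.* N ℕ.* N ℕ.+ suc ℓ ℕ.* (N ℕ.* N)) ℕ.+ 768 ℕ.* (λ′ ℕ.* λ′) ℕ.* (suc ℓ ℕ.* (N ℕ.* N) ℕ.+ 2 ℕ.* (R ℕ.+ N)))
  scalar-count = begin
    Z ℕ.* (N ℕ.* N ℕ.* N)
      ≤⟨ ℕₚ.*-monoˡ-≤ (N ℕ.* N ℕ.* N) Z≤ ⟩
    (64 ℕ.* (K ℕ.+ suc ℓ ℕ.* E′) ℕ.+ 768 ℕ.* Λ ℕ.* (suc ℓ ℕ.* E′ ℕ.+ Q ℕ.* U)) ℕ.* (N ℕ.* N ℕ.* N)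
      ≡⟨ l₁ K (suc ℓ) E′ Λ Q U N ⟩
    64 ℕ.* (K ℕ.* (N ℕ.* N ℕ.* N) ℕ.+ suc ℓ ℕ.* (N ℕ.* N) ℕ.* (N ℕ.* E′)) ℕ.+ 768 ℕ.* Λ ℕ.* (suc ℓ ℕ.* (N ℕ.* N) ℕ.* (N ℕ.* E′) ℕ.+ Q ℕ.* N ℕ.* (N ℕ.* N ℕ.* U))
      ≤⟨ ℕₚ.+-mono-≤ (ℕₚ.*-monoʳ-≤ 64 (ℕₚ.+-monoʳ-≤ (K ℕ.* (N ℕ.* N ℕ.* N)) (ℕₚ.*-monoʳ-≤ (suc ℓ ℕ.* (N ℕ.* N)) E′-K)))
           (ℕₚ.*-monoʳ-≤ (768 ℕ.* Λ) (ℕₚ.+-mono-≤ (ℕₚ.*-monoʳ-≤ (suc ℓ ℕ.* (N ℕ.* N)) E′-K) (ℕₚ.*-mono-≤ QN≤ (hdiv-elim (2 ℕ.* K) (N ℕ.* N))))) ⟩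
    64 ℕ.* (K ℕ.* (N ℕ.* N ℕ.* N) ℕ.+ suc ℓ ℕ.* (N ℕ.* N) ℕ.* K) ℕ.+ 768 ℕ.* Λ ℕ.* (suc ℓ ℕ.* (N ℕ.* N) ℕ.* K ℕ.+ (R ℕ.+ N) ℕ.* (2 ℕ.* K))
      ≡⟨ l₂ K (suc ℓ) Λ N R ⟩
    K ℕ.* (64 ℕ.* (N ℕ.* N ℕ.* N ℕ.+ suc ℓ ℕ.* (N ℕ.* N)) ℕ.+ 768 ℕ.* Λ ℕ.* (suc ℓ ℕ.* (N ℕ.* N) ℕ.+ 2 ℕ.* (R ℕ.+ N))) ∎
    where
    Λ = λ′ ℕ.* λ′
    QN≤ : Q ℕ.* N ℕ.≤ R ℕ.+ N
    QN≤ = ℕₚ.≤-trans (ℕₚ.+-monoʳ-≤ N (m/n*n≤m R N)) (ℕₚ.≤-reflexive (ℕₚ.+-comm N R))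
    l₁ : ∀ K l E Λ Q U N → (64 ℕ.* (K ℕ.+ l ℕ.* E) ℕ.+ 768 ℕ.* Λ ℕ.* (l ℕ.* E ℕ.+ Q ℕ.* U)) ℕ.* (N ℕ.* N ℕ.* N) ≡
      64 ℕ.* (K ℕ.* (N ℕ.* N ℕ.* N) ℕ.+ l ℕ.* (N ℕ.* N) ℕ.* (N ℕ.* E)) ℕ.+ 768 ℕ.* Λ ℕ.* (l ℕ.* (N ℕ.* N) ℕ.* (N ℕ.* E) ℕ.+ Q ℕ.* N ℕ.* (N ℕ.* N ℕ.* U))
    l₁ = solveℕ-∀
    l₂ : ∀ K l Λ N R → 64 ℕ.* (K ℕ.* (N ℕ.* N ℕ.* N) ℕ.+ l ℕ.* (N ℕ.* N) ℕ.* K) ℕ.+ 768 ℕ.* Λ ℕ.* (l ℕ.* (N ℕ.* N) ℕ.* K ℕ.+ (R ℕ.+ N) ℕ.* (2 ℕ.* K)) ≡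
      K ℕ.* (64 ℕ.* (N ℕ.* N ℕ.* N ℕ.+ l ℕ.* (N ℕ.* N)) ℕ.+ 768 ℕ.* Λ ℕ.* (l ℕ.* (N ℕ.* N) ℕ.+ 2 ℕ.* (R ℕ.+ N)))
    l₂ = solveℕ-∀

-- Size of the ball

-- The bound is 3/4 - 1/n for the sum of 1/k² over 2 ≤ k ≤ n, with n = m + 2 and cleared
-- denominators. It is exact at n = 2, and the step is 1/(n + 1)² ≤ 1/n - 1/(n + 1).
∑-squares : ∀ ρ m → 4 ℕ.* (2 ℕ.+ m) ℕ.* ∑ⁿ (applyUpTo (2 ℕ.+_) (suc m)) (λ k → hdiv ρ k ℕ.* hdiv ρ k) ℕ.≤ (3 ℕ.* m ℕ.+ 2) ℕ.* (ρ ℕ.* ρ)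
∑-squares ρ zero = begin
  8 ℕ.* (x ℕ.* x ℕ.+ 0)               ≡⟨ l x ⟩
  2 ℕ.* ((2 ℕ.* x) ℕ.* (2 ℕ.* x))     ≤⟨ ℕₚ.*-monoʳ-≤ 2 (ℕₚ.*-mono-≤ (hdiv-elim ρ 2) (hdiv-elim ρ 2)) ⟩
  2 ℕ.* (ρ ℕ.* ρ) ∎
  where
  open ℕₚ.≤-Reasoning
  x = hdiv ρ 2
  l : ∀ x → 8 ℕ.* (x ℕ.* x ℕ.+ 0) ≡ 2 ℕ.* ((2 ℕ.* x) ℕ.* (2 ℕ.* x))
  l = solveℕ-∀
∑-squares ρ (suc m) = ℕₚ.*-cancelʳ-≤ _ _ (2 ℕ.+ m) (begin
  4 ℕ.* (3 ℕ.+ m) ℕ.* ∑ⁿ (applyUpTo (2 ℕ.+_) (suc (suc m))) F ℕ.* (2 ℕ.+ m)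
    ≡⟨ cong (λ t → 4 ℕ.* (3 ℕ.+ m) ℕ.* t ℕ.* (2 ℕ.+ m)) (∑ⁿ-last (2 ℕ.+_) (suc m) F) ⟩
  4 ℕ.* (3 ℕ.+ m) ℕ.* (S ℕ.+ x ℕ.* x) ℕ.* (2 ℕ.+ m)
    ≡⟨ l₁ m S x ⟩
  (3 ℕ.+ m) ℕ.* (4 ℕ.* (2 ℕ.+ m) ℕ.* S) ℕ.+ 4 ℕ.* ((2 ℕ.+ m) ℕ.* (3 ℕ.+ m) ℕ.* (x ℕ.* x))
    ≤⟨ ℕₚ.+-mono-≤ (ℕₚ.*-monoʳ-≤ (3 ℕ.+ m) (∑-squares ρ m)) (ℕₚ.*-monoʳ-≤ 4 (begin
         (2 ℕ.+ m) ℕ.* (3 ℕ.+ m) ℕ.* (x ℕ.* x)        ≤⟨ ℕₚ.*-monoˡ-≤ (x ℕ.* x) (ℕₚ.*-monoˡ-≤ (3 ℕ.+ m) (ℕₚ.n≤1+n (2 ℕ.+ m))) ⟩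
         (3 ℕ.+ m) ℕ.* (3 ℕ.+ m) ℕ.* (x ℕ.* x)        ≡⟨ l₂ (3 ℕ.+ m) x ⟩
         ((3 ℕ.+ m) ℕ.* x) ℕ.* ((3 ℕ.+ m) ℕ.* x)      ≤⟨ ℕₚ.*-mono-≤ (hdiv-elim ρ (3 ℕ.+ m)) (hdiv-elim ρ (3 ℕ.+ m)) ⟩
         ρ ℕ.* ρ ∎)) ⟩
  (3 ℕ.+ m) ℕ.* ((3 ℕ.* m ℕ.+ 2) ℕ.* (ρ ℕ.* ρ)) ℕ.+ 4 ℕ.* (ρ ℕ.* ρ)
    ≡⟨ l₃ m (ρ ℕ.* ρ) ⟩
  (3 ℕ.* suc m ℕ.+ 2) ℕ.* (ρ ℕ.* ρ) ℕ.* (2 ℕ.+ m) ∎)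
  where
  open ℕₚ.≤-Reasoning
  F = λ k → hdiv ρ k ℕ.* hdiv ρ k
  S = ∑ⁿ (applyUpTo (2 ℕ.+_) (suc m)) F
  x = hdiv ρ (3 ℕ.+ m)
  l₁ : ∀ m S x → 4 ℕ.* (3 ℕ.+ m) ℕ.* (S ℕ.+ x ℕ.* x) ℕ.* (2 ℕ.+ m) ≡ (3 ℕ.+ m) ℕ.* (4 ℕ.* (2 ℕ.+ m) ℕ.* S) ℕ.+ 4 ℕ.* ((2 ℕ.+ m) ℕ.* (3 ℕ.+ m) ℕ.* (x ℕ.* x))
  l₁ = solveℕ-∀
  l₂ : ∀ a x → a ℕ.* a ℕ.* (x ℕ.* x) ≡ (a ℕ.* x) ℕ.* (a ℕ.* x)
  l₂ = solveℕ-∀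
  l₃ : ∀ m y → (3 ℕ.+ m) ℕ.* ((3 ℕ.* m ℕ.+ 2) ℕ.* y) ℕ.+ 4 ℕ.* y ≡ (3 ℕ.* suc m ℕ.+ 2) ℕ.* y ℕ.* (2 ℕ.+ m)
  l₃ = solveℕ-∀

-- Adding multiples of (c , d) to any Bézout solution brings its first entry into the range from 0
-- to c - 1; the equation then forces the second entry to be at most d. So every coprime row of the
-- box completes to a matrix of the ball.
small-bezout : ∀ c d → 0 ℕ.< c → 0 ℕ.< d → Coprime c d → Σ V λ r → cross r (+ c , + d) ≡ 1ℤ × abs (proj₁ r) ℕ.≤ c × abs (proj₂ r) ℕ.≤ d
small-bezout (suc c₀) d _ 0<d cop = reduce (raw (coprime-Bézout cop))
  where
  c = suc c₀
  raw : Bézout.Identity 1 c d → Σ V λ r → cross r (+ c , + d) ≡ 1ℤ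
  raw (Bézout.-+ x y eq) = (+ y , + x) , trans (cong₂ _-_ (sym (ℤₚ.pos-* y d)) (sym (ℤₚ.pos-* x c)))
      (trans (cong (λ t → + t - + (x ℕ.* c)) (sym eq)) (trans (cong (λ t → t - + (x ℕ.* c)) (ℤₚ.pos-+ 1 (x ℕ.* c))) (l (+ (x ℕ.* c)))))
    where
    l : ∀ t → (1ℤ + t) - t ≡ 1ℤ
    l = solve-∀
  raw (Bézout.+- x y eq) = (- + y , - + x) , trans (l₀ (+ y) (+ d) (+ x) (+ c)) (trans (cong₂ _-_ (sym (ℤₚ.pos-* x c)) (sym (ℤₚ.pos-* y d)))
      (trans (cong (λ t → + t - + (y ℕ.* d)) (sym eq)) (trans (cong (λ t → t - + (y ℕ.* d)) (ℤₚ.pos-+ 1 (y ℕ.* d))) (l (+ (y ℕ.* d))))))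
    where
    l : ∀ t → (1ℤ + t) - t ≡ 1ℤ
    l = solve-∀
    l₀ : ∀ y d x c → - y * d - - x * c ≡ x * c - y * d
    l₀ = solve-∀
  reduce : (Σ V λ r → cross r (+ c , + d) ≡ 1ℤ) → Σ V λ r → cross r (+ c , + d) ≡ 1ℤ × abs (proj₁ r) ℕ.≤ c × abs (proj₂ r) ℕ.≤ d
  reduce ((a , b) , e) = (a₀ , b₀) , e₀ , ℕₚ.<⇒≤ a₀<c , b₀≤d
    where
    q = a /ℕ c
    a₀ = + (a %ℕ c)
    b₀ = b - q * + d
    a₀<c = n%ℕd<d a c
    e₀ : a₀ * + d - b₀ * + c ≡ 1ℤ
    e₀ = trans (l a₀ q b (+ c) (+ d)) (trans (cong (λ t → t * + d - b * + c) (sym (a≡a%ℕn+[a/ℕn]*n a c))) e)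
      where
      l : ∀ a₀ q b c d → a₀ * d - (b - q * d) * c ≡ (a₀ + q * c) * d - b * c
      l = solve-∀
    b₀≤d : abs b₀ ℕ.≤ d
    b₀≤d = ℕₚ.*-cancelʳ-≤ (abs b₀) d c (begin
      abs b₀ ℕ.* c              ≡⟨ sym (ℤₚ.abs-* b₀ (+ c)) ⟩
      abs (b₀ * + c)            ≡⟨ cong abs (trans (l (a₀ * + d) (b₀ * + c)) (cong (λ t → a₀ * + d - t) e₀)) ⟩
      abs (a₀ * + d - 1ℤ)       ≤⟨ ℤₚ.∣i-j∣≤∣i∣+∣j∣ (a₀ * + d) 1ℤ ⟩
      abs (a₀ * + d) ℕ.+ 1      ≡⟨ cong (ℕ._+ 1) (ℤₚ.abs-* a₀ (+ d)) ⟩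
      (a %ℕ c) ℕ.* d ℕ.+ 1      ≤⟨ ℕₚ.+-monoʳ-≤ _ 0<d ⟩
      (a %ℕ c) ℕ.* d ℕ.+ d      ≡⟨ ℕₚ.+-comm _ d ⟩
      suc (a %ℕ c) ℕ.* d        ≤⟨ ℕₚ.*-monoˡ-≤ d a₀<c ⟩
      c ℕ.* d                   ≡⟨ ℕₚ.*-comm c d ⟩
      d ℕ.* c ∎)
      where
      open ℕₚ.≤-Reasoning
      l : ∀ x y → y ≡ x - (x - y)
      l = solve-∀

rng-lower : ∀ ρ (F : ℤ → ℕ) → ∑ⁿ (applyUpTo id ρ) (λ i → F (+ suc i)) ℕ.≤ ∑ⁿ (rng ρ) F
rng-lower ρ F = ℕₚ.≤-trans (ℕₚ.≤-trans (ℕₚ.≤-reflexive (sym (∑ⁿ-applyUpTo-∘ suc id ρ (λ i → F (+ i))))) (ℕₚ.m≤n+m _ (F 0ℤ)))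
  (ℕₚ.≤-trans (ℕₚ.m≤m+n _ _) (ℕₚ.≤-reflexive (sym (∑ⁿ-rng ρ F))))

-- At least a quarter of the pairs are coprime: ρ² − Σ_{k≥2} (ρ/k)² ≥ ρ²/4.
ball-size : ∀ ρ m → ρ ≡ 2 ℕ.+ m → ρ ℕ.* ρ ℕ.≤ 4 ℕ.* ∑ⁿ (Ball ρ) (λ _ → 1)
ball-size ρ m ρ≡ = ℕₚ.≤-trans main (ℕₚ.*-monoʳ-≤ 4 coprime-rows)
  where
  open ℕₚ.≤-Reasoning
  Y = applyUpTo id ρ
  cop : ℕ → ℕ → ℕ
  cop i j = indⁿ (coprime? (suc i) (suc j))
  CC = ∑ⁿ Y (λ i → ∑ⁿ Y (cop i))
  coprime-rows : CC ℕ.≤ ∑ⁿ (Ball ρ) (λ _ → 1)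
  coprime-rows = begin
    CC
      ≤⟨ ∑ⁿ-mono∈ Y (λ i i∈ → ∑ⁿ-mono∈ Y (λ j j∈ → pt i j i∈ j∈)) ⟩
    ∑ⁿ Y (λ i → ∑ⁿ Y (λ j → G (+ suc i , + suc j)))
      ≤⟨ ∑ⁿ-mono Y (λ i → rng-lower ρ (λ d → G (+ suc i , d))) ⟩
    ∑ⁿ Y (λ i → ∑ⁿ (rng ρ) (λ d → G (+ suc i , d)))
      ≤⟨ rng-lower ρ (λ c → ∑ⁿ (rng ρ) (λ d → G (c , d))) ⟩
    ∑ⁿ (rng ρ) (λ c → ∑ⁿ (rng ρ) (λ d → G (c , d)))
      ≡⟨ sym (trans (∑ⁿ-Ball ρ (λ _ → 1)) (trans (∑ⁿ-swap (rng² ρ) (rng² ρ) _) (∑ⁿ-cartesian (rng ρ) (rng ρ) G))) ⟩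
    ∑ⁿ (Ball ρ) (λ _ → 1) ∎
    where
    G : V → ℕ
    G s = ∑ⁿ (rng² ρ) (λ r → indⁿ (one? (rows r s)) ℕ.* 1)
    pt : ∀ i j → i ∈ Y → j ∈ Y → cop i j ℕ.≤ G (+ suc i , + suc j)
    pt i j i∈ j∈ = ℕₚ.≤-trans (≤-indⁿ (coprime? (suc i) (suc j)) {b = G (+ suc i , + suc j)}
        (λ cp → ℕₚ.≤-trans (ℕₚ.≤-reflexive (indⁿ-yes (coprime? (suc i) (suc j)) cp)) (one-row cp)) (indⁿ-no (coprime? (suc i) (suc j))))
        (indⁿ-*≤ (coprime? (suc i) (suc j)) _)
      where
      one-row : Coprime (suc i) (suc j) → 1 ℕ.≤ G (+ suc i , + suc j)
      one-row cp = let (r , e , p , q) = small-bezout (suc i) (suc j) (ℕ.s≤s ℕ.z≤n) (ℕ.s≤s ℕ.z≤n) cp in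
        ℕₚ.≤-trans (ℕₚ.≤-reflexive (sym (cong (ℕ._* 1) (indⁿ-yes (one? (rows r (+ suc i , + suc j))) e))))
          (∑ⁿ-term≤ (λ r → indⁿ (one? (rows r (+ suc i , + suc j))) ℕ.* 1)
            (∈-rng²⁺ r (ℕₚ.≤-trans p (∈-upTo⇒< i∈)) (ℕₚ.≤-trans q (∈-upTo⇒< j∈))))
  KK = applyUpTo (2 ℕ.+_) (suc m)
  S = ∑ⁿ KK (λ k → hdiv ρ k ℕ.* hdiv ρ k)
  dv : ℕ → ℕ → ℕ
  dv k i = indⁿ (k ℕD.∣? suc i)
  multiples : ∀ k → ∑ⁿ Y (dv k) ℕ.≤ hdiv ρ k ⊎ k ≡ 0
  multiples zero    = inj₂ refl
  multiples (suc k) = inj₁ (ℕₚ.≤-trans (cover (λ i → suc k ℕD.∣? suc i) ℕₚ._≟_ Y (applyUpTo suc (ρ / suc k)) (λ q → ℕ.pred (q ℕ.* suc k)) 1 mult cov)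
      (ℕₚ.≤-reflexive (trans (ℕₚ.*-identityʳ _) (length-applyUpTo suc (ρ / suc k)))))
    where
    mult : ∀ z → ∑ⁿ Y (λ x → indⁿ (x ℕₚ.≟ z)) ℕ.≤ 1
    mult z = ℕₚ.≤-trans (ℕₚ.≤-reflexive (trans (∑ⁿ-cong Y (λ x → indⁿ-⇔ (x ℕₚ.≟ z) (+ x ℤₚ.≟ + z) (cong (λ n → + n)) ℤₚ.+-injective))
               (sym (∑ⁿ-applyUpTo-∘ +_ id ρ (λ x → indⁿ (x ℤₚ.≟ + z)))))) (mult-applyUpTo ℤₚ.+-injective ρ (+ z))
    cov : ∀ i → i ∈ Y → suc k ℕD.∣ suc i → Σ ℕ λ q → q ∈ applyUpTo suc (ρ / suc k) × i ≡ ℕ.pred (q ℕ.* suc k)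
    cov i i∈ (ℕD.divides zero ())
    cov i i∈ (ℕD.divides (suc q) eq) = suc q , ∈-applyUpTo⁺ suc (hdiv-intro ρ (suc k) (suc q)
      (ℕₚ.≤-trans (ℕₚ.≤-reflexive (trans (ℕₚ.*-comm (suc k) (suc q)) (sym eq))) (∈-upTo⇒< i∈)) (λ ())) , cong ℕ.pred eq
  cover-pair : ∀ i j → i ∈ Y → 1 ℕ.≤ cop i j ℕ.+ ∑ⁿ KK (λ k → dv k i ℕ.* dv k j)
  cover-pair i j i∈ with coprime? (suc i) (suc j)
  ... | yes _ = ℕ.s≤s ℕ.z≤n
  ... | no nc = ℕₚ.≤-trans (ℕₚ.≤-reflexive (sym (cong₂ ℕ._*_ (indⁿ-yes (g ℕD.∣? suc i) g∣i) (indⁿ-yes (g ℕD.∣? suc j) g∣j))))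
      (∑ⁿ-term≤ (λ k → dv k i ℕ.* dv k j) (subst (_∈ KK) (ℕₚ.m+[n∸m]≡n 2≤g) (∈-applyUpTo⁺ (2 ℕ.+_) {g ℕ.∸ 2} {suc m} (ℕ.s≤s (ℕₚ.∸-monoˡ-≤ 2 (ℕₚ.≤-trans g≤ρ (ℕₚ.≤-reflexive ρ≡)))))))
    where
    g = gcd (suc i) (suc j)
    g∣i = gcd[m,n]∣m (suc i) (suc j)
    g∣j = gcd[m,n]∣n (suc i) (suc j)
    2≤g : 2 ℕ.≤ g
    2≤g = ℕₚ.≤∧≢⇒< (ℕₚ.n≢0⇒n>0 (gcd[m,n]≢0 (suc i) (suc j) (inj₁ λ ()))) (λ e → nc (gcd≡1⇒coprime (sym e)))
    g≤ρ : g ℕ.≤ ρ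
    g≤ρ = ℕₚ.≤-trans (ℕD.∣⇒≤ g∣i) (∈-upTo⇒< i∈)
  total : ρ ℕ.* ρ ℕ.≤ CC ℕ.+ S
  total = begin
    ρ ℕ.* ρ
      ≡⟨ sym (trans (∑ⁿ-const Y (length Y ℕ.* 1)) (cong₂ ℕ._*_ lenY (trans (ℕₚ.*-identityʳ _) lenY))) ⟩
    ∑ⁿ Y (λ i → length Y ℕ.* 1)
      ≡⟨ ∑ⁿ-cong Y (λ i → sym (∑ⁿ-const Y 1)) ⟩
    ∑ⁿ Y (λ i → ∑ⁿ Y (λ j → 1))
      ≤⟨ ∑ⁿ-mono∈ Y (λ i i∈ → ∑ⁿ-mono Y (λ j → cover-pair i j i∈)) ⟩
    ∑ⁿ Y (λ i → ∑ⁿ Y (λ j → cop i j ℕ.+ ∑ⁿ KK (λ k → dv k i ℕ.* dv k j)))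
      ≡⟨ trans (∑ⁿ-cong Y (λ i → ∑ⁿ-+ Y (cop i) _)) (∑ⁿ-+ Y _ _) ⟩
    CC ℕ.+ ∑ⁿ Y (λ i → ∑ⁿ Y (λ j → ∑ⁿ KK (λ k → dv k i ℕ.* dv k j)))
      ≡⟨ cong (CC ℕ.+_) (trans (∑ⁿ-cong Y (λ i → trans (∑ⁿ-swap Y KK _) (∑ⁿ-cong KK (λ k → ∑ⁿ-*ˡ Y (dv k i) (dv k))))) (trans (∑ⁿ-swap Y KK _) (∑ⁿ-cong KK (λ k → ∑ⁿ-*ʳ Y (∑ⁿ Y (dv k)) (dv k))))) ⟩
    CC ℕ.+ ∑ⁿ KK (λ k → ∑ⁿ Y (dv k) ℕ.* ∑ⁿ Y (dv k))
      ≤⟨ ℕₚ.+-monoʳ-≤ CC (∑ⁿ-mono∈ KK (λ k k∈ → ℕₚ.*-mono-≤ (mk k k∈) (mk k k∈))) ⟩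
    CC ℕ.+ S ∎
    where
    lenY = length-applyUpTo id ρ
    mk : ∀ k → k ∈ KK → ∑ⁿ Y (dv k) ℕ.≤ hdiv ρ k
    mk k k∈ with ∈-applyUpTo⁻ (2 ℕ.+_) k∈
    ... | (i , _ , refl) = [ id , (λ ()) ]′ (multiples (2 ℕ.+ i))
  S-small : 4 ℕ.* S ℕ.≤ 3 ℕ.* (ρ ℕ.* ρ)
  S-small = ℕₚ.*-cancelʳ-≤ (4 ℕ.* S) (3 ℕ.* (ρ ℕ.* ρ)) ρ {{ℕ.>-nonZero (subst (0 ℕ.<_) (sym ρ≡) (ℕ.s≤s ℕ.z≤n))}} (begin
    4 ℕ.* S ℕ.* ρ                       ≡⟨ l₁ S ρ ⟩
    4 ℕ.* ρ ℕ.* S                       ≤⟨ ℕₚ.≤-trans (ℕₚ.≤-reflexive (cong (λ k → 4 ℕ.* k ℕ.* S) ρ≡)) (∑-squares ρ m) ⟩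
    (3 ℕ.* m ℕ.+ 2) ℕ.* (ρ ℕ.* ρ)       ≤⟨ ℕₚ.*-monoˡ-≤ (ρ ℕ.* ρ) (ℕₚ.≤-trans (ℕₚ.+-monoʳ-≤ (3 ℕ.* m) (ℕₚ.m≤m+n 2 4)) (ℕₚ.≤-reflexive (trans (l₂ m) (cong (3 ℕ.*_) (sym ρ≡))))) ⟩
    3 ℕ.* ρ ℕ.* (ρ ℕ.* ρ)               ≡⟨ l₃ ρ (ρ ℕ.* ρ) ⟩
    3 ℕ.* (ρ ℕ.* ρ) ℕ.* ρ ∎)
    where
    l₁ : ∀ s r → 4 ℕ.* s ℕ.* r ≡ 4 ℕ.* r ℕ.* s
    l₁ = solveℕ-∀
    l₂ : ∀ m → 3 ℕ.* m ℕ.+ 6 ≡ 3 ℕ.* suc (suc m)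
    l₂ = solveℕ-∀
    l₃ : ∀ r y → 3 ℕ.* r ℕ.* y ≡ 3 ℕ.* y ℕ.* r
    l₃ = solveℕ-∀
  main : ρ ℕ.* ρ ℕ.≤ 4 ℕ.* CC
  main = ℕₚ.+-cancelʳ-≤ (3 ℕ.* (ρ ℕ.* ρ)) (ρ ℕ.* ρ) (4 ℕ.* CC) (begin
    ρ ℕ.* ρ ℕ.+ 3 ℕ.* (ρ ℕ.* ρ)      ≡⟨⟩
    4 ℕ.* (ρ ℕ.* ρ)                  ≤⟨ ℕₚ.*-monoʳ-≤ 4 total ⟩
    4 ℕ.* (CC ℕ.+ S)                 ≡⟨ ℕₚ.*-distribˡ-+ 4 CC S ⟩
    4 ℕ.* CC ℕ.+ 4 ℕ.* S             ≤⟨ ℕₚ.+-monoʳ-≤ (4 ℕ.* CC) S-small ⟩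
    4 ℕ.* CC ℕ.+ 3 ℕ.* (ρ ℕ.* ρ) ∎)

-- Choice of parameters

pos-^ : ∀ a i → (+ a) ^ i ≡ + (a ℕ.^ i)
pos-^ a zero    = refl
pos-^ a (suc i) = trans (*-congˡ (+ a) (pos-^ a i)) (sym (ℤₚ.pos-* a (a ℕ.^ i)))

ind-pos : {P : Set} (d : Dec P) → ind d ≡ + indⁿ d
ind-pos (yes _) = refl
ind-pos (no _)  = refl

^-cancel-≤ : ∀ k .{{_ : ℕ.NonZero k}} x y → x ℕ.^ k ℕ.≤ y ℕ.^ k → x ℕ.≤ y
^-cancel-≤ k x y le = ℕₚ.≮⇒≥ (λ y<x → ℕₚ.<⇒≱ (ℕₚ.^-monoˡ-< k y<x) le)

log-interval : ∀ b → 2 ℕ.≤ b → ∀ N → 1 ℕ.≤ N → Σ ℕ λ j → b ℕ.^ j ℕ.≤ N × N ℕ.< b ℕ.^ suc j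
log-interval b 2≤b N 1≤N = go N (b^> N)
  where
  b^> : ∀ n → n ℕ.< b ℕ.^ n
  b^> n = ℕₚ.<-≤-trans (n<2^n n) (ℕₚ.^-monoˡ-≤ n 2≤b)
  go : ∀ n → N ℕ.< b ℕ.^ n → Σ ℕ λ j → b ℕ.^ j ℕ.≤ N × N ℕ.< b ℕ.^ suc j
  go zero    lt = ⊥-elim (ℕₚ.<⇒≱ lt 1≤N)
  go (suc n) lt with b ℕ.^ n ℕₚ.≤? N
  ... | yes le = n , le , lt
  ... | no nle = go n (ℕₚ.≰⇒> nle)

-- Numerical constants are kept as variables below: a literal times a neutral term would be unfolded in unary.
linear≤2^ : ∀ a b n → b ℕ.≤ a ℕ.* n ℕ.+ b → a ℕ.* n ℕ.+ b ℕ.≤ 2 ℕ.^ n → 1 ℕ.≤ n → ∀ x → a ℕ.* (n ℕ.+ x) ℕ.+ b ℕ.≤ 2 ℕ.^ (n ℕ.+ x)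
linear≤2^ a b n _ base _ zero = subst (λ m → a ℕ.* m ℕ.+ b ℕ.≤ 2 ℕ.^ m) (sym (ℕₚ.+-identityʳ n)) base
linear≤2^ a b n h base 1≤n (suc x) = begin
  a ℕ.* (n ℕ.+ suc x) ℕ.+ b   ≡⟨ l a n x b ⟩
  T ℕ.+ a                     ≤⟨ ℕₚ.+-monoʳ-≤ T (ℕₚ.≤-trans (ℕₚ.m≤m*n a (n ℕ.+ x) {{ℕ.>-nonZero (ℕₚ.≤-trans 1≤n (ℕₚ.m≤m+n n x))}}) (ℕₚ.m≤m+n (a ℕ.* (n ℕ.+ x)) b)) ⟩
  T ℕ.+ T                     ≤⟨ ℕₚ.+-mono-≤ ih ih ⟩
  P ℕ.+ P                     ≡⟨ trans (cong (P ℕ.+_) (sym (ℕₚ.+-identityʳ P))) (cong (2 ℕ.^_) (sym (ℕₚ.+-suc n x))) ⟩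
  2 ℕ.^ (n ℕ.+ suc x) ∎
  where
  open ℕₚ.≤-Reasoning
  T = a ℕ.* (n ℕ.+ x) ℕ.+ b
  P = 2 ℕ.^ (n ℕ.+ x)
  ih = linear≤2^ a b n h base 1≤n x
  l : ∀ a n x b → a ℕ.* (n ℕ.+ suc x) ℕ.+ b ≡ (a ℕ.* (n ℕ.+ x) ℕ.+ b) ℕ.+ a
  l = solveℕ-∀

κ-shape : ∀ a K₁ ρ L d → 8 ℕ.* a ≡ K₁ → K₁ ℕ.* suc L ℕ.≤ d → 8 ℕ.* (a ℕ.* (ρ ℕ.* suc L)) ℕ.≤ d ℕ.* ρ
κ-shape a _ ρ L d refl le = ℕₚ.≤-trans (ℕₚ.≤-reflexive (l a ρ (suc L))) (ℕₚ.*-monoˡ-≤ ρ le)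
  where
  l : ∀ a r s → 8 ℕ.* (a ℕ.* (r ℕ.* s)) ≡ 8 ℕ.* a ℕ.* s ℕ.* r
  l = solveℕ-∀

Φ-shape : ∀ c₁ c₂ N l Λ S G → N ℕ.* N ℕ.≤ G → l ℕ.* N ℕ.≤ G → Λ ℕ.* (l ℕ.* N) ℕ.≤ G → Λ ℕ.* S ℕ.≤ 2 ℕ.* (G ℕ.* N) →
  c₁ ℕ.* (N ℕ.* N ℕ.* N ℕ.+ l ℕ.* (N ℕ.* N)) ℕ.+ c₂ ℕ.* Λ ℕ.* (l ℕ.* (N ℕ.* N) ℕ.+ 2 ℕ.* S) ℕ.≤ (2 ℕ.* c₁ ℕ.+ 5 ℕ.* c₂) ℕ.* (G ℕ.* N)
Φ-shape c₁ c₂ N l Λ S G h₁ h₂ h₃ h₄ = begin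
  _ ≡⟨ l₁ c₁ c₂ N l Λ S ⟩
  c₁ ℕ.* (N ℕ.* N ℕ.* N ℕ.+ l ℕ.* N ℕ.* N) ℕ.+ c₂ ℕ.* (Λ ℕ.* (l ℕ.* N) ℕ.* N ℕ.+ 2 ℕ.* (Λ ℕ.* S))
    ≤⟨ ℕₚ.+-mono-≤ (ℕₚ.*-monoʳ-≤ c₁ (ℕₚ.+-mono-≤ (ℕₚ.*-monoˡ-≤ N h₁) (ℕₚ.*-monoˡ-≤ N h₂))) (ℕₚ.*-monoʳ-≤ c₂ (ℕₚ.+-mono-≤ (ℕₚ.*-monoˡ-≤ N h₃) (ℕₚ.*-monoʳ-≤ 2 h₄))) ⟩
  c₁ ℕ.* (G ℕ.* N ℕ.+ G ℕ.* N) ℕ.+ c₂ ℕ.* (G ℕ.* N ℕ.+ 2 ℕ.* (2 ℕ.* (G ℕ.* N)))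
    ≡⟨ l₂ c₁ c₂ (G ℕ.* N) ⟩
  (2 ℕ.* c₁ ℕ.+ 5 ℕ.* c₂) ℕ.* (G ℕ.* N) ∎
  where
  open ℕₚ.≤-Reasoning
  l₁ : ∀ c₁ c₂ N l Λ S → c₁ ℕ.* (N ℕ.* N ℕ.* N ℕ.+ l ℕ.* (N ℕ.* N)) ℕ.+ c₂ ℕ.* Λ ℕ.* (l ℕ.* (N ℕ.* N) ℕ.+ 2 ℕ.* S) ≡
       c₁ ℕ.* (N ℕ.* N ℕ.* N ℕ.+ l ℕ.* N ℕ.* N) ℕ.+ c₂ ℕ.* (Λ ℕ.* (l ℕ.* N) ℕ.* N ℕ.+ 2 ℕ.* (Λ ℕ.* S))
  l₁ = solveℕ-∀
  l₂ : ∀ c₁ c₂ x → c₁ ℕ.* (x ℕ.+ x) ℕ.+ c₂ ℕ.* (x ℕ.+ 2 ℕ.* (2 ℕ.* x)) ≡ (2 ℕ.* c₁ ℕ.+ 5 ℕ.* c₂) ℕ.* x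
  l₂ = solveℕ-∀

Contracting : ℕ → ℕ → Set
Contracting ρ N = ∀ f → InV N f → New N f →
  + 2 * ∑ (Ball ρ) (λ g → ⟨ (λ v → f (g ▹ v)) , f ⟩[ N ]) ≤ ∑ (Ball ρ) (λ _ → 1ℤ) * ⟨ f , f ⟩[ N ]

-- With ρ = δ²⁰ the walk gains δ¹⁹ per step over the collision bound, and N lies between consecutive powers of δ³⁵.
module Numeric (C e δ′ ρ L J K₁ a₈₆ : ℕ) (δ≡ : δ′ ≡ 2 ℕ.^ e) (ρ≡ : ρ ≡ δ′ ℕ.^ 20) (L≡ : L ≡ 40 ℕ.* e ℕ.+ 2) (J≡ : suc J ≡ 2 ℕ.^ L)
               (K≡ : 8 ℕ.* 9216 ≡ K₁) (86≡ : 86 ≡ a₈₆)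
               (fewC : ∀ m → 0 ℕ.< m → FewFactors 24 C m)
               (10≤e : 10 ℕ.≤ e) (const≤ : K₁ ℕ.* suc L ℕ.≤ δ′) (C≤ : C ℕ.≤ δ′) (64≤δ : 64 ℕ.≤ δ′) where
  open ℕₚ.≤-Reasoning

  instance
    δ′≢0 : ℕ.NonZero δ′
    δ′≢0 = ℕ.>-nonZero (ℕₚ.≤-trans (ℕ.s≤s ℕ.z≤n) 64≤δ)

  2≤δ : 2 ℕ.≤ δ′
  2≤δ = ℕₚ.≤-trans (ℕₚ.m≤m+n 2 62) 64≤δ

  mono : ∀ {a b} → a ℕ.≤ b → δ′ ℕ.^ a ℕ.≤ δ′ ℕ.^ b
  mono = ℕₚ.^-monoʳ-≤ δ′

  1≤ρ : 1 ℕ.≤ ρ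
  1≤ρ = subst (1 ℕ.≤_) (sym ρ≡) (ℕₚ.m^n>0 δ′ 20)

  2≤ρ : 2 ℕ.≤ ρ
  2≤ρ = ℕₚ.≤-trans 2≤δ (ℕₚ.≤-trans (ℕₚ.≤-trans (ℕₚ.≤-reflexive (sym (ℕₚ.*-identityʳ δ′))) (mono {1} {20} (ℕ.s≤s ℕ.z≤n))) (ℕₚ.≤-reflexive (sym ρ≡)))

  ρ-2^ : ρ ≡ 2 ℕ.^ (20 ℕ.* e)
  ρ-2^ = trans ρ≡ (trans (cong (ℕ._^ 20) δ≡) (trans (ℕₚ.^-*-assoc 2 e 20) (cong (2 ℕ.^_) (ℕₚ.*-comm e 20))))

  ρ²-2^ : ρ ℕ.* ρ ≡ 2 ℕ.^ (40 ℕ.* e)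
  ρ²-2^ = trans (cong₂ ℕ._*_ ρ-2^ ρ-2^) (trans (sym (ℕₚ.^-distribˡ-+-* 2 (20 ℕ.* e) (20 ℕ.* e))) (cong (2 ℕ.^_) (sym (ℕₚ.*-distribʳ-+ e 20 20))))

  2ρ²≤J : 2 ℕ.* (ρ ℕ.* ρ) ℕ.≤ J
  2ρ²≤J = ℕ.s≤s⁻¹ (ℕₚ.≤-trans (ℕₚ.≤-trans (ℕₚ.≤-reflexive (cong (λ t → suc (2 ℕ.* t)) ρ²-2^)) (lt (2 ℕ.^ (40 ℕ.* e)) (ℕₚ.m^n>0 2 (40 ℕ.* e))))
      (ℕₚ.≤-reflexive (trans (sym (trans (cong (2 ℕ.^_) L≡) (trans (ℕₚ.^-distribˡ-+-* 2 (40 ℕ.* e) 2) (ℕₚ.*-comm (2 ℕ.^ (40 ℕ.* e)) 4)))) (sym J≡))))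
    where
    lt : ∀ y → 1 ℕ.≤ y → suc (2 ℕ.* y) ℕ.≤ 4 ℕ.* y
    lt y p = ℕₚ.≤-trans (ℕₚ.+-monoˡ-≤ (2 ℕ.* y) (ℕₚ.≤-trans p (ℕₚ.m≤n*m y 2))) (ℕₚ.≤-reflexive (l y))
      where
      l : ∀ y → 2 ℕ.* y ℕ.+ 2 ℕ.* y ≡ 4 ℕ.* y
      l = solveℕ-∀

  κ = Star.κ ρ 1≤ρ L J J≡ 2ρ²≤J

  b : ℕ
  b = ∑ⁿ (Ball ρ) (λ _ → 1)

  -- The 8 is 2 · 4: per letter, 2 is the loss in q / 2 and 4 the loss in the ball size `b≥`.
  -- Together with the logarithm in κ it is absorbed into one factor δ.
  κ≤ : 8 ℕ.* κ ℕ.≤ δ′ ℕ.^ 21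
  κ≤ = ℕₚ.≤-trans (κ-shape 9216 K₁ ρ L δ′ K≡ const≤) (ℕₚ.≤-reflexive (cong (δ′ ℕ.*_) ρ≡))

  b≥ : δ′ ℕ.^ 40 ℕ.≤ 4 ℕ.* b
  b≥ = ℕₚ.≤-trans (ℕₚ.≤-reflexive (trans (ℕₚ.^-distribˡ-+-* δ′ 20 20) (sym (cong₂ ℕ._*_ ρ≡ ρ≡)))) (ball-size ρ (ρ ℕ.∸ 2) (sym (ℕₚ.m+[n∸m]≡n 2≤ρ)))

  module _ (N j : ℕ) (12≤j : 12 ℕ.≤ j) (lo : δ′ ℕ.^ (35 ℕ.* j) ℕ.≤ N) (hi : N ℕ.≤ δ′ ℕ.^ (35 ℕ.* j ℕ.+ 35)) where
    n ℓ λ′ R B : ℕ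
    n = (j ℕ.+ j) ℕ.+ (j ℕ.+ j)
    ℓ = (20 ℕ.* e ℕ.+ 1) ℕ.* n ℕ.+ 1
    -- The divisor bound with k = 24 is needed up to R², about δ^(168 j), and 168 = 7 · 24; the
    -- extra factor δ absorbs C.
    λ′ = δ′ ℕ.^ (7 ℕ.* j ℕ.+ 1)
    R = (2 ℕ.* ρ) ℕ.^ n
    B = R ℕ.* R

    1≤j : 1 ℕ.≤ j
    1≤j = ℕₚ.≤-trans (ℕ.s≤s ℕ.z≤n) 12≤j

    le+ : ∀ a {c} d → c ≡ a ℕ.+ d → a ℕ.≤ c
    le+ a d refl = ℕₚ.m≤m+n a d

    2≤N : 2 ℕ.≤ N
    2≤N = ℕₚ.≤-trans 2≤δ (ℕₚ.≤-trans (ℕₚ.≤-reflexive (sym (ℕₚ.*-identityʳ δ′))) (ℕₚ.≤-trans (mono {1} {35 ℕ.* j} (ℕₚ.≤-trans 1≤j (ℕₚ.m≤n*m j 35))) lo))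

    instance
      N≢0 : ℕ.NonZero N
      N≢0 = ℕ.>-nonZero (ℕₚ.≤-trans (ℕ.s≤s ℕ.z≤n) 2≤N)

    R-2^ : R ≡ 2 ℕ.^ ((20 ℕ.* e ℕ.+ 1) ℕ.* n)
    R-2^ = trans (cong (ℕ._^ n) (trans (cong (2 ℕ.*_) ρ-2^) (cong (2 ℕ.^_) (ℕₚ.+-comm 1 (20 ℕ.* e))))) (ℕₚ.^-*-assoc 2 (20 ℕ.* e ℕ.+ 1) n)

    R<2^ℓ : suc R ℕ.≤ 2 ℕ.^ ℓ
    R<2^ℓ = ℕₚ.≤-trans (ℕₚ.+-monoˡ-≤ R (ℕₚ.m^n>0 (2 ℕ.* ρ) {{ℕₚ.m*n≢0 2 ρ {{_}} {{ℕ.>-nonZero 1≤ρ}}}} n)) (ℕₚ.≤-reflexive (trans (cong (λ t → t ℕ.+ t) R-2^)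
      (trans (l (2 ℕ.^ ((20 ℕ.* e ℕ.+ 1) ℕ.* n))) (sym (ℕₚ.^-distribˡ-+-* 2 ((20 ℕ.* e ℕ.+ 1) ℕ.* n) 1)))))
      where
      l : ∀ x → x ℕ.+ x ≡ x ℕ.* 2
      l = solveℕ-∀

    n≡ : n ≡ 4 ℕ.* j
    n≡ = l j
      where
      l : ∀ j → (j ℕ.+ j) ℕ.+ (j ℕ.+ j) ≡ 4 ℕ.* j
      l = solveℕ-∀

    R≤ : R ℕ.≤ δ′ ℕ.^ (84 ℕ.* j)
    R≤ = begin
      (2 ℕ.* ρ) ℕ.^ n          ≤⟨ ℕₚ.^-monoˡ-≤ n (ℕₚ.≤-trans (ℕₚ.*-monoˡ-≤ ρ 2≤δ) (ℕₚ.≤-reflexive (cong (δ′ ℕ.*_) ρ≡))) ⟩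
      (δ′ ℕ.^ 21) ℕ.^ n        ≡⟨ trans (ℕₚ.^-*-assoc δ′ 21 n) (cong (δ′ ℕ.^_) (trans (cong (21 ℕ.*_) n≡) (sym (ℕₚ.*-assoc 21 4 j)))) ⟩
      δ′ ℕ.^ (84 ℕ.* j) ∎

    R≥ : δ′ ℕ.^ (80 ℕ.* j) ℕ.≤ R
    R≥ = begin
      δ′ ℕ.^ (80 ℕ.* j)        ≡⟨ sym (trans (ℕₚ.^-*-assoc δ′ 20 n) (cong (δ′ ℕ.^_) (trans (cong (20 ℕ.*_) n≡) (sym (ℕₚ.*-assoc 20 4 j))))) ⟩
      (δ′ ℕ.^ 20) ℕ.^ n        ≡⟨ cong (ℕ._^ n) (sym ρ≡) ⟩
      ρ ℕ.^ n                  ≤⟨ ℕₚ.^-monoˡ-≤ n (ℕₚ.m≤n*m ρ 2) ⟩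
      R ∎

    1≤R : 1 ℕ.≤ R
    1≤R = ℕₚ.≤-trans (ℕₚ.m^n>0 δ′ (80 ℕ.* j)) R≥

    N≤B : N ℕ.≤ B
    N≤B = ℕₚ.≤-trans hi (ℕₚ.≤-trans (mono (ℕₚ.≤-trans (ℕₚ.+-monoʳ-≤ (35 ℕ.* j) (ℕₚ.≤-trans (ℕₚ.m≤m*n 35 j {{ℕ.>-nonZero 1≤j}}) ℕₚ.≤-refl)) (le+ (35 ℕ.* j ℕ.+ 35 ℕ.* j) (10 ℕ.* j) (l j))))
      (ℕₚ.≤-trans R≥ (ℕₚ.m≤m*n R R {{ℕ.>-nonZero 1≤R}})))
      where
      l : ∀ j → 80 ℕ.* j ≡ 35 ℕ.* j ℕ.+ 35 ℕ.* j ℕ.+ 10 ℕ.* j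
      l = solveℕ-∀

    few : ∀ m → 0 ℕ.< m → m ℕ.≤ B → Σ (List (ℕ × ℕ)) λ fs → Complete m fs × length fs ℕ.≤ λ′
    few m m>0 m≤B with fewC m m>0
    ... | (fs , comp , len) = fs , comp , ^-cancel-≤ 24 (length fs) λ′ (begin
      length fs ℕ.^ 24       ≤⟨ len ⟩
      C ℕ.* m                ≤⟨ ℕₚ.*-mono-≤ C≤ (ℕₚ.≤-trans m≤B (ℕₚ.*-mono-≤ R≤ R≤)) ⟩
      δ′ ℕ.* (δ′ ℕ.^ (84 ℕ.* j) ℕ.* δ′ ℕ.^ (84 ℕ.* j))
        ≡⟨ cong (δ′ ℕ.*_) (sym (ℕₚ.^-distribˡ-+-* δ′ (84 ℕ.* j) (84 ℕ.* j))) ⟩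
      δ′ ℕ.^ suc (84 ℕ.* j ℕ.+ 84 ℕ.* j)
        ≤⟨ mono (le+ (suc (84 ℕ.* j ℕ.+ 84 ℕ.* j)) 23 (l j)) ⟩
      δ′ ℕ.^ ((7 ℕ.* j ℕ.+ 1) ℕ.* 24)
        ≡⟨ sym (ℕₚ.^-*-assoc δ′ (7 ℕ.* j ℕ.+ 1) 24) ⟩
      λ′ ℕ.^ 24 ∎)
      where
      l : ∀ j → (7 ℕ.* j ℕ.+ 1) ℕ.* 24 ≡ suc (84 ℕ.* j ℕ.+ 84 ℕ.* j) ℕ.+ 23
      l = solveℕ-∀

    Z = Count.Z ρ 1≤ρ L J J≡ 2ρ²≤J N 2≤N n ℓ λ′ B few ℕₚ.≤-refl N≤B R<2^ℓ
    scalar-count = Count.scalar-count ρ 1≤ρ L J J≡ 2ρ²≤J N 2≤N n ℓ λ′ B few ℕₚ.≤-refl N≤B R<2^ℓ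

    G : ℕ
    G = δ′ ℕ.^ (70 ℕ.* j ℕ.+ 70)

    ℓ≤ : suc ℓ ℕ.≤ δ′ ℕ.^ j
    ℓ≤ = begin
      suc ℓ                            ≡⟨ trans (cong (λ t → suc ((20 ℕ.* e ℕ.+ 1) ℕ.* t ℕ.+ 1)) n≡) (l₁ e j) ⟩
      80 ℕ.* (e ℕ.* j) ℕ.+ 4 ℕ.* j ℕ.+ 2
        ≤⟨ ℕₚ.+-mono-≤ (ℕₚ.+-monoʳ-≤ (80 ℕ.* (e ℕ.* j)) (ℕₚ.*-monoʳ-≤ 4 (ℕₚ.m≤n*m j e {{e≢0}}))) (ℕₚ.*-monoʳ-≤ 2 {1} {e ℕ.* j} (ℕₚ.*-mono-≤ (ℕ.>-nonZero⁻¹ e {{e≢0}}) 1≤j)) ⟩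
      80 ℕ.* (e ℕ.* j) ℕ.+ 4 ℕ.* (e ℕ.* j) ℕ.+ 2 ℕ.* (e ℕ.* j)
        ≡⟨ trans (l₂ (e ℕ.* j)) (cong (λ a → a ℕ.* (e ℕ.* j)) {86} {a₈₆} 86≡) ⟩
      a₈₆ ℕ.* (e ℕ.* j)
        ≤⟨ subst (λ t → a₈₆ ℕ.* t ℕ.≤ 2 ℕ.^ t) (ℕₚ.m+[n∸m]≡n ej≥10) (ℕₚ.≤-trans (ℕₚ.m≤m+n _ 0)
             (linear≤2^ a₈₆ 0 10 ℕ.z≤n (subst (λ a → a ℕ.* 10 ℕ.+ 0 ℕ.≤ 1024) 86≡ (ℕₚ.≤ᵇ⇒≤ 860 1024 _)) (ℕ.s≤s ℕ.z≤n) (e ℕ.* j ℕ.∸ 10))) ⟩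
      2 ℕ.^ (e ℕ.* j)                  ≡⟨ sym (ℕₚ.^-*-assoc 2 e j) ⟩
      (2 ℕ.^ e) ℕ.^ j                  ≡⟨ cong (ℕ._^ j) (sym δ≡) ⟩
      δ′ ℕ.^ j ∎
      where
      e≢0 : ℕ.NonZero e
      e≢0 = ℕ.>-nonZero (ℕₚ.≤-trans (ℕ.s≤s ℕ.z≤n) 10≤e)
      ej≥10 : 10 ℕ.≤ e ℕ.* j
      ej≥10 = ℕₚ.≤-trans 10≤e (ℕₚ.m≤m*n e j {{ℕ.>-nonZero 1≤j}})
      l₁ : ∀ e j → suc ((20 ℕ.* e ℕ.+ 1) ℕ.* (4 ℕ.* j) ℕ.+ 1) ≡ 80 ℕ.* (e ℕ.* j) ℕ.+ 4 ℕ.* j ℕ.+ 2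
      l₁ = solveℕ-∀
      l₂ : ∀ x → 80 ℕ.* x ℕ.+ 4 ℕ.* x ℕ.+ 2 ℕ.* x ≡ 86 ℕ.* x
      l₂ = solveℕ-∀

    ^3 : ∀ a c d → δ′ ℕ.^ a ℕ.* δ′ ℕ.^ c ℕ.* δ′ ℕ.^ d ≡ δ′ ℕ.^ (a ℕ.+ c ℕ.+ d)
    ^3 a c d = trans (cong (ℕ._* δ′ ℕ.^ d) (sym (ℕₚ.^-distribˡ-+-* δ′ a c))) (sym (ℕₚ.^-distribˡ-+-* δ′ (a ℕ.+ c) d))

    T₁ : N ℕ.* N ℕ.≤ G
    T₁ = ℕₚ.≤-trans (ℕₚ.*-mono-≤ hi hi) (ℕₚ.≤-reflexive (trans (sym (ℕₚ.^-distribˡ-+-* δ′ (35 ℕ.* j ℕ.+ 35) (35 ℕ.* j ℕ.+ 35))) (cong (δ′ ℕ.^_) (l j))))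
      where
      l : ∀ j → 35 ℕ.* j ℕ.+ 35 ℕ.+ (35 ℕ.* j ℕ.+ 35) ≡ 70 ℕ.* j ℕ.+ 70
      l = solveℕ-∀

    T₃ : λ′ ℕ.* λ′ ℕ.* (suc ℓ ℕ.* N) ℕ.≤ G
    T₃ = begin
      λ′ ℕ.* λ′ ℕ.* (suc ℓ ℕ.* N)
        ≤⟨ ℕₚ.*-monoʳ-≤ (λ′ ℕ.* λ′) (ℕₚ.*-mono-≤ ℓ≤ hi) ⟩
      λ′ ℕ.* λ′ ℕ.* (δ′ ℕ.^ j ℕ.* δ′ ℕ.^ (35 ℕ.* j ℕ.+ 35))
        ≡⟨ trans (cong (λ′ ℕ.* λ′ ℕ.*_) (sym (ℕₚ.^-distribˡ-+-* δ′ j (35 ℕ.* j ℕ.+ 35)))) (^3 (7 ℕ.* j ℕ.+ 1) (7 ℕ.* j ℕ.+ 1) (j ℕ.+ (35 ℕ.* j ℕ.+ 35))) ⟩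
      δ′ ℕ.^ ((7 ℕ.* j ℕ.+ 1) ℕ.+ (7 ℕ.* j ℕ.+ 1) ℕ.+ (j ℕ.+ (35 ℕ.* j ℕ.+ 35)))
        ≤⟨ mono (le+ ((7 ℕ.* j ℕ.+ 1) ℕ.+ (7 ℕ.* j ℕ.+ 1) ℕ.+ (j ℕ.+ (35 ℕ.* j ℕ.+ 35))) (20 ℕ.* j ℕ.+ 33) (l j)) ⟩
      G ∎
      where
      l : ∀ j → 70 ℕ.* j ℕ.+ 70 ≡ (7 ℕ.* j ℕ.+ 1) ℕ.+ (7 ℕ.* j ℕ.+ 1) ℕ.+ (j ℕ.+ (35 ℕ.* j ℕ.+ 35)) ℕ.+ (20 ℕ.* j ℕ.+ 33)
      l = solveℕ-∀

    T₂ : suc ℓ ℕ.* N ℕ.≤ G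
    T₂ = ℕₚ.≤-trans (ℕₚ.m≤n*m (suc ℓ ℕ.* N) (λ′ ℕ.* λ′) {{ℕₚ.m*n≢0 λ′ λ′ {{ℕₚ.m^n≢0 δ′ (7 ℕ.* j ℕ.+ 1)}} {{ℕₚ.m^n≢0 δ′ (7 ℕ.* j ℕ.+ 1)}}}}) T₃

    -- Here R must stay below N³ with room for the divisor bound: λ′² R has exponent 14 j + 84 j,
    -- against 105 j for N³.
    T₄ : λ′ ℕ.* λ′ ℕ.* (R ℕ.+ N) ℕ.≤ 2 ℕ.* (G ℕ.* N)
    T₄ = begin
      λ′ ℕ.* λ′ ℕ.* (R ℕ.+ N)
        ≤⟨ ℕₚ.*-monoʳ-≤ (λ′ ℕ.* λ′) (ℕₚ.+-mono-≤ (begin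
             R                                              ≤⟨ R≤ ⟩
             δ′ ℕ.^ (84 ℕ.* j)                              ≡⟨ trans (cong (δ′ ℕ.^_) (l₁ j)) (ℕₚ.^-distribˡ-+-* δ′ (49 ℕ.* j) (35 ℕ.* j)) ⟩
             D49 ℕ.* δ′ ℕ.^ (35 ℕ.* j)                      ≤⟨ ℕₚ.*-monoʳ-≤ D49 lo ⟩
             D49 ℕ.* N ∎) (ℕₚ.m≤n*m N D49 {{ℕₚ.m^n≢0 δ′ (49 ℕ.* j)}})) ⟩
      λ′ ℕ.* λ′ ℕ.* (D49 ℕ.* N ℕ.+ D49 ℕ.* N)
        ≡⟨ l₂ (λ′ ℕ.* λ′) D49 N ⟩
      2 ℕ.* (λ′ ℕ.* λ′ ℕ.* D49 ℕ.* N)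
        ≤⟨ ℕₚ.*-monoʳ-≤ 2 (ℕₚ.*-monoˡ-≤ N (ℕₚ.≤-trans (ℕₚ.≤-reflexive (^3 (7 ℕ.* j ℕ.+ 1) (7 ℕ.* j ℕ.+ 1) (49 ℕ.* j))) (mono (le+ ((7 ℕ.* j ℕ.+ 1) ℕ.+ (7 ℕ.* j ℕ.+ 1) ℕ.+ 49 ℕ.* j) (7 ℕ.* j ℕ.+ 68) (l₃ j))))) ⟩
      2 ℕ.* (G ℕ.* N) ∎
      where
      D49 = δ′ ℕ.^ (49 ℕ.* j)
      l₁ : ∀ j → 84 ℕ.* j ≡ 49 ℕ.* j ℕ.+ 35 ℕ.* j
      l₁ = solveℕ-∀
      l₂ : ∀ x d n → x ℕ.* (d ℕ.* n ℕ.+ d ℕ.* n) ≡ 2 ℕ.* (x ℕ.* d ℕ.* n)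
      l₂ = solveℕ-∀
      l₃ : ∀ j → 70 ℕ.* j ℕ.+ 70 ≡ (7 ℕ.* j ℕ.+ 1) ℕ.+ (7 ℕ.* j ℕ.+ 1) ℕ.+ 49 ℕ.* j ℕ.+ (7 ℕ.* j ℕ.+ 68)
      l₃ = solveℕ-∀

    Φ : ℕ
    Φ = 64 ℕ.* (N ℕ.* N ℕ.* N ℕ.+ suc ℓ ℕ.* (N ℕ.* N)) ℕ.+ 768 ℕ.* (λ′ ℕ.* λ′) ℕ.* (suc ℓ ℕ.* (N ℕ.* N) ℕ.+ 2 ℕ.* (R ℕ.+ N))

    -- All terms of Φ are multiples of G N, with total coefficient 2 · 64 + 5 · 768 = 3968 < 64² ≤
    -- δ². Then 70 j + 72 ≤ 76 j requires j ≥ 12.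
    Φ< : Φ ℕ.< δ′ ℕ.^ (76 ℕ.* j) ℕ.* N
    Φ< = begin-strict
      Φ ≤⟨ Φ-shape 64 768 N (suc ℓ) (λ′ ℕ.* λ′) (R ℕ.+ N) G T₁ T₂ T₃ T₄ ⟩
      (2 ℕ.* 64 ℕ.+ 5 ℕ.* 768) ℕ.* (G ℕ.* N)
        <⟨ ℕₚ.*-monoˡ-< (G ℕ.* N) {{ℕₚ.m*n≢0 G N {{ℕₚ.m^n≢0 δ′ (70 ℕ.* j ℕ.+ 70)}}}} (ℕₚ.<-≤-trans (ℕₚ.≤ᵇ⇒≤ 3969 4096 _) (ℕₚ.*-mono-≤ 64≤δ 64≤δ)) ⟩
      δ′ ℕ.* δ′ ℕ.* (G ℕ.* N)
        ≡⟨ l₃ δ′ G N ⟩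
      δ′ ℕ.^ 2 ℕ.* G ℕ.* N
        ≤⟨ ℕₚ.*-monoˡ-≤ N (ℕₚ.≤-trans (ℕₚ.≤-reflexive (sym (ℕₚ.^-distribˡ-+-* δ′ 2 (70 ℕ.* j ℕ.+ 70)))) (mono exps)) ⟩
      δ′ ℕ.^ (76 ℕ.* j) ℕ.* N ∎
      where
      l₃ : ∀ d g n → d ℕ.* d ℕ.* (g ℕ.* n) ≡ d ℕ.* (d ℕ.* 1) ℕ.* g ℕ.* n
      l₃ = solveℕ-∀
      exps : 2 ℕ.+ (70 ℕ.* j ℕ.+ 70) ℕ.≤ 76 ℕ.* j
      exps = ℕₚ.≤-trans (ℕₚ.≤-reflexive (l₄ j)) (ℕₚ.≤-trans (ℕₚ.+-monoʳ-≤ (70 ℕ.* j) (ℕₚ.*-monoʳ-≤ 6 12≤j)) (ℕₚ.≤-reflexive (l₅ j)))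
        where
        l₄ : ∀ j → 2 ℕ.+ (70 ℕ.* j ℕ.+ 70) ≡ 70 ℕ.* j ℕ.+ 72
        l₄ = solveℕ-∀
        l₅ : ∀ j → 70 ℕ.* j ℕ.+ 6 ℕ.* j ≡ 76 ℕ.* j
        l₅ = solveℕ-∀

    N³ : ℕ
    N³ = N ℕ.* N ℕ.* N

    -- Per letter the ball has δ^40 / 4 elements against 8κ ≤ δ^21, a gain of δ^19. Over n = 4j
    -- letters this is δ^(76 j), which exceeds Φ / N, essentially N² or about δ^(70 j).
    final : 2 ℕ.^ n ℕ.* (N ℕ.* N ℕ.* Z) ℕ.< b ℕ.^ n
    final = ℕₚ.*-cancelʳ-< (N³ ℕ.* 4 ℕ.^ n) (2 ℕ.^ n ℕ.* (N ℕ.* N ℕ.* Z)) (b ℕ.^ n) (begin-strict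
      2 ℕ.^ n ℕ.* (N ℕ.* N ℕ.* Z) ℕ.* (N³ ℕ.* 4 ℕ.^ n)
        ≡⟨ l₁ (2 ℕ.^ n) (N ℕ.* N) Z N³ (4 ℕ.^ n) ⟩
      2 ℕ.^ n ℕ.* 4 ℕ.^ n ℕ.* (N ℕ.* N) ℕ.* (Z ℕ.* N³)
        ≤⟨ ℕₚ.*-monoʳ-≤ (2 ℕ.^ n ℕ.* 4 ℕ.^ n ℕ.* (N ℕ.* N)) scalar-count ⟩
      2 ℕ.^ n ℕ.* 4 ℕ.^ n ℕ.* (N ℕ.* N) ℕ.* (κ ℕ.^ n ℕ.* Φ)
        ≡⟨ trans (cong (λ t → t ℕ.* (N ℕ.* N) ℕ.* (κ ℕ.^ n ℕ.* Φ)) (sym (*-^ 2 4 n))) (trans (l₂ (8 ℕ.^ n) (N ℕ.* N) (κ ℕ.^ n) Φ) (cong (λ t → t ℕ.* ((N ℕ.* N) ℕ.* Φ)) (sym (*-^ 8 κ n)))) ⟩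
      (8 ℕ.* κ) ℕ.^ n ℕ.* (N ℕ.* N ℕ.* Φ)
        ≤⟨ ℕₚ.*-monoˡ-≤ (N ℕ.* N ℕ.* Φ) (ℕₚ.^-monoˡ-≤ n κ≤) ⟩
      (δ′ ℕ.^ 21) ℕ.^ n ℕ.* (N ℕ.* N ℕ.* Φ)
        <⟨ ℕₚ.*-monoʳ-< ((δ′ ℕ.^ 21) ℕ.^ n) {{ℕₚ.m^n≢0 (δ′ ℕ.^ 21) n {{ℕₚ.m^n≢0 δ′ 21}}}} (ℕₚ.*-monoʳ-< (N ℕ.* N) {{ℕₚ.m*n≢0 N N}} Φ<) ⟩
      (δ′ ℕ.^ 21) ℕ.^ n ℕ.* (N ℕ.* N ℕ.* (δ′ ℕ.^ (76 ℕ.* j) ℕ.* N))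
        ≡⟨ trans (l₃ ((δ′ ℕ.^ 21) ℕ.^ n) N (δ′ ℕ.^ (76 ℕ.* j))) (cong (ℕ._* N³) pw) ⟩
      (δ′ ℕ.^ 40) ℕ.^ n ℕ.* N³
        ≤⟨ ℕₚ.*-monoˡ-≤ N³ (ℕₚ.^-monoˡ-≤ n b≥) ⟩
      (4 ℕ.* b) ℕ.^ n ℕ.* N³
        ≡⟨ trans (cong (ℕ._* N³) (*-^ 4 b n)) (l₄ (4 ℕ.^ n) (b ℕ.^ n) N³) ⟩
      b ℕ.^ n ℕ.* (N³ ℕ.* 4 ℕ.^ n) ∎)
      where
      pw : (δ′ ℕ.^ 21) ℕ.^ n ℕ.* δ′ ℕ.^ (76 ℕ.* j) ≡ (δ′ ℕ.^ 40) ℕ.^ n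
      pw = trans (cong (ℕ._* δ′ ℕ.^ (76 ℕ.* j)) (ℕₚ.^-*-assoc δ′ 21 n)) (trans (sym (ℕₚ.^-distribˡ-+-* δ′ (21 ℕ.* n) (76 ℕ.* j)))
             (trans (cong (δ′ ℕ.^_) (trans (cong (λ t → 21 ℕ.* t ℕ.+ 76 ℕ.* j) n≡) (trans (l j) (cong (40 ℕ.*_) (sym n≡))))) (sym (ℕₚ.^-*-assoc δ′ 40 n))))
        where
        l : ∀ j → 21 ℕ.* (4 ℕ.* j) ℕ.+ 76 ℕ.* j ≡ 40 ℕ.* (4 ℕ.* j)
        l = solveℕ-∀
      l₁ : ∀ a m z c d → a ℕ.* (m ℕ.* z) ℕ.* (c ℕ.* d) ≡ a ℕ.* d ℕ.* m ℕ.* (z ℕ.* c)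
      l₁ = solveℕ-∀
      l₂ : ∀ a m k p → a ℕ.* m ℕ.* (k ℕ.* p) ≡ a ℕ.* k ℕ.* (m ℕ.* p)
      l₂ = solveℕ-∀
      l₃ : ∀ a n d → a ℕ.* (n ℕ.* n ℕ.* (d ℕ.* n)) ≡ a ℕ.* d ℕ.* (n ℕ.* n ℕ.* n)
      l₃ = solveℕ-∀
      l₄ : ∀ a b c → a ℕ.* b ℕ.* c ≡ b ℕ.* (c ℕ.* a)
      l₄ = solveℕ-∀

    module _ (f : V → ℤ) (inV : InV N f) (new : New N f) where
      pow = Words.pow (Ball ρ) Ball-det (Ball-adj ρ)
      q = Words.Moments.q (Ball ρ) Ball-det (Ball-adj ρ) N f inV

      contraction : + 2 * ∑ (Ball ρ) (λ g → ⟨ (λ v → f (g ▹ v)) , f ⟩[ N ]) ≤ + b * ⟨ f , f ⟩[ N ]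
      contraction = subst₂ _≤_ (*-congˡ (+ 2) (Words.∑-pow-1 (Ball ρ) Ball-det (Ball-adj ρ) (λ z → ⟨ (λ v → f (z ▹ v)) , f ⟩[ N ]))) (cong₂ _*_ q≡ (Words.Moments.A₀ (Ball ρ) Ball-det (Ball-adj ρ) N f inV))
        (Words.Moments.new-bound (Ball ρ) Ball-det (Ball-adj ρ) N f inV new j (subst₂ _<_ (sym lhs) (sym rhs) (+<+ final)))
        where
        q≡ : q ≡ + b
        q≡ = ∑-pos (Ball ρ) (λ _ → 1)
        Z≡ : ∑ (pow n) (χ N) ≡ + Z
        Z≡ = trans (∑-cong (pow n) (λ g → ind-pos (scalar? N g))) (∑-pos (pow n) _)
        lhs : ((+ 4) ^ j * (+ 4) ^ j) * ((+ N * + N) * ∑ (pow n) (χ N)) ≡ + (2 ℕ.^ n ℕ.* (N ℕ.* N ℕ.* Z))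
        lhs = trans (cong₂ _*_ (trans (cong₂ _*_ (pos-^ 4 j) (pos-^ 4 j)) (trans (sym (ℤₚ.pos-* (4 ℕ.^ j) (4 ℕ.^ j))) (cong (λ t → + t) four)))
                                (trans (cong₂ _*_ (sym (ℤₚ.pos-* N N)) Z≡) (sym (ℤₚ.pos-* (N ℕ.* N) Z)))) (sym (ℤₚ.pos-* (2 ℕ.^ n) (N ℕ.* N ℕ.* Z)))
          where
          four : 4 ℕ.^ j ℕ.* 4 ℕ.^ j ≡ 2 ℕ.^ n
          four = trans (cong₂ ℕ._*_ (ℕₚ.^-*-assoc 2 2 j) (ℕₚ.^-*-assoc 2 2 j)) (trans (sym (ℕₚ.^-distribˡ-+-* 2 (2 ℕ.* j) (2 ℕ.* j))) (cong (2 ℕ.^_) (l j)))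
            where
            l : ∀ j → 2 ℕ.* j ℕ.+ 2 ℕ.* j ≡ (j ℕ.+ j) ℕ.+ (j ℕ.+ j)
            l = solveℕ-∀
        rhs : (q * q) ^ j * (q * q) ^ j ≡ + (b ℕ.^ n)
        rhs = trans (cong (λ t → (t * t) ^ j * (t * t) ^ j) q≡) (trans (cong₂ _*_ bb bb) (trans (sym (ℤₚ.pos-* (b ℕ.^ (j ℕ.+ j)) (b ℕ.^ (j ℕ.+ j)))) (cong (λ t → + t) (sym (ℕₚ.^-distribˡ-+-* b (j ℕ.+ j) (j ℕ.+ j))))))
          where
          bb : (+ b * + b) ^ j ≡ + (b ℕ.^ (j ℕ.+ j))
          bb = trans (cong (_^ j) (sym (ℤₚ.pos-* b b))) (trans (pos-^ (b ℕ.* b) j) (cong (λ t → + t) (trans (*-^ b b j) (sym (ℕₚ.^-distribˡ-+-* b j j)))))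

  base : ℕ
  base = δ′ ℕ.^ 35

  2≤base : 2 ℕ.≤ base
  2≤base = ℕₚ.≤-trans 2≤δ (ℕₚ.≤-trans (ℕₚ.≤-reflexive (sym (ℕₚ.*-identityʳ δ′))) (mono {1} {35} (ℕ.s≤s ℕ.z≤n)))

  main : ∀ N → base ℕ.^ 12 ℕ.≤ N → Contracting ρ N
  main N N₀≤N f inV new = subst (λ q → + 2 * ∑ (Ball ρ) (λ g → ⟨ (λ v → f (g ▹ v)) , f ⟩[ N ]) ≤ q * ⟨ f , f ⟩[ N ]) (sym (∑-pos (Ball ρ) (λ _ → 1)))
    (go (log-interval base 2≤base N (ℕₚ.≤-trans (ℕₚ.m^n>0 base {{ℕₚ.m^n≢0 δ′ 35}} 12) N₀≤N)))
    where
    go : (Σ ℕ λ j → base ℕ.^ j ℕ.≤ N × N ℕ.< base ℕ.^ suc j) → + 2 * ∑ (Ball ρ) (λ g → ⟨ (λ v → f (g ▹ v)) , f ⟩[ N ]) ≤ + b * ⟨ f , f ⟩[ N ]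
    go (j , lo , hi) = contraction N j 12≤j (subst (ℕ._≤ N) (ℕₚ.^-*-assoc δ′ 35 j) lo)
        (ℕₚ.<⇒≤ (ℕₚ.<-≤-trans hi (ℕₚ.≤-reflexive (trans (ℕₚ.^-*-assoc δ′ 35 (suc j)) (cong (δ′ ℕ.^_) (trans (ℕₚ.*-suc 35 j) (ℕₚ.+-comm 35 (35 ℕ.* j)))))))) f inV new
      where
      12≤j : 12 ℕ.≤ j
      12≤j = ℕ.s≤s⁻¹ (ℕₚ.≰⇒> (λ sj≤12 → ℕₚ.<⇒≱ hi (ℕₚ.≤-trans (ℕₚ.^-monoʳ-≤ base {{ℕₚ.m^n≢0 δ′ 35}} sj≤12) N₀≤N)))

-- 27 is the least t with 8 · 9216 · (40 t + 3) ≤ 2^t, and 40 e + 3 is L + 1. Adding C to the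
-- exponent makes δ exceed C as well. Since δ is a power of 2, the logarithm L of 4ρ² is available
-- exactly.
module Parameters (C K₁ t e L δ′ : ℕ) (K≡ : 8 ℕ.* 9216 ≡ K₁) (t≡ : t ≡ 27) (e≡ : e ≡ t ℕ.+ C) (L≡ : L ≡ 40 ℕ.* e ℕ.+ 2) (δ≡ : δ′ ≡ 2 ℕ.^ e) where
  t≤ : ∀ m → m ℕ.≤ 27 → m ℕ.≤ t
  t≤ m = subst (m ℕ.≤_) (sym t≡)

  const≤ : K₁ ℕ.* suc L ℕ.≤ δ′
  const≤ = ℕₚ.≤-trans (ℕₚ.≤-reflexive (trans (cong (λ x → K₁ ℕ.* suc x) L≡) (trans (l K₁ e) (cong (λ x → K₁ ℕ.* 40 ℕ.* x ℕ.+ K₁ ℕ.* 3) e≡))))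
    (ℕₚ.≤-trans (linear≤2^ (K₁ ℕ.* 40) (K₁ ℕ.* 3) t (ℕₚ.m≤n+m _ _)
      (subst₂ (λ k m → k ℕ.* 40 ℕ.* m ℕ.+ k ℕ.* 3 ℕ.≤ 2 ℕ.^ m) K≡ (sym t≡) (ℕₚ.≤ᵇ⇒≤ 79847424 134217728 _)) (t≤ 1 (ℕ.s≤s ℕ.z≤n)) C)
      (ℕₚ.≤-reflexive (trans (cong (2 ℕ.^_) (sym e≡)) (sym δ≡))))
    where
    l : ∀ k e → k ℕ.* suc (40 ℕ.* e ℕ.+ 2) ≡ k ℕ.* 40 ℕ.* e ℕ.+ k ℕ.* 3
    l = solveℕ-∀

  e-lower : ∀ m → m ℕ.≤ 27 → m ℕ.≤ e
  e-lower m h = subst (m ℕ.≤_) (sym e≡) (ℕₚ.≤-trans (t≤ m h) (ℕₚ.m≤m+n t C))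

  C≤ : C ℕ.≤ δ′
  C≤ = ℕₚ.≤-trans (subst (C ℕ.≤_) (sym e≡) (ℕₚ.m≤n+m C t)) (ℕₚ.≤-trans (ℕₚ.<⇒≤ (n<2^n e)) (ℕₚ.≤-reflexive (sym δ≡)))

  64≤δ : 64 ℕ.≤ δ′
  64≤δ = ℕₚ.≤-trans (ℕₚ.^-monoʳ-≤ 2 (e-lower 6 (ℕₚ.m≤m+n 6 21))) (ℕₚ.≤-reflexive (sym δ≡))

  10≤e : 10 ℕ.≤ e
  10≤e = e-lower 10 (ℕₚ.m≤m+n 10 17)

abstract
  new-forms-contract : Σ ℕ λ ρ → (1 ℕ.≤ ρ) × Σ ℕ λ N₀ → ∀ N → N₀ ℕ.≤ N → Contracting ρ N
  new-forms-contract = go (few-factors 24) (8 ℕ.* 9216) refl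
    where
    go : (Σ ℕ λ C → ∀ m → 0 ℕ.< m → FewFactors 24 C m) → ∀ K₁ → 8 ℕ.* 9216 ≡ K₁ → Σ ℕ λ ρ → (1 ℕ.≤ ρ) × Σ ℕ λ N₀ → ∀ N → N₀ ℕ.≤ N → Contracting ρ N
    set : ∀ C → (∀ m → 0 ℕ.< m → FewFactors 24 C m) → ∀ K₁ a₈₆ t e L δ′ ρ J → 8 ℕ.* 9216 ≡ K₁ → 86 ≡ a₈₆ → t ≡ 27 → e ≡ t ℕ.+ C → L ≡ 40 ℕ.* e ℕ.+ 2 → δ′ ≡ 2 ℕ.^ e →
          ρ ≡ δ′ ℕ.^ 20 → suc J ≡ 2 ℕ.^ L → Σ ℕ λ ρ → (1 ℕ.≤ ρ) × Σ ℕ λ N₀ → ∀ N → N₀ ℕ.≤ N → Contracting ρ N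
    set C fewC K₁ a₈₆ t e L δ′ ρ J K≡ 86≡ t≡ e≡ L≡ δ≡ ρ≡ J≡ =
      ρ , subst (1 ℕ.≤_) (sym ρ≡) (ℕₚ.m^n>0 δ′ {{ℕ.>-nonZero (ℕₚ.≤-trans (ℕ.s≤s ℕ.z≤n) 64≤δ)}} 20) , (δ′ ℕ.^ 35) ℕ.^ 12 ,
      Numeric.main C e δ′ ρ L J K₁ a₈₆ δ≡ ρ≡ L≡ J≡ K≡ 86≡ fewC 10≤e const≤ C≤ 64≤δ
      where
      10≤e : 10 ℕ.≤ e
      10≤e = Parameters.10≤e C K₁ t e L δ′ K≡ t≡ e≡ L≡ δ≡
      const≤ : K₁ ℕ.* suc L ℕ.≤ δ′
      const≤ = Parameters.const≤ C K₁ t e L δ′ K≡ t≡ e≡ L≡ δ≡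
      C≤ : C ℕ.≤ δ′
      C≤ = Parameters.C≤ C K₁ t e L δ′ K≡ t≡ e≡ L≡ δ≡
      64≤δ : 64 ℕ.≤ δ′
      64≤δ = Parameters.64≤δ C K₁ t e L δ′ K≡ t≡ e≡ L≡ δ≡
    go (C , fewC) K₁ K≡ = with-t 27 refl
      where
      with-t : ∀ t → t ≡ 27 → Σ ℕ λ ρ → (1 ℕ.≤ ρ) × Σ ℕ λ N₀ → ∀ N → N₀ ℕ.≤ N → Contracting ρ N
      with-t t t≡ = with-L (40 ℕ.* (t ℕ.+ C) ℕ.+ 2) refl
        where
        with-L : ∀ L → L ≡ 40 ℕ.* (t ℕ.+ C) ℕ.+ 2 → Σ ℕ λ ρ → (1 ℕ.≤ ρ) × Σ ℕ λ N₀ → ∀ N → N₀ ℕ.≤ N → Contracting ρ N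
        with-L L L≡ = set C fewC K₁ 86 t (t ℕ.+ C) L (2 ℕ.^ (t ℕ.+ C)) ((2 ℕ.^ (t ℕ.+ C)) ℕ.^ 20) (ℕ.pred (2 ℕ.^ L))
                        K≡ refl t≡ refl L≡ refl refl (ℕₚ.suc-pred (2 ℕ.^ L) {{ℕₚ.m^n≢0 2 L}})

-- Energy

defect : ℕ → (V → ℤ) → Mat → ℤ
defect N f g = ∑ (res² N) (λ v → (f (g ▹ v) - f v) * (f (g ▹ v) - f v))

Lᴹ Uᴹ : Mat
Lᴹ = mat 1ℤ 0ℤ 1ℤ 1ℤ
Uᴹ = mat 1ℤ 1ℤ 0ℤ 1ℤ

energy : ℕ → (V → ℤ) → ℤ
energy N f = defect N f Lᴹ + defect N f Uᴹ

defect≥0 : ∀ N f g → 0ℤ ≤ defect N f g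
defect≥0 N f g = ∑-nonneg (res² N) (λ v → 0≤² (f (g ▹ v) - f v))

energy≥0 : ∀ N f → 0ℤ ≤ energy N f
energy≥0 N f = 0≤+ (defect≥0 N f Lᴹ) (defect≥0 N f Uᴹ)

sum-sq≤ : ∀ a b → (a + b) * (a + b) ≤ + 2 * (a * a) + + 2 * (b * b)
sum-sq≤ a b = ≤-by ((a - b) * (a - b)) (0≤² (a - b)) (l a b)
  where
  l : ∀ a b → (a + b) * (a + b) + (a - b) * (a - b) ≡ + 2 * (a * a) + + 2 * (b * b)
  l = solve-∀

Per²-sq : ∀ {N f} → Per² N f → ∀ g → Per² N (λ v → (f (g ▹ v) - f v) * (f (g ▹ v) - f v))
Per²-sq {f = f} per g x y x′ y′ p q = cong₂ (λ a b → (a - b) * (a - b)) (Per²-▹ {F = f} per g x y x′ y′ p q) (per x y x′ y′ p q)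

defect-· : ∀ N .{{_ : ℕ.NonZero N}} f → Per² N f → ∀ g h → det h ≡ 1ℤ → defect N f (g · h) ≤ + 2 * defect N f g + + 2 * defect N f h
defect-· N f per g h e = begin
  defect N f (g · h)
    ≡⟨ ∑-cong (res² N) (λ v → cong (λ t → t * t) (trans (cong (λ u → f u - f v) (·-▹ g h v)) (l (f (g ▹ h ▹ v)) (f (h ▹ v)) (f v)))) ⟩
  ∑ (res² N) (λ v → ((f (g ▹ h ▹ v) - f (h ▹ v)) + (f (h ▹ v) - f v)) * ((f (g ▹ h ▹ v) - f (h ▹ v)) + (f (h ▹ v) - f v)))
    ≤⟨ ∑-mono (res² N) (λ v → sum-sq≤ (f (g ▹ h ▹ v) - f (h ▹ v)) (f (h ▹ v) - f v)) ⟩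
  ∑ (res² N) (λ v → + 2 * ((f (g ▹ h ▹ v) - f (h ▹ v)) * (f (g ▹ h ▹ v) - f (h ▹ v))) + + 2 * ((f (h ▹ v) - f v) * (f (h ▹ v) - f v)))
    ≡⟨ trans (∑-⊕ (res² N) _ _) (cong₂ _+_ (∑-*ˡ (res² N) (+ 2) _) (∑-*ˡ (res² N) (+ 2) _)) ⟩
  + 2 * ∑ (res² N) (λ v → (f (g ▹ h ▹ v) - f (h ▹ v)) * (f (g ▹ h ▹ v) - f (h ▹ v))) + + 2 * defect N f h
    ≡⟨ cong (λ t → + 2 * t + + 2 * defect N f h) (∑-reindex N (λ u → (f (g ▹ u) - f u) * (f (g ▹ u) - f u)) (Per²-sq per g) h (det-mod h e)) ⟩
  + 2 * defect N f g + + 2 * defect N f h ∎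
  where
  open ℤₚ.≤-Reasoning
  l : ∀ a b c → a - c ≡ (a - b) + (b - c)
  l = solve-∀

defect-adj : ∀ N .{{_ : ℕ.NonZero N}} f → Per² N f → ∀ g → det g ≡ 1ℤ → defect N f (adj g) ≡ defect N f g
defect-adj N f per g e = trans (sym (∑-reindex N _ (Per²-sq per (adj g)) g (det-mod g e)))
  (∑-cong (res² N) (λ v → trans (cong (λ u → (f u - f (g ▹ v)) * (f u - f (g ▹ v))) (adj-inverseˡ g e v)) (l (f v) (f (g ▹ v)))))
  where
  l : ∀ a b → (a - b) * (a - b) ≡ (b - a) * (b - a)
  l = solve-∀

value≤total : ∀ N .{{_ : ℕ.NonZero N}} F → Per² N F → (∀ v → 0ℤ ≤ F v) → ∀ v → F v ≤ ∑ (res² N) F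
value≤total N F perF F≥0 v = subst (_≤ ∑ (res² N) F) (∑-δ² N F perF v) (∑-mono (res² N) (λ u → bound (+ N ∣? _) (+ N ∣? _) (F u) (F≥0 u)))
  where
  bound : {P Q : Set} (p : Dec P) (q : Dec Q) → ∀ b → 0ℤ ≤ b → ind p * ind q * b ≤ b
  bound (yes _) (yes _) b _   = ℤₚ.≤-reflexive (ℤₚ.*-identityˡ b)
  bound (yes _) (no _)  b 0≤b = 0≤b
  bound (no _)  q       b 0≤b = 0≤b

-- The constant k precedes N and f: it may depend on the matrix only.
record Controlled (g : Mat) : Set where
  constructor controlled
  field
    det-1 : det g ≡ 1ℤ
    k     : ℕ
    bound : ∀ N → .{{_ : ℕ.NonZero N}} → ∀ f → InV N f → defect N f g ≤ + k * energy N f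

controlled-L : Controlled Lᴹ
controlled-L = controlled refl 1 λ N f _ → ≤-by (defect N f Uᴹ) (defect≥0 N f Uᴹ) (sym (ℤₚ.*-identityˡ (energy N f)))

controlled-U : Controlled Uᴹ
controlled-U = controlled refl 1 λ N f _ → ≤-by (defect N f Lᴹ) (defect≥0 N f Lᴹ) (trans (ℤₚ.+-comm (defect N f Uᴹ) (defect N f Lᴹ)) (sym (ℤₚ.*-identityˡ (energy N f))))

controlled-· : ∀ g h → Controlled g → Controlled h → Controlled (g · h)
controlled-· g h (controlled dg k p) (controlled dh k′ p′) = controlled (trans (det-· g h) (cong₂ _*_ dg dh)) (2 ℕ.* (k ℕ.+ k′)) λ N f inV → begin
  defect N f (g · h)                                      ≤⟨ defect-· N f (InV.per inV) g h dh ⟩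
  + 2 * defect N f g + + 2 * defect N f h                 ≤⟨ ℤₚ.+-mono-≤ (*-monoˡ (+ 2) (+≤+ ℕ.z≤n) (p N f inV)) (*-monoˡ (+ 2) (+≤+ ℕ.z≤n) (p′ N f inV)) ⟩
  + 2 * (+ k * energy N f) + + 2 * (+ k′ * energy N f)    ≡⟨ trans (l (+ k) (+ k′) (energy N f)) (cong (_* energy N f) (trans (cong (λ t → + 2 * t) (sym (ℤₚ.pos-+ k k′))) (sym (ℤₚ.pos-* 2 (k ℕ.+ k′))))) ⟩
  + (2 ℕ.* (k ℕ.+ k′)) * energy N f ∎
  where
  open ℤₚ.≤-Reasoning
  l : ∀ a b e → + 2 * (a * e) + + 2 * (b * e) ≡ + 2 * (a + b) * e
  l = solve-∀

controlled-adj : ∀ g → Controlled g → Controlled (adj g)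
controlled-adj g (controlled dg k p) = controlled (trans (det-adj g) dg) k λ N f inV → ℤₚ.≤-trans (ℤₚ.≤-reflexive (defect-adj N f (InV.per inV) g dg)) (p N f inV)

-Iᴹ : Mat
-Iᴹ = mat -[1+ 0 ] 0ℤ 0ℤ -[1+ 0 ]

controlled--I : Controlled -Iᴹ
controlled--I = controlled refl 0 λ N f inV → ℤₚ.≤-reflexive (∑-zero∈ (res² N) (λ v _ → trans (cong (λ t → (t - f v) * (t - f v)) (neg N f inV v)) (l (f v))))
  where
  l : ∀ a → (a - a) * (a - a) ≡ 0ℤ
  l = solve-∀
  neg : ∀ N f → InV N f → ∀ v → f (-Iᴹ ▹ v) ≡ f v
  neg N f inV (x , y) = trans (cong f (cong₂ _,_ (l₁ x y) (l₂ x y))) (InV.scl inV -[1+ 0 ] (-[1+ 0 ] , ≡-mod-refl 1ℤ) (x , y))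
    where
    l₁ : ∀ x y → -[1+ 0 ] * x + 0ℤ * y ≡ -[1+ 0 ] * x
    l₁ = solve-∀
    l₂ : ∀ x y → 0ℤ * x + -[1+ 0 ] * y ≡ -[1+ 0 ] * y
    l₂ = solve-∀

shear : ℤ → Mat
shear k = mat 1ℤ k 0ℤ 1ℤ

controlled-shear⁺ : ∀ n → Controlled (shear (+ n))
controlled-shear⁺ zero = controlled refl 0 λ N f inV → ℤₚ.≤-reflexive (∑-zero∈ (res² N) (λ v _ → trans (cong (λ u → (f u - f v) * (f u - f v)) (I▹ v)) (l (f v))))
  where
  l : ∀ a → (a - a) * (a - a) ≡ 0ℤ
  l = solve-∀
controlled-shear⁺ (suc n) = subst Controlled (mat-≡ refl (l (+ n)) refl refl) (controlled-· Uᴹ (shear (+ n)) controlled-U (controlled-shear⁺ n))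
  where
  l : ∀ n → 1ℤ * n + 1ℤ * 1ℤ ≡ 1ℤ + n
  l = solve-∀
controlled-shear : ∀ k → Controlled (shear k)
controlled-shear (+ n)      = controlled-shear⁺ n
controlled-shear (-[1+ n ]) = controlled-adj (shear (+ suc n)) (controlled-shear⁺ (suc n))

Jᴹ : Mat
Jᴹ = mat 0ℤ -[1+ 0 ] 1ℤ 0ℤ

controlled-J : Controlled Jᴹ
controlled-J = controlled-· (adj Uᴹ · Lᴹ) (adj Uᴹ) (controlled-· (adj Uᴹ) Lᴹ cU controlled-L) cU
  where cU = controlled-adj Uᴹ controlled-U

controlled-upper : ∀ a b d → a * d ≡ 1ℤ → Controlled (mat a b 0ℤ d)
controlled-upper a b d e = go a d (ℕₚ.m*n≡1⇒m≡1 (abs a) (abs d) e′) (ℕₚ.m*n≡1⇒n≡1 (abs a) (abs d) e′) e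
  where
  e′ : abs a ℕ.* abs d ≡ 1
  e′ = trans (sym (ℤₚ.abs-* a d)) (cong abs e)
  go : ∀ a d → abs a ≡ 1 → abs d ≡ 1 → a * d ≡ 1ℤ → Controlled (mat a b 0ℤ d)
  go (+ 1) (+ 1) refl refl _ = controlled-shear b
  go (+ 1) (-[1+ 0 ]) refl refl ()
  go (-[1+ 0 ]) (+ 1) refl refl ()
  go (-[1+ 0 ]) (-[1+ 0 ]) refl refl _ = subst Controlled (mat-≡ refl (l b) refl refl) (controlled-· -Iᴹ (shear (- b)) controlled--I (controlled-shear (- b)))
    where
    l : ∀ b → -[1+ 0 ] * - b + 0ℤ * 1ℤ ≡ b
    l = solve-∀

-- Euclid's algorithm on the first column.
controlled-SL₂ : ∀ g → det g ≡ 1ℤ → Controlled g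
controlled-SL₂ g e = <-rec (λ n → ∀ g → abs (Mat.c g) ≡ n → det g ≡ 1ℤ → Controlled g) step _ g refl e
  where
  euclid : ∀ a b c d .{{_ : ℤNonZero c}} → (∀ {m} → m ℕ.< abs c → ∀ g → abs (Mat.c g) ≡ m → det g ≡ 1ℤ → Controlled g) →
           det (mat a b c d) ≡ 1ℤ → Controlled (mat a b c d)
  euclid a b c d rec e = subst Controlled
      (mat-≡ (l₁ a q c) (l₁ b q d) (l₂ c (- a + q * c)) (l₂ d (- b + q * d)))
      (controlled-· (shear q) (Jᴹ · g′) (controlled-shear q) (controlled-· Jᴹ g′ controlled-J (rec small g′ refl e′)))
    where
    q = a ℤD./ c
    g′ = mat c d (- a + q * c) (- b + q * d)
    e′ : det g′ ≡ 1ℤ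
    e′ = trans (l a b c d q) e
      where
      l : ∀ a b c d q → c * (- b + q * d) - d * (- a + q * c) ≡ a * d - b * c
      l = solve-∀
    small : abs (- a + q * c) ℕ.< abs c
    small = subst (ℕ._< abs c) (sym (trans (cong abs (trans (cong (λ t → - t + q * c) (ℤD.a≡a%n+[a/n]*n a c)) (l (+ (a ℤD.% c)) (q * c)))) (ℤₚ.∣-i∣≡∣i∣ (+ (a ℤD.% c))))) (ℤD.n%d<d a c)
      where
      l : ∀ r x → - (r + x) + x ≡ - r
      l = solve-∀
    l₁ : ∀ a q c → 1ℤ * (0ℤ * c + -[1+ 0 ] * (- a + q * c)) + q * (1ℤ * c + 0ℤ * (- a + q * c)) ≡ a
    l₁ = solve-∀
    l₂ : ∀ c x → 0ℤ * (0ℤ * c + -[1+ 0 ] * x) + 1ℤ * (1ℤ * c + 0ℤ * x) ≡ c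
    l₂ = solve-∀
  step : ∀ n → (∀ {m} → m ℕ.< n → ∀ g → abs (Mat.c g) ≡ m → det g ≡ 1ℤ → Controlled g) → ∀ g → abs (Mat.c g) ≡ n → det g ≡ 1ℤ → Controlled g
  step n rec (mat a b (+ zero) d) _ e = controlled-upper a b d (trans (l a b d) e)
    where
    l : ∀ a b d → a * d ≡ a * d - b * 0ℤ
    l = solve-∀
  step n rec (mat a b c@(+ suc _) d) refl e = euclid a b c d rec e
  step n rec (mat a b c@(-[1+ _ ]) d) refl e = euclid a b c d rec e

-- A finite sum of constants, one for each matrix of the ball. It is uniform in N because ρ is fixed
-- before N.
controlled-sum : ∀ ρ → Σ ℕ λ k → ∀ N → .{{_ : ℕ.NonZero N}} → ∀ f → InV N f → ∑ (Ball ρ) (defect N f) ≤ + k * energy N f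
controlled-sum ρ = go (Ball ρ) (λ m → Ball-det m)
  where
  go : ∀ xs → (∀ {g} → g ∈ xs → det g ≡ 1ℤ) → Σ ℕ λ k → ∀ N → .{{_ : ℕ.NonZero N}} → ∀ f → InV N f → ∑ xs (defect N f) ≤ + k * energy N f
  go []       _ = 0 , λ N f _ → ℤₚ.≤-refl
  go (g ∷ xs) h with controlled-SL₂ g (h (here refl)) | go xs (λ m → h (there m))
  ... | controlled _ k p | (k′ , p′) = k ℕ.+ k′ , λ N f inV → ℤₚ.≤-trans (ℤₚ.+-mono-≤ (p N f inV) (p′ N f inV))
        (ℤₚ.≤-reflexive (trans (sym (ℤₚ.*-distribʳ-+ (energy N f) (+ k) (+ k′))) (cong (_* energy N f) (sym (ℤₚ.pos-+ k k′)))))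

defect-expand : ∀ N .{{_ : ℕ.NonZero N}} f → Per² N f → ∀ g → det g ≡ 1ℤ →
                defect N f g ≡ + 2 * ⟨ f , f ⟩[ N ] - + 2 * ⟨ (λ v → f (g ▹ v)) , f ⟩[ N ]
defect-expand N f per g e = begin
  defect N f g
    ≡⟨ ∑-cong (res² N) (λ v → l (f (g ▹ v)) (f v)) ⟩
  ∑ (res² N) (λ v → (f (g ▹ v) * f (g ▹ v) + f v * f v) - + 2 * (f (g ▹ v) * f v))
    ≡⟨ trans (∑-- (res² N) _ _) (cong₂ _-_ (∑-⊕ (res² N) _ _) (∑-*ˡ (res² N) (+ 2) _)) ⟩
  (∑ (res² N) (λ v → f (g ▹ v) * f (g ▹ v)) + ⟨ f , f ⟩[ N ]) - + 2 * ⟨ (λ v → f (g ▹ v)) , f ⟩[ N ]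
    ≡⟨ cong (λ t → (t + ⟨ f , f ⟩[ N ]) - + 2 * ⟨ (λ v → f (g ▹ v)) , f ⟩[ N ])
         (∑-reindex N (λ u → f u * f u) (λ x y x′ y′ p q → cong (λ t → t * t) (per x y x′ y′ p q)) g (det-mod g e)) ⟩
  (⟨ f , f ⟩[ N ] + ⟨ f , f ⟩[ N ]) - + 2 * ⟨ (λ v → f (g ▹ v)) , f ⟩[ N ]
    ≡⟨ l′ ⟨ f , f ⟩[ N ] (+ 2 * ⟨ (λ v → f (g ▹ v)) , f ⟩[ N ]) ⟩
  + 2 * ⟨ f , f ⟩[ N ] - + 2 * ⟨ (λ v → f (g ▹ v)) , f ⟩[ N ] ∎
  where
  open ≡-Reasoning
  l : ∀ a b → (a - b) * (a - b) ≡ (a * a + b * b) - + 2 * (a * b)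
  l = solve-∀
  l′ : ∀ a b → (a + a) - b ≡ + 2 * a - b
  l′ = solve-∀

-- The defects over the ball add up to 2 q ‖f‖² minus twice the total correlation, and contraction
-- bounds the latter by q ‖f‖². So their sum is at least q ‖f‖², hence at least ‖f‖² as the ball
-- contains the identity.
new-forms-gap : Σ ℕ λ k → Σ ℕ λ N₀ → ∀ N → .{{_ : ℕ.NonZero N}} → N₀ ℕ.≤ N → ∀ f → InV N f → New N f → ⟨ f , f ⟩[ N ] ≤ + k * energy N f
new-forms-gap = go new-forms-contract
  where
  go : (Σ ℕ λ ρ → (1 ℕ.≤ ρ) × Σ ℕ λ N₀ → ∀ N → N₀ ℕ.≤ N → Contracting ρ N) →
       Σ ℕ λ k → Σ ℕ λ N₀ → ∀ N → .{{_ : ℕ.NonZero N}} → N₀ ℕ.≤ N → ∀ f → InV N f → New N f → ⟨ f , f ⟩[ N ] ≤ + k * energy N f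
  go (ρ , 1≤ρ , N₀ , con) = proj₁ (controlled-sum ρ) , N₀ , λ N N₀≤N f inV new → bound N N₀≤N f inV new
    where
    D = Ball ρ
    q = ∑ D (λ _ → 1ℤ)
    q≥1 : 1ℤ ≤ q
    q≥1 = ∑-term≤ {f = λ _ → 1ℤ} (λ _ → +≤+ ℕ.z≤n) (∈-Ball⁺ (1ℤ , 0ℤ) (0ℤ , 1ℤ) (∈-rng²⁺ (1ℤ , 0ℤ) 1≤ρ ℕ.z≤n) (∈-rng²⁺ (0ℤ , 1ℤ) ℕ.z≤n 1≤ρ) refl)
    bound : ∀ N → .{{_ : ℕ.NonZero N}} → N₀ ℕ.≤ N → ∀ f → InV N f → New N f → ⟨ f , f ⟩[ N ] ≤ + proj₁ (controlled-sum ρ) * energy N f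
    bound N N₀≤N f inV new = begin
      A                                     ≡⟨ sym (ℤₚ.*-identityˡ A) ⟩
      1ℤ * A                                ≤⟨ *-monoʳ A A≥0 q≥1 ⟩
      q * A                                 ≤⟨ ≤-by (q * A - + 2 * B) (0≤- (con N N₀≤N f inV new)) (l q A B) ⟩
      + 2 * A * q - + 2 * B                 ≡⟨ sym total ⟩
      ∑ D (defect N f)                      ≤⟨ proj₂ (controlled-sum ρ) N f inV ⟩
      + proj₁ (controlled-sum ρ) * energy N f ∎
      where
      open ℤₚ.≤-Reasoning
      A = ⟨ f , f ⟩[ N ]
      A≥0 : 0ℤ ≤ A
      A≥0 = ∑-nonneg (res² N) (λ v → 0≤² (f v))
      B = ∑ D (λ g → ⟨ (λ v → f (g ▹ v)) , f ⟩[ N ])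
      l : ∀ q a b → q * a + (q * a - + 2 * b) ≡ + 2 * a * q - + 2 * b
      l = solve-∀
      total : ∑ D (defect N f) ≡ + 2 * A * q - + 2 * B
      total = trans (∑-cong∈ D (λ g g∈ → trans (defect-expand N f (InV.per inV) g (Ball-det g∈)) (cong (λ t → t - + 2 * ⟨ (λ v → f (g ▹ v)) , f ⟩[ N ]) (sym (ℤₚ.*-identityʳ (+ 2 * A))))))
        (trans (∑-- D _ _) (cong₂ _-_ (∑-*ˡ D (+ 2 * A) (λ _ → 1ℤ)) (∑-*ˡ D (+ 2) _)))

-- Old forms

Prim-▹ : ∀ {N} g → det g ≡ 1ℤ → ∀ v → Prim N (g ▹ v) → Prim N v
Prim-▹ (mat a b c d) e (x , y) ((z , w) , pr) = (d * z - b * w , - c * z + a * w) , ∣-via pr (cong (λ t → t - 1ℤ) (l a b c d x y z w))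
  where
  l : ∀ a b c d x y z w → (a * x + b * y) * w - z * (c * x + d * y) ≡ x * (- c * z + a * w) - (d * z - b * w) * y
  l = solve-∀

InV-▹ : ∀ {N f} → InV N f → ∀ g → det g ≡ 1ℤ → InV N (λ v → f (g ▹ v))
InV-▹ {N} {f} inV g@(mat a b c d) e = record
  { per = Per²-▹ {F = f} per g
  ; scl = λ t u v → trans (cong f (lin t v)) (scl t u (g ▹ v))
  ; sup = λ v → [ inj₁ , (λ pr → inj₂ (Prim-▹ g e v pr)) ]′ (sup (g ▹ v)) }
  where
  open InV inV
  lin : ∀ t v → g ▹ t ⊛ v ≡ t ⊛ (g ▹ v)
  lin t (x , y) = cong₂ _,_ (l t a b x y) (l t c d x y)
    where
    l : ∀ t a b x y → a * (t * x) + b * (t * y) ≡ t * (a * x + b * y)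
    l = solve-∀

InV-lin : ∀ {N f h} → InV N f → InV N h → ∀ a b → InV N (λ v → a * f v + b * h v)
InV-lin {N} {f} {h} F H a b = record
  { per = λ x y x′ y′ p q → cong₂ (λ s t → a * s + b * t) (InV.per F x y x′ y′ p q) (InV.per H x y x′ y′ p q)
  ; scl = λ t u v → cong₂ (λ s t → a * s + b * t) (InV.scl F t u v) (InV.scl H t u v)
  ; sup = sup }
  where
  z : ∀ a b → a * 0ℤ + b * 0ℤ ≡ 0ℤ
  z = solve-∀
  sup : ∀ v → a * f v + b * h v ≡ 0ℤ ⊎ Prim N v
  sup v with InV.sup F v | InV.sup H v
  ... | inj₂ pr | _ = inj₂ pr
  ... | inj₁ _  | inj₂ pr = inj₂ pr
  ... | inj₁ e  | inj₁ e′ = inj₁ (trans (cong₂ (λ s t → a * s + b * t) e e′) (z a b))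

InV-cong : ∀ {N f h} → (∀ v → f v ≡ h v) → InV N f → InV N h
InV-cong eq F = record
  { per = λ x y x′ y′ p q → trans (sym (eq (x , y))) (trans (InV.per F x y x′ y′ p q) (eq (x′ , y′)))
  ; scl = λ t u v → trans (sym (eq (t ⊛ v))) (trans (InV.scl F t u v) (eq v))
  ; sup = λ v → [ (λ e → inj₁ (trans (sym (eq v)) e)) , inj₂ ]′ (InV.sup F v) }

≡-mod-weaken : ∀ {M N} → + M ∣ + N → ∀ x y → x ≡ y [ N ] → x ≡ y [ M ]
≡-mod-weaken M∣N _ _ h = Div.∣-trans M∣N h

∑²-shift : ∀ p (F : V → ℤ) → Per² p F → ∀ k → ∑ (res² p) (λ j → F (k ⊞ j)) ≡ ∑ (res² p) F
∑²-shift p F per (k , l) = begin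
  ∑ (res² p) (λ j → F ((k , l) ⊞ j))                                       ≡⟨ ∑²-nested p _ ⟩
  ∑ (res p) (λ x → ∑ (res p) (λ y → F (k + x , l + y)))                    ≡⟨ ∑-cong (res p) (λ x → ∑-shift p (λ y → F (k + x , y)) (λ a b e → per (k + x) a (k + x) b (≡-mod-refl (k + x)) e) l) ⟩
  ∑ (res p) (λ x → ∑ (res p) (λ y → F (k + x , y)))                        ≡⟨ ∑-shift p (λ x → ∑ (res p) (λ y → F (x , y))) (λ a b e → ∑-cong (res p) (λ y → per a y b y e (≡-mod-refl y))) k ⟩
  ∑ (res p) (λ x → ∑ (res p) (λ y → F (x , y)))                            ≡⟨ sym (∑²-nested p F) ⟩
  ∑ (res² p) F ∎
  where open ≡-Reasoning

∑-fibres : ∀ p d (F : ℤ → ℤ) → ∑ (res (p ℕ.* d)) F ≡ ∑ (res d) (λ c → ∑ (res p) (λ j → F (c + + d * j)))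
∑-fibres p d F = begin
  ∑ (res (p ℕ.* d)) F
    ≡⟨ ∑-applyUpTo-∘ +_ id (p ℕ.* d) F ⟩
  ∑ (applyUpTo id (p ℕ.* d)) (λ i → F (+ i))
    ≡⟨ ∑-blocks d p (λ i → F (+ i)) ⟩
  ∑ (applyUpTo id p) (λ j → ∑ (applyUpTo id d) (λ c → F (+ (j ℕ.* d ℕ.+ c))))
    ≡⟨ ∑-cong (applyUpTo id p) (λ j → ∑-cong (applyUpTo id d) (λ c → cong F (trans (ℤₚ.pos-+ (j ℕ.* d) c) (trans (cong (λ t → t + + c) (ℤₚ.pos-* j d)) (l (+ j) (+ d) (+ c)))))) ⟩
  ∑ (applyUpTo id p) (λ j → ∑ (applyUpTo id d) (λ c → F (+ c + + d * + j)))
    ≡⟨ ∑-swap (applyUpTo id p) (applyUpTo id d) _ ⟩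
  ∑ (applyUpTo id d) (λ c → ∑ (applyUpTo id p) (λ j → F (+ c + + d * + j)))
    ≡⟨ ∑-cong (applyUpTo id d) (λ c → sym (∑-applyUpTo-∘ +_ id p (λ j → F (+ c + + d * j)))) ⟩
  ∑ (applyUpTo id d) (λ c → ∑ (res p) (λ j → F (+ c + + d * j)))
    ≡⟨ sym (∑-applyUpTo-∘ +_ id d (λ c → ∑ (res p) (λ j → F (c + + d * j)))) ⟩
  ∑ (res d) (λ c → ∑ (res p) (λ j → F (c + + d * j))) ∎
  where
  open ≡-Reasoning
  l : ∀ j d c → j * d + c ≡ c + d * j
  l = solve-∀

∑²-fibres : ∀ p d (F : V → ℤ) → ∑ (res² (p ℕ.* d)) F ≡ ∑ (res² d) (λ c → ∑ (res² p) (λ j → F (c ⊞ + d ⊛ j)))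
∑²-fibres p d F = begin
  ∑ (res² (p ℕ.* d)) F
    ≡⟨ trans (∑²-nested (p ℕ.* d) F) (trans (∑-fibres p d _) (∑-cong (res d) (λ c → ∑-cong (res p) (λ j → ∑-fibres p d _)))) ⟩
  ∑ (res d) (λ c → ∑ (res p) (λ j → ∑ (res d) (λ c′ → ∑ (res p) (λ j′ → F (c + + d * j , c′ + + d * j′)))))
    ≡⟨ ∑-cong (res d) (λ c → ∑-swap (res p) (res d) _) ⟩
  ∑ (res d) (λ c → ∑ (res d) (λ c′ → ∑ (res p) (λ j → ∑ (res p) (λ j′ → F (c + + d * j , c′ + + d * j′)))))
    ≡⟨ ∑-cong (res d) (λ c → ∑-cong (res d) (λ c′ → sym (∑²-nested p _))) ⟩
  ∑ (res d) (λ c → ∑ (res d) (λ c′ → ∑ (res² p) (λ j → F ((c , c′) ⊞ + d ⊛ j))))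
    ≡⟨ sym (∑²-nested d _) ⟩
  ∑ (res² d) (λ c → ∑ (res² p) (λ j → F (c ⊞ + d ⊛ j))) ∎
  where open ≡-Reasoning

prime-unit : ∀ {p} → Prime p → ∀ x → ¬ (+ p ∣ x) → Unit p x
prime-unit {p} pp x p∤x = signed x (λ e → p∤x e) (bez (coprime-Bézout cop))
  where
  cop : Coprime (abs x) p
  cop {i} (i∣x , i∣p) with prime⇒irreducible pp i∣p
  ... | inj₁ i≡1 = i≡1
  ... | inj₂ refl = ⊥-elim (p∤x (Div.∣ᵤ⇒∣ i∣x))
  bez : Bézout.Identity 1 (abs x) p → Unit p (+ abs x)
  bez (Bézout.+- s t eq) = + s , divides (+ t) (trans (cong (λ z → z - 1ℤ) (trans (sym (ℤₚ.pos-* (abs x) s)) (trans (cong (λ z → + z) (trans (ℕₚ.*-comm (abs x) s) (sym eq))) (ℤₚ.pos-+ 1 (t ℕ.* p))))) (trans (l (+ (t ℕ.* p))) (ℤₚ.pos-* t p)))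
    where
    l : ∀ z → (1ℤ + z) - 1ℤ ≡ z
    l = solve-∀
  bez (Bézout.-+ s t eq) = - + s , divides (- + t) (trans (l (+ abs x) (+ s)) (trans (cong (λ z → - z) (trans (cong (λ z → 1ℤ + z) (trans (sym (ℤₚ.pos-* (abs x) s)) (cong (λ z → + z) (ℕₚ.*-comm (abs x) s)))) (trans (sym (ℤₚ.pos-+ 1 (s ℕ.* abs x))) (trans (cong (λ z → + z) eq) (ℤₚ.pos-* t p))))) (l′ (+ t) (+ p))))
    where
    l : ∀ x s → x * - s - 1ℤ ≡ - (1ℤ + x * s)
    l = solve-∀
    l′ : ∀ t p → - (t * p) ≡ - t * p
    l′ = solve-∀
  signed : ∀ x → (+ p ∣ x → ⊥) → Unit p (+ abs x) → Unit p x
  signed (+ n)      _ u = u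
  signed (-[1+ n ]) _ (s , e) = - s , ∣-via e (cong (λ z → z - 1ℤ) (l (+ suc n) s))
    where
    l : ∀ x s → x * s ≡ - x * - s
    l = solve-∀

∑-zero-or : ∀ {A : Set} {P : Set} (xs : List A) (f : A → ℤ) → (∀ x → f x ≡ 0ℤ ⊎ P) → ∑ xs f ≡ 0ℤ ⊎ P
∑-zero-or []       f h = inj₁ refl
∑-zero-or (x ∷ xs) f h with h x | ∑-zero-or xs f h
... | inj₂ p | _ = inj₂ p
... | inj₁ _ | inj₂ p = inj₂ p
... | inj₁ e | inj₁ e′ = inj₁ (cong₂ _+_ e e′)

-- The trace of f to level d = N/p, and the splitting of f into a form of level d and a form with vanishing trace.
module Peel (p d : ℕ) (pp : Prime p) .{{d≢0 : ℕ.NonZero d}} where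
  open ℤₚ.≤-Reasoning

  instance
    p≢0 : ℕ.NonZero p
    p≢0 = prime⇒nonZero pp

  N : ℕ
  N = p ℕ.* d

  instance
    N≢0 : ℕ.NonZero N
    N≢0 = ℕₚ.m*n≢0 p d

  N≡ : + N ≡ + p * + d
  N≡ = ℤₚ.pos-* p d

  d∣N : + d ∣ + N
  d∣N = divides (+ p) N≡

  p∣N : + p ∣ + N
  p∣N = divides (+ d) (trans N≡ (ℤₚ.*-comm (+ p) (+ d)))

  p∤1 : ¬ (+ p ∣ 1ℤ)
  p∤1 e = ℕ.nonTrivial⇒≢1 {{prime⇒nonTrivial pp}} (ℕD.∣1⇒≡1 (Div.∣⇒∣ᵤ e))

  S : (V → ℤ) → V → ℤ
  S f c = ∑ (res² p) (λ j → f (c ⊞ + d ⊛ j))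

  lift-mod : ∀ c x x′ → x ≡ x′ [ p ] → c + + d * x ≡ c + + d * x′ [ N ]
  lift-mod c x x′ (divides q e) = divides q (trans (l c (+ d) x x′) (trans (*-congˡ (+ d) e) (trans (l′ (+ d) q (+ p)) (*-congˡ q (sym N≡)))))
    where
    l : ∀ c d x x′ → (c + d * x) - (c + d * x′) ≡ d * (x - x′)
    l = solve-∀
    l′ : ∀ d q p → d * (q * p) ≡ q * (p * d)
    l′ = solve-∀

  fibre-per : ∀ {f} → Per² N f → ∀ c → Per² p (λ j → f (c ⊞ + d ⊛ j))
  fibre-per per (c , c′) x y x′ y′ e e′ = per _ _ _ _ (lift-mod c x x′ e) (lift-mod c′ y y′ e′)

  S-per : ∀ {f} → Per² N f → Per² d (S f)
  S-per {f} per x y x′ y′ (divides q e) (divides q′ e′) =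
    trans (∑-cong (res² p) (λ (j , j′) → cong f (cong₂ _,_ (eq x x′ q j e) (eq y y′ q′ j′ e′))))
          (∑²-shift p (λ j → f ((x′ , y′) ⊞ + d ⊛ j)) (fibre-per {f} per (x′ , y′)) (q , q′))
    where
    eq : ∀ x x′ q j → x - x′ ≡ q * + d → x + + d * j ≡ x′ + + d * (q + j)
    eq x x′ q j e = trans (l x x′ (+ d * j)) (trans (cong (λ t → x′ + t + + d * j) e) (l′ x′ q (+ d) j))
      where
      l : ∀ x x′ z → x + z ≡ x′ + (x - x′) + z
      l = solve-∀
      l′ : ∀ x q d j → x + q * d + d * j ≡ x + d * (q + j)
      l′ = solve-∀

  -- The witness x satisfies 1 - t x = (1 - t s)(1 - t s′). This works also when p divides d, where
  -- the Chinese remainder theorem does not apply.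
  Unit-prod : ∀ t → Unit p t → Unit d t → Unit N t
  Unit-prod t (s , divides q e) (s′ , divides q′ e′) = s + s′ - s * (t * s′) , divides (- (q * q′))
      (trans (l t s s′) (trans (cong₂ (λ a b → - (a * b)) e e′) (trans (l′ q q′ (+ p) (+ d)) (*-congˡ (- (q * q′)) (sym N≡)))))
    where
    l : ∀ t s s′ → t * (s + s′ - s * (t * s′)) - 1ℤ ≡ - ((t * s - 1ℤ) * (t * s′ - 1ℤ))
    l = solve-∀
    l′ : ∀ q q′ p d → - ((q * p) * (q′ * d)) ≡ - (q * q′) * (p * d)
    l′ = solve-∀

  Prim-prod : ∀ v → Prim p v → Prim d v → Prim N v
  Prim-prod (x , y) ((z , w) , divides q e) ((z′ , w′) , divides q′ e′) =
    (z + z′ - a * z′ , w + w′ - a * w′) , divides (- (q * q′))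
      (trans (l x y z w z′ w′) (trans (cong₂ (λ a b → - (a * b)) e e′) (trans (l′ q q′ (+ p) (+ d)) (*-congˡ (- (q * q′)) (sym N≡)))))
    where
    a = x * w - z * y
    l : ∀ x y z w z′ w′ → x * (w + w′ - (x * w - z * y) * w′) - (z + z′ - (x * w - z * y) * z′) * y - 1ℤ ≡ - ((x * w - z * y - 1ℤ) * (x * w′ - z′ * y - 1ℤ))
    l = solve-∀
    l′ : ∀ q q′ p d → - ((q * p) * (q′ * d)) ≡ - (q * q′) * (p * d)
    l′ = solve-∀

  Prim-fibre : ∀ c j → Prim N (c ⊞ + d ⊛ j) → Prim d c
  Prim-fibre (c , c′) (j , j′) ((z , w) , e) = (z , w) , ∣-via (Div.∣m∣n⇒∣m-n (Div.∣-trans d∣N e) (divides (j * w - z * j′) refl)) (l c c′ j j′ z w (+ d))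
    where
    l : ∀ c c′ j j′ z w d → ((c + d * j) * w - z * (c′ + d * j′) - 1ℤ) - (j * w - z * j′) * d ≡ c * w - z * c′ - 1ℤ
    l = solve-∀

  -- If p divides t, then p does not divide d, since t is invertible modulo d; so p does not divide
  -- t + d. This makes traces to level d invariant under all units modulo d.
  lift-unit : ∀ t → Unit d t → Σ ℤ λ t′ → t ≡ t′ [ d ] × Unit p t′ × Unit N t′
  lift-unit t ud@(s , e) with + p ∣? t
  ... | no p∤t = t , ≡-mod-refl t , up , Unit-prod t up ud
    where up = prime-unit pp t p∤t
  ... | yes p∣t = t + + d , ∣-via (divides (-[1+ 0 ]) refl) (l t (+ d)) , up , Unit-prod (t + + d) up (s , ∣-via (Div.∣m∣n⇒∣m+n e (divides s refl)) (l′ t s (+ d)))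
    where
    l : ∀ t d → -[1+ 0 ] * d ≡ t - (t + d)
    l = solve-∀
    l′ : ∀ t s d → (t * s - 1ℤ) + s * d ≡ (t + d) * s - 1ℤ
    l′ = solve-∀
    l″ : ∀ t s → t * s - (t * s - 1ℤ) ≡ 1ℤ
    l″ = solve-∀
    p∤d : ¬ (+ p ∣ + d)
    p∤d p∣d = p∤1 (∣-via (Div.∣m∣n⇒∣m-n (Div.∣m⇒∣m*n s p∣t) (Div.∣-trans p∣d e)) (l″ t s))
    up : Unit p (t + + d)
    up = prime-unit pp (t + + d) (λ e′ → p∤d (Div.∣m+n∣m⇒∣n e′ p∣t))

  ∑²-scale : ∀ t → Unit p t → ∀ F → Per² p F → ∑ (res² p) (λ j → F (t ⊛ j)) ≡ ∑ (res² p) F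
  ∑²-scale t u@(s , e) F per = begin-equality
    ∑ (res² p) (λ j → F (t ⊛ j))
      ≡⟨ ∑-cong (res² p) (λ j → sym (∑-δ² p F per (t ⊛ j))) ⟩
    ∑ (res² p) (λ j → ∑ (res² p) (λ i → δ² p i (t ⊛ j) * F i))
      ≡⟨ ∑-swap (res² p) (res² p) _ ⟩
    ∑ (res² p) (λ i → ∑ (res² p) (λ j → δ² p i (t ⊛ j) * F i))
      ≡⟨ ∑-cong (res² p) (λ i → trans (∑-*ʳ (res² p) (F i) _) (trans (*-congʳ (F i) (trans (∑-cong (res² p) (λ j → flip i j)) (∑-δ²1 p (s ⊛ i)))) (ℤₚ.*-identityˡ (F i)))) ⟩
    ∑ (res² p) F ∎
    where
    one : ∀ i j → + p ∣ i - t * j → + p ∣ j - s * i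
    one i j h = ∣-via (Div.∣m∣n⇒∣m-n (Div.∣n⇒∣m*n (- s) h) (Div.∣m⇒∣m*n j e)) (l i j s t)
      where
      l : ∀ i j s t → - s * (i - t * j) - (t * s - 1ℤ) * j ≡ j - s * i
      l = solve-∀
    two : ∀ i j → + p ∣ j - s * i → + p ∣ i - t * j
    two i j h = ∣-via (Div.∣m∣n⇒∣m-n (Div.∣n⇒∣m*n (- t) h) (Div.∣m⇒∣m*n i e)) (l i j s t)
      where
      l : ∀ i j s t → - t * (j - s * i) - (t * s - 1ℤ) * i ≡ i - t * j
      l = solve-∀
    flip : ∀ i j → δ² p i (t ⊛ j) ≡ δ² p j (s ⊛ i)
    flip (i , i′) (j , j′) = ind²-⇔ (+ p ∣? _) (+ p ∣? _) (+ p ∣? _) (+ p ∣? _) (λ h h′ → one i j h , one i′ j′ h′) (λ h h′ → two i j h , two i′ j′ h′)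

  S-InV : ∀ {f} → InV N f → InV d (S f)
  S-InV {f} inV = record { per = S-per {f} per ; scl = scl′ ; sup = λ c → ∑-zero-or (res² p) _ (λ j → [ inj₁ , (λ pr → inj₂ (Prim-fibre c j pr)) ]′ (sup (c ⊞ + d ⊛ j))) }
    where
    open InV inV
    scl′ : ∀ t → Unit d t → ∀ c → S f (t ⊛ c) ≡ S f c
    scl′ t u c@(x , y) with lift-unit t u
    ... | (t′ , t≡t′ , up , uN) = begin-equality
      S f (t ⊛ c)   ≡⟨ S-per {f} per (t * x) (t * y) (t′ * x) (t′ * y) (≡-mod-* t x t′ x t≡t′ (≡-mod-refl x)) (≡-mod-* t y t′ y t≡t′ (≡-mod-refl y)) ⟩
      S f (t′ ⊛ c)  ≡⟨ sym (∑²-scale t′ up (λ j → f (t′ ⊛ c ⊞ + d ⊛ j)) (fibre-per {f} per (t′ ⊛ c))) ⟩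
      ∑ (res² p) (λ j → f (t′ ⊛ c ⊞ + d ⊛ t′ ⊛ j))
                    ≡⟨ ∑-cong (res² p) (λ (j , j′) → trans (cong f (cong₂ _,_ (l t′ x (+ d) j) (l t′ y (+ d) j′))) (scl t′ uN (c ⊞ + d ⊛ (j , j′)))) ⟩
      S f c ∎
      where
      l : ∀ t x d j → t * x + d * (t * j) ≡ t * (x + d * j)
      l = solve-∀

  S-▹ : ∀ {f} → Per² N f → ∀ g → det g ≡ 1ℤ → ∀ c → S (λ v → f (g ▹ v)) c ≡ S f (g ▹ c)
  S-▹ {f} per g@(mat a b c′ d′) e (x , y) = begin-equality
    ∑ (res² p) (λ j → f (g ▹ ((x , y) ⊞ + d ⊛ j)))
      ≡⟨ ∑-cong (res² p) (λ (j , j′) → cong f (cong₂ _,_ (l a b x y (+ d) j j′) (l c′ d′ x y (+ d) j j′))) ⟩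
    ∑ (res² p) (λ j → f ((g ▹ (x , y)) ⊞ + d ⊛ (g ▹ j)))
      ≡⟨ ∑-reindex p (λ j → f ((g ▹ (x , y)) ⊞ + d ⊛ j)) (fibre-per {f} per (g ▹ (x , y))) g (det-mod g e) ⟩
    S f (g ▹ (x , y)) ∎
    where
    l : ∀ a b x y d j j′ → a * (x + d * j) + b * (y + d * j′) ≡ (a * x + b * y) + d * (a * j + b * j′)
    l = solve-∀

  Mask : V → Set
  Mask (x , y) = ¬ (+ p ∣ x × + p ∣ y)

  mask? : ∀ v → Dec (Mask v)
  mask? (x , y) = ¬? ((+ p ∣? x) ×-dec (+ p ∣? y))

  m : V → ℤ
  m v = ind (mask? v)

  m-idem : ∀ v → m v * m v ≡ m v
  m-idem v with mask? v
  ... | yes _ = refl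
  ... | no  _ = refl

  Mask⇒Prim : ∀ v → Mask v → Prim p v
  Mask⇒Prim (x , y) h with + p ∣? x
  ... | no p∤x = let (s , e) = prime-unit pp x p∤x in (0ℤ , s) , ∣-via e (l x y s)
    where
    l : ∀ x y s → x * s - 1ℤ ≡ x * s - 0ℤ * y - 1ℤ
    l = solve-∀
  ... | yes p∣x = let (s , e) = prime-unit pp y (λ p∣y → h (p∣x , p∣y)) in (- s , 0ℤ) , ∣-via e (l x y s)
    where
    l : ∀ x y s → y * s - 1ℤ ≡ x * 0ℤ - - s * y - 1ℤ
    l = solve-∀

  Prim⇒Mask : ∀ v → Prim p v → Mask v
  Prim⇒Mask (x , y) ((z , w) , e) (p∣x , p∣y) =
    p∤1 (∣-via (Div.∣m∣n⇒∣m-n (Div.∣m∣n⇒∣m-n (Div.∣m⇒∣m*n w p∣x) (Div.∣n⇒∣m*n z p∣y)) e) (l (x * w - z * y)))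
    where
    l : ∀ a → a - (a - 1ℤ) ≡ 1ℤ
    l = solve-∀

  Prim-p : ∀ {v} → Prim N v → Prim p v
  Prim-p (z , e) = z , Div.∣-trans p∣N e

  m-absorb : ∀ {f} → InV N f → ∀ v → m v * f v ≡ f v
  m-absorb {f} inV v with InV.sup inV v
  ... | inj₁ e = trans (*-congˡ (m v) e) (trans (ℤₚ.*-zeroʳ (m v)) (sym e))
  ... | inj₂ pr = trans (*-congʳ (f v) (ind-yes (mask? v) (Prim⇒Mask v (Prim-p {v} pr)))) (ℤₚ.*-identityˡ (f v))

  m-cong : ∀ v v′ → (Mask v → Mask v′) → (Mask v′ → Mask v) → m v ≡ m v′
  m-cong v v′ = ind-⇔ (mask? v) (mask? v′)

  m-per : Per² p m
  m-per x y x′ y′ e e′ = m-cong (x , y) (x′ , y′) (tr x y x′ y′ e e′) (tr x′ y′ x y (≡-mod-sym x x′ e) (≡-mod-sym y y′ e′))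
    where
    back : ∀ x x′ → x ≡ x′ [ p ] → + p ∣ x′ → + p ∣ x
    back x x′ e h = ∣-via (Div.∣m∣n⇒∣m+n e h) (l x x′)
      where
      l : ∀ x x′ → x - x′ + x′ ≡ x
      l = solve-∀
    tr : ∀ x y x′ y′ → x ≡ x′ [ p ] → y ≡ y′ [ p ] → Mask (x , y) → Mask (x′ , y′)
    tr x y x′ y′ e e′ h (hx , hy) = h (back x x′ e hx , back y y′ e′ hy)

  m-▹ : ∀ g → det g ≡ 1ℤ → ∀ v → m (g ▹ v) ≡ m v
  m-▹ g e v = m-cong (g ▹ v) v (λ h k → h (fwd g v k)) (λ h k → h (subst (λ u → + p ∣ proj₁ u × + p ∣ proj₂ u) (adj-inverseˡ g e v) (fwd (adj g) (g ▹ v) k)))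
    where
    fwd : ∀ g v → (+ p ∣ proj₁ v × + p ∣ proj₂ v) → (+ p ∣ proj₁ (g ▹ v) × + p ∣ proj₂ (g ▹ v))
    fwd (mat a b c d) (x , y) (hx , hy) = Div.∣m∣n⇒∣m+n (Div.∣n⇒∣m*n a hx) (Div.∣n⇒∣m*n b hy) , Div.∣m∣n⇒∣m+n (Div.∣n⇒∣m*n c hx) (Div.∣n⇒∣m*n d hy)

  m-⊛ : ∀ t → Unit p t → ∀ v → m (t ⊛ v) ≡ m v
  m-⊛ t (s , e) (x , y) = m-cong (t ⊛ (x , y)) (x , y) (λ h (hx , hy) → h (Div.∣n⇒∣m*n t hx , Div.∣n⇒∣m*n t hy)) (λ h (hx , hy) → h (un x hx , un y hy))
    where
    un : ∀ x → + p ∣ t * x → + p ∣ x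
    un x h = ∣-via (Div.∣m∣n⇒∣m-n (Div.∣n⇒∣m*n s h) (Div.∣m⇒∣m*n x e)) (l s t x)
      where
      l : ∀ s t x → s * (t * x) - (t * s - 1ℤ) * x ≡ x
      l = solve-∀

  -- This is p² when p divides d and p² - 1 otherwise: in the second case exactly one point of the
  -- fibre is divisible by p.
  κ : ℤ
  κ = + p * + p - (1ℤ - ind (+ p ∣? + d))

  -- The number of points of the fibre over c that stay primitive at p.
  fibre-mask : ∀ c → Prim d c → ∑ (res² p) (λ j → m (c ⊞ + d ⊛ j)) ≡ κ
  fibre-mask c@(x , y) pr with + p ∣? + d
  ... | yes p∣d = trans (∑-cong (res² p) (λ j → ind-yes (mask? (c ⊞ + d ⊛ j)) (full j))) (trans (∑²-const p 1ℤ) (l (+ p)))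
    where
    l : ∀ p → p * p * 1ℤ ≡ p * p - (1ℤ - 1ℤ)
    l = solve-∀
    full : ∀ j → Mask (c ⊞ + d ⊛ j)
    full (j , j′) (h , h′) = Prim⇒Mask c (proj₁ pr , Div.∣-trans p∣d (proj₂ pr)) (Div.∣m+n∣n⇒∣m h (Div.∣m⇒∣m*n j p∣d) , Div.∣m+n∣n⇒∣m h′ (Div.∣m⇒∣m*n j′ p∣d))
  ... | no p∤d = begin-equality
    ∑ (res² p) (λ j → m (c ⊞ + d ⊛ j))
      ≡⟨ ∑-cong (res² p) pt ⟩
    ∑ (res² p) (λ j → 1ℤ - δ² p j j₀)
      ≡⟨ trans (∑-- (res² p) (λ _ → 1ℤ) (λ j → δ² p j j₀)) (cong₂ _-_ (∑²-const p 1ℤ) (∑-δ²1 p j₀)) ⟩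
    + p * + p * 1ℤ - 1ℤ
      ≡⟨ l (+ p) ⟩
    + p * + p - (1ℤ - 0ℤ) ∎
    where
    l : ∀ p → p * p * 1ℤ - 1ℤ ≡ p * p - (1ℤ - 0ℤ)
    l = solve-∀
    s = proj₁ (prime-unit pp (+ d) p∤d)
    e = proj₂ (prime-unit pp (+ d) p∤d)
    j₀ : V
    j₀ = (- (s * x) , - (s * y))
    fwd : ∀ x j → + p ∣ x + + d * j → + p ∣ j - - (s * x)
    fwd x j h = ∣-via (Div.∣m∣n⇒∣m-n (Div.∣n⇒∣m*n s h) (Div.∣m⇒∣m*n j e)) (l₁ s x (+ d) j)
      where
      l₁ : ∀ s x d j → s * (x + d * j) - (d * s - 1ℤ) * j ≡ j - - (s * x)
      l₁ = solve-∀
    bwd : ∀ x j → + p ∣ j - - (s * x) → + p ∣ x + + d * j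
    bwd x j h = ∣-via (Div.∣m∣n⇒∣m-n (Div.∣n⇒∣m*n (+ d) h) (Div.∣m⇒∣m*n x e)) (l₁ s x (+ d) j)
      where
      l₁ : ∀ s x d j → d * (j - - (s * x)) - (d * s - 1ℤ) * x ≡ x + d * j
      l₁ = solve-∀
    neg-ind : {P : Set} (a : Dec P) → ind (¬? a) ≡ 1ℤ - ind a
    neg-ind (yes _) = refl
    neg-ind (no _)  = refl
    pt : ∀ j → m (c ⊞ + d ⊛ j) ≡ 1ℤ - δ² p j j₀
    pt (j , j′) = trans (neg-ind ((+ p ∣? (x + + d * j)) ×-dec (+ p ∣? (y + + d * j′)))) (cong (λ t → 1ℤ - t)
      (trans (sym (ind-* (+ p ∣? (x + + d * j)) (+ p ∣? (y + + d * j′))))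
        (ind²-⇔ (+ p ∣? _) (+ p ∣? _) (+ p ∣? _) (+ p ∣? _) (λ h h′ → fwd x j h , fwd y j′ h′) (λ h h′ → bwd x j h , bwd y j′ h′))))

  κ>0 : 0ℤ < κ
  κ>0 with + p ∣? + d
  ... | yes _ = ℤₚ.<-≤-trans (+<+ (ℕ.s≤s ℕ.z≤n)) (ℤₚ.≤-trans 4≤p² (ℤₚ.≤-reflexive (l (+ p * + p))))
    where
    l : ∀ x → x ≡ x - (1ℤ - 1ℤ)
    l = solve-∀
    4≤p² : + 4 ≤ + p * + p
    4≤p² = subst (+ 4 ≤_) (ℤₚ.pos-* p p) (+≤+ (ℕₚ.*-mono-≤ (ℕ.nonTrivial⇒n>1 p {{prime⇒nonTrivial pp}}) (ℕ.nonTrivial⇒n>1 p {{prime⇒nonTrivial pp}})))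
  ... | no _ = ℤₚ.<-≤-trans (+<+ (ℕ.s≤s ℕ.z≤n)) (ℤₚ.≤-trans (≤-by {+ 3} (+ p * + p - + 4) (0≤- 4≤p²) (l (+ p * + p))) ℤₚ.≤-refl)
    where
    l : ∀ x → + 3 + (x - + 4) ≡ x - (1ℤ - 0ℤ)
    l = solve-∀
    4≤p² : + 4 ≤ + p * + p
    4≤p² = subst (+ 4 ≤_) (ℤₚ.pos-* p p) (+≤+ (ℕₚ.*-mono-≤ (ℕ.nonTrivial⇒n>1 p {{prime⇒nonTrivial pp}}) (ℕ.nonTrivial⇒n>1 p {{prime⇒nonTrivial pp}})))

  masked-sum : ∀ h → Per² d h → (∀ c → h c ≡ 0ℤ ⊎ Prim d c) → ∑ (res² N) (λ v → m v * h v) ≡ κ * ∑ (res² d) h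
  masked-sum h per sup = trans (∑²-fibres p d (λ v → m v * h v)) (trans (∑-cong (res² d) pt) (∑-*ˡ (res² d) κ h))
    where
    drop : ∀ c j → h (c ⊞ + d ⊛ j) ≡ h c
    drop (x , y) (j , j′) = per _ _ _ _ (divides j (l x (+ d) j)) (divides j′ (l y (+ d) j′))
      where
      l : ∀ x d j → x + d * j - x ≡ j * d
      l = solve-∀
    pt : ∀ c → ∑ (res² p) (λ j → m (c ⊞ + d ⊛ j) * h (c ⊞ + d ⊛ j)) ≡ κ * h c
    pt c = trans (∑-cong (res² p) (λ j → *-congˡ (m (c ⊞ + d ⊛ j)) (drop c j))) (trans (∑-*ʳ (res² p) (h c) _) ([ zero-case , (λ pr → *-congʳ (h c) (fibre-mask c pr)) ]′ (sup c)))
      where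
      zero-case : h c ≡ 0ℤ → ∑ (res² p) (λ j → m (c ⊞ + d ⊛ j)) * h c ≡ κ * h c
      zero-case e = trans (trans (*-congˡ (∑ (res² p) (λ j → m (c ⊞ + d ⊛ j))) e) (ℤₚ.*-zeroʳ (∑ (res² p) (λ j → m (c ⊞ + d ⊛ j))))) (sym (trans (*-congˡ κ e) (ℤₚ.*-zeroʳ κ)))

  -- The average of f over the primitive points of each fibre is m · S f / κ, which is the
  -- orthogonal projection to forms coming from level d. `rest` is the complement, multiplied by κ
  -- to stay in ℤ. The mask m keeps the support on vectors that are primitive at p.
  rest : (V → ℤ) → V → ℤ
  rest f v = κ * f v + -[1+ 0 ] * (m v * S f v)

  S-drop : ∀ {f} → Per² N f → ∀ c j → S f (c ⊞ + d ⊛ j) ≡ S f c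
  S-drop {f} per (x , y) (j , j′) = S-per {f} per (x + + d * j) (y + + d * j′) x y (divides j (l x (+ d) j)) (divides j′ (l y (+ d) j′))
    where
    l : ∀ x d j → x + d * j - x ≡ j * d
    l = solve-∀

  E-InV : ∀ {f} → InV N f → InV N (λ v → m v * S f v)
  E-InV {f} inV = record
    { per = λ x y x′ y′ e e′ → cong₂ _*_ (m-per x y x′ y′ (≡-mod-weaken p∣N x x′ e) (≡-mod-weaken p∣N y y′ e′)) (InV.per Sf x y x′ y′ (≡-mod-weaken d∣N x x′ e) (≡-mod-weaken d∣N y y′ e′))
    ; scl = λ t (s , e) v → cong₂ _*_ (m-⊛ t (s , Div.∣-trans p∣N e) v) (InV.scl Sf t (s , Div.∣-trans d∣N e) v)
    ; sup = sup′ }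
    where
    Sf = S-InV inV
    sup′ : ∀ v → m v * S f v ≡ 0ℤ ⊎ Prim N v
    sup′ v = [ (λ e → inj₁ (trans (*-congˡ (m v) e) (ℤₚ.*-zeroʳ (m v)))) , (λ pr → masked pr (mask? v)) ]′ (InV.sup Sf v)
      where
      masked : Prim d v → Dec (Mask v) → m v * S f v ≡ 0ℤ ⊎ Prim N v
      masked pr (yes h) = inj₂ (Prim-prod v (Mask⇒Prim v h) pr)
      masked pr (no ¬h) = inj₁ (*-congʳ (S f v) (ind-no (mask? v) ¬h))

  rest-InV : ∀ {f} → InV N f → InV N (rest f)
  rest-InV inV = InV-lin inV (E-InV inV) κ -[1+ 0 ]

  S² : ∀ {f} → InV N f → InV d (λ v → S f v * S f v)
  S² {f} inV = record
    { per = λ x y x′ y′ e e′ → cong (λ t → t * t) (InV.per Sf x y x′ y′ e e′)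
    ; scl = λ t u v → cong (λ t → t * t) (InV.scl Sf t u v)
    ; sup = λ v → [ (λ e → inj₁ (cong (λ t → t * t) e)) , inj₂ ]′ (InV.sup Sf v) }
    where Sf = S-InV inV

  -- S f is constant on fibres, so pairing it with f at level N gives ⟨S f , S f⟩ at level d;
  -- pairing the masked S f with itself gives κ times this by `masked-sum`. The cross terms
  -- therefore combine.
  pythagoras : ∀ {f} → InV N f → κ * κ * ⟨ f , f ⟩[ N ] ≡ κ * ⟨ S f , S f ⟩[ d ] + ⟨ rest f , rest f ⟩[ N ]
  pythagoras {f} inV = sym (begin-equality
    κ * ⟨ S f , S f ⟩[ d ] + ⟨ rest f , rest f ⟩[ N ]
      ≡⟨ +-congˡ (κ * ⟨ S f , S f ⟩[ d ]) (trans (∑-cong (res² N) expand) (trans (∑-⊕ (res² N) _ _) (cong₂ _+_ (trans (∑-- (res² N) _ _) (cong₂ _-_ (∑-*ˡ (res² N) (κ * κ) _) (∑-*ˡ (res² N) (+ 2 * κ) _))) (masked-sum (λ v → S f v * S f v) (InV.per (S² inV)) (InV.sup (S² inV)))))) ⟩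
    κ * ⟨ S f , S f ⟩[ d ] + ((κ * κ * ⟨ f , f ⟩[ N ] - + 2 * κ * ∑ (res² N) (λ v → f v * S f v)) + κ * ⟨ S f , S f ⟩[ d ])
      ≡⟨ cong (λ t → κ * ⟨ S f , S f ⟩[ d ] + ((κ * κ * ⟨ f , f ⟩[ N ] - + 2 * κ * t) + κ * ⟨ S f , S f ⟩[ d ])) cross-term ⟩
    κ * ⟨ S f , S f ⟩[ d ] + ((κ * κ * ⟨ f , f ⟩[ N ] - + 2 * κ * ⟨ S f , S f ⟩[ d ]) + κ * ⟨ S f , S f ⟩[ d ])
      ≡⟨ l κ ⟨ S f , S f ⟩[ d ] (κ * κ * ⟨ f , f ⟩[ N ]) ⟩
    κ * κ * ⟨ f , f ⟩[ N ] ∎)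
    where
    l : ∀ k a b → k * a + ((b - + 2 * k * a) + k * a) ≡ b
    l = solve-∀
    expand : ∀ v → rest f v * rest f v ≡ (κ * κ * (f v * f v) - + 2 * κ * (f v * S f v)) + m v * (S f v * S f v)
    expand v = trans (l₁ κ (f v) (m v) (S f v)) (cong₂ (λ a b → (κ * κ * (f v * f v) - + 2 * κ * (a * S f v)) + b * (S f v * S f v)) (m-absorb inV v) (m-idem v))
      where
      l₁ : ∀ k f m s → (k * f + -[1+ 0 ] * (m * s)) * (k * f + -[1+ 0 ] * (m * s)) ≡ (k * k * (f * f) - + 2 * k * (m * f * s)) + m * m * (s * s)
      l₁ = solve-∀
    cross-term : ∑ (res² N) (λ v → f v * S f v) ≡ ⟨ S f , S f ⟩[ d ]
    cross-term = trans (∑²-fibres p d (λ v → f v * S f v)) (∑-cong (res² d) (λ c → trans (∑-cong (res² p) (λ j → *-congˡ (f (c ⊞ + d ⊛ j)) (S-drop {f} (InV.per inV) c j))) (∑-*ʳ (res² p) (S f c) _)))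

  S-lin : ∀ f h a b c → S (λ v → a * f v + b * h v) c ≡ a * S f c + b * S h c
  S-lin f h a b c = trans (∑-⊕ (res² p) _ _) (cong₂ _+_ (∑-*ˡ (res² p) a _) (∑-*ˡ (res² p) b _))

  -- The trace and the mask commute with SL₂(ℤ), so the splitting of f ∘ g - f is the difference of
  -- the splittings, and `pythagoras` applies to it.
  pythagoras-defect : ∀ {f} → InV N f → ∀ g → det g ≡ 1ℤ → κ * κ * defect N f g ≡ κ * defect d (S f) g + defect N (rest f) g
  pythagoras-defect {f} inV g e = trans (*-congˡ (κ * κ) (∑-cong (res² N) (λ v → cong (λ t → t * t) (φ≡ v))))
    (trans (pythagoras inφ) (cong₂ _+_ (*-congˡ κ (∑-cong (res² d) (λ c → cong (λ t → t * t) (Sφ c)))) (∑-cong (res² N) (λ v → cong (λ t → t * t) (restφ v)))))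
    where
    φ′ : V → ℤ
    φ′ v = 1ℤ * f (g ▹ v) + -[1+ 0 ] * f v
    inφ : InV N φ′
    inφ = InV-lin (InV-▹ inV g e) inV 1ℤ -[1+ 0 ]
    l : ∀ a b → a - b ≡ 1ℤ * a + -[1+ 0 ] * b
    l = solve-∀
    φ≡ : ∀ v → f (g ▹ v) - f v ≡ φ′ v
    φ≡ v = l (f (g ▹ v)) (f v)
    Sφ : ∀ c → S φ′ c ≡ S f (g ▹ c) - S f c
    Sφ c = trans (S-lin (λ v → f (g ▹ v)) f 1ℤ -[1+ 0 ] c) (trans (cong (λ t → 1ℤ * t + -[1+ 0 ] * S f c) (S-▹ {f} (InV.per inV) g e c)) (sym (l (S f (g ▹ c)) (S f c))))
    restφ : ∀ v → rest φ′ v ≡ rest f (g ▹ v) - rest f v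
    restφ v = trans (cong (λ t → κ * φ′ v + -[1+ 0 ] * (m v * t)) (Sφ v)) (trans (l₁ κ (f (g ▹ v)) (f v) (m v) (S f (g ▹ v)) (S f v))
        (cong (λ t → (κ * f (g ▹ v) + -[1+ 0 ] * (t * S f (g ▹ v))) - rest f v) (sym (m-▹ g e v))))
      where
      l₁ : ∀ k a b m s t → k * (1ℤ * a + -[1+ 0 ] * b) + -[1+ 0 ] * (m * (s - t)) ≡ (k * a + -[1+ 0 ] * (m * s)) - (k * b + -[1+ 0 ] * (m * t))
      l₁ = solve-∀

  pythagoras-energy : ∀ {f} → InV N f → κ * κ * energy N f ≡ κ * energy d (S f) + energy N (rest f)
  pythagoras-energy {f} inV = trans (ℤₚ.*-distribˡ-+ (κ * κ) (defect N f Lᴹ) (defect N f Uᴹ))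
    (trans (cong₂ _+_ (pythagoras-defect inV Lᴹ refl) (pythagoras-defect inV Uᴹ refl)) (l κ (defect d (S f) Lᴹ) (defect N (rest f) Lᴹ) (defect d (S f) Uᴹ) (defect N (rest f) Uᴹ)))
    where
    l : ∀ k a b c d → (k * a + b) + (k * c + d) ≡ k * (a + c) + (b + d)
    l = solve-∀

  S-rest : ∀ {f} → InV N f → ∀ c → S (rest f) c ≡ 0ℤ
  S-rest {f} inV c = trans (S-lin f (λ v → m v * S f v) κ -[1+ 0 ] c) (trans (cong (λ t → κ * S f c + -[1+ 0 ] * t)
      (trans (∑-cong (res² p) (λ j → *-congˡ (m (c ⊞ + d ⊛ j)) (S-drop {f} (InV.per inV) c j))) (∑-*ʳ (res² p) (S f c) _))) ([ z , pr ]′ (InV.sup (S-InV inV) c)))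
    where
    M = ∑ (res² p) (λ j → m (c ⊞ + d ⊛ j))
    z : S f c ≡ 0ℤ → κ * S f c + -[1+ 0 ] * (M * S f c) ≡ 0ℤ
    z e = trans (cong (λ t → κ * t + -[1+ 0 ] * (M * t)) e) (l κ M)
      where
      l : ∀ k m → k * 0ℤ + -[1+ 0 ] * (m * 0ℤ) ≡ 0ℤ
      l = solve-∀
    pr : Prim d c → κ * S f c + -[1+ 0 ] * (M * S f c) ≡ 0ℤ
    pr h = trans (cong (λ t → κ * S f c + -[1+ 0 ] * (t * S f c)) (fibre-mask c h)) (l κ (S f c))
      where
      l : ∀ k s → k * s + -[1+ 0 ] * (k * s) ≡ 0ℤ
      l = solve-∀

  S-total : ∀ f → ∑ (res² d) (S f) ≡ ∑ (res² N) f
  S-total f = sym (∑²-fibres p d f)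

  rest-total : ∀ {f} → InV N f → ∑ (res² N) f ≡ 0ℤ → ∑ (res² N) (rest f) ≡ 0ℤ
  rest-total {f} inV e = trans (∑-⊕ (res² N) _ _) (trans (cong₂ _+_ (trans (∑-*ˡ (res² N) κ f) (trans (*-congˡ κ e) (ℤₚ.*-zeroʳ κ)))
      (trans (∑-*ˡ (res² N) -[1+ 0 ] _) (*-congˡ -[1+ 0 ] (trans (masked-sum (S f) (InV.per (S-InV inV)) (InV.sup (S-InV inV))) (trans (*-congˡ κ (trans (S-total f) e)) (ℤₚ.*-zeroʳ κ)))))) refl)

  -- Norm and energy split with the same coefficients, so K is passed on unchanged. A loss at each
  -- prime would not be uniform in N.
  combine : ∀ K {f} → InV N f → ⟨ S f , S f ⟩[ d ] ≤ + K * energy d (S f) →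
            ⟨ rest f , rest f ⟩[ N ] ≤ + K * energy N (rest f) → ⟨ f , f ⟩[ N ] ≤ + K * energy N f
  combine K {f} inV old new = *-cancel-pos _ _ (κ * κ) (pos*pos κ>0 κ>0) (begin
    κ * κ * ⟨ f , f ⟩[ N ]                                ≡⟨ pythagoras inV ⟩
    κ * ⟨ S f , S f ⟩[ d ] + ⟨ rest f , rest f ⟩[ N ]     ≤⟨ ℤₚ.+-mono-≤ (*-monoˡ κ (ℤₚ.<⇒≤ κ>0) old) new ⟩
    κ * (+ K * energy d (S f)) + + K * energy N (rest f)  ≡⟨ l κ (+ K) (energy d (S f)) (energy N (rest f)) ⟩
    + K * (κ * energy d (S f) + energy N (rest f))        ≡⟨ cong (λ t → + K * t) (sym (pythagoras-energy inV)) ⟩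
    + K * (κ * κ * energy N f)                            ≡⟨ l′ (+ K) (κ * κ) (energy N f) ⟩
    κ * κ * (+ K * energy N f) ∎)
    where
    l : ∀ k K a b → k * (K * a) + K * b ≡ K * (k * a + b)
    l = solve-∀
    l′ : ∀ K k a → K * (k * a) ≡ k * (K * a)
    l′ = solve-∀

-- The spectral gap

prime-divisor : ∀ n → 1 ℕ.< n → Σ ℕ λ p → Σ ℕ λ m → Prime p × n ≡ p ℕ.* m
prime-divisor n 1<n with factorise n {{ℕ.>-nonZero (ℕₚ.<-trans (ℕ.s≤s ℕ.z≤n) 1<n)}}
... | record { factors = [] ; isFactorisation = refl } = ⊥-elim (ℕₚ.<-irrefl refl 1<n)
... | record { factors = p ∷ ps ; isFactorisation = eq ; factorsPrime = pp Allᴸ.∷ _ } = p , product ps , pp , eq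

trace : ℕ → ℕ → (V → ℤ) → V → ℤ
trace p d f c = ∑ (res² p) (λ j → f (c ⊞ + d ⊛ j))

-- β generates the ideal of some g = gcd(β , N) with N/g > 1; a prime p of N/g gives N/p ≡ βk.
traces-vanish⇒New : ∀ N .{{_ : ℕ.NonZero N}} f → Per² N f →
  (∀ p d → Prime p → N ≡ p ℕ.* d → ∀ c → trace p d f c ≡ 0ℤ) → New N f
traces-vanish⇒New N f per vanish β N∤β u = cancel (begin
  + p * + p * T                                           ≡⟨ sym (∑²-const p T) ⟩
  ∑ (res² p) (λ j → T)                                    ≡⟨ ∑-cong (res² p) (λ j → sym (∑²-shift N F perF (k ⊛ j))) ⟩
  ∑ (res² p) (λ j → ∑ (res² N) (λ q → F (k ⊛ j ⊞ q)))     ≡⟨ ∑-swap (res² p) (res² N) _ ⟩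
  ∑ (res² N) (λ q → ∑ (res² p) (λ j → F (k ⊛ j ⊞ q)))     ≡⟨ ∑-cong (res² N) (λ q → ∑-cong (res² p) (λ j → move q j)) ⟩
  ∑ (res² N) (λ q → trace p d f (u ⊞ β ⊛ q))              ≡⟨ ∑-zero∈ (res² N) (λ q _ → vanish p d pp N≡pd (u ⊞ β ⊛ q)) ⟩
  0ℤ ∎)
  where
  open ≡-Reasoning
  F : V → ℤ
  F q = f (u ⊞ β ⊛ q)
  T = ∑ (res² N) F
  perF : Per² N F
  perF = Per²-⊞ {F = f} per u β
  g = gcd (abs β) N
  g∣N : g ℕD.∣ N
  g∣N = gcd[m,n]∣n (abs β) N
  N′ = ℕD._∣_.quotient g∣N
  N≡N′g : N ≡ N′ ℕ.* g
  N≡N′g = ℕD._∣_.equality g∣N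
  1<N′ : 1 ℕ.< N′
  1<N′ = big N′ N≡N′g
    where
    big : ∀ n → N ≡ n ℕ.* g → 1 ℕ.< n
    big zero    e = ⊥-elim (ℕ.≢-nonZero⁻¹ N e)
    big (suc zero) e = ⊥-elim (N∤β (Div.∣ᵤ⇒∣ (subst (ℕD._∣ abs β) (sym (trans e (ℕₚ.*-identityˡ g))) (gcd[m,n]∣m (abs β) N))))
    big (suc (suc n)) e = ℕ.s≤s (ℕ.s≤s ℕ.z≤n)
  pd = prime-divisor N′ 1<N′
  p = proj₁ pd
  m = proj₁ (proj₂ pd)
  pp : Prime p
  pp = proj₁ (proj₂ (proj₂ pd))
  d = m ℕ.* g
  N≡pd : N ≡ p ℕ.* d
  N≡pd = trans N≡N′g (trans (cong (ℕ._* g) (proj₂ (proj₂ (proj₂ pd)))) (ℕₚ.*-assoc p m g))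
  bez : Σ ℤ λ x → β * x ≡ + g [ N ]
  bez = go (Bézout.identity (gcd-GCD (abs β) N))
    where
    |β|x : ∀ β x → Σ ℤ λ y → β * y ≡ + abs β * x
    |β|x (+ n) x = x , refl
    |β|x (-[1+ n ]) x = - x , l (+ suc n) x
      where
      l : ∀ n x → - n * - x ≡ n * x
      l = solve-∀
    go : Bézout.Identity g (abs β) N → Σ ℤ λ x → β * x ≡ + g [ N ]
    go (Bézout.+- x y eq) = let (z , e) = |β|x β (+ x) in z , divides (+ y) (trans (cong (λ t → t - + g) (trans e (trans (sym (ℤₚ.pos-* (abs β) x))
        (cong (λ t → + t) (trans (ℕₚ.*-comm (abs β) x) (sym eq)))))) (trans (cong (λ t → t - + g) (ℤₚ.pos-+ g (y ℕ.* N))) (trans (l (+ g) (+ (y ℕ.* N))) (ℤₚ.pos-* y N))))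
      where
      l : ∀ a b → (a + b) - a ≡ b
      l = solve-∀
    go (Bézout.-+ x y eq) = let (z , e) = |β|x β (- + x) in z , divides (- + y) (trans (cong (λ t → t - + g) (trans e (l₀ (+ abs β) (+ x))))
        (trans (l (+ abs β * + x) (+ g)) (trans (cong (λ t → - t) (trans (cong (λ t → + g + t) (trans (sym (ℤₚ.pos-* (abs β) x)) (cong (λ t → + t) (ℕₚ.*-comm (abs β) x)))) (trans (sym (ℤₚ.pos-+ g (x ℕ.* abs β))) (trans (cong (λ t → + t) eq) (ℤₚ.pos-* y N))))) (l₁ (+ y) (+ N)))))
      where
      l₀ : ∀ b x → b * - x ≡ - (b * x)
      l₀ = solve-∀
      l : ∀ a g → - a - g ≡ - (g + a)
      l = solve-∀
      l₁ : ∀ y n → - (y * n) ≡ - y * n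
      l₁ = solve-∀
  k = proj₁ bez * + m
  βk≡d : β * k ≡ + d [ N ]
  βk≡d = ∣-via (Div.∣m⇒∣m*n (+ m) (proj₂ bez)) (trans (l β (proj₁ bez) (+ g) (+ m)) (cong (λ t → β * k - t) (sym (ℤₚ.pos-* m g))))
    where
    l : ∀ b x g m → (b * x - g) * m ≡ b * (x * m) - m * g
    l = solve-∀
  move : ∀ q j → F (k ⊛ j ⊞ q) ≡ f (u ⊞ β ⊛ q ⊞ + d ⊛ j)
  move (q , q′) (j , j′) = per _ _ _ _ (pt (proj₁ u) q j) (pt (proj₂ u) q′ j′)
    where
    pt : ∀ u q j → u + β * (k * j + q) ≡ (u + β * q) + + d * j [ N ]
    pt u q j = ∣-via (Div.∣m⇒∣m*n j βk≡d) (l u β k j q (+ d))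
      where
      l : ∀ u b k j q d → (b * k - d) * j ≡ u + b * (k * j + q) - ((u + b * q) + d * j)
      l = solve-∀
  cancel : + p * + p * T ≡ 0ℤ → T ≡ 0ℤ
  cancel e = ℤₚ.*-cancelˡ-≡ (+ p * + p) T 0ℤ {{ℤₚ.i*j≢0 (+ p) (+ p) {{prime⇒nonZero pp}} {{prime⇒nonZero pp}}}} (trans e (sym (ℤₚ.*-zeroʳ (+ p * + p))))

Gap : ℕ → ℕ → Set
Gap K N = ∀ f → InV N f → ∑ (res² N) f ≡ 0ℤ → ⟨ f , f ⟩[ N ] ≤ + K * energy N f

-- Peeling at p preserves a vanishing trace at q, since q-fibres respect the mask at p.
rest-trace : ∀ {p d q d′} (pp : Prime p) (qq : Prime q) .{{_ : ℕ.NonZero d}} → p ≢ q → p ℕ.* d ≡ q ℕ.* d′ → ∀ {f} →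
             (∀ c → trace q d′ f c ≡ 0ℤ) → ∀ c → trace q d′ (Peel.rest p d pp f) c ≡ 0ℤ
rest-trace {p} {d} {q} {d′} pp qq p≢q eq {f} vanish c@(x , y) = begin
  ∑ (res² q) (λ j → κ * f (c ⊞ + d′ ⊛ j) + -[1+ 0 ] * (m (c ⊞ + d′ ⊛ j) * S f (c ⊞ + d′ ⊛ j)))
    ≡⟨ ∑-cong (res² q) (λ j → cong (λ t → κ * f (c ⊞ + d′ ⊛ j) + -[1+ 0 ] * (t * S f (c ⊞ + d′ ⊛ j))) (m-const j)) ⟩
  ∑ (res² q) (λ j → κ * f (c ⊞ + d′ ⊛ j) + -[1+ 0 ] * (m c * S f (c ⊞ + d′ ⊛ j)))
    ≡⟨ trans (∑-⊕ (res² q) _ _) (cong₂ _+_ (∑-*ˡ (res² q) κ _) (trans (∑-*ˡ (res² q) -[1+ 0 ] _) (*-congˡ -[1+ 0 ] (∑-*ˡ (res² q) (m c) _)))) ⟩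
  κ * trace q d′ f c + -[1+ 0 ] * (m c * ∑ (res² q) (λ j → S f (c ⊞ + d′ ⊛ j)))
    ≡⟨ cong₂ (λ a b → κ * a + -[1+ 0 ] * (m c * b)) (vanish c) (trans (∑-swap (res² q) (res² p) _) (∑-zero∈ (res² p) (λ i _ → trans (∑-cong (res² q) (λ j → cong f (comm i j))) (vanish (c ⊞ + d ⊛ i))))) ⟩
  κ * 0ℤ + -[1+ 0 ] * (m c * 0ℤ)
    ≡⟨ l κ (m c) ⟩
  0ℤ ∎
  where
  open ≡-Reasoning
  κ = Peel.κ p d pp
  m = Peel.m p d pp
  S = Peel.S p d pp
  l : ∀ k m → k * 0ℤ + -[1+ 0 ] * (m * 0ℤ) ≡ 0ℤ
  l = solve-∀
  p∣d′ : + p ∣ + d′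
  p∣d′ with euclidsLemma q d′ pp (ℕD.divides d (trans (sym eq) (ℕₚ.*-comm p d)))
  ... | inj₂ h = Div.∣ᵤ⇒∣ h
  ... | inj₁ h with prime⇒irreducible qq h
  ...   | inj₁ refl = ⊥-elim (ℕ.nonTrivial⇒≢1 {{prime⇒nonTrivial pp}} refl)
  ...   | inj₂ e = ⊥-elim (p≢q e)
  m-const : ∀ j → m (c ⊞ + d′ ⊛ j) ≡ m c
  m-const (j , j′) = Peel.m-per p d pp (x + + d′ * j) (y + + d′ * j′) x y (sh x j) (sh y j′)
    where
    sh : ∀ x j → x + + d′ * j ≡ x [ p ]
    sh x j = ∣-via (Div.∣m⇒∣m*n j p∣d′) (l′ x (+ d′ * j))
      where
      l′ : ∀ x z → z ≡ x + z - x
      l′ = solve-∀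
  comm : ∀ i j → c ⊞ + d′ ⊛ j ⊞ + d ⊛ i ≡ c ⊞ + d ⊛ i ⊞ + d′ ⊛ j
  comm (i , i′) (j , j′) = cong₂ _,_ (l′ x (+ d′ * j) (+ d * i)) (l′ y (+ d′ * j′) (+ d * i′))
    where
    l′ : ∀ x a b → x + a + b ≡ x + b + a
    l′ = solve-∀

module Descent (K : ℕ) (N : ℕ) .{{_ : ℕ.NonZero N}}
               (new-gap : ∀ f → InV N f → New N f → ⟨ f , f ⟩[ N ] ≤ + K * energy N f)
               (lower : ∀ d → .{{_ : ℕ.NonZero d}} → d ℕ.< N → Gap K d) where

  -- `rem` lists the candidates whose trace may still be nonzero. Removing the level N/p part at one
  -- prime leaves the vanishing traces at the other primes intact, so once the list is empty f is
  -- new.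
  peel : ∀ (rem : List ℕ) f → InV N f → ∑ (res² N) f ≡ 0ℤ →
         (∀ p d → Prime p → N ≡ p ℕ.* d → (∀ c → trace p d f c ≡ 0ℤ) ⊎ p ∈ rem) → ⟨ f , f ⟩[ N ] ≤ + K * energy N f
  peel [] f inV _ done = new-gap f inV (traces-vanish⇒New N f (InV.per inV) (λ p d pp e → [ id , (λ ()) ]′ (done p d pp e)))
  peel (x ∷ rem) f inV mean done with prime? x | x ℕD.∣? N
  ... | no ¬p | _ = peel rem f inV mean (λ p d pp e → [ inj₁ , (λ { (here refl) → ⊥-elim (¬p pp) ; (there h) → inj₂ h }) ]′ (done p d pp e))
  ... | yes _ | no ¬d = peel rem f inV mean (λ p d pp e → [ inj₁ , (λ { (here refl) → ⊥-elim (¬d (ℕD.divides d (trans e (ℕₚ.*-comm p d)))) ; (there h) → inj₂ h }) ]′ (done p d pp e))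
  ... | yes pp | yes (ℕD.divides d eq) = go N (trans eq (ℕₚ.*-comm d x)) f inV mean done lower (peel rem)
    where
    go : ∀ M → M ≡ x ℕ.* d → .{{_ : ℕ.NonZero M}} → ∀ f → InV M f → ∑ (res² M) f ≡ 0ℤ →
         (∀ p d → Prime p → M ≡ p ℕ.* d → (∀ c → trace p d f c ≡ 0ℤ) ⊎ p ∈ x ∷ rem) →
         (∀ d → .{{_ : ℕ.NonZero d}} → d ℕ.< M → Gap K d) →
         (∀ f → InV M f → ∑ (res² M) f ≡ 0ℤ → (∀ p d → Prime p → M ≡ p ℕ.* d → (∀ c → trace p d f c ≡ 0ℤ) ⊎ p ∈ rem) → ⟨ f , f ⟩[ M ] ≤ + K * energy M f) →
         ⟨ f , f ⟩[ M ] ≤ + K * energy M f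
    go M refl f inV mean done lower rec = Peel.combine x d pp K inV
        (lower d d<M (Peel.S x d pp f) (Peel.S-InV x d pp inV) (trans (Peel.S-total x d pp f) mean))
        (rec (Peel.rest x d pp f) (Peel.rest-InV x d pp inV) (Peel.rest-total x d pp inV mean) done′)
      where
      d>0 : 0 ℕ.< d
      d>0 = ℕₚ.n≢0⇒n>0 (λ { refl → ℕ.≢-nonZero⁻¹ M (ℕₚ.*-zeroʳ x) })
      instance
        d≢0 : ℕ.NonZero d
        d≢0 = ℕ.>-nonZero d>0
      d<M : d ℕ.< x ℕ.* d
      d<M = subst (d ℕ.<_) (ℕₚ.*-comm d x) (ℕₚ.m<m*n d x (ℕ.nonTrivial⇒n>1 x {{prime⇒nonTrivial pp}}))
      done′ : ∀ p d₁ → Prime p → x ℕ.* d ≡ p ℕ.* d₁ → (∀ c → trace p d₁ (Peel.rest x d pp f) c ≡ 0ℤ) ⊎ p ∈ rem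
      done′ p d₁ qq e = cases (x ℕₚ.≟ p) (done p d₁ qq e)
        where
        cases : Dec (x ≡ p) → (∀ c → trace p d₁ f c ≡ 0ℤ) ⊎ p ∈ x ∷ rem → (∀ c → trace p d₁ (Peel.rest x d pp f) c ≡ 0ℤ) ⊎ p ∈ rem
        cases (yes refl) _ = inj₁ (λ c → subst (λ k → trace x k (Peel.rest x d pp f) c ≡ 0ℤ) (ℕₚ.*-cancelˡ-≡ d d₁ x {{prime⇒nonZero pp}} e) (Peel.S-rest x d pp inV c))
        cases (no x≢p) (inj₁ v) = inj₁ (rest-trace pp qq x≢p e {f} v)
        cases (no x≢p) (inj₂ (here refl)) = ⊥-elim (x≢p refl)
        cases (no x≢p) (inj₂ (there h)) = inj₂ h

  gap : Gap K N
  gap f inV mean = peel (applyUpTo id (suc N)) f inV mean (λ p d pp e → inj₂ (∈-applyUpTo⁺ id (ℕ.s≤s (ℕD.∣⇒≤ (ℕD.divides d (trans e (ℕₚ.*-comm p d)))))))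

-- Poincaré inequality at a fixed level

euclid-cost : ℕ → ℕ
euclid-cost zero    = 0
euclid-cost (suc n) = 2 ℕ.* (1 ℕ.+ euclid-cost n)

-- Small levels: Euclid's algorithm connects every vector to (g , 0) for some g.
module Small (N : ℕ) .{{_ : ℕ.NonZero N}} (f : V → ℤ) (inV : InV N f) where
  open InV inV

  E : ℤ
  E = energy N f

  sq : ℤ → ℤ
  sq x = x * x

  step : ∀ g → defect N f g ≤ E → ∀ v → sq (f (g ▹ v) - f v) ≤ E
  step g le v = ℤₚ.≤-trans (value≤total N (λ v → sq (f (g ▹ v) - f v)) (Per²-sq per g) (λ v → 0≤² (f (g ▹ v) - f v)) v) le

  move : ∀ g → defect N f g ≤ E → ∀ {u v} → g ▹ u ≡ v → sq (f v - f u) ≤ E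
  move g le {u} refl = step g le u

  defect-L : defect N f Lᴹ ≤ E
  defect-L = ≤-by (defect N f Uᴹ) (defect≥0 N f Uᴹ) refl

  defect-U : defect N f Uᴹ ≤ E
  defect-U = ≤-by (defect N f Lᴹ) (defect≥0 N f Lᴹ) (ℤₚ.+-comm (defect N f Uᴹ) (defect N f Lᴹ))

  Near : ℕ → V → Set
  Near c v = Σ ℤ λ g → sq (f v - f (g , 0ℤ)) ≤ + c * E × (Prim N v → Prim N (g , 0ℤ))

  E≥0 : 0ℤ ≤ E
  E≥0 = energy≥0 N f

  -- Each step of a path doubles the constant by `sum-sq≤`, whence the recursion of `euclid-cost`.
  -- Primitivity is carried along so that the end point (g , 0) has g a unit and f takes the value
  -- `base` there.
  near-step : ∀ c u v → sq (f v - f u) ≤ E → (Prim N v → Prim N u) → Near c u → Near (2 ℕ.* (1 ℕ.+ c)) v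
  near-step c u v le pr (g , le′ , pr′) = g , (begin
    sq (f v - f (g , 0ℤ))                                      ≡⟨ cong sq (l (f v) (f u) (f (g , 0ℤ))) ⟩
    sq ((f v - f u) + (f u - f (g , 0ℤ)))                      ≤⟨ sum-sq≤ (f v - f u) (f u - f (g , 0ℤ)) ⟩
    + 2 * sq (f v - f u) + + 2 * sq (f u - f (g , 0ℤ))         ≤⟨ ℤₚ.+-mono-≤ (*-monoˡ (+ 2) (+≤+ ℕ.z≤n) le) (*-monoˡ (+ 2) (+≤+ ℕ.z≤n) le′) ⟩
    + 2 * E + + 2 * (+ c * E)                                  ≡⟨ trans (l′ E (+ c)) (cong (_* E) (trans (cong (λ t → + 2 * t) (sym (ℤₚ.pos-+ 1 c))) (sym (ℤₚ.pos-* 2 (1 ℕ.+ c))))) ⟩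
    + (2 ℕ.* (1 ℕ.+ c)) * E ∎) , pr′ ∘ pr
    where
    open ℤₚ.≤-Reasoning
    l : ∀ a b c → a - c ≡ (a - b) + (b - c)
    l = solve-∀
    l′ : ∀ e c → + 2 * e + + 2 * (c * e) ≡ + 2 * (1ℤ + c) * e
    l′ = solve-∀

  near-mono : ∀ {c c′} v → c ℕ.≤ c′ → Near c v → Near c′ v
  near-mono v le (g , h , pr) = g , ℤₚ.≤-trans h (*-monoʳ E E≥0 (+≤+ le)) , pr

  near-0 : ∀ c x → Near c (x , 0ℤ)
  near-0 c x = x , ℤₚ.≤-trans (ℤₚ.≤-reflexive (l (f (x , 0ℤ)))) (0≤* {+ c} (+≤+ ℕ.z≤n) E≥0) , id
    where
    l : ∀ a → (a - a) * (a - a) ≡ 0ℤ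
    l = solve-∀

  U-back : ∀ u v → Uᴹ ▹ u ≡ v → Prim N v → Prim N u
  U-back u _ refl = Prim-▹ Uᴹ refl u

  L-back : ∀ u v → Lᴹ ▹ u ≡ v → Prim N v → Prim N u
  L-back u _ refl = Prim-▹ Lᴹ refl u

  flip-sq : ∀ a b → sq (a - b) ≡ sq (b - a)
  flip-sq = l
    where
    l : ∀ a b → (a - b) * (a - b) ≡ (b - a) * (b - a)
    l = solve-∀

  -- (x , y) is reached from (x ∸ y , y) by U and from (x , y ∸ x) by L; (0 , y) goes to (y , y) by U and comes from (y , 0) by L.
  euclid : ∀ n x y → x ℕ.+ (y ℕ.+ y) ℕ.≤ n → Near (euclid-cost (suc n)) (+ x , + y)
  euclid n x zero le = near-0 (euclid-cost (suc n)) (+ x)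
  euclid zero zero (suc y) ()
  euclid zero (suc x) (suc y) ()
  euclid (suc n) zero (suc y) le = near-step (euclid-cost (suc n)) (+ suc y , + suc y) (0ℤ , + suc y)
      (subst (_≤ E) (flip-sq (f (+ suc y , + suc y)) (f (0ℤ , + suc y))) (move Uᴹ defect-U up))
      (Prim-▹ (adj Uᴹ) refl (+ suc y , + suc y) ∘ subst (Prim N) (sym (cong₂ _,_ (l₅ (+ suc y)) (l₆ (+ suc y)))))
      (near-mono {2 ℕ.* (1 ℕ.+ 0)} (+ suc y , + suc y) (ℕₚ.*-monoʳ-≤ 2 (ℕₚ.+-monoʳ-≤ 1 {0} {euclid-cost n} ℕ.z≤n))
        (near-step 0 (+ suc y , 0ℤ) (+ suc y , + suc y) (move Lᴹ defect-L down) (L-back (+ suc y , 0ℤ) (+ suc y , + suc y) down) (near-0 0 (+ suc y))))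
    where
    l₁ : ∀ y → 1ℤ * 0ℤ + 1ℤ * y ≡ y
    l₁ = solve-∀
    l₂ : ∀ y → 0ℤ * 0ℤ + 1ℤ * y ≡ y
    l₂ = solve-∀
    l₃ : ∀ y → 1ℤ * y + 0ℤ * 0ℤ ≡ y
    l₃ = solve-∀
    l₄ : ∀ y → 1ℤ * y + 1ℤ * 0ℤ ≡ y
    l₄ = solve-∀
    l₅ : ∀ y → 1ℤ * y + - 1ℤ * y ≡ 0ℤ
    l₅ = solve-∀
    l₆ : ∀ y → - 0ℤ * y + 1ℤ * y ≡ y
    l₆ = solve-∀
    up : Uᴹ ▹ (0ℤ , + suc y) ≡ (+ suc y , + suc y)
    up = cong₂ _,_ (l₁ (+ suc y)) (l₂ (+ suc y))
    down : Lᴹ ▹ (+ suc y , 0ℤ) ≡ (+ suc y , + suc y)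
    down = cong₂ _,_ (l₃ (+ suc y)) (l₄ (+ suc y))
  euclid (suc n) (suc x) (suc y) le = [ by-U , by-L ]′ (ℕₚ.≤-total (suc y) (suc x))
    where
    by-U : suc y ℕ.≤ suc x → Near (euclid-cost (suc (suc n))) (+ suc x , + suc y)
    by-U y≤x = near-step (euclid-cost (suc n)) (+ (x ℕ.∸ y) , + suc y) (+ suc x , + suc y) (move Uᴹ defect-U eq) (U-back (+ (x ℕ.∸ y) , + suc y) (+ suc x , + suc y) eq)
        (euclid n (x ℕ.∸ y) (suc y) (ℕₚ.≤-trans (ℕₚ.+-monoˡ-≤ (suc y ℕ.+ suc y) (ℕₚ.m∸n≤m x y)) (ℕ.s≤s⁻¹ le)))
      where
      e : x ℕ.∸ y ℕ.+ suc y ≡ suc x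
      e = trans (ℕₚ.+-suc (x ℕ.∸ y) y) (cong suc (ℕₚ.m∸n+n≡m (ℕ.s≤s⁻¹ y≤x)))
      l₁ : ∀ a y → 1ℤ * a + 1ℤ * y ≡ a + y
      l₁ = solve-∀
      l₂ : ∀ a y → 0ℤ * a + 1ℤ * y ≡ y
      l₂ = solve-∀
      eq : Uᴹ ▹ (+ (x ℕ.∸ y) , + suc y) ≡ (+ suc x , + suc y)
      eq = cong₂ _,_ (trans (l₁ (+ (x ℕ.∸ y)) (+ suc y)) (trans (sym (ℤₚ.pos-+ (x ℕ.∸ y) (suc y))) (cong (λ t → + t) e))) (l₂ (+ (x ℕ.∸ y)) (+ suc y))
    by-L : suc x ℕ.≤ suc y → Near (euclid-cost (suc (suc n))) (+ suc x , + suc y)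
    by-L x≤y = near-step (euclid-cost (suc n)) (+ suc x , + (y ℕ.∸ x)) (+ suc x , + suc y) (move Lᴹ defect-L eq) (L-back (+ suc x , + (y ℕ.∸ x)) (+ suc x , + suc y) eq)
        (euclid n (suc x) (y ℕ.∸ x) (ℕ.s≤s⁻¹ (ℕₚ.≤-trans (ℕ.s≤s (ℕ.s≤s (ℕₚ.+-monoʳ-≤ x (ℕₚ.+-mono-≤ (ℕₚ.m∸n≤m y x) (ℕₚ.m∸n≤m y x)))))
           (ℕₚ.≤-trans (ℕₚ.≤-reflexive (cong suc (sym (trans (ℕₚ.+-suc x (y ℕ.+ y)) refl)))) (ℕₚ.≤-trans (ℕ.s≤s (ℕₚ.+-monoʳ-≤ x (ℕ.s≤s (ℕₚ.+-monoʳ-≤ y (ℕₚ.n≤1+n y))))) le)))))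
      where
      e : suc x ℕ.+ (y ℕ.∸ x) ≡ suc y
      e = cong suc (ℕₚ.m+[n∸m]≡n (ℕ.s≤s⁻¹ x≤y))
      l₁ : ∀ a y → 1ℤ * a + 0ℤ * y ≡ a
      l₁ = solve-∀
      l₂ : ∀ a y → 1ℤ * a + 1ℤ * y ≡ a + y
      l₂ = solve-∀
      eq : Lᴹ ▹ (+ suc x , + (y ℕ.∸ x)) ≡ (+ suc x , + suc y)
      eq = cong₂ _,_ (l₁ (+ suc x) (+ (y ℕ.∸ x))) (trans (l₂ (+ suc x) (+ (y ℕ.∸ x))) (trans (sym (ℤₚ.pos-+ (suc x) (y ℕ.∸ x))) (cong (λ t → + t) e)))

  base : ℤ
  base = f (1ℤ , 0ℤ)

  base-value : ∀ g → Prim N (g , 0ℤ) → f (g , 0ℤ) ≡ base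
  base-value g ((z , w) , e) = trans (cong f (cong₂ _,_ (sym (ℤₚ.*-identityʳ g)) (sym (ℤₚ.*-zeroʳ g)))) (scl g (w , ∣-via e (l g w z)) (1ℤ , 0ℤ))
    where
    l : ∀ g w z → g * w - z * 0ℤ - 1ℤ ≡ g * w - 1ℤ
    l = solve-∀

  C : ℕ
  C = euclid-cost (suc (N ℕ.+ (N ℕ.+ N)))

  near : ∀ v → v ∈ res² N → Near C v
  near (x , y) m with ∈-cartesianProduct⁻ (res N) (res N) m
  ... | (mx , my) with ∈-applyUpTo⁻ +_ mx | ∈-applyUpTo⁻ +_ my
  ...   | (i , i< , refl) | (j , j< , refl) = euclid (N ℕ.+ (N ℕ.+ N)) i j (ℕₚ.+-mono-≤ (ℕₚ.<⇒≤ i<) (ℕₚ.+-mono-≤ (ℕₚ.<⇒≤ j<) (ℕₚ.<⇒≤ j<)))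

  CE≥0 : 0ℤ ≤ + C * E
  CE≥0 = 0≤* {+ C} (+≤+ ℕ.z≤n) E≥0

  -- f is close to `base` only at primitive vectors and is 0 elsewhere, so f - base cannot be used
  -- on all of (ℤ/N)². The expression f² - 2 base f is at most (f - base)² at the former and
  -- vanishes at the latter, and its sum is ‖f‖² when f has mean zero.
  pointwise : ∀ v → v ∈ res² N → f v * f v - + 2 * base * f v ≤ + C * E
  pointwise v v∈ = [ zero-case , prim-case ]′ (sup v)
    where
    zero-case : f v ≡ 0ℤ → f v * f v - + 2 * base * f v ≤ + C * E
    zero-case e = ℤₚ.≤-trans (ℤₚ.≤-reflexive (trans (cong (λ t → t * t - + 2 * base * t) e) (l base))) CE≥0
      where
      l : ∀ b → 0ℤ * 0ℤ - + 2 * b * 0ℤ ≡ 0ℤ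
      l = solve-∀
    prim-case : Prim N v → f v * f v - + 2 * base * f v ≤ + C * E
    prim-case pr = go (near v v∈)
      where
      l : ∀ a b → a * a - + 2 * b * a + b * b ≡ (a - b) * (a - b)
      l = solve-∀
      go : Near C v → f v * f v - + 2 * base * f v ≤ + C * E
      go (g , le , pr′) = ℤₚ.≤-trans (≤-by (base * base) (0≤² base) (l (f v) base)) (subst (λ b → sq (f v - b) ≤ + C * E) (base-value g (pr′ pr)) le)

  poincare : ∑ (res² N) f ≡ 0ℤ → ⟨ f , f ⟩[ N ] ≤ + (N ℕ.* N ℕ.* C) * E
  poincare mean = begin
    ⟨ f , f ⟩[ N ]                                               ≡⟨ sym (trans (∑-- (res² N) _ _) (trans (cong (λ t → ⟨ f , f ⟩[ N ] - t) (trans (∑-*ˡ (res² N) (+ 2 * base) f) (trans (*-congˡ (+ 2 * base) mean) (ℤₚ.*-zeroʳ (+ 2 * base))))) (l ⟨ f , f ⟩[ N ]))) ⟩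
    ∑ (res² N) (λ v → f v * f v - + 2 * base * f v)              ≤⟨ ∑-mono∈ (res² N) pointwise ⟩
    ∑ (res² N) (λ _ → + C * E)                                   ≡⟨ ∑²-const N (+ C * E) ⟩
    + N * + N * (+ C * E)                                        ≡⟨ trans (sym (ℤₚ.*-assoc (+ N * + N) (+ C) E)) (cong (_* E) (trans (cong (_* + C) (sym (ℤₚ.pos-* N N))) (sym (ℤₚ.pos-* (N ℕ.* N) C)))) ⟩
    + (N ℕ.* N ℕ.* C) * E ∎
    where
    open ℤₚ.≤-Reasoning
    l : ∀ a → a - 0ℤ ≡ a
    l = solve-∀

small-gap : ∀ N .{{_ : ℕ.NonZero N}} → Gap (N ℕ.* N ℕ.* euclid-cost (suc (N ℕ.+ (N ℕ.+ N)))) N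
small-gap N f inV mean = Small.poincare N f inV mean

gap-mono : ∀ {K K′} N → K ℕ.≤ K′ → Gap K N → Gap K′ N
gap-mono N le g f inV mean = ℤₚ.≤-trans (g f inV mean) (*-monoʳ (energy N f) (energy≥0 N f) (+≤+ le))

-- The descent through divisors ends below N₀, where new forms have no contraction. K therefore
-- includes the Poincaré constants of all levels below N₀.
spectral-gap : Σ ℕ λ K → ∀ N → .{{_ : ℕ.NonZero N}} → Gap K N
spectral-gap = go new-forms-gap
  where
  go : (Σ ℕ λ k → Σ ℕ λ N₀ → ∀ N → .{{_ : ℕ.NonZero N}} → N₀ ℕ.≤ N → ∀ f → InV N f → New N f → ⟨ f , f ⟩[ N ] ≤ + k * energy N f) →
       Σ ℕ λ K → ∀ N → .{{_ : ℕ.NonZero N}} → Gap K N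
  go (k , N₀ , new) = K , λ N → <-rec (λ N → .{{_ : ℕ.NonZero N}} → Gap K N) step N
    where
    cost : ℕ → ℕ
    cost N = N ℕ.* N ℕ.* euclid-cost (suc (N ℕ.+ (N ℕ.+ N)))
    K = k ℕ.+ ∑ⁿ (applyUpTo id N₀) cost
    step : ∀ N → (∀ {d} → d ℕ.< N → .{{_ : ℕ.NonZero d}} → Gap K d) → .{{_ : ℕ.NonZero N}} → Gap K N
    step N rec with N₀ ℕₚ.≤? N
    ... | yes N₀≤N = Descent.gap K N (λ f inV nw → ℤₚ.≤-trans (new N N₀≤N f inV nw) (*-monoʳ (energy N f) (energy≥0 N f) (+≤+ (ℕₚ.m≤m+n k _)))) (λ d d<N → rec d<N)
    ... | no N₀≰N = gap-mono N (ℕₚ.≤-trans (∑ⁿ-term≤ cost (∈-applyUpTo⁺ id (ℕₚ.≰⇒> N₀≰N))) (ℕₚ.m≤n+m _ k)) (small-gap N)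

-- Contraction of T

-- The action of M a on y = p/q, taken as the vector (p , q), is y ↦ [a, 1, y].
M : ℕ → Mat
M a = mat 1ℤ 1ℤ (+ a) (+ suc a)

M₁ M₂ : Mat
M₁ = M 1
M₂ = M 2

T : (V → ℤ) → V → ℤ
T f v = f (M₁ ▹ v) + f (M₂ ▹ v)

T-InV : ∀ {N f} → InV N f → InV N (T f)
T-InV {f = f} inV = InV-cong (λ v → l (f (M₁ ▹ v)) (f (M₂ ▹ v))) (InV-lin (InV-▹ inV M₁ refl) (InV-▹ inV M₂ refl) 1ℤ 1ℤ)
  where
  l : ∀ a b → 1ℤ * a + 1ℤ * b ≡ a + b
  l = solve-∀

∑-▹ : ∀ N .{{_ : ℕ.NonZero N}} f → Per² N f → ∀ g → det g ≡ 1ℤ → ∑ (res² N) (λ v → f (g ▹ v)) ≡ ∑ (res² N) f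
∑-▹ N f per g e = ∑-reindex N f per g (det-mod g e)

T-total : ∀ N .{{_ : ℕ.NonZero N}} f → Per² N f → ∑ (res² N) (T f) ≡ + 2 * ∑ (res² N) f
T-total N f per = trans (∑-⊕ (res² N) _ _) (trans (cong₂ _+_ (∑-▹ N f per M₁ refl) (∑-▹ N f per M₂ refl)) (l (∑ (res² N) f)))
  where
  l : ∀ a → a + a ≡ + 2 * a
  l = solve-∀

module Parallelogram (N : ℕ) .{{_ : ℕ.NonZero N}} (f : V → ℤ) (per : Per² N f) where

  gradient : V → ℤ
  gradient v = f (M₂ ▹ v) - f (M₁ ▹ v)

  -- M₂ = L M₁
  ∑-gradient² : ∑ (res² N) (λ v → gradient v * gradient v) ≡ defect N f Lᴹ
  ∑-gradient² = trans (∑-cong (res² N) (λ v → cong (λ u → (f u - f (M₁ ▹ v)) * (f u - f (M₁ ▹ v))) (·-▹ Lᴹ M₁ v)))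
    (∑-▹ N (λ v → (f (Lᴹ ▹ v) - f v) * (f (Lᴹ ▹ v) - f v)) (Per²-sq per Lᴹ) M₁ refl)

  ‖f∘_‖² : ∀ g → det g ≡ 1ℤ → ∑ (res² N) (λ v → f (g ▹ v) * f (g ▹ v)) ≡ ⟨ f , f ⟩[ N ]
  ‖f∘_‖² = ∑-▹ N (λ v → f v * f v) (λ x y x′ y′ p q → cong (λ t → t * t) (per x y x′ y′ p q))

  -- The parallelogram law at each vector: the sum of the two values is T f and their difference
  -- `gradient`, whose norm is the defect of L because M₂ = L M₁.
  ‖T‖² : ⟨ T f , T f ⟩[ N ] + defect N f Lᴹ ≡ + 4 * ⟨ f , f ⟩[ N ]
  ‖T‖² = begin
    ⟨ T f , T f ⟩[ N ] + defect N f Lᴹ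
      ≡⟨ +-congˡ ⟨ T f , T f ⟩[ N ] (sym ∑-gradient²) ⟩
    ⟨ T f , T f ⟩[ N ] + ∑ (res² N) (λ v → gradient v * gradient v)
      ≡⟨ trans (sym (∑-⊕ (res² N) _ _)) (∑-cong (res² N) (λ v → l (f (M₁ ▹ v)) (f (M₂ ▹ v)))) ⟩
    ∑ (res² N) (λ v → + 2 * (f (M₁ ▹ v) * f (M₁ ▹ v)) + + 2 * (f (M₂ ▹ v) * f (M₂ ▹ v)))
      ≡⟨ trans (∑-⊕ (res² N) _ _) (cong₂ _+_ (trans (∑-*ˡ (res² N) (+ 2) _) (*-congˡ (+ 2) (‖f∘_‖² M₁ refl)))
                                             (trans (∑-*ˡ (res² N) (+ 2) _) (*-congˡ (+ 2) (‖f∘_‖² M₂ refl)))) ⟩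
    + 2 * ⟨ f , f ⟩[ N ] + + 2 * ⟨ f , f ⟩[ N ]
      ≡⟨ l₄ ⟨ f , f ⟩[ N ] ⟩
    + 4 * ⟨ f , f ⟩[ N ] ∎
    where
    open ≡-Reasoning
    l : ∀ a b → (a + b) * (a + b) + (b - a) * (b - a) ≡ + 2 * (a * a) + + 2 * (b * b)
    l = solve-∀
    l₄ : ∀ a → + 2 * a + + 2 * a ≡ + 4 * a
    l₄ = solve-∀

  D₁ D₂ : ℤ
  D₁ = defect N f Lᴹ
  D₂ = defect N (T f) Lᴹ

  Qᴹ : Mat
  Qᴹ = mat (+ 3) -[1+ 0 ] (+ 4) -[1+ 0 ]

  -- Q = M₁ L M₁⁻¹, and 2 f ∘ M₁ = T f - gradient.
  defect-Q : defect N f Qᴹ ≤ D₂ + + 4 * D₁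
  defect-Q = *-cancel-pos _ _ (+ 4) (+<+ (ℕ.s≤s ℕ.z≤n)) (begin
    + 4 * defect N f Qᴹ
      ≡⟨ *-congˡ (+ 4) (sym (∑-▹ N (λ v → (f (Qᴹ ▹ v) - f v) * (f (Qᴹ ▹ v) - f v)) (Per²-sq per Qᴹ) M₁ refl)) ⟩
    + 4 * ∑ (res² N) (λ v → (f (Qᴹ ▹ M₁ ▹ v) - f (M₁ ▹ v)) * (f (Qᴹ ▹ M₁ ▹ v) - f (M₁ ▹ v)))
      ≡⟨ trans (sym (∑-*ˡ (res² N) (+ 4) _)) (∑-cong (res² N) (λ v → trans (cong (λ u → + 4 * ((f u - f (M₁ ▹ v)) * (f u - f (M₁ ▹ v)))) (QM≡ v))
            (l (f (M₁ ▹ Lᴹ ▹ v)) (f (M₁ ▹ v)) (f (M₂ ▹ Lᴹ ▹ v)) (f (M₂ ▹ v))))) ⟩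
    ∑ (res² N) (λ v → ((T f (Lᴹ ▹ v) - T f v) + (gradient v - gradient (Lᴹ ▹ v))) * ((T f (Lᴹ ▹ v) - T f v) + (gradient v - gradient (Lᴹ ▹ v))))
      ≤⟨ ∑-mono (res² N) (λ v → ℤₚ.≤-trans (sum-sq≤ (T f (Lᴹ ▹ v) - T f v) (gradient v - gradient (Lᴹ ▹ v)))
            (ℤₚ.+-monoʳ-≤ (+ 2 * ((T f (Lᴹ ▹ v) - T f v) * (T f (Lᴹ ▹ v) - T f v))) (*-monoˡ (+ 2) (+≤+ ℕ.z≤n) (diff-sq≤ (gradient v) (gradient (Lᴹ ▹ v)))))) ⟩
    ∑ (res² N) (λ v → + 2 * ((T f (Lᴹ ▹ v) - T f v) * (T f (Lᴹ ▹ v) - T f v))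
        + + 2 * (+ 2 * (gradient v * gradient v) + + 2 * (gradient (Lᴹ ▹ v) * gradient (Lᴹ ▹ v))))
      ≡⟨ trans (∑-⊕ (res² N) _ _) (cong₂ _+_ (∑-*ˡ (res² N) (+ 2) _) (trans (∑-*ˡ (res² N) (+ 2) _)
            (*-congˡ (+ 2) (trans (∑-⊕ (res² N) _ _) (cong₂ _+_ (trans (∑-*ˡ (res² N) (+ 2) _) (*-congˡ (+ 2) ∑-gradient²))
               (trans (∑-*ˡ (res² N) (+ 2) _) (*-congˡ (+ 2) (trans (∑-▹ N (λ v → gradient v * gradient v) grad²-per Lᴹ refl) ∑-gradient²)))))))) ⟩
    + 2 * D₂ + + 2 * (+ 2 * D₁ + + 2 * D₁)
      ≤⟨ ≤-by (+ 2 * D₂ + + 8 * D₁) (0≤+ (0≤* {+ 2} (+≤+ ℕ.z≤n) (defect≥0 N (T f) Lᴹ)) (0≤* {+ 8} (+≤+ ℕ.z≤n) (defect≥0 N f Lᴹ))) (l₄ D₁ D₂) ⟩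
    + 4 * (D₂ + + 4 * D₁) ∎)
    where
    open ℤₚ.≤-Reasoning
    QM≡ : ∀ v → Qᴹ ▹ M₁ ▹ v ≡ M₁ ▹ Lᴹ ▹ v
    QM≡ v = trans (sym (·-▹ Qᴹ M₁ v)) (·-▹ M₁ Lᴹ v)
    l : ∀ a b c d → + 4 * ((a - b) * (a - b)) ≡ (((a + c) - (b + d)) + ((d - b) - (c - a))) * (((a + c) - (b + d)) + ((d - b) - (c - a)))
    l = solve-∀
    l₄ : ∀ a b → + 2 * b + + 2 * (+ 2 * a + + 2 * a) + (+ 2 * b + + 8 * a) ≡ + 4 * (b + + 4 * a)
    l₄ = solve-∀
    diff-sq≤ : ∀ a b → (a - b) * (a - b) ≤ + 2 * (a * a) + + 2 * (b * b)
    diff-sq≤ a b = ≤-by ((a + b) * (a + b)) (0≤² (a + b)) (l′ a b)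
      where
      l′ : ∀ a b → (a - b) * (a - b) + (a + b) * (a + b) ≡ + 2 * (a * a) + + 2 * (b * b)
      l′ = solve-∀
    grad²-per : Per² N (λ v → gradient v * gradient v)
    grad²-per x y x′ y′ p q = cong (λ t → t * t) (cong₂ _-_ (Per²-▹ {F = f} per M₂ x y x′ y′ p q) (Per²-▹ {F = f} per M₁ x y x′ y′ p q))

  L² : Mat
  L² = Lᴹ · Lᴹ

  -- U⁻¹ = L⁻² Q L²
  energy≤ : energy N f ≤ + 41 * (+ 4 * D₁ + D₂)
  energy≤ = begin
    D₁ + defect N f Uᴹ
      ≡⟨ +-congˡ D₁ (sym (defect-adj N f per Uᴹ refl)) ⟩
    D₁ + defect N f (adj L² · (Qᴹ · L²))
      ≤⟨ ℤₚ.+-monoʳ-≤ D₁ (defect-· N f per (adj L²) (Qᴹ · L²) refl) ⟩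
    D₁ + (+ 2 * defect N f (adj L²) + + 2 * defect N f (Qᴹ · L²))
      ≡⟨ cong (λ t → D₁ + (+ 2 * t + + 2 * defect N f (Qᴹ · L²))) (defect-adj N f per L² refl) ⟩
    D₁ + (+ 2 * defect N f L² + + 2 * defect N f (Qᴹ · L²))
      ≤⟨ ℤₚ.+-monoʳ-≤ D₁ (ℤₚ.+-monoʳ-≤ (+ 2 * defect N f L²) (*-monoˡ (+ 2) (+≤+ ℕ.z≤n) (defect-· N f per Qᴹ L² refl))) ⟩
    D₁ + (+ 2 * defect N f L² + + 2 * (+ 2 * defect N f Qᴹ + + 2 * defect N f L²))
      ≡⟨ l D₁ (defect N f L²) (defect N f Qᴹ) ⟩
    D₁ + (+ 6 * defect N f L² + + 4 * defect N f Qᴹ)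
      ≤⟨ ℤₚ.+-monoʳ-≤ D₁ (ℤₚ.+-mono-≤ (*-monoˡ (+ 6) (+≤+ ℕ.z≤n) (defect-· N f per Lᴹ Lᴹ refl)) (*-monoˡ (+ 4) (+≤+ ℕ.z≤n) defect-Q)) ⟩
    D₁ + (+ 6 * (+ 2 * D₁ + + 2 * D₁) + + 4 * (D₂ + + 4 * D₁))
      ≤⟨ ≤-by (+ 123 * D₁ + + 37 * D₂) (0≤+ (0≤* {+ 123} (+≤+ ℕ.z≤n) (defect≥0 N f Lᴹ)) (0≤* {+ 37} (+≤+ ℕ.z≤n) (defect≥0 N (T f) Lᴹ))) (l′ D₁ D₂) ⟩
    + 41 * (+ 4 * D₁ + D₂) ∎
    where
    open ℤₚ.≤-Reasoning
    l : ∀ d l q → d + (+ 2 * l + + 2 * (+ 2 * q + + 2 * l)) ≡ d + (+ 6 * l + + 4 * q)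
    l = solve-∀
    l′ : ∀ a b → a + (+ 6 * (+ 2 * a + + 2 * a) + + 4 * (b + + 4 * a)) + (+ 123 * a + + 37 * b) ≡ + 41 * (+ 4 * a + b)
    l′ = solve-∀

-- A function nearly invariant under L loses almost nothing in one step. Applying ‖T‖² to f and to T
-- f gives the loss 16 ‖f‖² - ‖T² f‖² = 4 D₁ + D₂, and the second step detects Q. In `energy≤` the
-- energy is at most 41 D₁ + 4 D₂, whence the factor 41.
T²-contract : ∀ {K N} .{{_ : ℕ.NonZero N}} → Gap K N → ∀ f → InV N f → ∑ (res² N) f ≡ 0ℤ →
              + (suc (K ℕ.* 41)) * ⟨ T (T f) , T (T f) ⟩[ N ] + ⟨ f , f ⟩[ N ] ≤ + (16 ℕ.* suc (K ℕ.* 41)) * ⟨ f , f ⟩[ N ]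
T²-contract {K} {N} gap f inV mean = begin
  K′ * X₂ + X₀                                  ≤⟨ ℤₚ.+-monoʳ-≤ (K′ * X₂) bound ⟩
  K′ * X₂ + K′ * (+ 4 * D₁ + D₂)                ≡⟨ cong (λ t → K′ * X₂ + K′ * t) (l X₀ X₁ X₂ D₁ D₂ (Parallelogram.‖T‖² N f (InV.per inV)) (Parallelogram.‖T‖² N (T f) (InV.per (T-InV inV)))) ⟩
  K′ * X₂ + K′ * (+ 16 * X₀ - X₂)               ≡⟨ l′ K′ X₂ X₀ ⟩
  + 16 * K′ * X₀                                ≡⟨ cong (_* X₀) (sym (ℤₚ.pos-* 16 (suc (K ℕ.* 41)))) ⟩
  + (16 ℕ.* suc (K ℕ.* 41)) * X₀ ∎
  where
  open ℤₚ.≤-Reasoning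
  D₁ = Parallelogram.D₁ N f (InV.per inV)
  D₂ = Parallelogram.D₂ N f (InV.per inV)
  K′ = + (suc (K ℕ.* 41))
  X₀ = ⟨ f , f ⟩[ N ]
  X₁ = ⟨ T f , T f ⟩[ N ]
  X₂ = ⟨ T (T f) , T (T f) ⟩[ N ]
  D≥0 : 0ℤ ≤ + 4 * D₁ + D₂
  D≥0 = 0≤+ (0≤* {+ 4} (+≤+ ℕ.z≤n) (defect≥0 N f Lᴹ)) (defect≥0 N (T f) Lᴹ)
  bound : X₀ ≤ K′ * (+ 4 * D₁ + D₂)
  bound = begin
    X₀                                   ≤⟨ gap f inV mean ⟩
    + K * energy N f                     ≤⟨ *-monoˡ (+ K) (+≤+ ℕ.z≤n) (Parallelogram.energy≤ N f (InV.per inV)) ⟩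
    + K * (+ 41 * (+ 4 * D₁ + D₂))       ≡⟨ trans (sym (ℤₚ.*-assoc (+ K) (+ 41) (+ 4 * D₁ + D₂))) (cong (_* (+ 4 * D₁ + D₂)) (sym (ℤₚ.pos-* K 41))) ⟩
    + (K ℕ.* 41) * (+ 4 * D₁ + D₂)       ≤⟨ *-monoʳ (+ 4 * D₁ + D₂) D≥0 (+≤+ (ℕₚ.n≤1+n (K ℕ.* 41))) ⟩
    K′ * (+ 4 * D₁ + D₂) ∎
  l : ∀ x₀ x₁ x₂ d₁ d₂ → x₁ + d₁ ≡ + 4 * x₀ → x₂ + d₂ ≡ + 4 * x₁ → + 4 * d₁ + d₂ ≡ + 16 * x₀ - x₂
  l x₀ x₁ x₂ d₁ d₂ e e′ = trans (p x₁ x₂ d₁ d₂) (trans (cong₂ (λ s t → + 4 * s + (t - x₂ - + 4 * x₁)) e e′) (q x₀ x₁ x₂))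
    where
    p : ∀ x₁ x₂ d₁ d₂ → + 4 * d₁ + d₂ ≡ + 4 * (x₁ + d₁) + (x₂ + d₂ - x₂ - + 4 * x₁)
    p = solve-∀
    q : ∀ x₀ x₁ x₂ → + 4 * (+ 4 * x₀) + (+ 4 * x₁ - x₂ - + 4 * x₁) ≡ + 16 * x₀ - x₂
    q = solve-∀
  l′ : ∀ k a b → k * a + k * (+ 16 * b - a) ≡ + 16 * k * b
  l′ = solve-∀

-- Reaching a point

residue : ∀ N .{{_ : ℕ.NonZero N}} z → Σ ℤ λ r → r ∈ res N × z ≡ r [ N ]
residue N z = + (z %ℕ N) , ∈-applyUpTo⁺ +_ (n%ℕd<d z N) ,
  divides (z /ℕ N) (trans (cong (λ t → t - + (z %ℕ N)) (a≡a%ℕn+[a/ℕn]*n z N)) (l (+ (z %ℕ N)) ((z /ℕ N) * + N)))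
  where
  l : ∀ a b → (a + b) - a ≡ b
  l = solve-∀

∃-mod? : ∀ N .{{_ : ℕ.NonZero N}} {P : ℤ → Set} → (∀ x → Dec (P x)) → (∀ x y → x ≡ y [ N ] → P x → P y) → Dec (Σ ℤ P)
∃-mod? N {P} P? resp = map′ (λ h → let (x , _ , px) = find h in x , px)
  (λ (x , px) → let (r , r∈ , x≡r) = residue N x in lose r∈ (resp x r x≡r px)) (any? P? (res N))

unit? : ∀ N .{{_ : ℕ.NonZero N}} t → Dec (Unit N t)
unit? N t = ∃-mod? N (λ s → + N ∣? (t * s - 1ℤ)) (λ x y e h → ∣-via (Div.∣m∣n⇒∣m-n h (Div.∣n⇒∣m*n t e)) (l t x y))
  where
  l : ∀ t x y → t * x - 1ℤ - t * (x - y) ≡ t * y - 1ℤ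
  l = solve-∀

prim? : ∀ N .{{_ : ℕ.NonZero N}} v → Dec (Prim N v)
prim? N (x , y) = map′ (λ (z , w , e) → (z , w) , e) (λ ((z , w) , e) → z , w , e)
  (∃-mod? N
    (λ z → ∃-mod? N (λ w → + N ∣? (x * w - z * y - 1ℤ)) (λ w w′ e h → ∣-via (Div.∣m∣n⇒∣m-n h (Div.∣n⇒∣m*n x e)) (l x y z w w′)))
    (λ z z′ e (w , h) → w , ∣-via (Div.∣m∣n⇒∣m+n h (Div.∣m⇒∣m*n y e)) (l′ x y z z′ w)))
  where
  l : ∀ x y z w w′ → x * w - z * y - 1ℤ - x * (w - w′) ≡ x * w′ - z * y - 1ℤ
  l = solve-∀
  l′ : ∀ x y z z′ w → x * w - z * y - 1ℤ + (z - z′) * y ≡ x * w - z′ * y - 1ℤ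
  l′ = solve-∀

-- Decidable sets of points of the projective line.
record Cone (N : ℕ) : Set₁ where
  field
    Holds   : V → Set
    holds?  : ∀ v → Dec (Holds v)
    resp    : ∀ x y x′ y′ → x ≡ x′ [ N ] → y ≡ y′ [ N ] → Holds (x , y) → Holds (x′ , y′)
    scale   : ∀ t → Unit N t → ∀ v → Holds v → Holds (t ⊛ v)
    prim    : ∀ v → Holds v → Prim N v

  indicator : V → ℤ
  indicator v = ind (holds? v)

  indicator-InV : InV N indicator
  indicator-InV = record
    { per = λ x y x′ y′ e e′ → ind-⇔ (holds? (x , y)) (holds? (x′ , y′)) (resp x y x′ y′ e e′) (resp x′ y′ x y (≡-mod-sym x x′ e) (≡-mod-sym y y′ e′))
    ; scl = λ t (s , e) (x , y) → ind-⇔ (holds? (t ⊛ (x , y))) (holds? (x , y))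
        (λ h → resp (s * (t * x)) (s * (t * y)) x y (un t s e x) (un t s e y) (scale s (t , ∣-via e (cong (λ z → z - 1ℤ) (ℤₚ.*-comm t s))) (t ⊛ (x , y)) h))
        (scale t (s , e) (x , y))
    ; sup = sup }
    where
    un : ∀ t s → t * s ≡ 1ℤ [ N ] → ∀ x → s * (t * x) ≡ x [ N ]
    un t s e x = ∣-via (Div.∣m⇒∣m*n x e) (l t s x)
      where
      l : ∀ t s x → (t * s - 1ℤ) * x ≡ s * (t * x) - x
      l = solve-∀
    sup : ∀ v → indicator v ≡ 0ℤ ⊎ Prim N v
    sup v with holds? v
    ... | yes h = inj₂ (prim v h)
    ... | no _  = inj₁ refl

wholeLine : ∀ N .{{_ : ℕ.NonZero N}} → Cone N
wholeLine N = record
  { Holds  = Prim N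
  ; holds? = prim? N
  ; resp   = λ x y x′ y′ e e′ ((z , w) , h) → (z , w) , ∣-via (Div.∣m∣n⇒∣m+n (Div.∣m∣n⇒∣m-n h (Div.∣m⇒∣m*n w e)) (Div.∣n⇒∣m*n z e′)) (l x y x′ y′ z w)
  ; scale  = λ t (s , e) (x , y) ((z , w) , h) → (s * z , s * w) , ∣-via (Div.∣m∣n⇒∣m+n (Div.∣n⇒∣m*n (t * s) h) e) (l′ t s x y z w)
  ; prim   = λ _ → id }
  where
  l : ∀ x y x′ y′ z w → x * w - z * y - 1ℤ - (x - x′) * w + z * (y - y′) ≡ x′ * w - z * y′ - 1ℤ
  l = solve-∀
  l′ : ∀ t s x y z w → t * s * (x * w - z * y - 1ℤ) + (t * s - 1ℤ) ≡ t * x * (s * w) - s * z * (t * y) - 1ℤ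
  l′ = solve-∀

-- The affine point (u : 1). Requiring y to be a unit is what later makes the denominator coprime to
-- N.
point : ∀ N .{{_ : ℕ.NonZero N}} → ℤ → Cone N
point N u = record
  { Holds  = λ (x , y) → x ≡ u * y [ N ] × Unit N y
  ; holds? = λ (x , y) → (+ N ∣? (x - u * y)) ×-dec unit? N y
  ; resp   = λ x y x′ y′ e e′ (h , s , k) → ∣-via (Div.∣m∣n⇒∣m+n (Div.∣m∣n⇒∣m-n h e) (Div.∣n⇒∣m*n u e′)) (l₁ u x y x′ y′) ,
                                            s , ∣-via (Div.∣m∣n⇒∣m-n k (Div.∣m⇒∣m*n s e′)) (l₂ s y y′)
  ; scale  = λ t (s , e) (x , y) (h , r , k) → ∣-via (Div.∣n⇒∣m*n t h) (l₃ t u x y) ,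
                                               s * r , ∣-via (Div.∣m∣n⇒∣m+n (Div.∣n⇒∣m*n (t * s) k) e) (l₄ t s y r)
  ; prim   = λ (x , y) (h , s , k) → (- s , 0ℤ) , ∣-via k (l₅ s x y) }
  where
  l₁ : ∀ u x y x′ y′ → x - u * y - (x - x′) + u * (y - y′) ≡ x′ - u * y′
  l₁ = solve-∀
  l₂ : ∀ s y y′ → y * s - 1ℤ - (y - y′) * s ≡ y′ * s - 1ℤ
  l₂ = solve-∀
  l₃ : ∀ t u x y → t * (x - u * y) ≡ t * x - u * (t * y)
  l₃ = solve-∀
  l₄ : ∀ t s y r → t * s * (y * r - 1ℤ) + (t * s - 1ℤ) ≡ t * y * (s * r) - 1ℤ
  l₄ = solve-∀
  l₅ : ∀ s x y → y * s - 1ℤ ≡ x * 0ℤ - - s * y - 1ℤ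
  l₅ = solve-∀

T^ : ℕ → (V → ℤ) → V → ℤ
T^ zero    f = f
T^ (suc n) f = T^ n (T f)

T^-cong : ∀ n {f g} → (∀ v → f v ≡ g v) → ∀ v → T^ n f v ≡ T^ n g v
T^-cong zero    e = e
T^-cong (suc n) e = T^-cong n (λ v → cong₂ _+_ (e (M₁ ▹ v)) (e (M₂ ▹ v)))

T^-lin : ∀ n f g a b v → T^ n (λ v → a * f v - b * g v) v ≡ a * T^ n f v - b * T^ n g v
T^-lin zero    f g a b v = refl
T^-lin (suc n) f g a b v = trans (T^-cong n (λ v → l a b (f (M₁ ▹ v)) (f (M₂ ▹ v)) (g (M₁ ▹ v)) (g (M₂ ▹ v))) v) (T^-lin n (T f) (T g) a b v)
  where
  l : ∀ a b x y z w → a * x - b * z + (a * y - b * w) ≡ a * (x + y) - b * (z + w)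
  l = solve-∀

T^-InV : ∀ {N} n {f} → InV N f → InV N (T^ n f)
T^-InV zero    inV = inV
T^-InV (suc n) inV = T^-InV n (T-InV inV)

T-line : ∀ N .{{_ : ℕ.NonZero N}} → let 𝟙 = Cone.indicator (wholeLine N) in ∀ v → T 𝟙 v ≡ + 2 * 𝟙 v
T-line N v = trans (cong₂ _+_ (inv M₁ refl) (inv M₂ refl)) (l (ind (prim? N v)))
  where
  l : ∀ a → a + a ≡ + 2 * a
  l = solve-∀
  inv : ∀ g → det g ≡ 1ℤ → ind (prim? N (g ▹ v)) ≡ ind (prim? N v)
  inv g e = ind-⇔ (prim? N (g ▹ v)) (prim? N v) (Prim-▹ g e v) (λ h → Prim-▹ (adj g) (trans (det-adj g) e) (g ▹ v) (subst (Prim N) (sym (adj-inverseˡ g e v)) h))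

T^-line : ∀ N .{{_ : ℕ.NonZero N}} n → let 𝟙 = Cone.indicator (wholeLine N) in ∀ v → T^ n 𝟙 v ≡ (+ 2) ^ n * 𝟙 v
T^-line N zero    v = sym (ℤₚ.*-identityˡ _)
T^-line N (suc n) v = begin
  T^ n (T 𝟙) v                            ≡⟨ T^-cong n (λ v → trans (T-line N v) (l (𝟙 v))) v ⟩
  T^ n (λ v → + 2 * 𝟙 v - 0ℤ * 𝟙 v) v     ≡⟨ T^-lin n 𝟙 𝟙 (+ 2) 0ℤ v ⟩
  + 2 * T^ n 𝟙 v - 0ℤ * T^ n 𝟙 v          ≡⟨ trans (sym (l (T^ n 𝟙 v))) (*-congˡ (+ 2) (T^-line N n v)) ⟩
  + 2 * ((+ 2) ^ n * 𝟙 v)                   ≡⟨ sym (ℤₚ.*-assoc (+ 2) ((+ 2) ^ n) (𝟙 v)) ⟩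
  (+ 2) ^ suc n * 𝟙 v ∎
  where
  open ≡-Reasoning
  𝟙 = Cone.indicator (wholeLine N)
  l : ∀ a → + 2 * a ≡ + 2 * a - 0ℤ * a
  l = solve-∀

orbit : ∀ {n} → V → Vec ℕ n → V
orbit v []       = v
orbit v (a ∷ as) = M a ▹ orbit v as

-- T^ n f v is the sum of f over the ends of all words of length n, and a sum of zeros is zero; so a
-- nonzero value exhibits a word.
search : ∀ n f v → (Σ (Vec ℕ n) λ as → All (λ a → a ≡ 1 ⊎ a ≡ 2) as × f (orbit v as) ≢ 0ℤ) ⊎ T^ n f v ≡ 0ℤ
search zero f v with f v ℤₚ.≟ 0ℤ
... | yes e = inj₂ e
... | no ¬e = inj₁ ([] , [] , ¬e)
search (suc n) f v with search n (T f) v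
... | inj₂ e = inj₂ e
... | inj₁ (as , all , ¬e) with f (M₁ ▹ orbit v as) ℤₚ.≟ 0ℤ | f (M₂ ▹ orbit v as) ℤₚ.≟ 0ℤ
...   | no ¬e₁ | _      = inj₁ (1 ∷ as , inj₁ refl ∷ all , ¬e₁)
...   | yes _  | no ¬e₂ = inj₁ (2 ∷ as , inj₂ refl ∷ all , ¬e₂)
...   | yes e₁ | yes e₂ = ⊥-elim (¬e (cong₂ _+_ e₁ e₂))

ind-≤1 : {P : Set} (d : Dec P) → ind d ≤ 1ℤ
ind-≤1 (yes _) = ℤₚ.≤-refl
ind-≤1 (no _)  = +≤+ ℕ.z≤n

ind-idem : {P : Set} (d : Dec P) → ind d * ind d ≡ ind d
ind-idem (yes _) = refl
ind-idem (no _)  = refl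

decay : ∀ {N} .{{_ : ℕ.NonZero N}} {K m} →
        (∀ f → InV N f → ∑ (res² N) f ≡ 0ℤ → + K * ⟨ T (T f) , T (T f) ⟩[ N ] ≤ + m * ⟨ f , f ⟩[ N ]) →
        ∀ k f → InV N f → ∑ (res² N) f ≡ 0ℤ → (+ K) ^ k * ⟨ T^ (k ℕ.* 2) f , T^ (k ℕ.* 2) f ⟩[ N ] ≤ (+ m) ^ k * ⟨ f , f ⟩[ N ]
decay c zero f inV mean = ℤₚ.≤-refl
decay {N} {K} {m} c (suc k) f inV mean = begin
  + K * (+ K) ^ k * X                                       ≡⟨ ℤₚ.*-assoc (+ K) ((+ K) ^ k) X ⟩
  + K * ((+ K) ^ k * X)                                     ≤⟨ *-monoˡ (+ K) (+≤+ ℕ.z≤n) (decay c k (T (T f)) (T-InV (T-InV inV)) mean″) ⟩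
  + K * ((+ m) ^ k * ⟨ T (T f) , T (T f) ⟩[ N ])            ≡⟨ l (+ K) ((+ m) ^ k) ⟨ T (T f) , T (T f) ⟩[ N ] ⟩
  (+ m) ^ k * (+ K * ⟨ T (T f) , T (T f) ⟩[ N ])            ≤⟨ *-monoˡ ((+ m) ^ k) (subst (0ℤ ≤_) (sym (pos-^ m k)) (+≤+ ℕ.z≤n)) (c f inV mean) ⟩
  (+ m) ^ k * (+ m * ⟨ f , f ⟩[ N ])                        ≡⟨ l′ ((+ m) ^ k) (+ m) ⟨ f , f ⟩[ N ] ⟩
  + m * (+ m) ^ k * ⟨ f , f ⟩[ N ] ∎
  where
  open ℤₚ.≤-Reasoning
  X = ⟨ T^ (k ℕ.* 2) (T (T f)) , T^ (k ℕ.* 2) (T (T f)) ⟩[ N ]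
  l : ∀ a b c → a * (b * c) ≡ b * (a * c)
  l = solve-∀
  l′ : ∀ a b c → a * (b * c) ≡ b * a * c
  l′ = solve-∀
  mean-T : ∀ f → InV N f → ∑ (res² N) f ≡ 0ℤ → ∑ (res² N) (T f) ≡ 0ℤ
  mean-T f inV e = trans (T-total N f (InV.per inV)) (trans (*-congˡ (+ 2) e) refl)
  mean″ : ∑ (res² N) (T (T f)) ≡ 0ℤ
  mean″ = mean-T (T f) (T-InV inV) (mean-T f inV mean)

-- If no path of length 2k led from v₀ into S, the mean-zero function P·1_S - G·1 would have a value at v₀ too large for its decay.
module Reach (N : ℕ) .{{_ : ℕ.NonZero N}} (S : Cone N) (v₀ : V) (v₀-prim : Prim N v₀) (s : V) (s∈S : Cone.Holds S s) where
  g 𝟙 : V → ℤ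
  g = Cone.indicator S
  𝟙 = Cone.indicator (wholeLine N)

  P G W : ℤ
  P = ∑ (res² N) 𝟙
  G = ∑ (res² N) g
  W = + N * + N

  -- The indicator of S minus its mean over the primitive vectors, multiplied by their number P to
  -- stay in ℤ.
  f : V → ℤ
  f v = P * g v - G * 𝟙 v

  f-InV : InV N f
  f-InV = InV-cong (λ v → l P (g v) G (𝟙 v)) (InV-lin (Cone.indicator-InV S) (Cone.indicator-InV (wholeLine N)) P (- G))
    where
    l : ∀ p g G h → p * g + - G * h ≡ p * g - G * h
    l = solve-∀

  f-mean : ∑ (res² N) f ≡ 0ℤ
  f-mean = trans (∑-- (res² N) _ _) (trans (cong₂ _-_ (∑-*ˡ (res² N) P g) (∑-*ˡ (res² N) G 𝟙)) (l P G))
    where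
    l : ∀ p g → p * g - g * p ≡ 0ℤ
    l = solve-∀

  W≥0 : 0ℤ ≤ W
  W≥0 = 0≤² (+ N)

  total≤ : (C : Cone N) → 0ℤ ≤ ∑ (res² N) (Cone.indicator C) × ∑ (res² N) (Cone.indicator C) ≤ W
  total≤ C = ∑-nonneg (res² N) (λ v → ind-≥0 (Cone.holds? C v)) ,
    ℤₚ.≤-trans (∑-mono (res² N) (λ v → ind-≤1 (Cone.holds? C v))) (ℤₚ.≤-reflexive (trans (∑²-const N 1ℤ) (ℤₚ.*-identityʳ W)))

  sq≤ : ∀ {x} → 0ℤ ≤ x → x ≤ W → x * x ≤ W * W
  sq≤ {x} x≥0 x≤W = ℤₚ.≤-trans (*-monoˡ x x≥0 x≤W) (*-monoʳ W W≥0 x≤W)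

  f²≤ : ∀ v → f v * f v ≤ + 2 * (W * W)
  f²≤ v = begin
    f v * f v
      ≤⟨ ≤-by (+ 2 * (P * (g v * (G * 𝟙 v)))) (0≤* {+ 2} (+≤+ ℕ.z≤n) (0≤* (proj₁ (total≤ (wholeLine N))) (0≤* (ind-≥0 (Cone.holds? S v)) (0≤* (proj₁ (total≤ S)) (ind-≥0 (prim? N v))))))
           (trans (l P G (g v) (𝟙 v)) (cong₂ (λ a b → P * P * a + G * G * b) (ind-idem (Cone.holds? S v)) (ind-idem (prim? N v)))) ⟩
    P * P * g v + G * G * 𝟙 v
      ≤⟨ ℤₚ.+-mono-≤ (ℤₚ.≤-trans (*-monoˡ (P * P) (0≤² P) (ind-≤1 (Cone.holds? S v))) (ℤₚ.≤-reflexive (ℤₚ.*-identityʳ (P * P))))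
                     (ℤₚ.≤-trans (*-monoˡ (G * G) (0≤² G) (ind-≤1 (prim? N v))) (ℤₚ.≤-reflexive (ℤₚ.*-identityʳ (G * G)))) ⟩
    P * P + G * G
      ≤⟨ ℤₚ.+-mono-≤ (sq≤ (proj₁ (total≤ (wholeLine N))) (proj₂ (total≤ (wholeLine N)))) (sq≤ (proj₁ (total≤ S)) (proj₂ (total≤ S))) ⟩
    W * W + W * W
      ≡⟨ l₂ (W * W) ⟩
    + 2 * (W * W) ∎
    where
    open ℤₚ.≤-Reasoning
    l : ∀ P G g h → (P * g - G * h) * (P * g - G * h) + + 2 * (P * (g * (G * h))) ≡ P * P * (g * g) + G * G * (h * h)
    l = solve-∀
    l₂ : ∀ a → a + a ≡ + 2 * a
    l₂ = solve-∀

  ‖f‖²≤ : ⟨ f , f ⟩[ N ] ≤ W * (+ 2 * (W * W))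
  ‖f‖²≤ = ℤₚ.≤-trans (∑-mono (res² N) f²≤) (ℤₚ.≤-reflexive (∑²-const N (+ 2 * (W * W))))

  1≤G : 1ℤ ≤ G
  1≤G = subst (_≤ G) (ind-yes (Cone.holds? S s) s∈S) (value≤total N g (InV.per (Cone.indicator-InV S)) (λ v → ind-≥0 (Cone.holds? S v)) s)

  1≤G² : 1ℤ ≤ G * G
  1≤G² = ℤₚ.≤-trans 1≤G (ℤₚ.≤-trans (ℤₚ.≤-reflexive (sym (ℤₚ.*-identityʳ G))) (*-monoˡ G (proj₁ (total≤ S)) 1≤G))

  far : ∀ k → T^ (k ℕ.* 2) g v₀ ≡ 0ℤ → (+ 16) ^ k ≤ ⟨ T^ (k ℕ.* 2) f , T^ (k ℕ.* 2) f ⟩[ N ]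
  far k e = begin
    (+ 16) ^ k                          ≡⟨ sym (ℤₚ.*-identityʳ ((+ 16) ^ k)) ⟩
    (+ 16) ^ k * 1ℤ                     ≤⟨ *-monoˡ ((+ 16) ^ k) (subst (0ℤ ≤_) (sym (pos-^ 16 k)) (+≤+ ℕ.z≤n)) 1≤G² ⟩
    (+ 16) ^ k * (G * G)                ≡⟨ cong (_* (G * G)) (sym (16^ k)) ⟩
    (+ 2) ^ n * (+ 2) ^ n * (G * G)     ≡⟨ l ((+ 2) ^ n) G ⟩
    - (G * (+ 2) ^ n) * - (G * (+ 2) ^ n)
      ≡⟨ sym (cong (λ t → t * t) value) ⟩
    T^ n f v₀ * T^ n f v₀               ≤⟨ value≤total N (λ v → T^ n f v * T^ n f v) (λ x y x′ y′ p q → cong (λ t → t * t) (InV.per (T^-InV n f-InV) x y x′ y′ p q)) (λ v → 0≤² (T^ n f v)) v₀ ⟩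
    ⟨ T^ n f , T^ n f ⟩[ N ] ∎
    where
    open ℤₚ.≤-Reasoning
    n = k ℕ.* 2
    l : ∀ a b → a * a * (b * b) ≡ - (b * a) * - (b * a)
    l = solve-∀
    16^ : ∀ k → (+ 2) ^ (k ℕ.* 2) * (+ 2) ^ (k ℕ.* 2) ≡ (+ 16) ^ k
    16^ zero    = refl
    16^ (suc k) = trans (l′ ((+ 2) ^ (k ℕ.* 2))) (*-congˡ (+ 16) (16^ k))
      where
      l′ : ∀ a → (+ 2 * (+ 2 * a)) * (+ 2 * (+ 2 * a)) ≡ + 16 * (a * a)
      l′ = solve-∀
    value : T^ n f v₀ ≡ - (G * (+ 2) ^ n)
    value = trans (T^-lin n g 𝟙 P G v₀) (trans (cong₂ (λ a b → P * a - G * b) e (trans (T^-line N n v₀) (*-congˡ ((+ 2) ^ n) (ind-yes (prim? N v₀) v₀-prim)))) (l₃ P G ((+ 2) ^ n)))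
      where
      l₃ : ∀ p g t → p * 0ℤ - g * (t * 1ℤ) ≡ - (g * t)
      l₃ = solve-∀

  -- The contraction factor of T² / 4 on squared norms is m / (m + 1), and ‖f‖² ≤ 2 N⁶ by counting
  -- vectors. If S were missed, the value at the starting vector alone would give ‖T^(2k) f‖² ≥
  -- 16^k, against the hypothesis on k.
  reach : ∀ K → Gap K N → ∀ m → suc m ≡ 16 ℕ.* suc (K ℕ.* 41) → ∀ k → m ℕ.^ k ℕ.* (N ℕ.* N ℕ.* (2 ℕ.* (N ℕ.* N ℕ.* (N ℕ.* N)))) ℕ.< suc m ℕ.^ k →
          Σ (Vec ℕ (k ℕ.* 2)) λ as → All (λ a → a ≡ 1 ⊎ a ≡ 2) as × Cone.Holds S (orbit v₀ as)
  reach K gap m m≡ k lt with search (k ℕ.* 2) g v₀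
  ... | inj₁ (as , all , ¬e) = as , all , holds (Cone.holds? S (orbit v₀ as)) ¬e
    where
    holds : {A : Set} (d : Dec A) → ind d ≢ 0ℤ → A
    holds (yes a) _ = a
    holds (no _)  h = ⊥-elim (h refl)
  ... | inj₂ e = ⊥-elim (ℕₚ.<⇒≱ lt (ℤₚ.drop‿+≤+ (begin
    + (suc m ℕ.^ k)                                           ≡⟨ trans (cong (λ t → + (t ℕ.^ k)) m≡) (trans (sym (pos-^ (16 ℕ.* K′) k)) (trans (cong (_^ k) (trans (cong (λ t → + t) (ℕₚ.*-comm 16 K′)) (ℤₚ.pos-* K′ 16))) (^-prod (+ K′) (+ 16) k))) ⟩
    (+ K′) ^ k * (+ 16) ^ k                                   ≤⟨ *-monoˡ ((+ K′) ^ k) (subst (0ℤ ≤_) (sym (pos-^ K′ k)) (+≤+ ℕ.z≤n)) (far k e) ⟩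
    (+ K′) ^ k * ⟨ T^ (k ℕ.* 2) f , T^ (k ℕ.* 2) f ⟩[ N ]     ≤⟨ decay {K = K′} {m = m} contract k f f-InV f-mean ⟩
    (+ m) ^ k * ⟨ f , f ⟩[ N ]                                ≤⟨ *-monoˡ ((+ m) ^ k) (subst (0ℤ ≤_) (sym (pos-^ m k)) (+≤+ ℕ.z≤n)) ‖f‖²≤ ⟩
    (+ m) ^ k * (W * (+ 2 * (W * W)))                         ≡⟨ cast ⟩
    + (m ℕ.^ k ℕ.* (N ℕ.* N ℕ.* (2 ℕ.* (N ℕ.* N ℕ.* (N ℕ.* N))))) ∎)))
    where
    open ℤₚ.≤-Reasoning
    K′ = suc (K ℕ.* 41)
    ^-prod : ∀ a b k → (a * b) ^ k ≡ a ^ k * b ^ k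
    ^-prod a b zero    = refl
    ^-prod a b (suc k) = trans (*-congˡ (a * b) (^-prod a b k)) (l a b (a ^ k) (b ^ k))
      where
      l : ∀ a b c d → a * b * (c * d) ≡ a * c * (b * d)
      l = solve-∀
    W≡ : W ≡ + (N ℕ.* N)
    W≡ = sym (ℤₚ.pos-* N N)
    cast : (+ m) ^ k * (W * (+ 2 * (W * W))) ≡ + (m ℕ.^ k ℕ.* (N ℕ.* N ℕ.* (2 ℕ.* (N ℕ.* N ℕ.* (N ℕ.* N)))))
    cast = trans (cong₂ _*_ (pos-^ m k) (trans (cong (λ w → w * (+ 2 * (w * w))) W≡)
             (trans (cong (λ t → + (N ℕ.* N) * (+ 2 * t)) (sym (ℤₚ.pos-* (N ℕ.* N) (N ℕ.* N))))
               (trans (cong (λ t → + (N ℕ.* N) * t) (sym (ℤₚ.pos-* 2 (N ℕ.* N ℕ.* (N ℕ.* N))))) (sym (ℤₚ.pos-* (N ℕ.* N) (2 ℕ.* (N ℕ.* N ℕ.* (N ℕ.* N)))))))))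
           (sym (ℤₚ.pos-* (m ℕ.^ k) (N ℕ.* N ℕ.* (2 ℕ.* (N ℕ.* N ℕ.* (N ℕ.* N))))))
    contract : ∀ f → InV N f → ∑ (res² N) f ≡ 0ℤ → + K′ * ⟨ T (T f) , T (T f) ⟩[ N ] ≤ + m * ⟨ f , f ⟩[ N ]
    contract f inV mean = cancel _ ⟨ f , f ⟩[ N ] (T²-contract {K} {N} gap f inV mean)
      where
      cancel : ∀ a x → a + x ≤ + (16 ℕ.* K′) * x → a ≤ + m * x
      cancel a x le = ≤-by ((1ℤ + + m) * x - (a + x)) (0≤- (subst (λ t → a + x ≤ t * x) (trans (cong (λ t → + t) (sym m≡)) (ℤₚ.pos-+ 1 m)) le)) (l₁ a x (+ m))
        where
        l₁ : ∀ a x m → a + ((1ℤ + m) * x - (a + x)) ≡ m * x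
        l₁ = solve-∀

-- Continued fractions

-- For y = p/q one has [a, 1, y] = (p + q) / (a p + (a + 1) q).
cf-num cf-den : ∀ {n} → Vec ℕ n → ℕ
cf-num []       = 0
cf-num (a ∷ as) = cf-num as ℕ.+ cf-den as
cf-den []       = 1
cf-den (a ∷ as) = a ℕ.* cf-num as ℕ.+ suc a ℕ.* cf-den as

cf-den>0 : ∀ {n} (as : Vec ℕ n) → 0 ℕ.< cf-den as
cf-den>0 []       = ℕ.s≤s ℕ.z≤n
cf-den>0 (a ∷ as) = ℕₚ.≤-trans (cf-den>0 as) (ℕₚ.≤-trans (ℕₚ.m≤m+n (cf-den as) (a ℕ.* cf-den as)) (ℕₚ.m≤n+m (suc a ℕ.* cf-den as) (a ℕ.* cf-num as)))

cf-coprime : ∀ {n} (as : Vec ℕ n) → Coprime (cf-num as) (cf-den as)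
cf-coprime []       (_ , i∣1) = ℕD.∣1⇒≡1 i∣1
cf-coprime (a ∷ as) {i} (i∣p+q , i∣d) = cf-coprime as (ℕD.∣m+n∣m⇒∣n (subst (i ℕD.∣_) (ℕₚ.+-comm (cf-num as) (cf-den as)) i∣p+q) i∣q , i∣q)
  where
  l : ∀ a p q → a ℕ.* p ℕ.+ suc a ℕ.* q ≡ a ℕ.* (p ℕ.+ q) ℕ.+ q
  l = solveℕ-∀
  i∣q : i ℕD.∣ cf-den as
  i∣q = ℕD.∣m+n∣m⇒∣n (subst (i ℕD.∣_) (l a (cf-num as) (cf-den as)) i∣d) (ℕD.∣n⇒∣m*n a i∣p+q)

orbit-cf : ∀ {n} (as : Vec ℕ n) → orbit (0ℤ , 1ℤ) as ≡ (+ cf-num as , + cf-den as)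
orbit-cf []       = refl
orbit-cf (a ∷ as) = trans (cong (M a ▹_) (orbit-cf as)) (cong₂ _,_
  (trans (l (+ cf-num as) (+ cf-den as)) (sym (ℤₚ.pos-+ (cf-num as) (cf-den as))))
  (trans (cong₂ _+_ (sym (ℤₚ.pos-* a (cf-num as))) (sym (ℤₚ.pos-* (suc a) (cf-den as)))) (sym (ℤₚ.pos-+ (a ℕ.* cf-num as) (suc a ℕ.* cf-den as)))))
  where
  l : ∀ p q → 1ℤ * p + 1ℤ * q ≡ p + q
  l = solve-∀

-- Equality with p/q is kept up to cross-multiplication through the recursion, so nothing has to be
-- normalised on the way. Coprimality of p and q identifies the normal form once, at the end, in
-- `cf-lowest-terms`.
Represents : ℚ → ℕ → ℕ → Set
Represents x p q = Σ ℕ λ q′ → q ≡ suc q′ × toℚᵘ x ≃ᵘ mkℚᵘ (+ p) q′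

represents-+ : ∀ b {x p q} → Represents x p q → Represents (fromℚᵘ (mkℚᵘ (+ b) 0) ℚ.+ x) (b ℕ.* q ℕ.+ p) q
represents-+ b {x} {p} (q′ , refl , e) = q′ , refl , ℚᵘₚ.≃-trans (ℚₚ.toℚᵘ-homo-+ (fromℚᵘ (mkℚᵘ (+ b) 0)) x)
  (ℚᵘₚ.≃-trans (ℚᵘₚ.+-cong (ℚₚ.toℚᵘ-fromℚᵘ (mkℚᵘ (+ b) 0)) e) (*≡* (cong₂ _*_ num (cong (λ t → + suc t) (sym (ℕₚ.+-identityʳ q′))))))
  where
  num : + b * + suc q′ + + p * 1ℤ ≡ + (b ℕ.* suc q′ ℕ.+ p)
  num = trans (cong₂ _+_ (sym (ℤₚ.pos-* b (suc q′))) (ℤₚ.*-identityʳ (+ p))) (sym (ℤₚ.pos-+ (b ℕ.* suc q′) p))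

recip-positive : ∀ n d .(c : Coprime (suc n) (suc d)) .(c′ : Coprime (suc d) (suc n)) → recip (mkℚ (+ suc n) d c) ≡ mkℚ (+ suc d) n c′
recip-positive n d c c′ with mkℚ (+ suc n) d c ℚₚ.≟ ℚ.0ℚ
... | no _ = refl

represents-recip : ∀ {x p q} → 0 ℕ.< p → Represents x p q → Represents (recip x) q p
represents-recip {mkℚ (+ suc n) d c} {suc p} _ (q′ , refl , *≡* e) = p , refl ,
  subst (λ y → toℚᵘ y ≃ᵘ mkℚᵘ (+ suc q′) p) (sym (recip-positive n d c (λ (i , j) → c (j , i))))
    (*≡* (trans (ℤₚ.*-comm (+ suc d) (+ suc p)) (trans (sym e) (ℤₚ.*-comm (+ suc n) (+ suc q′)))))
represents-recip {mkℚ (+ 0) d c}       {suc p} _ (q′ , refl , *≡* ())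
represents-recip {mkℚ -[1+ n ] d c}    {suc p} _ (q′ , refl , *≡* ())

represents-cf : ∀ {n} (as : Vec ℕ n) → Represents (cf (withOnes as)) (cf-num as) (cf-den as)
represents-cf []       = 0 , refl , *≡* refl
represents-cf (a ∷ as) = subst₂ (Represents (cf (withOnes (a ∷ as)))) (l₁ p q) (l₂ a p q)
  (represents-recip (ℕₚ.≤-trans (cf-den>0 as) (ℕₚ.m≤n+m q (a ℕ.* (1 ℕ.* q ℕ.+ p))))
    (represents-+ a (represents-recip (ℕₚ.≤-trans (cf-den>0 as) (subst (q ℕ.≤_) (sym (l₁ p q)) (ℕₚ.m≤n+m q p))) (represents-+ 1 (represents-cf as)))))
  where
  p = cf-num as
  q = cf-den as
  l₁ : ∀ p q → 1 ℕ.* q ℕ.+ p ≡ p ℕ.+ q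
  l₁ = solveℕ-∀
  l₂ : ∀ a p q → a ℕ.* (1 ℕ.* q ℕ.+ p) ℕ.+ q ≡ a ℕ.* p ℕ.+ suc a ℕ.* q
  l₂ = solveℕ-∀

cf-lowest-terms : ∀ {n} (as : Vec ℕ n) → ℚ.↥ (cf (withOnes as)) ≡ + cf-num as × ℚ.↧ₙ (cf (withOnes as)) ≡ cf-den as
cf-lowest-terms as = go (cf-den as) (cf-coprime as) (represents-cf as)
  where
  go : ∀ q → Coprime (cf-num as) q → Represents (cf (withOnes as)) (cf-num as) q →
       ℚ.↥ (cf (withOnes as)) ≡ + cf-num as × ℚ.↧ₙ (cf (withOnes as)) ≡ q
  go _ c (q′ , refl , e) = cong ℚ.↥_ x≡ , cong ℚ.↧ₙ_ x≡
    where
    x≡ : cf (withOnes as) ≡ mkℚ (+ cf-num as) q′ c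
    x≡ = ℚₚ.toℚᵘ-injective e

-- Logarithmic length and conclusion

bernoulli : ∀ m n → m ℕ.^ n ℕ.* (m ℕ.+ n) ℕ.≤ m ℕ.* suc m ℕ.^ n
bernoulli m zero    = ℕₚ.≤-reflexive (l m)
  where
  l : ∀ m → 1 ℕ.* (m ℕ.+ 0) ≡ m ℕ.* 1
  l = solveℕ-∀
bernoulli m (suc n) = begin
  m ℕ.* m ℕ.^ n ℕ.* (m ℕ.+ suc n)                 ≤⟨ ℕₚ.m≤m+n _ (m ℕ.^ n ℕ.* n) ⟩
  m ℕ.* m ℕ.^ n ℕ.* (m ℕ.+ suc n) ℕ.+ m ℕ.^ n ℕ.* n
                                                  ≡⟨ l m (m ℕ.^ n) n ⟩
  suc m ℕ.* (m ℕ.^ n ℕ.* (m ℕ.+ n))               ≤⟨ ℕₚ.*-monoʳ-≤ (suc m) (bernoulli m n) ⟩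
  suc m ℕ.* (m ℕ.* suc m ℕ.^ n)                   ≡⟨ l′ (suc m) m (suc m ℕ.^ n) ⟩
  m ℕ.* (suc m ℕ.* suc m ℕ.^ n) ∎
  where
  open ℕₚ.≤-Reasoning
  l : ∀ m x n → m ℕ.* x ℕ.* (m ℕ.+ suc n) ℕ.+ x ℕ.* n ≡ suc m ℕ.* (x ℕ.* (m ℕ.+ n))
  l = solveℕ-∀
  l′ : ∀ s m x → s ℕ.* (m ℕ.* x) ≡ m ℕ.* (s ℕ.* x)
  l′ = solveℕ-∀

2*m^m≤[1+m]^m : ∀ m .{{_ : ℕ.NonZero m}} → 2 ℕ.* m ℕ.^ m ℕ.≤ suc m ℕ.^ m
2*m^m≤[1+m]^m m = ℕₚ.*-cancelˡ-≤ m (ℕₚ.≤-trans (ℕₚ.≤-reflexive (l m (m ℕ.^ m))) (bernoulli m m))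
  where
  l : ∀ m x → m ℕ.* (2 ℕ.* x) ≡ x ℕ.* (m ℕ.+ m)
  l = solveℕ-∀

-- By Bernoulli, (1 + 1/m)^m ≥ 2, so m t double steps gain 2^t. With A = 2 N⁶ this is where the
-- logarithm of N enters.
outgrows : ∀ m .{{_ : ℕ.NonZero m}} t A → A ℕ.< 2 ℕ.^ t → m ℕ.^ (m ℕ.* t) ℕ.* A ℕ.< suc m ℕ.^ (m ℕ.* t)
outgrows m t A lt = begin-strict
  m ℕ.^ (m ℕ.* t) ℕ.* A                ≡⟨ ℕₚ.*-comm (m ℕ.^ (m ℕ.* t)) A ⟩
  A ℕ.* m ℕ.^ (m ℕ.* t)                <⟨ ℕₚ.*-monoˡ-< (m ℕ.^ (m ℕ.* t)) {{ℕₚ.m^n≢0 m (m ℕ.* t)}} lt ⟩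
  2 ℕ.^ t ℕ.* m ℕ.^ (m ℕ.* t)          ≡⟨ cong (2 ℕ.^ t ℕ.*_) (sym (ℕₚ.^-*-assoc m m t)) ⟩
  2 ℕ.^ t ℕ.* (m ℕ.^ m) ℕ.^ t          ≡⟨ sym (*-^ 2 (m ℕ.^ m) t) ⟩
  (2 ℕ.* m ℕ.^ m) ℕ.^ t                ≤⟨ ℕₚ.^-monoˡ-≤ t (2*m^m≤[1+m]^m m) ⟩
  (suc m ℕ.^ m) ℕ.^ t                  ≡⟨ ℕₚ.^-*-assoc (suc m) m t ⟩
  suc m ℕ.^ (m ℕ.* t) ∎
  where open ℕₚ.≤-Reasoning

1≤⌈log₂⌉ : ∀ {N} → 2 ℕ.≤ N → 1 ℕ.≤ ⌈log₂ N ⌉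
1≤⌈log₂⌉ 2≤N = ℕₚ.≤-trans (ℕₚ.≤-reflexive (sym (⌈log₂2^n⌉≡n 1))) (⌈log₂⌉-mono-≤ 2≤N)

-- Only monotonicity of the logarithm and its values at powers of 2 enter: the power of 2 above N
-- has exponent at most ⌈log₂ N⌉ + 1, which is at most twice the logarithm.
N≤2^2⌈log₂N⌉ : ∀ {N} → 2 ℕ.≤ N → N ℕ.≤ 2 ℕ.^ (2 ℕ.* ⌈log₂ N ⌉)
N≤2^2⌈log₂N⌉ {N} 2≤N = go (log-interval 2 ℕₚ.≤-refl N (ℕₚ.≤-trans (ℕ.s≤s ℕ.z≤n) 2≤N))
  where
  L = ⌈log₂ N ⌉
  go : (Σ ℕ λ j → 2 ℕ.^ j ℕ.≤ N × N ℕ.< 2 ℕ.^ suc j) → N ℕ.≤ 2 ℕ.^ (2 ℕ.* L)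
  go (j , lo , hi) = ℕₚ.≤-trans (ℕₚ.<⇒≤ hi) (ℕₚ.^-monoʳ-≤ 2 (ℕₚ.≤-trans (ℕₚ.+-mono-≤ (1≤⌈log₂⌉ 2≤N) j≤L) (ℕₚ.≤-reflexive (cong (L ℕ.+_) (sym (ℕₚ.+-identityʳ L))))))
    where
    j≤L : j ℕ.≤ L
    j≤L = subst (ℕ._≤ L) (⌈log₂2^n⌉≡n j) (⌈log₂⌉-mono-≤ lo)

2N⁶<2^ : ∀ {N} → 2 ℕ.≤ N → N ℕ.* N ℕ.* (2 ℕ.* (N ℕ.* N ℕ.* (N ℕ.* N))) ℕ.< 2 ℕ.^ (2 ℕ.+ 12 ℕ.* ⌈log₂ N ⌉)
2N⁶<2^ {N} 2≤N = begin-strict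
  N ℕ.* N ℕ.* (2 ℕ.* (N ℕ.* N ℕ.* (N ℕ.* N)))    ≤⟨ ℕₚ.*-mono-≤ (ℕₚ.*-mono-≤ le le) (ℕₚ.*-monoʳ-≤ 2 (ℕₚ.*-mono-≤ (ℕₚ.*-mono-≤ le le) (ℕₚ.*-mono-≤ le le))) ⟩
  X ℕ.* X ℕ.* (2 ℕ.* (X ℕ.* X ℕ.* (X ℕ.* X)))    ≡⟨ trans (l X) (cong (2 ℕ.*_) (ℕₚ.^-*-assoc 2 (2 ℕ.* L) 6)) ⟩
  2 ℕ.^ suc (2 ℕ.* L ℕ.* 6)                      <⟨ ℕₚ.^-monoʳ-< 2 (ℕ.s≤s (ℕ.s≤s ℕ.z≤n)) (ℕ.s≤s (ℕ.s≤s (ℕₚ.≤-reflexive (l′ L)))) ⟩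
  2 ℕ.^ (2 ℕ.+ 12 ℕ.* L) ∎
  where
  open ℕₚ.≤-Reasoning
  L = ⌈log₂ N ⌉
  X = 2 ℕ.^ (2 ℕ.* L)
  le = N≤2^2⌈log₂N⌉ 2≤N
  l : ∀ x → x ℕ.* x ℕ.* (2 ℕ.* (x ℕ.* x ℕ.* (x ℕ.* x))) ≡ 2 ℕ.* (x ℕ.* (x ℕ.* (x ℕ.* (x ℕ.* (x ℕ.* (x ℕ.* 1))))))
  l = solveℕ-∀
  l′ : ∀ L → 2 ℕ.* L ℕ.* 6 ≡ 12 ℕ.* L
  l′ = solveℕ-∀

unit-den⇒coprime : ∀ {N q} → Unit N (+ q) → Coprime q N
unit-den⇒coprime {N} {q} (s , e) {i} (i∣q , i∣N) = ℕD.∣1⇒≡1 (Div.∣⇒∣ᵤ {k = + i}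
  (∣-via (Div.∣m∣n⇒∣m-n (Div.∣m⇒∣m*n s (Div.∣ᵤ⇒∣ {k = + i} {i = + q} i∣q)) (Div.∣-trans (Div.∣ᵤ⇒∣ {k = + i} {i = + N} i∣N) e)) (l (+ q) s)))
  where
  l : ∀ q s → q * s - (q * s - 1ℤ) ≡ 1ℤ
  l = solve-∀

FewQuotients : ℕ → Set
FewQuotients C = ∀ N → 2 ℕ.≤ N → ∀ u → Σ ℕ λ ℓ → ℓ ℕ.≤ C ℕ.* ⌈log₂ N ⌉ × Σ (Vec ℕ ℓ) λ as → All (λ a → a ≡ 1 ⊎ a ≡ 2) as ×
  (+ cf-num as) ≡ u * + cf-den as [ N ] × Unit N (+ cf-den as)

few-quotients : Σ ℕ λ C → 0 ℕ.< C × FewQuotients C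
few-quotients = go spectral-gap
  where
  go : (Σ ℕ λ K → ∀ N → .{{_ : ℕ.NonZero N}} → Gap K N) → Σ ℕ λ C → 0 ℕ.< C × FewQuotients C
  go (K , gap) = m ℕ.* 28 , ℕ.s≤s ℕ.z≤n , λ N 2≤N u → from N {{ℕ.>-nonZero (ℕₚ.≤-trans (ℕ.s≤s ℕ.z≤n) 2≤N)}} 2≤N u
    where
    -- m + 1 = 16 (1 + 41 K) is the denominator of the contraction factor of T² / 4. The 28 is 2 ·
    -- 14: two letters for each application of T², and t = 2 + 12 ⌈log₂ N⌉ ≤ 14 ⌈log₂ N⌉.
    m = 15 ℕ.+ 16 ℕ.* (K ℕ.* 41)
    m≡ : suc m ≡ 16 ℕ.* suc (K ℕ.* 41)
    m≡ = l (K ℕ.* 41)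
      where
      l : ∀ x → 16 ℕ.+ 16 ℕ.* x ≡ 16 ℕ.* suc x
      l = solveℕ-∀
    from : ∀ N → .{{_ : ℕ.NonZero N}} → 2 ℕ.≤ N → ∀ u → Σ ℕ λ ℓ → ℓ ℕ.≤ m ℕ.* 28 ℕ.* ⌈log₂ N ⌉ × Σ (Vec ℕ ℓ) λ as → All (λ a → a ≡ 1 ⊎ a ≡ 2) as ×
      (+ cf-num as) ≡ u * + cf-den as [ N ] × Unit N (+ cf-den as)
    from N 2≤N u = k ℕ.* 2 , length≤ , proj₁ found , proj₁ (proj₂ found) , subst (Cone.Holds (point N u)) (orbit-cf (proj₁ found)) (proj₂ (proj₂ found))
      where
      t = 2 ℕ.+ 12 ℕ.* ⌈log₂ N ⌉
      k = m ℕ.* t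
      u∈ : Cone.Holds (point N u) (u , 1ℤ)
      u∈ = ∣-via ∣0 (l u) , 1ℤ , ∣0
        where
        l : ∀ u → 0ℤ ≡ u - u * 1ℤ
        l = solve-∀
      found : Σ (Vec ℕ (k ℕ.* 2)) λ as → All (λ a → a ≡ 1 ⊎ a ≡ 2) as × Cone.Holds (point N u) (orbit (0ℤ , 1ℤ) as)
      found = Reach.reach N (point N u) (0ℤ , 1ℤ) ((-[1+ 0 ] , 0ℤ) , ∣0) (u , 1ℤ) u∈ K (gap N) m m≡ k (outgrows m t _ (2N⁶<2^ 2≤N))
      length≤ : k ℕ.* 2 ℕ.≤ m ℕ.* 28 ℕ.* ⌈log₂ N ⌉
      length≤ = ℕₚ.≤-trans (ℕₚ.*-monoˡ-≤ 2 (ℕₚ.*-monoʳ-≤ m (ℕₚ.+-monoˡ-≤ (12 ℕ.* ⌈log₂ N ⌉) (ℕₚ.*-monoʳ-≤ 2 (1≤⌈log₂⌉ 2≤N))))) (ℕₚ.≤-reflexive (l m ⌈log₂ N ⌉))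
        where
        l : ∀ m L → m ℕ.* (2 ℕ.* L ℕ.+ 12 ℕ.* L) ℕ.* 2 ≡ m ℕ.* 28 ℕ.* L
        l = solveℕ-∀

theorem1p5 : Σ ℕ λ C → 0 ℕ.< C × Σ ℕ λ N₀ →
    (N : ℕ) → N₀ ℕ.≤ N → (u : ℕ) → u ℕ.< N →
    Σ ℕ λ ℓ → ℓ ℕ.≤ C ℕ.* ⌈log₂ N ⌉ ×
    Σ (Vec ℕ ℓ) λ a → All (λ x → x ≡ 1 ⊎ x ≡ 2) a ×
    (Coprime (↧ₙ (cf (withOnes a))) N ×
    (+ N) ∣ℤ (↥ (cf (withOnes a)) - (+ u) * (+ (↧ₙ (cf (withOnes a))))))
theorem1p5 = let (C , C>0 , short) = few-quotients in C , C>0 , 2 , λ N 2≤N u _ →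
  -- The threshold 2 makes ⌈log₂ N⌉ at least 1, which absorbs the additive constant in the length;
  -- the spectral gap itself holds at every level.
  let (ℓ , ℓ≤ , a , digits , p≡uq , unit) = short N 2≤N (+ u)
      (num≡ , den≡) = cf-lowest-terms a
  in ℓ , ℓ≤ , a , digits ,
     subst₂ (λ p q → Coprime q N × (+ N) ∣ℤ (p - (+ u) * (+ q))) (sym num≡) (sym den≡) (unit-den⇒coprime unit , Div.∣⇒∣ᵤ p≡uq)
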